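{- For any integers $d\ge 2$ and $n\ge1$ and any prime power $q$, \[ \mathrm{Q}_{\mathbb{F}_q}\left(T_{d,\mathbb{F}_{q^n}}\right)\ge\frac{n}{48d^2q}. \]
   Context: For a finite extension $\mathbb{F}/\mathbb{K}$ of degree $l$ and $d\ge2$, $T_{d,\mathbb{F}}\in\mathbb{K}^l\otimes\cdots\otimes\mathbb{K}^l$ ($d$ factors) is the structure tensor over $\mathbb{K}$ of the multiplication map $\mathbb{F}^{d-1}\to\mathbb{F}$, $(x_1,\dots,x_{d-1})\mapsto x_1\cdots x_{d-1}$ (coefficients $t_{j_1\cdots j_d}$ defined by $\omega_{j_1}\cdots\omega_{j_{d-1}}=\sum_{j_d}t_{j_1\cdots j_d}\omega_{j_d}$ for a $\mathbb{K}$-basis $(\omega_j)$ of $\mathbb{F}$); here $\mathbb{K}=\mathbb{F}_q$, $\mathbb{F}=\mathbb{F}_{q^n}$. For tensors $S,T$, $S\preceq T$ means $S=(g_1\otimes\cdots\otimes g_d)T$ for linear maps $g_i$; $\mathrm{Id}_s=\sum_{j=1}^s e_j^{\otimes d}\in(\mathbb{K}^s)^{\otimes d}$; the subrank is $\mathrm{Q}_{\mathbb{K}}(T)=\max\{s:\mathrm{Id}_s\preceq T\}$. -}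

module Defs where

open import Level using (Level; _⊔_)
open import Data.Nat using (ℕ; zero; suc; _^_)
open import Data.Nat.Primality using (Prime)
open import Data.Fin using (Fin; zero; suc; inject₁; fromℕ; _≟_)
open import Data.Vec.Functional using (_∷_)
open import Data.Product using (Σ; ∃; ∃₂; _×_)
open import Data.Bool using (if_then_else_)
open import Relation.Nullary using (¬_)
open import Relation.Nullary.Decidable using (⌊_⌋)
open import Algebra.Bundles using (CommutativeRing)
open import Algebra.Morphism.Structures using (module RingMorphisms)
open import Function.Bundles using (Inverse)
import Relation.Binary.PropositionalEquality as ≡

private variable c ℓ c′ ℓ′ : Level

IsPrimePower : ℕ → Set
IsPrimePower q = ∃₂ λ p k → Prime p × q ≡.≡ p ^ suc k

record IsField (R : CommutativeRing c ℓ) : Set (c ⊔ ℓ) where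
  open CommutativeRing R using (Carrier; _≈_; _+_; _*_; 0#; 1#)
  field
    0≉1 : ¬ (0# ≈ 1#)
    inverse : ∀ x → ¬ (x ≈ 0#) → ∃ λ y → x * y ≈ 1#

HasCardinality : CommutativeRing c ℓ → ℕ → Set (c ⊔ ℓ)
HasCardinality R q = Inverse (≡.setoid (Fin q)) (CommutativeRing.setoid R)

module _ (R : CommutativeRing c ℓ) where
  open CommutativeRing R using (Carrier; _≈_; _+_; _*_; 0#; 1#)

  ∑ : (n : ℕ) → (Fin n → Carrier) → Carrier
  ∑ zero f = 0#
  ∑ (suc n) f = f zero + ∑ n (λ i → f (suc i))

  ∏ : (n : ℕ) → (Fin n → Carrier) → Carrier
  ∏ zero f = 1#
  ∏ (suc n) f = f zero * ∏ n (λ i → f (suc i))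

  ∑Idx : (d n : ℕ) → ((Fin d → Fin n) → Carrier) → Carrier
  ∑Idx zero n f = f (λ ())
  ∑Idx (suc d) n f = ∑ n (λ j → ∑Idx d n (λ js → f (j ∷ js)))

  Tensor : ℕ → ℕ → Set c
  Tensor d n = (Fin d → Fin n) → Carrier

  δ : {s : ℕ} → Fin s → Fin s → Carrier
  δ a b = if ⌊ a ≟ b ⌋ then 1# else 0#

  IdT : (d s : ℕ) → Tensor d s
  IdT d s i = ∑ s (λ e → ∏ d (λ k → δ (i k) e))

  -- S ⪯ T : S = (g_1 ⊗ ... ⊗ g_d) T for linear maps g_k : K^n → K^m (matrices m × n)
  Restriction : {d m n : ℕ} → Tensor d m → Tensor d n → Set (c ⊔ ℓ)
  Restriction {d} {m} {n} S T =
    Σ (Fin d → Fin m → Fin n → Carrier) λ g →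
      ∀ (i : Fin d → Fin m) →
        S i ≈ ∑Idx d n (λ j → ∏ d (λ k → g k (i k) (j k)) * T j)

  SubrankAtLeast : {d n : ℕ} → Tensor d n → ℕ → Set (c ⊔ ℓ)
  SubrankAtLeast {d} T s = Restriction (IdT d s) T

-- A field extension F/K via a ring homomorphism ι : K → F, together with a
-- K-basis (ω_j)_{j<n} of F: coord is the inverse of  c ↦ ∑_j ι(c_j) ω_j.
module _ (K : CommutativeRing c ℓ) (F : CommutativeRing c′ ℓ′) where
  private
    module K = CommutativeRing K
    module F = CommutativeRing F

  IsRingHom : (K.Carrier → F.Carrier) → Set (c ⊔ ℓ ⊔ ℓ′)
  IsRingHom = RingMorphisms.IsRingHomomorphism K.rawRing F.rawRing

  record Basis (ι : K.Carrier → F.Carrier) (n : ℕ) : Set (c ⊔ ℓ ⊔ c′ ⊔ ℓ′) where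
    field
      ω : Fin n → F.Carrier
      coord : F.Carrier → Fin n → K.Carrier
      coord-cong : ∀ {x y} → x F.≈ y → ∀ j → coord x j K.≈ coord y j
      expand : ∀ x → x F.≈ ∑ F n (λ j → ι (coord x j) F.* ω j)
      coord-unique : ∀ (a : Fin n → K.Carrier) j →
        coord (∑ F n (λ i → ι (a i) F.* ω i)) j K.≈ a j

  -- Structure tensor T_{d,F} over K w.r.t. the basis ω:
  -- ω_{j_1} ⋯ ω_{j_{d-1}} = ∑_{j_d} t_{j_1…j_d} ω_{j_d}.
  -- (For d = 0 there is no such tensor; we set it to 0, this case is excluded by d ≥ 2.)
  structureTensor : {ι : K.Carrier → F.Carrier} {n : ℕ} → Basis ι n →
                    (d : ℕ) → Tensor K d n
  structureTensor B zero j = K.0#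
  structureTensor B (suc m) j =
    coord (∏ F m (λ k → ω (j (inject₁ k)))) (j (fromℕ m))
    where open Basis B

-- It suffices to find a_1, …, a_s in F such that no K-linear relation between the (d-1)-fold products of
-- the a_l involves a power a_l^(d-1): functionals dual to these powers then restrict the tensor to Id_s.
-- Such elements come from a curve with many points. Over the field κ with q² elements, the k-th curve of
-- the tower x_1^q + x_1 = T, x_{i+1}^q + x_{i+1} = x_i^q / (x_i^(q-1) + 1) of Garcia and Stichtenoth has
-- Q = q^k rational points with T = 1 and one, totally ramified, point with T = ∞. It carries 2Q independent
-- functions with no pole outside T = ∞ and coefficients of degree ≤ 2 in T. Functions that vanish at all
-- points with T = 1 are divisible by T - 1, which lowers this degree, so after three evaluations no function
-- is left: some evaluation has rank s ≥ 2Q/3 and yields functions f_l and points P_l with f_l(P_m) = δ_lm.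
-- A combination of (d-1)-fold products of the f_l that vanishes at ∞ is zero, having no poles, and
-- its value at P_l is the coefficient of f_l^(d-1). Whether it vanishes at ∞ only depends on the expansions
-- of the f_l at ∞ up to O(dQ) terms, which are polynomials over K of length O(dQ) in a generator ξ of the
-- completion. The a_l are the values of these polynomials at some θ ∈ F whose first ⌈n/2⌉ powers are
-- linearly independent over K; such θ exists as polynomials of low degree have too few roots to exhaust F.
module Submission where

import Data.Nat.Properties as ℕP
import Data.Integer.Properties as ℤP
import Relation.Binary.PropositionalEquality as ≡
import Algebra.Solver.Ring
import Algebra.Properties.Ring
import Algebra.Properties.Semiring.Mult.TCOptimised
import Relation.Binary.Reasoning.Setoid
open import Defs
import Data.Fin.Properties as FinP
import Algebra.Properties.CommutativeSemiring.Exp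
import Algebra.Properties.CommutativeSemiring.Binomial
import Algebra.Properties.Semiring.Mult
import Algebra.Properties.Monoid.Sum
import Data.Fin
import Data.Nat.Tactic.RingSolver as ℕSolver
import Data.Sum
import Data.Fin.Permutation as Perm
import Algebra.Properties.CommutativeMonoid.Sum
open import Level using (Level; _⊔_) renaming (suc to lsuc)
open import Data.Nat as ℕ using (ℕ; zero; suc; z≤n; s≤s)
open import Data.Integer as ℤ using (ℤ; +_; -[1+_])
open import Data.Maybe using (just; nothing; Maybe)
open import Data.Sum using (_⊎_; inj₁; inj₂)
open import Data.Product using (Σ; ∃; _×_; _,_; proj₁; proj₂)
open import Algebra.Bundles using (CommutativeRing; AbelianGroup)
open import Algebra.Solver.Ring.AlmostCommutativeRing using (fromCommutativeRing; _-Raw-AlmostCommutative⟶_)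
open import Relation.Nullary using (¬_; yes; no; Dec)
open import Data.Nat.Combinatorics using (_C_; nCn≡1; nC1≡n)
open import Data.Fin using (Fin; zero; suc; toℕ; fromℕ; inject₁; combine; remQuot; finToFun; funToFin; punchOut)
open import Data.Empty using (⊥-elim; ⊥)
open import Function using (_∘_)
open import Data.Integer.Tactic.RingSolver using (solve-∀)
open import Data.Integer.DivMod using (_/ℕ_; _%ℕ_; a≡a%ℕn+[a/ℕn]*n; n%ℕd<d)
open import Data.Unit using (⊤; tt)
open import Data.List using (List; []; _∷_; length; tabulate)
open import Data.List.Relation.Unary.All using (All; []; _∷_)
open import Data.Nat.Divisibility as ∣ using (_∣_; _∣?_)
open import Data.List.Properties using (length-tabulate)
open import Data.List.Relation.Unary.All.Properties using (tabulate⁻)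
open import Data.Maybe as Maybe using (Maybe)
open import Relation.Nullary.Decidable using (map′; ¬?; _×-dec_)
open import Data.Vec.Functional as FVec using ()
open import Algebra.Morphism.Structures using (module RingMorphisms)
open import Function.Bundles using (Inverse)
open ≡ using (_≡_; _≢_)

-- No function field, genus or Riemann-Roch theorem appears. The top ring is free of rank Q over
-- κ((T)) and is not shown to be a domain; a place is only a filtration by lower bounds of orders,
-- or a partial homomorphism to κ. One base ring serves all places: it is complete at T = 0, while T
-- = ∞ and T = 1 concern its Laurent polynomials. The obstacle is T = 0: over it the later x_i have
-- poles, so regularity outside T = ∞ becomes a condition there. Over κ((T)) the ring splits along a
-- tree of explicit places, with a basis that is integral up to one factor T. Counting replaces
-- Riemann-Roch: Q coordinates that are polynomials of degree < 2 + `loss`, under Q · `loss`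
-- conditions, leave dimension at least 2Q, where `loss` bounds what is lost between the order of a
-- function and that of its coefficients. High powers absorb this loss: a function without poles
-- that vanishes at T = ∞ is nilpotent, and so has only zero values in κ. The expansions need
-- coefficients in K because F need not contain κ. The bound reached is n ≤ 30 (d-1)² q s, from n ≤
-- 20 (d-1)² q Q and 2Q ≤ 3s.

-- Commutative rings: integer coefficients, homomorphisms, polynomials, q-th powers.

module IntegerCoefficients {c ℓ} (R : CommutativeRing c ℓ) where
  open CommutativeRing R
  open Algebra.Properties.Ring ring
  open Algebra.Properties.Semiring.Mult.TCOptimised semiring using (1+×; ×-homo-+; ×1-homo-*) renaming (_×_ to _×′_)
  open Relation.Binary.Reasoning.Setoid setoid

  fromℤ : ℤ → Carrier
  fromℤ (+ n)    = n ×′ 1#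
  fromℤ -[1+ n ] = - (suc n ×′ 1#)

  private
    cancel-1+ : ∀ a b → (1# + a) - (1# + b) ≈ a - b
    cancel-1+ a b = begin
      (1# + a) + - (1# + b)    ≈⟨ +-cong (+-comm 1# a) (sym (-‿+-comm 1# b)) ⟩
      (a + 1#) + (- 1# + - b)  ≈⟨ +-assoc a 1# _ ⟩
      a + (1# + (- 1# + - b))  ≈⟨ +-congˡ (sym (+-assoc 1# (- 1#) (- b))) ⟩
      a + ((1# - 1#) + - b)    ≈⟨ +-congˡ (+-congʳ (-‿inverseʳ 1#)) ⟩
      a + (0# + - b)           ≈⟨ +-congˡ (+-identityˡ _) ⟩
      a - b                    ∎

    fromℤ-⊖ : ∀ m n → fromℤ (m ℤ.⊖ n) ≈ m ×′ 1# - n ×′ 1#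
    fromℤ-⊖ m zero = sym (trans (+-congˡ -0#≈0#) (+-identityʳ _))
    fromℤ-⊖ zero (suc n) = sym (+-identityˡ _)
    fromℤ-⊖ (suc m) (suc n) = begin
      fromℤ (suc m ℤ.⊖ suc n)          ≡⟨ ≡.cong fromℤ (ℤP.[1+m]⊖[1+n]≡m⊖n m n) ⟩
      fromℤ (m ℤ.⊖ n)                  ≈⟨ fromℤ-⊖ m n ⟩
      m ×′ 1# - n ×′ 1#                  ≈⟨ cancel-1+ _ _ ⟨
      (1# + m ×′ 1#) - (1# + n ×′ 1#)    ≈⟨ +-cong (1+× m 1#) (-‿cong (1+× n 1#)) ⟨
      suc m ×′ 1# - suc n ×′ 1#          ∎

    +-homo : ∀ i j → fromℤ (i ℤ.+ j) ≈ fromℤ i + fromℤ j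
    +-homo (+ m) (+ n) = ×-homo-+ 1# m n
    +-homo (+ m) -[1+ n ] = fromℤ-⊖ m (suc n)
    +-homo -[1+ m ] (+ n) = trans (fromℤ-⊖ n (suc m)) (+-comm _ _)
    +-homo -[1+ m ] -[1+ n ] = begin
      - (suc (suc (m ℕ.+ n)) ×′ 1#)     ≡⟨ ≡.cong (λ k → - (suc k ×′ 1#)) (≡.sym (ℕP.+-suc m n)) ⟩
      - ((suc m ℕ.+ suc n) ×′ 1#)       ≈⟨ -‿cong (×-homo-+ 1# (suc m) (suc n)) ⟩
      - (suc m ×′ 1# + suc n ×′ 1#)      ≈⟨ -‿+-comm _ _ ⟨
      - (suc m ×′ 1#) - suc n ×′ 1#      ∎

    -‿homo : ∀ i → fromℤ (ℤ.- i) ≈ - fromℤ i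
    -‿homo (+ zero) = sym -0#≈0#
    -‿homo (+ suc n) = refl
    -‿homo -[1+ n ] = sym (-‿involutive _)

    *-homo⁺ : ∀ m j → fromℤ (+ m ℤ.* j) ≈ fromℤ (+ m) * fromℤ j
    *-homo⁺ m (+ n) = trans (reflexive (≡.cong fromℤ (≡.sym (ℤP.pos-* m n)))) (×1-homo-* m n)
    *-homo⁺ m -[1+ n ] = begin
      fromℤ (+ m ℤ.* -[1+ n ])            ≡⟨ ≡.cong fromℤ (≡.sym (ℤP.neg-distribʳ-* (+ m) (+ suc n))) ⟩
      fromℤ (ℤ.- (+ m ℤ.* + suc n))       ≈⟨ -‿homo (+ m ℤ.* + suc n) ⟩
      - fromℤ (+ m ℤ.* + suc n)           ≈⟨ -‿cong (*-homo⁺ m (+ suc n)) ⟩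
      - (m ×′ 1# * (suc n ×′ 1#))           ≈⟨ -‿distribʳ-* _ _ ⟩
      m ×′ 1# * - (suc n ×′ 1#)             ∎

    *-homo : ∀ i j → fromℤ (i ℤ.* j) ≈ fromℤ i * fromℤ j
    *-homo (+ m) j = *-homo⁺ m j
    *-homo -[1+ m ] j = begin
      fromℤ (-[1+ m ] ℤ.* j)              ≡⟨ ≡.cong fromℤ (≡.sym (ℤP.neg-distribˡ-* (+ suc m) j)) ⟩
      fromℤ (ℤ.- (+ suc m ℤ.* j))         ≈⟨ -‿homo (+ suc m ℤ.* j) ⟩
      - fromℤ (+ suc m ℤ.* j)             ≈⟨ -‿cong (*-homo⁺ (suc m) j) ⟩
      - (suc m ×′ 1# * fromℤ j)            ≈⟨ -‿distribˡ-* _ _ ⟩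
      - (suc m ×′ 1#) * fromℤ j            ∎

  private
    morphism : CommutativeRing.rawRing ℤP.+-*-commutativeRing -Raw-AlmostCommutative⟶ fromCommutativeRing R
    morphism = record
      { ⟦_⟧ = fromℤ ; +-homo = +-homo ; *-homo = *-homo ; -‿homo = -‿homo
      ; 0-homo = refl ; 1-homo = refl }

    fromℤ-dec : ∀ i j → _
    fromℤ-dec i j with i ℤ.≟ j
    ... | yes i≡j = just (reflexive (≡.cong fromℤ i≡j))
    ... | no _ = nothing

  open Algebra.Solver.Ring (CommutativeRing.rawRing ℤP.+-*-commutativeRing) (fromCommutativeRing R) morphism fromℤ-dec public
    using (solve; con; _:=_; _:+_; _:*_; _:-_; :-_)

record Hom {c ℓ c′ ℓ′} (R : CommutativeRing c ℓ) (S : CommutativeRing c′ ℓ′) : Set (c ⊔ ℓ ⊔ c′ ⊔ ℓ′) where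
  private
    module R = CommutativeRing R
    module S = CommutativeRing S
  field
    ⟦_⟧    : R.Carrier → S.Carrier
    cong   : ∀ {x y} → x R.≈ y → ⟦ x ⟧ S.≈ ⟦ y ⟧
    +-homo : ∀ x y → ⟦ x R.+ y ⟧ S.≈ ⟦ x ⟧ S.+ ⟦ y ⟧
    *-homo : ∀ x y → ⟦ x R.* y ⟧ S.≈ ⟦ x ⟧ S.* ⟦ y ⟧
    1-homo : ⟦ R.1# ⟧ S.≈ S.1#

module RingKit {c ℓ} (R : CommutativeRing c ℓ) where
  open CommutativeRing R public using (Carrier; _≈_; _+_; _*_; -_; 0#; 1#; _-_; refl; sym; trans; setoid
    ; +-cong; +-congˡ; +-congʳ; +-assoc; +-comm; +-identityˡ; +-identityʳ; *-cong; *-congˡ; *-congʳ; *-assoc; *-comm; *-identityˡ; *-identityʳ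
    ; distribˡ; distribʳ; zeroˡ; zeroʳ; -‿cong; -‿inverseˡ; -‿inverseʳ) renaming (reflexive to ≡⇒≈)
  open CommutativeRing R using (ring; semiring; commutativeSemiring; +-monoid)
  open IntegerCoefficients R public using (solve; con; _:=_; _:+_; _:*_; _:-_; :-_)
  open Algebra.Properties.Ring ring public using (-0#≈0#; -‿distribˡ-*; -‿distribʳ-*; -‿involutive)
  open Algebra.Properties.CommutativeSemiring.Exp commutativeSemiring public using (_^_; ^-congˡ; ^-congʳ; ^-homo-*; ^-distrib-*)
  open Algebra.Properties.Semiring.Mult semiring public using (×-assoc-*; ×-comm-*) renaming (_×_ to _·ℕ_)
  open Relation.Binary.Reasoning.Setoid setoid public using (begin_; step-≈-⟩; step-≈-⟨; _∎)

  x-y≈0⇒x≈y : ∀ {x y} → x - y ≈ 0# → x ≈ y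
  x-y≈0⇒x≈y {x} {y} e = trans (solve 2 (λ x y → x := x :- y :+ y) refl x y) (trans (+-congʳ e) (+-identityˡ y))

  x≈y⇒x-y≈0 : ∀ {x y} → x ≈ y → x - y ≈ 0#
  x≈y⇒x-y≈0 {x} {y} e = trans (+-congʳ e) (-‿inverseʳ y)

  1^ : ∀ n → 1# ^ n ≈ 1#
  1^ zero = refl
  1^ (suc n) = trans (*-identityˡ _) (1^ n)

  0^suc : ∀ n → 0# ^ suc n ≈ 0#
  0^suc n = zeroˡ _

  ∑-cong : ∀ n {f g : Fin n → Carrier} → (∀ i → f i ≈ g i) → ∑ R n f ≈ ∑ R n g
  ∑-cong zero e = refl
  ∑-cong (suc n) e = +-cong (e zero) (∑-cong n (e ∘ suc))

  ∑-0 : ∀ n {f : Fin n → Carrier} → (∀ i → f i ≈ 0#) → ∑ R n f ≈ 0#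
  ∑-0 zero e = refl
  ∑-0 (suc n) e = trans (+-cong (e zero) (∑-0 n (e ∘ suc))) (+-identityˡ 0#)

  ∑-+ : ∀ n (f g : Fin n → Carrier) → ∑ R n (λ i → f i + g i) ≈ ∑ R n f + ∑ R n g
  ∑-+ zero f g = sym (+-identityˡ 0#)
  ∑-+ (suc n) f g = trans (+-congˡ (∑-+ n (f ∘ suc) (g ∘ suc)))
    (solve 4 (λ a b c d → a :+ b :+ (c :+ d) := a :+ c :+ (b :+ d)) refl _ _ _ _)

  *-∑ : ∀ n x (f : Fin n → Carrier) → x * ∑ R n f ≈ ∑ R n (λ i → x * f i)
  *-∑ zero x f = zeroʳ x
  *-∑ (suc n) x f = trans (distribˡ _ _ _) (+-congˡ (*-∑ n x (f ∘ suc)))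

  ∑-swap : ∀ m n (f : Fin m → Fin n → Carrier) →
           ∑ R m (λ i → ∑ R n (f i)) ≈ ∑ R n (λ j → ∑ R m (λ i → f i j))
  ∑-swap zero n f = sym (∑-0 n (λ _ → refl))
  ∑-swap (suc m) n f = trans (+-congˡ (∑-swap m n (f ∘ suc))) (sym (∑-+ n _ _))

  ∑-single : ∀ n (f : Fin n → Carrier) j → (∀ i → i ≢ j → f i ≈ 0#) → ∑ R n f ≈ f j
  ∑-single (suc n) f zero z = trans (+-congˡ (∑-0 n (λ i → z (suc i) (λ ())))) (+-identityʳ _)
  ∑-single (suc n) f (suc j) z = trans (+-cong (z zero (λ ())) (∑-single n (f ∘ suc) j λ i i≢j → z (suc i) (i≢j ∘ FinP.suc-injective)))
    (+-identityˡ _)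

  ∏-cong : ∀ n {f g : Fin n → Carrier} → (∀ i → f i ≈ g i) → ∏ R n f ≈ ∏ R n g
  ∏-cong zero e = refl
  ∏-cong (suc n) e = *-cong (e zero) (∏-cong n (e ∘ suc))

  ∏-zero : ∀ n (f : Fin n → Carrier) i → f i ≈ 0# → ∏ R n f ≈ 0#
  ∏-zero (suc n) f zero e = trans (*-congʳ e) (zeroˡ _)
  ∏-zero (suc n) f (suc i) e = trans (*-congˡ (∏-zero n (f ∘ suc) i e)) (zeroʳ _)

  ∏-* : ∀ n x (f : Fin n → Carrier) → ∏ R n (λ i → x * f i) ≈ x ^ n * ∏ R n f
  ∏-* zero x f = sym (*-identityˡ 1#)
  ∏-* (suc n) x f = trans (*-congˡ (∏-* n x (f ∘ suc))) (solve 4 (λ x f a b → x :* f :* (a :* b) := x :* a :* (f :* b)) refl x (f zero) (x ^ n) _)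

  ∏-1 : ∀ n (f : Fin n → Carrier) → (∀ i → f i ≈ 1#) → ∏ R n f ≈ 1#
  ∏-1 zero f e = refl
  ∏-1 (suc n) f e = trans (*-cong (e zero) (∏-1 n (f ∘ suc) (e ∘ suc))) (*-identityˡ 1#)

  horner : ∀ n → (Fin n → Carrier) → Carrier → Carrier
  horner zero p x = 0#
  horner (suc n) p x = p zero + x * horner n (p ∘ suc) x

  horner-cong : ∀ n {p r : Fin n → Carrier} {x y} → (∀ i → p i ≈ r i) → x ≈ y → horner n p x ≈ horner n r y
  horner-cong zero e x≈y = refl
  horner-cong (suc n) e x≈y = +-cong (e zero) (*-cong x≈y (horner-cong n (e ∘ suc) x≈y))

  horner-+ : ∀ n (p r : Fin n → Carrier) x → horner n (λ i → p i + r i) x ≈ horner n p x + horner n r x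
  horner-+ zero p r x = sym (+-identityˡ 0#)
  horner-+ (suc n) p r x = trans (+-congˡ (*-congˡ (horner-+ n (p ∘ suc) (r ∘ suc) x)))
    (solve 5 (λ a b x c d → a :+ b :+ x :* (c :+ d) := a :+ x :* c :+ (b :+ x :* d)) refl _ _ _ _ _)

  horner-* : ∀ n a (p : Fin n → Carrier) x → horner n (λ i → a * p i) x ≈ a * horner n p x
  horner-* zero a p x = sym (zeroʳ a)
  horner-* (suc n) a p x = trans (+-congˡ (*-congˡ (horner-* n a (p ∘ suc) x)))
    (solve 4 (λ a b x c → a :* b :+ x :* (a :* c) := a :* (b :+ x :* c)) refl _ _ _ _)

  horner-0 : ∀ n (p : Fin n → Carrier) x → (∀ i → p i ≈ 0#) → horner n p x ≈ 0#
  horner-0 zero p x e = refl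
  horner-0 (suc n) p x e = trans (+-cong (e zero) (*-congˡ (horner-0 n (p ∘ suc) x (e ∘ suc))))
    (trans (+-identityˡ _) (zeroʳ x))

  horner-∑ : ∀ n (p : Fin n → Carrier) x → horner n p x ≈ ∑ R n (λ i → p i * x ^ toℕ i)
  horner-∑ zero p x = refl
  horner-∑ (suc n) p x = +-cong (sym (*-identityʳ _)) (begin
    x * horner n (p ∘ suc) x                        ≈⟨ *-congˡ (horner-∑ n (p ∘ suc) x) ⟩
    x * ∑ R n (λ i → p (suc i) * x ^ toℕ i)         ≈⟨ *-∑ n x _ ⟩
    ∑ R n (λ i → x * (p (suc i) * x ^ toℕ i))       ≈⟨ ∑-cong n (λ i → solve 3 (λ x p y → x :* (p :* y) := p :* (x :* y)) refl x (p (suc i)) (x ^ toℕ i)) ⟩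
    ∑ R n (λ i → p (suc i) * (x * x ^ toℕ i))       ∎)

  -- coefficients of (p(X) - p(r)) / (X - r)
  quotient : ∀ n → (Fin (suc n) → Carrier) → Carrier → Fin n → Carrier
  quotient (suc n) p r zero = horner (suc n) (p ∘ suc) r
  quotient (suc n) p r (suc i) = quotient n (p ∘ suc) r i

  horner-quotient : ∀ n p r x → horner (suc n) p x ≈ horner (suc n) p r + (x - r) * horner n (quotient n p r) x
  horner-quotient zero p r x = solve 3 (λ p r x → p :+ x :* con (+ 0) := p :+ r :* con (+ 0) :+ (x :- r) :* con (+ 0)) refl _ _ _
  horner-quotient (suc n) p r x = trans (+-congˡ (*-congˡ (horner-quotient n (p ∘ suc) r x)))
    (solve 5 (λ p x h r g → p :+ x :* (h :+ (x :- r) :* g) := p :+ r :* h :+ (x :- r) :* (h :+ x :* g)) refl _ _ _ _ _)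

  -- A polynomial with all values in S at sufficiently separated points has all coefficients in S.
  module Interpolation {s} (S : Carrier → Set s)
    (S-resp : ∀ {x y} → x ≈ y → S x → S y) (S-0 : S 0#)
    (S-- : ∀ {x y} → S x → S y → S (x - y)) where

    from-quotient : ∀ n p r → (∀ x → S x → S (r * x)) → S (horner (suc n) p r) →
                    (∀ i → S (quotient n p r i)) → ∀ i → S (p i)
    -- Here p(r) = p₀ + r · p′(r) with p′ the shifted polynomial, and p′(r) is the constant
    -- coefficient of the quotient, hence in S.
    from-quotient n p r S-r h t zero = S-resp (solve 2 (λ p x → p :+ x :- x := p) refl _ _) (S-- h (S-r _ (tail-value n p t)))
      where
      tail-value : ∀ n p → (∀ i → S (quotient n p r i)) → S (horner n (p ∘ suc) r)
      tail-value zero p t = S-0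
      tail-value (suc n) p t = t zero
    from-quotient (suc n) p r S-r h t (suc i) = from-quotient n (p ∘ suc) r S-r (t zero) (t ∘ suc) i

    interpolation : ∀ {n} (r : Fin n → Carrier) → (∀ a x → S x → S (r a * x)) →
                    (∀ a b → a ≢ b → ∀ x → S ((r a - r b) * x) → S x) →
                    (p : Fin n → Carrier) → (∀ a → S (horner n p (r a))) → ∀ i → S (p i)
    interpolation {suc n} r S-r cancel p vals =
      from-quotient n p (r zero) (S-r zero) (vals zero)
        (interpolation (r ∘ suc) (S-r ∘ suc) (λ a b a≢b → cancel (suc a) (suc b) (a≢b ∘ FinP.suc-injective))
          (quotient n p (r zero)) λ a → cancel (suc a) zero (λ ()) _
            (S-resp (trans (+-congʳ (horner-quotient n p (r zero) (r (suc a))))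
              (solve 2 (λ x y → x :+ y :- x := y) refl _ _)) (S-- (vals (suc a)) (vals zero))))

  vanishing : ∀ {n} (r : Fin n → Carrier) → (∀ a b → a ≢ b → ∀ x → (r a - r b) * x ≈ 0# → x ≈ 0#) →
              (p : Fin n → Carrier) → (∀ a → horner n p (r a) ≈ 0#) → ∀ i → p i ≈ 0#
  vanishing r cancel = Interpolation.interpolation (_≈ 0#) (λ e z → trans (sym e) z) refl
    (λ x y → trans (+-cong x (trans (-‿cong y) -0#≈0#)) (+-identityˡ 0#)) r
    (λ a x e → trans (*-congˡ e) (zeroʳ _)) cancel

  -- Stands for "q is a power of the characteristic": it is what the additivity of x ↦ x^q rests on,
  -- and it passes along homomorphisms.
  BinomialsVanish : ℕ → Set ℓ
  BinomialsVanish q = ∀ i → 0 ℕ.< i → i ℕ.< q → (q C i) ·ℕ 1# ≈ 0#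

  private
    module Sum = Algebra.Properties.Monoid.Sum +-monoid

  freshman : ∀ q → BinomialsVanish (suc q) → ∀ x y → (x + y) ^ suc q ≈ x ^ suc q + y ^ suc q
  freshman q vanish x y = begin
    (x + y) ^ suc q                                                       ≈⟨ Bin.theorem (suc q) x y ⟩
    t zero + Sum.sum (t ∘ suc)                                            ≈⟨ +-congˡ (Sum.sum-init-last (t ∘ suc)) ⟩
    t zero + (Sum.sum (λ i → t (suc (inject₁ i))) + t (suc (fromℕ q)))    ≈⟨ +-cong first (+-cong (middle q λ i → t-middle i) last) ⟩
    y ^ suc q + (0# + x ^ suc q)                                          ≈⟨ solve 2 (λ a b → a :+ (con (+ 0) :+ b) := b :+ a) refl _ _ ⟩
    x ^ suc q + y ^ suc q                                                 ∎
    where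
    module Bin = Algebra.Properties.CommutativeSemiring.Binomial commutativeSemiring
    t = Bin.binomialTerm x y (suc q)
    first : t zero ≈ y ^ suc q
    first = trans (+-identityʳ _) (*-identityˡ _)
    last : t (suc (fromℕ q)) ≈ x ^ suc q
    last rewrite FinP.toℕ-fromℕ q | nCn≡1 (suc q) | ℕP.n∸n≡0 q = trans (+-identityʳ _) (*-identityʳ _)
    middle : ∀ n {f : Fin n → Carrier} → (∀ i → f i ≈ 0#) → Sum.sum f ≈ 0#
    middle zero e = refl
    middle (suc n) e = trans (+-cong (e zero) (middle n (e ∘ suc))) (+-identityˡ 0#)
    t-middle : ∀ i → t (suc (inject₁ i)) ≈ 0#
    t-middle i = begin
      (suc q C k) ·ℕ z             ≈⟨ ·-cong (suc q C k) (*-identityˡ z) ⟨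
      (suc q C k) ·ℕ (1# * z)      ≈⟨ ×-assoc-* (suc q C k) 1# z ⟨
      ((suc q C k) ·ℕ 1#) * z      ≈⟨ *-congʳ (vanish k (s≤s z≤n) (s≤s (≡.subst (ℕ._< q) (≡.sym (FinP.toℕ-inject₁ i)) (FinP.toℕ<n i)))) ⟩
      0# * z                       ≈⟨ zeroˡ z ⟩
      0#                           ∎
      where
      k = suc (toℕ (inject₁ i))
      z = Bin.binomial x y (suc q) (suc (inject₁ i))
      ·-cong : ∀ n {a b} → a ≈ b → n ·ℕ a ≈ n ·ℕ b
      ·-cong zero e = refl
      ·-cong (suc n) e = +-cong e (·-cong n e)

module HomProperties {c ℓ c′ ℓ′} {R : CommutativeRing c ℓ} {S : CommutativeRing c′ ℓ′} (h : Hom R S) where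
  private
    module R = RingKit R
    module S = RingKit S
  open Hom h

  0-homo : ⟦ R.0# ⟧ S.≈ S.0#
  0-homo = S.trans (S.solve 1 (λ x → x S.:= x S.:+ x S.:- x) S.refl _)
    (S.trans (S.+-congʳ (S.trans (S.sym (+-homo _ _)) (cong (R.+-identityˡ _)))) (S.-‿inverseʳ _))

  -‿homo : ∀ x → ⟦ R.- x ⟧ S.≈ S.- ⟦ x ⟧
  -‿homo x = S.trans (S.solve 2 (λ a b → b S.:= a S.:+ b S.:- a) S.refl ⟦ x ⟧ _)
    (S.trans (S.+-congʳ (S.trans (S.sym (+-homo _ _)) (S.trans (cong (R.-‿inverseʳ x)) 0-homo))) (S.+-identityˡ _))

  minus-homo : ∀ x y → ⟦ x R.- y ⟧ S.≈ ⟦ x ⟧ S.- ⟦ y ⟧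
  minus-homo x y = S.trans (+-homo _ _) (S.+-congˡ (-‿homo y))

  ^-homo : ∀ x n → ⟦ x R.^ n ⟧ S.≈ ⟦ x ⟧ S.^ n
  ^-homo x zero = 1-homo
  ^-homo x (suc n) = S.trans (*-homo _ _) (S.*-congˡ (^-homo x n))

  ∑-homo : ∀ n f → ⟦ ∑ R n f ⟧ S.≈ ∑ S n (λ i → ⟦ f i ⟧)
  ∑-homo zero f = 0-homo
  ∑-homo (suc n) f = S.trans (+-homo _ _) (S.+-congˡ (∑-homo n (f ∘ suc)))

  horner-homo : ∀ n p x → ⟦ R.horner n p x ⟧ S.≈ S.horner n (λ i → ⟦ p i ⟧) ⟦ x ⟧
  horner-homo zero p x = 0-homo
  horner-homo (suc n) p x = S.trans (+-homo _ _) (S.+-congˡ (S.trans (*-homo _ _) (S.*-congˡ (horner-homo n (p ∘ suc) x))))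

  binomials-vanish : ∀ q → R.BinomialsVanish q → S.BinomialsVanish q
  binomials-vanish q v i 0<i i<q = S.trans (S.sym (·ℕ-homo (q C i))) (S.trans (cong (v i 0<i i<q)) 0-homo)
    where
    ·ℕ-homo : ∀ n → ⟦ n R.·ℕ R.1# ⟧ S.≈ n S.·ℕ S.1#
    ·ℕ-homo zero = 0-homo
    ·ℕ-homo (suc n) = S.trans (+-homo _ _) (S.+-cong 1-homo (·ℕ-homo n))

idHom : ∀ {c ℓ} (R : CommutativeRing c ℓ) → Hom R R
idHom R = record { ⟦_⟧ = λ x → x ; cong = λ e → e ; +-homo = λ _ _ → refl ; *-homo = λ _ _ → refl ; 1-homo = refl }
  where open CommutativeRing R

infixr 9 _∘ᴴ_
_∘ᴴ_ : ∀ {c₁ ℓ₁ c₂ ℓ₂ c₃ ℓ₃} {R : CommutativeRing c₁ ℓ₁} {S : CommutativeRing c₂ ℓ₂} {T : CommutativeRing c₃ ℓ₃} →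
       Hom S T → Hom R S → Hom R T
_∘ᴴ_ {T = T} g h = record
  { ⟦_⟧ = λ x → g.⟦ h.⟦ x ⟧ ⟧ ; cong = λ e → g.cong (h.cong e)
  ; +-homo = λ x y → trans (g.cong (h.+-homo x y)) (g.+-homo _ _)
  ; *-homo = λ x y → trans (g.cong (h.*-homo x y)) (g.*-homo _ _)
  ; 1-homo = trans (g.cong h.1-homo) g.1-homo }
  where
  open CommutativeRing T using (trans)
  module g = Hom g
  module h = Hom h

-- Rings of coefficient families and the extension B[z]/(z^n - α - β z).

module _ {c ℓ} (A : AbelianGroup c ℓ) where
  open AbelianGroup A

  mkCommutativeRing : (_*_ : Carrier → Carrier → Carrier) (1# : Carrier) →
    (∀ {x y u v} → x ≈ y → u ≈ v → (x * u) ≈ (y * v)) →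
    (∀ x y z → ((x * y) * z) ≈ (x * (y * z))) → (∀ x y → (x * y) ≈ (y * x)) → (∀ x → (1# * x) ≈ x) →
    (∀ x y z → (x * (y ∙ z)) ≈ ((x * y) ∙ (x * z))) → CommutativeRing c ℓ
  mkCommutativeRing _*_ 1# *-cong *-assoc *-comm 1*x distribˡ = record
    { Carrier = Carrier ; _≈_ = _≈_ ; _+_ = _∙_ ; _*_ = _*_ ; -_ = _⁻¹ ; 0# = ε ; 1# = 1#
    ; isCommutativeRing = record
      { isRing = record
        { +-isAbelianGroup = isAbelianGroup
        ; *-cong = *-cong ; *-assoc = *-assoc
        ; *-identity = 1*x , λ x → trans (*-comm x 1#) (1*x x)
        ; distrib = distribˡ , λ x y z → trans (*-comm _ x) (trans (distribˡ x y z) (∙-cong (*-comm x y) (*-comm x z))) }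
      ; *-comm = *-comm } }

-- Wrapping pointwise equality in a record lets the two sides be inferred.
record Pointwise {c ℓ} (B : CommutativeRing c ℓ) (I : Set) (f g : I → CommutativeRing.Carrier B) : Set ℓ where
  constructor pw
  field at : ∀ i → CommutativeRing._≈_ B (f i) (g i)
open Pointwise public

familyGroup : ∀ {c ℓ} → CommutativeRing c ℓ → Set → AbelianGroup c ℓ
familyGroup B I = record
  { Carrier = I → Carrier ; _≈_ = Pointwise B I
  ; _∙_ = λ f g i → f i + g i ; ε = λ _ → 0# ; _⁻¹ = λ f i → - f i
  ; isAbelianGroup = record
    { isGroup = record
      { isMonoid = record
        { isSemigroup = record
          { isMagma = record
            { isEquivalence = record { refl = pw λ i → refl ; sym = λ e → pw λ i → sym (at e i) ; trans = λ e e′ → pw λ i → trans (at e i) (at e′ i) }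
            ; ∙-cong = λ e e′ → pw λ i → +-cong (at e i) (at e′ i) }
          ; assoc = λ f g h → pw λ i → +-assoc _ _ _ }
        ; identity = (λ f → pw λ i → +-identityˡ _) , (λ f → pw λ i → +-identityʳ _) }
      ; inverse = (λ f → pw λ i → -‿inverseˡ _) , (λ f → pw λ i → -‿inverseʳ _)
      ; ⁻¹-cong = λ e → pw λ i → -‿cong (at e i) }
    ; comm = λ f g → pw λ i → +-comm _ _ } }
  where open CommutativeRing B

-- B[z]/(z^n - α - β z) for n = m + 2, with elements the coefficient families of 1, z, …, z^(n-1)
module Extension {c ℓ} (B : CommutativeRing c ℓ) (m : ℕ) (α β : CommutativeRing.Carrier B) where
  private
    module B = RingKit B
    n : ℕ
    n = suc (suc m)
    module A = AbelianGroup (familyGroup B (Fin n))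
    C : Set c
    C = A.Carrier
    open A using (_≈_) renaming (_∙_ to _+_; ε to 0#)
    last : Fin n
    last = fromℕ (suc m)

    infixr 8 _•_
    _•_ : B.Carrier → C → C
    (b • f) i = b B.* f i

  -- Multiplication by z: coefficients move up by one, and the last one wraps around through z^n = α
  -- + β z.
  Z : C → C
  Z f zero = α B.* f last
  Z f (suc zero) = f zero B.+ β B.* f last
  Z f (suc (suc i)) = f (inject₁ (suc i))

  private
    Z-cong : ∀ {f g} → f ≈ g → Z f ≈ Z g
    Z-cong e = pw λ where
      zero → B.*-congˡ (at e last)
      (suc zero) → B.+-cong (at e zero) (B.*-congˡ (at e last))
      (suc (suc i)) → at e _

    Z-+ : ∀ f g → Z (f + g) ≈ Z f + Z g
    Z-+ f g = pw λ where
      zero → B.distribˡ _ _ _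
      (suc zero) → B.solve 5 (λ a b β c d → a B.:+ b B.:+ β B.:* (c B.:+ d) B.:= a B.:+ β B.:* c B.:+ (b B.:+ β B.:* d)) B.refl _ _ _ _ _
      (suc (suc i)) → B.refl

    Z-• : ∀ b f → Z (b • f) ≈ b • Z f
    Z-• b f = pw λ where
      zero → B.solve 3 (λ α b f → α B.:* (b B.:* f) B.:= b B.:* (α B.:* f)) B.refl _ _ _
      (suc zero) → B.solve 4 (λ b g β f → b B.:* g B.:+ β B.:* (b B.:* f) B.:= b B.:* (g B.:+ β B.:* f)) B.refl _ _ _ _
      (suc (suc i)) → B.refl

    Z-0 : Z 0# ≈ 0#
    Z-0 = pw λ where
      zero → B.zeroʳ _
      (suc zero) → B.trans (B.+-identityˡ _) (B.zeroʳ _)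
      (suc (suc i)) → B.refl

  -- v(Z) applied to w
  act : ∀ k → (Fin k → B.Carrier) → C → C
  act zero v w = 0#
  act (suc k) v w = v zero • w + Z (act k (v ∘ suc) w)

  private
    act-cong : ∀ k {v v′ w w′} → (∀ i → v i B.≈ v′ i) → w ≈ w′ → act k v w ≈ act k v′ w′
    act-cong zero ev ew = A.refl
    act-cong (suc k) ev ew = A.∙-cong (pw λ i → B.*-cong (ev zero) (at ew i)) (Z-cong (act-cong k (ev ∘ suc) ew))

    act-congʳ : ∀ k v {w w′} → w ≈ w′ → act k v w ≈ act k v w′
    act-congʳ k v e = act-cong k {v} {v} (λ _ → B.refl) e

    4-swap : ∀ a b c d → (a + b) + (c + d) ≈ (a + c) + (b + d)
    4-swap a b c d = pw λ i → B.solve 4 (λ a b c d → a B.:+ b B.:+ (c B.:+ d) B.:= a B.:+ c B.:+ (b B.:+ d)) B.refl _ _ _ _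

    act-+ʳ : ∀ k v w w′ → act k v (w + w′) ≈ act k v w + act k v w′
    act-+ʳ zero v w w′ = A.sym (A.identityˡ 0#)
    act-+ʳ (suc k) v w w′ = A.trans (A.∙-cong (pw λ i → B.distribˡ _ _ _) (A.trans (Z-cong (act-+ʳ k (v ∘ suc) w w′)) (Z-+ _ _)))
      (4-swap _ _ _ _)

    act-•ʳ : ∀ k v b w → act k v (b • w) ≈ b • act k v w
    act-•ʳ zero v b w = pw λ i → B.sym (B.zeroʳ _)
    act-•ʳ (suc k) v b w = A.trans (A.∙-cong A.refl (A.trans (Z-cong (act-•ʳ k (v ∘ suc) b w)) (Z-• b _)))
      (pw λ i → B.solve 4 (λ v b w x → v B.:* (b B.:* w) B.:+ b B.:* x B.:= b B.:* (v B.:* w B.:+ x)) B.refl _ _ _ _)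

    act-0ʳ : ∀ k v → act k v 0# ≈ 0#
    act-0ʳ zero v = A.refl
    act-0ʳ (suc k) v = pw λ i → B.trans (B.+-cong (B.zeroʳ _) (at (A.trans (Z-cong (act-0ʳ k (v ∘ suc))) Z-0) i)) (B.+-identityˡ _)

    act-Z : ∀ k v w → act k v (Z w) ≈ Z (act k v w)
    act-Z zero v w = A.sym Z-0
    act-Z (suc k) v w = A.trans (A.∙-cong (A.sym (Z-• _ _)) (Z-cong (act-Z k (v ∘ suc) w))) (A.sym (Z-+ _ _))

    -- Both operators are polynomials in the single operator `Z`, so they commute. With v * w
    -- defined as v(Z) applied to w, commutativity and associativity of the product follow from this
    -- and from v(Z) 1 = v.
    act-comm : ∀ k l v w u → act k v (act l w u) ≈ act l w (act k v u)
    act-comm zero l v w u = A.sym (act-0ʳ l w)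
    act-comm (suc k) l v w u = A.trans
      (A.∙-cong (A.sym (act-•ʳ l w _ u)) (A.trans (Z-cong (act-comm k l (v ∘ suc) w u)) (A.sym (act-Z l w _))))
      (A.sym (act-+ʳ l w _ _))

    one : C
    one zero = B.1#
    one (suc i) = B.0#

    -- Starting from 1, a polynomial with k ≤ n coefficients never causes `Z` to wrap around, so the
    -- coefficients reappear unchanged and all later positions are zero.
    act-one-≥ : ∀ k v → k ℕ.≤ n → ∀ i → k ℕ.≤ toℕ i → act k v one i B.≈ B.0#
    act-one : ∀ k v → k ℕ.≤ n → ∀ i (j : Fin k) → toℕ j ≡ toℕ i → act k v one i B.≈ v j
    act-one-≥ zero v _ i _ = B.refl
    act-one-≥ (suc k) v (s≤s k≤) (suc zero) (s≤s z≤n) = B.trans (B.+-cong (B.zeroʳ _) (B.trans (B.+-cong B.refl (B.zeroʳ _)) (B.+-identityʳ _))) (B.+-identityˡ _)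
    act-one-≥ (suc k) v (s≤s k≤) (suc (suc i)) (s≤s k≤i) = B.trans (B.+-cong (B.zeroʳ _)
      (act-one-≥ k (v ∘ suc) (ℕP.m≤n⇒m≤1+n k≤) (inject₁ (suc i)) (≡.subst (k ℕ.≤_) (≡.cong suc (≡.sym (FinP.toℕ-inject₁ i))) k≤i))) (B.+-identityˡ _)
    act-one (suc k) v (s≤s k≤) zero zero e = B.trans (B.+-cong (B.*-identityʳ _) (B.trans (B.*-congˡ
      (act-one-≥ k (v ∘ suc) (ℕP.m≤n⇒m≤1+n k≤) last (≡.subst (k ℕ.≤_) (≡.cong suc (≡.sym (FinP.toℕ-fromℕ m))) k≤))) (B.zeroʳ _))) (B.+-identityʳ _)
    act-one (suc k) v (s≤s k≤) (suc zero) (suc j) e = B.trans (B.+-cong (B.zeroʳ _) (B.trans (B.+-cong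
      (act-one k (v ∘ suc) (ℕP.m≤n⇒m≤1+n k≤) zero j (ℕP.suc-injective e))
      (B.trans (B.*-congˡ (act-one-≥ k (v ∘ suc) (ℕP.m≤n⇒m≤1+n k≤) last (≡.subst (k ℕ.≤_) (≡.cong suc (≡.sym (FinP.toℕ-fromℕ m))) k≤))) (B.zeroʳ _)))
      (B.+-identityʳ _))) (B.+-identityˡ _)
    act-one (suc k) v (s≤s k≤) (suc (suc i)) (suc j) e = B.trans (B.+-cong (B.zeroʳ _)
      (act-one k (v ∘ suc) (ℕP.m≤n⇒m≤1+n k≤) (inject₁ (suc i)) j (≡.trans (ℕP.suc-injective e) (≡.cong suc (≡.sym (FinP.toℕ-inject₁ i)))))) (B.+-identityˡ _)

    act-oneʳ : ∀ w → act n w one ≈ w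
    act-oneʳ w = pw λ i → act-one n w ℕP.≤-refl i i ≡.refl

    act-0ˡ : ∀ k v w → (∀ i → v i B.≈ B.0#) → act k v w ≈ 0#
    act-0ˡ zero v w e = A.refl
    act-0ˡ (suc k) v w e = pw λ i → B.trans (B.+-cong (B.trans (B.*-congʳ (e zero)) (B.zeroˡ _)) (at (A.trans (Z-cong (act-0ˡ k (v ∘ suc) w (e ∘ suc))) Z-0) i)) (B.+-identityˡ _)

  private opaque
    _*_ : C → C → C
    _*_ = act n

    *-comm : ∀ v w → v * w ≈ w * v
    *-comm v w = A.trans (act-congʳ n v (A.sym (act-oneʳ w)))
      (A.trans (act-comm n n v w one) (act-congʳ n w (act-oneʳ v)))

    *-assoc : ∀ u v w → (u * v) * w ≈ u * (v * w)
    *-assoc u v w = A.trans (*-comm (u * v) w) (A.trans (act-comm n n w u v) (act-congʳ n u (*-comm w v)))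

    *-identityˡ : ∀ w → one * w ≈ w
    *-identityˡ w = pw λ i → B.trans (B.+-cong (B.*-identityˡ _) (at (A.trans (Z-cong (act-0ˡ (suc m) (one ∘ suc) w λ _ → B.refl)) Z-0) i)) (B.+-identityʳ _)

    *-cong : ∀ {v v′ w w′} → v ≈ v′ → w ≈ w′ → (v * w) ≈ (v′ * w′)
    *-cong {v} {v′} e e′ = act-cong n {v} {v′} (at e) e′

    *-distribˡ : ∀ v w w′ → (v * (w + w′)) ≈ (v * w) + (v * w′)
    *-distribˡ = act-+ʳ n

    Z*ʳ : ∀ v w → (v * Z w) ≈ Z (v * w)
    Z*ʳ = act-Z n

    *-identityʳ : ∀ w → (w * one) ≈ w
    *-identityʳ = act-oneʳ

    •*ʳ : ∀ v b w → (v * (b • w)) ≈ b • (v * w)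
    •*ʳ = act-•ʳ n

  opaque
    unfolding _*_
    *-act : ∀ v w → (v * w) ≈ act n v w
    *-act v w = A.refl

  ring : CommutativeRing c ℓ
  ring = mkCommutativeRing (familyGroup B (Fin n))
    _*_ one *-cong *-assoc *-comm *-identityˡ *-distribˡ

  private
    module E = RingKit ring

  z : C
  z = Z one

  z* : ∀ w → (z E.* w) ≈ Z w
  z* w = A.trans (*-comm z w) (A.trans (Z*ʳ w one) (Z-cong (*-identityʳ w)))

  private
    ι₀ : B.Carrier → C
    ι₀ b = b • one

    ι₀* : ∀ b w → (ι₀ b * w) ≈ b • w
    ι₀* b w = A.trans (*-comm _ _) (A.trans (•*ʳ w b one) (pw λ i → B.*-congˡ (at (*-identityʳ w) i)))

  ι : Hom B ring
  ι = record
    { ⟦_⟧ = ι₀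
    ; cong = λ e → pw λ i → B.*-congʳ e
    ; +-homo = λ x y → pw λ i → B.distribʳ _ _ _
    ; *-homo = λ x y → A.trans (pw λ i → B.*-assoc x y _) (A.sym (ι₀* x (ι₀ y)))
    ; 1-homo = pw λ i → B.*-identityˡ _ }

  open Hom ι using (⟦_⟧)

  ι-zero : ∀ b → ⟦ b ⟧ zero B.≈ b
  ι-zero b = B.*-identityʳ b

  ι-suc : ∀ b i → ⟦ b ⟧ (suc i) B.≈ B.0#
  ι-suc b i = B.zeroʳ b

  ι* : ∀ b w i → (⟦ b ⟧ E.* w) i B.≈ b B.* w i
  ι* b w i = at (ι₀* b w) i

  act-horner : ∀ k v w → act k v w ≈ E.horner k (λ i → ⟦ v i ⟧) z E.* w
  act-horner zero v w = E.sym (E.zeroˡ w)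
  act-horner (suc k) v w = E.trans (E.+-cong (E.sym (ι₀* (v zero) w))
    (E.trans (E.sym (z* _)) (E.trans (E.*-congˡ (act-horner k (v ∘ suc) w)) (E.sym (E.*-assoc _ _ _))))) (E.sym (E.distribʳ _ _ _))

  expand : ∀ f → f ≈ E.horner n (λ i → ⟦ f i ⟧) z
  expand f = A.trans (A.sym (act-oneʳ f)) (E.trans (act-horner n f one) (E.*-identityʳ _))

  z^n : (z E.^ n) ≈ ⟦ α ⟧ E.+ ⟦ β ⟧ E.* z
  z^n = A.trans (A.trans (E.*-congˡ (z^ (suc m) ℕP.≤-refl)) (z* _)) (pw λ where
      zero → B.trans (B.*-congˡ e-last) (B.sym (B.trans (B.+-congˡ (B.trans (ι* β z zero) (B.trans (B.*-congˡ (B.zeroʳ _)) (B.zeroʳ _)))) (B.+-identityʳ _)))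
      (suc zero) → B.trans (B.+-identityˡ _) (B.trans (B.*-congˡ e-last) (B.sym (B.trans (B.+-congʳ (B.zeroʳ _)) (B.trans (B.+-identityˡ _)
        (B.trans (ι* β z (suc zero)) (B.*-congˡ (B.trans (B.+-congˡ (B.zeroʳ _)) (B.+-identityʳ _))))))))
      (suc (suc i)) → B.trans (e-other i) (B.sym (B.trans (B.+-cong (B.zeroʳ _) (B.trans (ι* β z (suc (suc i))) (B.zeroʳ _))) (B.+-identityˡ _))))
    where
    -- The k-th standard basis vector. It equals z^k as long as k < n; one further application of
    -- `Z` then produces the relation.
    e : ℕ → Fin n → B.Carrier
    e k i with k ℕ.≟ toℕ i
    ... | yes _ = B.1#
    ... | no _ = B.0#
    e-yes : ∀ k i → k ≡ toℕ i → e k i ≡ B.1#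
    e-yes k i p with k ℕ.≟ toℕ i
    ... | yes _ = ≡.refl
    ... | no ¬p = ⊥-elim (¬p p)
    e-no : ∀ k i → k ≢ toℕ i → e k i ≡ B.0#
    e-no k i p with k ℕ.≟ toℕ i
    ... | yes q = ⊥-elim (p q)
    ... | no ¬p = ≡.refl
    e-last : e (suc m) last B.≈ B.1#
    e-last = B.≡⇒≈ (e-yes (suc m) last (≡.cong suc (≡.sym (FinP.toℕ-fromℕ m))))
    e-other : ∀ i → e (suc m) (inject₁ (suc i)) B.≈ B.0#
    e-other i = B.≡⇒≈ (e-no (suc m) (inject₁ (suc i)) λ p → ℕP.<⇒≢ (FinP.toℕ<n i) (≡.sym (≡.trans (ℕP.suc-injective p) (FinP.toℕ-inject₁ i))))
    last> : ∀ k → k ℕ.< suc m → k ≢ toℕ last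
    last> k k< p = ℕP.<⇒≢ k< (≡.trans p (≡.cong suc (FinP.toℕ-fromℕ m)))
    first : ∀ k → e k zero ≡ e (suc k) (suc zero)
    first zero = ≡.refl
    first (suc k) = ≡.refl
    shift : ∀ k i → Dec (k ≡ toℕ (inject₁ (suc i))) → e k (inject₁ (suc i)) ≡ e (suc k) (suc (suc i))
    shift k i (yes p) = ≡.trans (e-yes k _ p) (≡.sym (e-yes (suc k) (suc (suc i)) (≡.cong suc (≡.trans p (≡.cong suc (FinP.toℕ-inject₁ i))))))
    shift k i (no p) = ≡.trans (e-no k _ p) (≡.sym (e-no (suc k) (suc (suc i)) (λ p′ → p (≡.trans (ℕP.suc-injective p′) (≡.cong suc (≡.sym (FinP.toℕ-inject₁ i)))))))
    Z-e : ∀ k → k ℕ.< suc m → Z (e k) ≈ e (suc k)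
    Z-e k k< = pw λ where
      zero → B.trans (B.*-congˡ (B.≡⇒≈ (e-no k last (last> k k<)))) (B.zeroʳ _)
      (suc zero) → B.trans (B.+-congˡ (B.trans (B.*-congˡ (B.≡⇒≈ (e-no k last (last> k k<)))) (B.zeroʳ _)))
        (B.trans (B.+-identityʳ _) (B.≡⇒≈ (first k)))
      (suc (suc i)) → B.≡⇒≈ (shift k i (k ℕ.≟ toℕ (inject₁ (suc i))))
    z^ : ∀ k → k ℕ.≤ suc m → (z E.^ k) ≈ e k
    z^ zero k≤ = pw λ where
      zero → B.refl
      (suc i) → B.refl
    z^ (suc k) k≤ = A.trans (z* _) (A.trans (Z-cong (z^ k (ℕP.≤-trans (ℕP.n≤1+n k) k≤))) (Z-e k k≤))

  -- The universal property: if y satisfies the relation of z, substituting y for z turns `Z` into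
  -- multiplication by y, and is therefore multiplicative.
  module Lift {c′ ℓ′} {S : CommutativeRing c′ ℓ′} (h : Hom B S) (y : CommutativeRing.Carrier S) where
    private
      module S = RingKit S
      module h = Hom h
      module hp = HomProperties h

    lift₀ : ∀ k → (Fin k → B.Carrier) → S.Carrier
    lift₀ k f = S.horner k (λ i → h.⟦ f i ⟧) y

    lift₀-+ : ∀ k f g → lift₀ k (λ i → f i B.+ g i) S.≈ lift₀ k f S.+ lift₀ k g
    lift₀-+ k f g = S.trans (S.horner-cong k (λ i → h.+-homo (f i) (g i)) S.refl) (S.horner-+ k (λ i → h.⟦ f i ⟧) (λ i → h.⟦ g i ⟧) y)

    lift₀-* : ∀ k b f → lift₀ k (λ i → b B.* f i) S.≈ h.⟦ b ⟧ S.* lift₀ k f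
    lift₀-* k b f = S.trans (S.horner-cong k (λ i → h.*-homo b (f i)) S.refl) (S.horner-* k h.⟦ b ⟧ (λ i → h.⟦ f i ⟧) y)

    lift₀-0 : ∀ k f → (∀ i → f i B.≈ B.0#) → lift₀ k f S.≈ S.0#
    lift₀-0 k f e = S.horner-0 k (λ i → h.⟦ f i ⟧) y (λ i → S.trans (h.cong (e i)) hp.0-homo)

    private
      top : ∀ k (f : Fin (suc k) → B.Carrier) → lift₀ (suc k) f S.≈ lift₀ k (f ∘ inject₁) S.+ y S.^ k S.* h.⟦ f (fromℕ k) ⟧
      top zero f = S.solve 2 (λ a y → a S.:+ y S.:* S.con (+ 0) S.:= S.con (+ 0) S.:+ S.con (+ 1) S.:* a) S.refl _ _
      top (suc k) f = S.trans (S.+-congˡ (S.*-congˡ (top k (f ∘ suc))))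
        (S.solve 5 (λ a y b c d → a S.:+ y S.:* (b S.:+ c S.:* d) S.:= a S.:+ y S.:* b S.:+ y S.:* c S.:* d) S.refl _ _ _ _ (h.⟦ f (suc (fromℕ k)) ⟧))

    module _ (y^n : y S.^ n S.≈ h.⟦ α ⟧ S.+ h.⟦ β ⟧ S.* y) where
      lift-Z : ∀ f → lift₀ n (Z f) S.≈ y S.* lift₀ n f
      lift-Z f = S.sym (S.trans (S.*-congˡ (top (suc m) f)) (S.trans
        (S.solve 4 (λ y b c d → y S.:* (b S.:+ c S.:* d) S.:= y S.:* b S.:+ y S.:* c S.:* d) S.refl y _ (y S.^ suc m) _)
        (S.trans (S.+-congˡ (S.*-congʳ y^n)) (S.trans
          (S.solve 6 (λ y f0 r a b l → y S.:* (f0 S.:+ y S.:* r) S.:+ (a S.:+ b S.:* y) S.:* l S.:= a S.:* l S.:+ y S.:* (f0 S.:+ b S.:* l S.:+ y S.:* r)) S.refl y _ _ _ _ _)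
          (S.sym (S.+-cong (h.*-homo _ _) (S.*-congˡ (S.+-congʳ (S.trans (h.+-homo _ _) (S.+-congˡ (h.*-homo _ _)))))))))))

      lift-act : ∀ k v w → lift₀ n (act k v w) S.≈ lift₀ k v S.* lift₀ n w
      lift-act zero v w = S.trans (lift₀-0 n (λ _ → B.0#) (λ _ → B.refl)) (S.sym (S.zeroˡ _))
      lift-act (suc k) v w = S.trans (lift₀-+ n (v zero • w) (Z (act k (v ∘ suc) w)))
        (S.trans (S.+-cong (lift₀-* n (v zero) w) (S.trans (lift-Z (act k (v ∘ suc) w)) (S.*-congˡ (lift-act k (v ∘ suc) w))))
          (S.solve 4 (λ a w y r → a S.:* w S.:+ y S.:* (r S.:* w) S.:= (a S.:+ y S.:* r) S.:* w) S.refl _ _ _ _))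

      lift-ι : ∀ b → lift₀ n ⟦ b ⟧ S.≈ h.⟦ b ⟧
      lift-ι b = S.trans (S.+-cong (h.cong (ι-zero b)) (S.trans (S.*-congˡ (lift₀-0 (suc m) (⟦ b ⟧ ∘ suc) (ι-suc b))) (S.zeroʳ y))) (S.+-identityʳ _)

      lift : Hom ring S
      lift = record
        { ⟦_⟧ = lift₀ n
        ; cong = λ e → S.horner-cong n (λ i → h.cong (at e i)) S.refl
        ; +-homo = lift₀-+ n
        ; *-homo = λ v w → S.trans (S.horner-cong n (λ i → h.cong (at (*-act v w) i)) S.refl) (lift-act n v w)
        ; 1-homo = S.trans (S.+-cong h.1-homo (S.trans (S.*-congˡ (lift₀-0 (suc m) (one ∘ suc) (λ _ → B.refl))) (S.zeroʳ y))) (S.+-identityʳ _) }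

      lift-z : lift₀ n z S.≈ y
      lift-z = S.trans (lift-Z one) (S.trans (S.*-congˡ (Hom.1-homo lift)) (S.*-identityʳ y))

-- Power series, localization, and the ring of Laurent series.

module PowerSeries {c ℓ} (κ : CommutativeRing c ℓ) where
  private
    module κ = RingKit κ
    module A = AbelianGroup (familyGroup κ ℕ)
    C : Set c
    C = A.Carrier
    open A using (_≈_) renaming (_∙_ to _+_; ε to 0#)

    -- The Cauchy product, by splitting off the constant term of the left factor.
    mul : C → C → C
    mul f g zero = f zero κ.* g zero
    mul f g (suc n) = f zero κ.* g (suc n) κ.+ mul (f ∘ suc) g n

    mul-cong : ∀ {f f′ g g′} → (∀ i → f i κ.≈ f′ i) → (∀ i → g i κ.≈ g′ i) → ∀ n → mul f g n κ.≈ mul f′ g′ n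
    mul-cong ef eg zero = κ.*-cong (ef zero) (eg zero)
    mul-cong ef eg (suc n) = κ.+-cong (κ.*-cong (ef zero) (eg (suc n))) (mul-cong (ef ∘ suc) eg n)

    mul-0ˡ : ∀ f g → (∀ i → f i κ.≈ κ.0#) → ∀ n → mul f g n κ.≈ κ.0#
    mul-0ˡ f g e zero = κ.trans (κ.*-congʳ (e zero)) (κ.zeroˡ _)
    mul-0ˡ f g e (suc n) = κ.trans (κ.+-cong (κ.trans (κ.*-congʳ (e zero)) (κ.zeroˡ _)) (mul-0ˡ (f ∘ suc) g (e ∘ suc) n)) (κ.+-identityˡ _)

    mul-distribˡ : ∀ f g h n → mul f (g + h) n κ.≈ mul f g n κ.+ mul f h n
    mul-distribˡ f g h zero = κ.distribˡ _ _ _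
    mul-distribˡ f g h (suc n) = κ.trans (κ.+-cong (κ.distribˡ _ _ _) (mul-distribˡ (f ∘ suc) g h n))
      (κ.solve 4 (λ a b c d → a κ.:+ b κ.:+ (c κ.:+ d) κ.:= a κ.:+ c κ.:+ (b κ.:+ d)) κ.refl _ _ _ _)

    mul-distribʳ : ∀ f g h n → mul (f + g) h n κ.≈ mul f h n κ.+ mul g h n
    mul-distribʳ f g h zero = κ.distribʳ _ _ _
    mul-distribʳ f g h (suc n) = κ.trans (κ.+-cong (κ.distribʳ _ _ _) (mul-distribʳ (f ∘ suc) (g ∘ suc) h n))
      (κ.solve 4 (λ a b c d → a κ.:+ b κ.:+ (c κ.:+ d) κ.:= a κ.:+ c κ.:+ (b κ.:+ d)) κ.refl _ _ _ _)

    mul-scale : ∀ a f g n → mul (λ i → a κ.* f i) g n κ.≈ a κ.* mul f g n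
    mul-scale a f g zero = κ.*-assoc _ _ _
    mul-scale a f g (suc n) = κ.trans (κ.+-cong (κ.*-assoc _ _ _) (mul-scale a (f ∘ suc) g n)) (κ.sym (κ.distribˡ _ _ _))

    mul-suc : ∀ f g n → mul f g (suc n) κ.≈ mul f (g ∘ suc) n κ.+ f (suc n) κ.* g zero
    mul-suc f g zero = κ.refl
    mul-suc f g (suc n) = κ.trans (κ.+-congˡ (mul-suc (f ∘ suc) g n)) (κ.sym (κ.+-assoc _ _ _))

    mul-comm : ∀ f g n → mul f g n κ.≈ mul g f n
    mul-comm f g zero = κ.*-comm _ _
    mul-comm f g (suc n) = κ.trans (mul-suc f g n) (κ.trans (κ.+-comm _ _) (κ.+-cong (κ.*-comm _ _) (mul-comm f (g ∘ suc) n)))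

    mul-assoc : ∀ f g h n → mul (mul f g) h n κ.≈ mul f (mul g h) n
    mul-assoc f g h zero = κ.*-assoc _ _ _
    mul-assoc f g h (suc n) = κ.trans
      (κ.+-cong (κ.*-assoc _ _ _) (κ.trans (mul-distribʳ (λ i → f zero κ.* g (suc i)) (mul (f ∘ suc) g) h n)
        (κ.+-cong (mul-scale (f zero) (g ∘ suc) h n) (mul-assoc (f ∘ suc) g h n))))
      (κ.solve 5 (λ a b c d e → a κ.:* (b κ.:* c) κ.:+ (a κ.:* d κ.:+ e) κ.:= a κ.:* (b κ.:* c κ.:+ d) κ.:+ e) κ.refl _ _ _ _ _)

    one : C
    one zero = κ.1#
    one (suc n) = κ.0#

    mul-oneˡ : ∀ f n → mul one f n κ.≈ f n
    mul-oneˡ f zero = κ.*-identityˡ _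
    mul-oneˡ f (suc n) = κ.trans (κ.+-cong (κ.*-identityˡ _) (mul-0ˡ (one ∘ suc) f (λ _ → κ.refl) n)) (κ.+-identityʳ _)

  private opaque
    _*_ : C → C → C
    _*_ = mul

    *-mul : ∀ f g n → (f * g) n κ.≈ mul f g n
    *-mul f g n = κ.refl

    *-cong : ∀ {f f′ g g′} → f ≈ f′ → g ≈ g′ → (f * g) ≈ (f′ * g′)
    *-cong e e′ = pw (mul-cong (at e) (at e′))

    *-assoc : ∀ f g h → ((f * g) * h) ≈ (f * (g * h))
    *-assoc f g h = pw (mul-assoc f g h)

    *-comm : ∀ f g → (f * g) ≈ (g * f)
    *-comm f g = pw (mul-comm f g)

    *-identityˡ : ∀ f → (one * f) ≈ f
    *-identityˡ f = pw (mul-oneˡ f)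

    *-distribˡ : ∀ f g h → (f * (g + h)) ≈ ((f * g) + (f * h))
    *-distribˡ f g h = pw (mul-distribˡ f g h)

  ring : CommutativeRing c ℓ
  ring = mkCommutativeRing (familyGroup κ ℕ) _*_ one *-cong *-assoc *-comm *-identityˡ *-distribˡ

  module P = RingKit ring

  T : C
  T zero = κ.0#
  T (suc zero) = κ.1#
  T (suc (suc n)) = κ.0#

  T*-zero : ∀ f → (T P.* f) zero κ.≈ κ.0#
  T*-zero f = κ.trans (*-mul T f zero) (κ.zeroˡ _)

  T*-suc : ∀ f n → (T P.* f) (suc n) κ.≈ f n
  T*-suc f n = κ.trans (*-mul T f (suc n)) (κ.trans (κ.+-cong (κ.zeroˡ _)
    (κ.trans (mul-cong {f′ = one} {g = f} (λ { zero → κ.refl ; (suc i) → κ.refl }) (λ _ → κ.refl) n) (mul-oneˡ f n))) (κ.+-identityˡ _))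

  T-regular : ∀ f → T P.* f P.≈ P.0# → f P.≈ P.0#
  T-regular f e = pw λ n → κ.trans (κ.sym (T*-suc f n)) (at e (suc n))

  private
    const₀ : κ.Carrier → C
    const₀ a zero = a
    const₀ a (suc n) = κ.0#

    const* : ∀ a f n → (const₀ a * f) n κ.≈ a κ.* f n
    const* a f n = κ.trans (*-mul _ f n) (go n)
      where
      go : ∀ n → mul (const₀ a) f n κ.≈ a κ.* f n
      go zero = κ.refl
      go (suc n) = κ.trans (κ.+-congˡ (mul-0ˡ (const₀ a ∘ suc) f (λ _ → κ.refl) n)) (κ.+-identityʳ _)

  const : Hom κ ring
  const = record
    { ⟦_⟧ = const₀
    ; cong = λ e → pw λ { zero → e ; (suc n) → κ.refl }
    ; +-homo = λ x y → pw λ { zero → κ.refl ; (suc n) → κ.sym (κ.+-identityʳ _) }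
    ; *-homo = λ x y → pw λ n → κ.sym (κ.trans (const* x (const₀ y) n) (split x y n))
    ; 1-homo = pw λ { zero → κ.refl ; (suc n) → κ.refl } }
    where
    split : ∀ x y n → x κ.* const₀ y n κ.≈ const₀ (x κ.* y) n
    split x y zero = κ.refl
    split x y (suc n) = κ.zeroʳ _

  const-* : ∀ a f n → (Hom.⟦_⟧ const a P.* f) n κ.≈ a κ.* f n
  const-* = const*

  _below_ : C → ℕ → Set ℓ
  f below a = ∀ i → i ℕ.< a → f i κ.≈ κ.0#

  _above_ : C → ℕ → Set ℓ
  f above a = ∀ i → a ℕ.< i → f i κ.≈ κ.0#

  *-below : ∀ a b f g → f below a → g below b → (f P.* g) below (a ℕ.+ b)
  *-below a b f g vf vg i i< = κ.trans (*-mul f g i) (go a f vf i i<)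
    where
    go : ∀ a f → f below a → ∀ i → i ℕ.< a ℕ.+ b → mul f g i κ.≈ κ.0#
    go zero f vf zero i< = κ.trans (κ.*-congˡ (vg zero i<)) (κ.zeroʳ _)
    go zero f vf (suc i) i< = κ.trans (κ.+-cong (κ.trans (κ.*-congˡ (vg (suc i) i<)) (κ.zeroʳ _))
      (go zero (f ∘ suc) (λ _ ()) i (ℕP.<-trans (ℕP.n<1+n i) i<))) (κ.+-identityˡ _)
    go (suc a) f vf zero i< = κ.trans (κ.*-congʳ (vf zero (s≤s z≤n))) (κ.zeroˡ _)
    go (suc a) f vf (suc i) (s≤s i<) = κ.trans (κ.+-cong (κ.trans (κ.*-congʳ (vf zero (s≤s z≤n))) (κ.zeroˡ _))
      (go a (f ∘ suc) (λ j j< → vf (suc j) (s≤s j<)) i i<)) (κ.+-identityˡ _)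

  *-above : ∀ a b f g → f above a → g above b → (f P.* g) above (a ℕ.+ b)
  *-above a b f g vf vg i i< = κ.trans (*-mul f g i) (go a f vf i i<)
    where
    go : ∀ a f → f above a → ∀ i → a ℕ.+ b ℕ.< i → mul f g i κ.≈ κ.0#
    go zero f vf (suc i) i< = κ.trans (κ.+-cong (κ.trans (κ.*-congˡ (vg (suc i) i<)) (κ.zeroʳ _))
      (mul-0ˡ (f ∘ suc) g (λ j → vf (suc j) (s≤s z≤n)) i)) (κ.+-identityˡ _)
    go (suc a) f vf (suc i) (s≤s i<) = κ.trans (κ.+-cong (κ.trans (κ.*-congˡ (vg (suc i) (s≤s (ℕP.≤-trans (ℕP.m≤n+m b a) (ℕP.<⇒≤ i<))))) (κ.zeroʳ _))
      (go a (f ∘ suc) (λ j j< → vf (suc j) (s≤s j<)) i i<)) (κ.+-identityˡ _)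

  *-0ˡ-above : ∀ f g → (∀ i → f i κ.≈ κ.0#) → ∀ i → (f P.* g) i κ.≈ κ.0#
  *-0ˡ-above f g e i = κ.trans (*-mul f g i) (mul-0ˡ f g e i)

  factor : ∀ n f → f below n → f P.≈ T P.^ n P.* (λ i → f (n ℕ.+ i))
  factor zero f _ = P.sym (P.*-identityˡ f)
  factor (suc n) f v = P.trans (pw λ { zero → κ.trans (v zero (s≤s z≤n)) (κ.sym (T*-zero _)) ; (suc i) → κ.sym (T*-suc (f ∘ suc) i) })
    (P.trans (P.*-congˡ (factor n (f ∘ suc) (λ i i< → v (suc i) (s≤s i<)))) (P.sym (P.*-assoc _ _ _)))

  -- The iteration s ↦ V - s^q converges T-adically to a root of s^q + s = V.
  module Root (p : ℕ) (freshman : ∀ x y → (x P.+ y) P.^ suc (suc p) P.≈ x P.^ suc (suc p) P.+ y P.^ suc (suc p))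
              (V : C) (V₀ : V below 1) where
    private
      q : ℕ
      q = suc (suc p)

      power-minus : ∀ x y → x P.^ q P.- y P.^ q P.≈ (x P.- y) P.^ q
      power-minus x y = P.trans (P.+-congʳ (P.trans (P.^-congˡ q (P.solve 2 (λ x y → x P.:= x P.:- y P.:+ y) P.refl x y)) (freshman (x P.- y) y)))
        (P.solve 2 (λ a b → a P.:+ b P.:- b P.:= a) P.refl _ _)

      -- Since q ≥ 2, a q-th power gains at least one order. This is why the iteration contracts.
      power-below : ∀ a x → x below (suc a) → (x P.^ q) below (suc (suc a))
      power-below a x v i i< = *-below (suc a) (suc a ℕ.+ 0) x (x P.^ suc p) v (*-below (suc a) 0 x (x P.^ p) v (λ _ ()))
        i (ℕP.≤-trans i< (s≤s (≡.subst (suc a ℕ.≤_) (≡.sym (ℕP.+-suc a (a ℕ.+ 0))) (s≤s (ℕP.m≤m+n a (a ℕ.+ 0))))))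

      S : ℕ → C
      S zero = P.0#
      S (suc M) = V P.- S M P.^ q

      step : ∀ M → (S (suc M) P.- S M) below (suc M)
      step zero i i< = κ.trans (at (P.+-cong (P.+-congˡ {V} (P.-‿cong (P.0^suc (suc p)))) (P.refl {P.- P.0#})) i)
        (κ.trans (κ.solve 1 (λ v → v κ.:- κ.con (+ 0) κ.:- κ.con (+ 0) κ.:= v) κ.refl _) (V₀ i i<))
      step (suc M) i i< = κ.trans (at e i) (κ.trans (κ.-‿cong (power-below M (S (suc M) P.- S M) (step M) i i<)) κ.-0#≈0#)
        where
        e : S (suc (suc M)) P.- S (suc M) P.≈ P.- (S (suc M) P.- S M) P.^ q
        e = P.trans (P.solve 3 (λ v a b → v P.:- a P.:- (v P.:- b) P.:= P.:- (a P.:- b)) P.refl V _ _) (P.-‿cong (power-minus _ _))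

      stable : ∀ M k i → i ℕ.≤ M → S (M ℕ.+ k) i κ.≈ S M i
      stable M zero i i≤ = κ.≡⇒≈ (≡.cong (λ n → S n i) (ℕP.+-identityʳ M))
      stable M (suc k) i i≤ = κ.trans (κ.≡⇒≈ (≡.cong (λ n → S n i) (ℕP.+-suc M k)))
        (κ.trans (κ.x-y≈0⇒x≈y (step (M ℕ.+ k) i (s≤s (ℕP.≤-trans i≤ (ℕP.m≤m+n M k))))) (stable M k i i≤))

    -- The n-th coefficient no longer changes from the n-th iterate on, so the diagonal is the
    -- limit.
    root : C
    root n = S n n

    private
      approx : ∀ M → (root P.- S M) below (suc M)
      approx M i (s≤s i≤) = κ.x≈y⇒x-y≈0 (κ.sym (κ.trans (κ.≡⇒≈ (≡.cong (λ n → S n i) (≡.sym (ℕP.m+[n∸m]≡n i≤)))) (stable i (M ℕ.∸ i) i ℕP.≤-refl)))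

    root-equation : root P.^ q P.+ root P.≈ V
    root-equation = pw λ n → κ.trans
      (κ.+-cong (κ.x-y≈0⇒x≈y (κ.trans (at (power-minus root (S n)) n) (power-below n (root P.- S n) (approx n) n (ℕP.m≤n⇒m≤1+n (ℕP.n<1+n n)))))
        (κ.sym (κ.x-y≈0⇒x≈y (step n n (ℕP.n<1+n n)))))
      (κ.solve 2 (λ v x → x κ.:+ (v κ.:- x) κ.:= v) κ.refl (V n) _)

    root-below : ∀ t → V below t → root below t
    root-below t v i i< = S-below i i i<
      where
      S-below : ∀ M → S M below t
      S-below zero i _ = κ.refl
      S-below (suc M) i i< = κ.trans (κ.+-cong (v i i<) (κ.trans (κ.-‿cong (*-below t 0 (S M) (S M P.^ suc p) (S-below M) (λ _ ()) i
        (ℕP.≤-trans i< (ℕP.m≤m+n t 0)))) κ.-0#≈0#)) (κ.+-identityˡ _)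

-- R[1/t] for a non-zero-divisor t; the pair (n , f) stands for f / t^n.
module Localization {c ℓ} (R : CommutativeRing c ℓ) (t : CommutativeRing.Carrier R)
  (regular : ∀ x → CommutativeRing._≈_ R (CommutativeRing._*_ R t x) (CommutativeRing.0# R) → CommutativeRing._≈_ R x (CommutativeRing.0# R)) where
  private
    module R = RingKit R

  regular^ : ∀ n x → t R.^ n R.* x R.≈ R.0# → x R.≈ R.0#
  regular^ zero x e = R.trans (R.sym (R.*-identityˡ x)) e
  regular^ (suc n) x e = regular^ n x (regular _ (R.trans (R.sym (R.*-assoc t _ x)) e))

  Fraction : Set c
  Fraction = ℕ × R.Carrier

  record _≃_ (x y : Fraction) : Set ℓ where
    constructor cross
    field equality : t R.^ proj₁ y R.* proj₂ x R.≈ t R.^ proj₁ x R.* proj₂ y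
  open _≃_ public

  private
    group : AbelianGroup c ℓ
    group = record
      { Carrier = Fraction ; _≈_ = _≃_
      ; _∙_ = λ { (n , f) (m , g) → n ℕ.+ m , t R.^ m R.* f R.+ t R.^ n R.* g }
      ; ε = 0 , R.0# ; _⁻¹ = λ { (n , f) → n , R.- f }
      ; isAbelianGroup = record
        { isGroup = record
          { isMonoid = record
            { isSemigroup = record
              { isMagma = record
                { isEquivalence = record
                  { refl = cross R.refl
                  ; sym = λ e → cross (R.sym (equality e))
                  -- Transitivity is shown after multiplication by t^m, the denominator of the
                  -- middle fraction, which regularity then cancels.
                  ; trans = λ { {n , f} {m , g} {l , h} (cross e) (cross e′) → cross (R.x-y≈0⇒x≈y (regular^ m _ (R.trans
                      (R.solve 5 (λ tm tl f tn h → tm R.:* (tl R.:* f R.:- tn R.:* h) R.:= tl R.:* (tm R.:* f) R.:- tn R.:* (tm R.:* h)) R.refl (t R.^ m) (t R.^ l) f (t R.^ n) h)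
                      (R.trans (R.+-cong (R.*-congˡ e) (R.-‿cong (R.*-congˡ (R.sym e′))))
                      (R.solve 3 (λ tl tn g → tl R.:* (tn R.:* g) R.:- tn R.:* (tl R.:* g) R.:= R.con (+ 0)) R.refl (t R.^ l) (t R.^ n) g))))) } }
                ; ∙-cong = λ { {n , f} {n′ , f′} {m , g} {m′ , g′} (cross e) (cross e′) → cross (R.trans (R.*-congʳ (R.^-homo-* t n′ m′)) (R.trans
                    (R.solve 6 (λ tn′ tm′ tm f tn g → tn′ R.:* tm′ R.:* (tm R.:* f R.:+ tn R.:* g) R.:= tm′ R.:* tm R.:* (tn′ R.:* f) R.:+ tn′ R.:* tn R.:* (tm′ R.:* g)) R.refl (t R.^ n′) (t R.^ m′) (t R.^ m) f (t R.^ n) g)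
                    (R.trans (R.+-cong (R.*-congˡ e) (R.*-congˡ e′)) (R.trans
                    (R.solve 6 (λ tn′ tm′ tm f tn g → tm′ R.:* tm R.:* (tn R.:* f) R.:+ tn′ R.:* tn R.:* (tm R.:* g) R.:= tn R.:* tm R.:* (tm′ R.:* f R.:+ tn′ R.:* g)) R.refl (t R.^ n′) (t R.^ m′) (t R.^ m) f′ (t R.^ n) g′)
                    (R.*-congʳ (R.sym (R.^-homo-* t n m))))))) } }
              ; assoc = λ { (n , f) (m , g) (l , h) → cross (R.*-cong (R.^-congʳ t (≡.sym (ℕP.+-assoc n m l))) (R.sym (R.trans
                  (R.+-cong (R.*-congʳ (R.^-homo-* t m l)) R.refl) (R.trans
                  (R.solve 6 (λ tm tl f tn g h → tm R.:* tl R.:* f R.:+ tn R.:* (tl R.:* g R.:+ tm R.:* h) R.:= tl R.:* (tm R.:* f R.:+ tn R.:* g) R.:+ tn R.:* tm R.:* h) R.refl (t R.^ m) (t R.^ l) f (t R.^ n) g h)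
                  (R.+-congˡ (R.*-congʳ (R.sym (R.^-homo-* t n m)))))))) } }
            ; identity = (λ { (n , f) → cross (R.*-congˡ (R.solve 2 (λ f tn → tn R.:* R.con (+ 0) R.:+ R.con (+ 1) R.:* f R.:= f) R.refl f (t R.^ n))) })
              , (λ { (n , f) → cross (R.*-cong (R.^-congʳ t (≡.sym (ℕP.+-identityʳ n))) (R.solve 2 (λ f tn → R.con (+ 1) R.:* f R.:+ tn R.:* R.con (+ 0) R.:= f) R.refl f (t R.^ n))) }) }
          ; inverse = (λ { (n , f) → cross (R.solve 3 (λ f tn u → R.con (+ 1) R.:* (tn R.:* (R.:- f) R.:+ tn R.:* f) R.:= u R.:* R.con (+ 0)) R.refl f (t R.^ n) _) })
            , (λ { (n , f) → cross (R.solve 3 (λ f tn u → R.con (+ 1) R.:* (tn R.:* f R.:+ tn R.:* (R.:- f)) R.:= u R.:* R.con (+ 0)) R.refl f (t R.^ n) _) })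
          ; ⁻¹-cong = λ { {n , f} {m , g} (cross e) → cross (R.trans (R.sym (R.-‿distribʳ-* _ _)) (R.trans (R.-‿cong e) (R.-‿distribʳ-* _ _))) } }
        ; comm = λ { (n , f) (m , g) → cross (R.*-cong (R.^-congʳ t (ℕP.+-comm m n)) (R.+-comm _ _)) } } }

  ring : CommutativeRing c ℓ
  ring = mkCommutativeRing group
    (λ { (n , f) (m , g) → n ℕ.+ m , f R.* g }) (0 , R.1#)
    (λ { {n , f} {n′ , f′} {m , g} {m′ , g′} (cross e) (cross e′) → cross (R.trans (R.*-congʳ (R.^-homo-* t n′ m′)) (R.trans
      (R.solve 4 (λ a b f g → a R.:* b R.:* (f R.:* g) R.:= a R.:* f R.:* (b R.:* g)) R.refl (t R.^ n′) (t R.^ m′) f g)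
      (R.trans (R.*-cong e e′) (R.trans
      (R.solve 4 (λ a b f g → a R.:* f R.:* (b R.:* g) R.:= a R.:* b R.:* (f R.:* g)) R.refl (t R.^ n) (t R.^ m) f′ g′)
      (R.*-congʳ (R.sym (R.^-homo-* t n m))))))) })
    (λ { (n , f) (m , g) (l , h) → cross (R.*-cong (R.^-congʳ t (≡.sym (ℕP.+-assoc n m l))) (R.*-assoc f g h)) })
    (λ { (n , f) (m , g) → cross (R.*-cong (R.^-congʳ t (ℕP.+-comm m n)) (R.*-comm f g)) })
    (λ { (n , f) → cross (R.*-congˡ (R.*-identityˡ f)) })
    (λ { (n , f) (m , g) (l , h) → cross (R.trans (R.*-congʳ (R.trans (R.^-homo-* t (n ℕ.+ m) (n ℕ.+ l)) (R.*-cong (R.^-homo-* t n m) (R.^-homo-* t n l)))) (R.trans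
      (R.solve 6 (λ tn tm tl f g h → tn R.:* tm R.:* (tn R.:* tl) R.:* (f R.:* (tl R.:* g R.:+ tm R.:* h)) R.:= tn R.:* (tm R.:* tl) R.:* (tn R.:* tl R.:* (f R.:* g) R.:+ tn R.:* tm R.:* (f R.:* h))) R.refl (t R.^ n) (t R.^ m) (t R.^ l) f g h)
      (R.*-cong (R.sym (R.trans (R.^-homo-* t n (m ℕ.+ l)) (R.*-congˡ (R.^-homo-* t m l))))
        (R.+-cong (R.*-congʳ (R.sym (R.^-homo-* t n l))) (R.*-congʳ (R.sym (R.^-homo-* t n m))))))) })

-- The properties of the ring κ((T)) of formal Laurent series that are used; q = p + 2.
record LaurentRing {c ℓ} (κ : CommutativeRing c ℓ) (p : ℕ) : Set (lsuc (c ⊔ ℓ)) where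
  private
    module κ = RingKit κ
  field
    ring : CommutativeRing c ℓ
  private
    module R = RingKit ring
  field
    const : Hom κ ring
    coeff : R.Carrier → ℤ → κ.Carrier
    coeff-cong : ∀ {x y} → x R.≈ y → ∀ m → coeff x m κ.≈ coeff y m
    coeff-ext : ∀ {x y} → (∀ m → coeff x m κ.≈ coeff y m) → x R.≈ y
    coeff-+ : ∀ x y m → coeff (x R.+ y) m κ.≈ coeff x m κ.+ coeff y m
    coeff-const* : ∀ a x m → coeff (Hom.⟦_⟧ const a R.* x) m κ.≈ a κ.* coeff x m
    T T⁻¹ : R.Carrier
    T*T⁻¹ : T R.* T⁻¹ R.≈ R.1#
    coeff-T : ∀ x m → coeff (T R.* x) (ℤ.suc m) κ.≈ coeff x m
    coeff-1 : coeff R.1# (+ 0) κ.≈ κ.1#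
    coeff-1′ : ∀ m → m ≢ + 0 → coeff R.1# m κ.≈ κ.0#

  Order : ℤ → R.Carrier → Set ℓ
  Order s x = ∀ m → m ℤ.< s → coeff x m κ.≈ κ.0#

  -- An infinite series has no degree: the elements with some degree are the Laurent polynomials,
  -- and only these are seen at T = ∞ and T = 1.
  Degree : ℤ → R.Carrier → Set ℓ
  Degree s x = ∀ m → s ℤ.< m → coeff x m κ.≈ κ.0#

  field
    bounded : ∀ x → ∃ λ s → Order s x
    Order-* : ∀ {s t x y} → Order s x → Order t y → Order (s ℤ.+ t) (x R.* y)
    Degree-* : ∀ {s t x y} → Degree s x → Degree t y → Degree (s ℤ.+ t) (x R.* y)
    truncate : ∀ s x → ∃ λ y → (∀ m → m ℤ.< s → coeff y m κ.≈ coeff x m) × (∀ m → s ℤ.≤ m → coeff y m κ.≈ κ.0#)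
    root : ∀ x → Order (+ 1) x → ∃ λ r → r R.^ suc (suc p) R.+ r R.≈ x × (∀ t → Order t x → Order t r)
    1/[1-T] : ∃ λ w → Order (+ 0) w × w R.* (R.1# R.- T) R.≈ R.1#

module _ {c ℓ} (κ : CommutativeRing c ℓ) (p : ℕ) (binomials : RingKit.BinomialsVanish κ (suc (suc p))) where
  private
    module κ = RingKit κ
    module PS = PowerSeries κ
    module P = PS.P
    module L = Localization PS.ring PS.T PS.T-regular
    module R = RingKit L.ring
    C : Set c
    C = P.Carrier

    at′ : C → ℤ → κ.Carrier
    at′ f (+ n) = f n
    at′ f -[1+ n ] = κ.0#

    at′-cong : ∀ {f g} → f P.≈ g → ∀ i → at′ f i κ.≈ at′ g i
    at′-cong e (+ n) = at e n
    at′-cong e -[1+ n ] = κ.refl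

    reindex : ∀ f {i j} → i ≡ j → at′ f i κ.≈ at′ f j
    reindex f e = κ.≡⇒≈ (≡.cong (at′ f) e)

    at′-T : ∀ f i → at′ (PS.T P.* f) (ℤ.suc i) κ.≈ at′ f i
    at′-T f (+ n) = PS.T*-suc f n
    at′-T f -[1+ zero ] = PS.T*-zero f
    at′-T f -[1+ suc n ] = κ.refl

    suc-+ : ∀ i k → i ℤ.+ + suc k ≡ ℤ.suc (i ℤ.+ + k)
    suc-+ i k = ≡.trans (≡.cong (λ j → i ℤ.+ j) (ℤP.pos-+ 1 k)) (lemma i (+ k))
      where
      lemma : ∀ i j → i ℤ.+ (+ 1 ℤ.+ j) ≡ + 1 ℤ.+ (i ℤ.+ j)
      lemma = solve-∀

    at′-T^ : ∀ k f i → at′ (PS.T P.^ k P.* f) (i ℤ.+ + k) κ.≈ at′ f i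
    at′-T^ zero f i = κ.trans (at′-cong (P.*-identityˡ f) (i ℤ.+ + 0)) (reindex f (ℤP.+-identityʳ i))
    at′-T^ (suc k) f i = κ.trans (at′-cong (P.*-assoc PS.T (PS.T P.^ k) f) (i ℤ.+ + suc k)) (κ.trans (reindex (PS.T P.* (PS.T P.^ k P.* f)) (suc-+ i k))
      (κ.trans (at′-T (PS.T P.^ k P.* f) (i ℤ.+ + k)) (at′-T^ k f i)))

    coeff : R.Carrier → ℤ → κ.Carrier
    coeff (n , f) m = at′ f (m ℤ.+ + n)

    shift-index : ∀ m n k → m ℤ.+ + n ℤ.+ + k ≡ m ℤ.+ + (n ℕ.+ k)
    shift-index m n k = ≡.trans (ℤP.+-assoc m (+ n) (+ k)) (≡.cong (λ j → m ℤ.+ j) (≡.sym (ℤP.pos-+ n k)))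

    scaled : ∀ n k f m → at′ (PS.T P.^ k P.* f) (m ℤ.+ + (n ℕ.+ k)) κ.≈ coeff (n , f) m
    scaled n k f m = κ.trans (reindex (PS.T P.^ k P.* f) (≡.sym (shift-index m n k))) (at′-T^ k f (m ℤ.+ + n))

    scaled′ : ∀ n k f m → at′ (PS.T P.^ k P.* f) (m ℤ.+ + (k ℕ.+ n)) κ.≈ coeff (n , f) m
    scaled′ n k f m = κ.trans (reindex (PS.T P.^ k P.* f) (≡.cong (λ j → m ℤ.+ + j) (ℕP.+-comm k n))) (scaled n k f m)

    coeff-cong : ∀ {x y} → x R.≈ y → ∀ m → coeff x m κ.≈ coeff y m
    coeff-cong {n , f} {k , g} e m = κ.trans (κ.sym (scaled n k f m)) (κ.trans (at′-cong (L.equality e) (m ℤ.+ + (n ℕ.+ k))) (scaled′ k n g m))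

    coeff-ext : ∀ {x y} → (∀ m → coeff x m κ.≈ coeff y m) → x R.≈ y
    coeff-ext {n , f} {k , g} e = L.cross (pw λ i → κ.trans (reindex (PS.T P.^ k P.* f) (index i))
      (κ.trans (scaled n k f (+ i ℤ.- + (n ℕ.+ k))) (κ.trans (e (+ i ℤ.- + (n ℕ.+ k))) (κ.trans (κ.sym (scaled′ k n g (+ i ℤ.- + (n ℕ.+ k)))) (reindex (PS.T P.^ n P.* g) (≡.sym (index i)))))))
      where
      lemma : ∀ i j → i ≡ i ℤ.- j ℤ.+ j
      lemma = solve-∀
      index : ∀ i → + i ≡ + i ℤ.- + (n ℕ.+ k) ℤ.+ + (n ℕ.+ k)
      index i = lemma (+ i) (+ (n ℕ.+ k))

    at′-+ : ∀ f g i → at′ (f P.+ g) i κ.≈ at′ f i κ.+ at′ g i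
    at′-+ f g (+ n) = κ.refl
    at′-+ f g -[1+ n ] = κ.sym (κ.+-identityˡ _)

    const : Hom κ L.ring
    const = record
      { ⟦_⟧ = λ a → 0 , Hom.⟦_⟧ PS.const a
      ; cong = λ e → L.cross (P.*-congˡ (Hom.cong PS.const e))
      ; +-homo = λ x y → L.cross (P.trans (P.*-congˡ (Hom.+-homo PS.const x y)) (P.solve 2 (λ x y → P.con (+ 1) P.:* (x P.:+ y) P.:= P.con (+ 1) P.:* (P.con (+ 1) P.:* x P.:+ P.con (+ 1) P.:* y)) P.refl _ _))
      ; *-homo = λ x y → L.cross (P.*-congˡ (Hom.*-homo PS.const x y))
      ; 1-homo = L.cross (P.*-congˡ (Hom.1-homo PS.const)) }

    Order Degree : ℤ → R.Carrier → Set ℓ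
    Order s x = ∀ m → m ℤ.< s → coeff x m κ.≈ κ.0#
    Degree s x = ∀ m → s ℤ.< m → coeff x m κ.≈ κ.0#

    pos : ℤ → ℕ
    pos (+ n) = n
    pos -[1+ n ] = 0

    ≤pos : ∀ s → s ℤ.≤ + pos s
    ≤pos (+ n) = ℤP.≤-refl
    ≤pos -[1+ n ] = ℤ.-≤+

    unshift : ∀ n i → + i ℤ.- + n ℤ.+ + n ≡ + i
    unshift n i = lemma (+ i) (+ n)
      where
      lemma : ∀ i j → i ℤ.- j ℤ.+ j ≡ i
      lemma = solve-∀

    shift-< : ∀ {i s} n → i ℤ.< s ℤ.+ + n → i ℤ.- + n ℤ.< s
    shift-< {i} {s} n i< = ≡.subst (i ℤ.- + n ℤ.<_) (lemma s (+ n)) (ℤP.+-monoˡ-< (ℤ.- + n) i<)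
      where
      lemma : ∀ s j → s ℤ.+ j ℤ.- j ≡ s
      lemma = solve-∀

    shift-> : ∀ {i s} n → s ℤ.+ + n ℤ.< i → s ℤ.< i ℤ.- + n
    shift-> {i} {s} n <i = ≡.subst (ℤ._< i ℤ.- + n) (lemma s (+ n)) (ℤP.+-monoˡ-< (ℤ.- + n) <i)
      where
      lemma : ∀ s j → s ℤ.+ j ℤ.- j ≡ s
      lemma = solve-∀

    at-zero : ∀ f n i → coeff (n , f) (+ i ℤ.- + n) κ.≈ κ.0# → f i κ.≈ κ.0#
    at-zero f n i e = κ.trans (reindex f (≡.sym (unshift n i))) e

    drop-pos : ∀ {i s} → i ℕ.< pos s → + i ℤ.< s
    drop-pos {i} {+ n} i< = ℤ.+<+ i<

    below′ : ∀ {s n f} → Order s (n , f) → f PS.below pos (s ℤ.+ + n)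
    below′ {s} {n} {f} v i i< = at-zero f n i (v _ (shift-< n (drop-pos i<)))

    sum-index : ∀ s t n k → s ℤ.+ t ℤ.+ + (n ℕ.+ k) ≡ (s ℤ.+ + n) ℤ.+ (t ℤ.+ + k)
    sum-index s t n k = ≡.trans (≡.cong (λ j → s ℤ.+ t ℤ.+ j) (ℤP.pos-+ n k)) (lemma s t (+ n) (+ k))
      where
      lemma : ∀ s t n k → s ℤ.+ t ℤ.+ (n ℤ.+ k) ≡ (s ℤ.+ n) ℤ.+ (t ℤ.+ k)
      lemma = solve-∀

    Order-* : ∀ {s t x y} → Order s x → Order t y → Order (s ℤ.+ t) (x R.* y)
    Order-* {s} {t} {n , f} {k , g} v w m m< = go (m ℤ.+ + (n ℕ.+ k)) (≡.subst (m ℤ.+ + (n ℕ.+ k) ℤ.<_) (sum-index s t n k) (ℤP.+-monoˡ-< _ m<))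
      where
      go : ∀ i → i ℤ.< (s ℤ.+ + n) ℤ.+ (t ℤ.+ + k) → at′ (f P.* g) i κ.≈ κ.0#
      go -[1+ i ] _ = κ.refl
      go (+ i) i< = PS.*-below (pos (s ℤ.+ + n)) (pos (t ℤ.+ + k)) f g (below′ {s} {n} {f} v) (below′ {t} {k} {g} w) i
        (ℤP.drop‿+<+ (ℤP.<-≤-trans i< (≡.subst ((s ℤ.+ + n) ℤ.+ (t ℤ.+ + k) ℤ.≤_) (≡.sym (ℤP.pos-+ (pos (s ℤ.+ + n)) _)) (ℤP.+-mono-≤ (≤pos (s ℤ.+ + n)) (≤pos (t ℤ.+ + k))))))

    Degree-* : ∀ {s t x y} → Degree s x → Degree t y → Degree (s ℤ.+ t) (x R.* y)
    Degree-* {s} {t} {n , f} {k , g} v w m m> =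
      go (s ℤ.+ + n) (t ℤ.+ + k) (m ℤ.+ + (n ℕ.+ k)) (λ i i> → at-zero f n i (v _ (shift-> n i>))) (λ i i> → at-zero g k i (w _ (shift-> k i>)))
        (≡.subst (ℤ._< m ℤ.+ + (n ℕ.+ k)) (sum-index s t n k) (ℤP.+-monoˡ-< _ m>))
      where
      go : ∀ a b i → (∀ j → a ℤ.< + j → f j κ.≈ κ.0#) → (∀ j → b ℤ.< + j → g j κ.≈ κ.0#) → a ℤ.+ b ℤ.< i → at′ (f P.* g) i κ.≈ κ.0#
      go a b -[1+ i ] v w i> = κ.refl
      -- A numerator of negative degree is the zero series.
      go -[1+ a ] b (+ i) v w i> = PS.*-0ˡ-above f g (λ j → v j ℤ.-<+) i
      go (+ a) -[1+ b ] (+ i) v w i> = κ.trans (at (P.*-comm f g) i) (PS.*-0ˡ-above g f (λ j → w j ℤ.-<+) i)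
      go (+ a) (+ b) (+ i) v w i> = PS.*-above a b f g (λ j j> → v j (ℤ.+<+ j>)) (λ j j> → w j (ℤ.+<+ j>)) i
        (ℤP.drop‿+<+ (≡.subst (ℤ._< + i) (≡.sym (ℤP.pos-+ a b)) i>))

    truncate : ∀ s x → ∃ λ y → (∀ m → m ℤ.< s → coeff y m κ.≈ coeff x m) × (∀ m → s ℤ.≤ m → coeff y m κ.≈ κ.0#)
    truncate s (n , f) = (n , g) , (λ m m< → same (m ℤ.+ + n) (ℤP.+-monoˡ-< (+ n) m<)) , λ m m≥ → other (m ℤ.+ + n) (ℤP.+-monoˡ-≤ (+ n) m≥)
      where
      g : C
      g i with + i ℤ.<? s ℤ.+ + n
      ... | yes _ = f i
      ... | no _ = κ.0#
      same : ∀ i → i ℤ.< s ℤ.+ + n → at′ g i κ.≈ at′ f i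
      same (+ i) i< with + i ℤ.<? s ℤ.+ + n
      ... | yes _ = κ.refl
      ... | no i≮ = ⊥-elim (i≮ i<)
      same -[1+ i ] _ = κ.refl
      other : ∀ i → s ℤ.+ + n ℤ.≤ i → at′ g i κ.≈ κ.0#
      other (+ i) i≥ with + i ℤ.<? s ℤ.+ + n
      ... | yes i< = ⊥-elim (ℤP.<⇒≱ i< i≥)
      ... | no _ = κ.refl
      other -[1+ i ] _ = κ.refl

    root : ∀ x → Order (+ 1) x → ∃ λ r → r R.^ suc (suc p) R.+ r R.≈ x × (∀ t → Order t x → Order t r)
    root (n , f) v = (0 , S.root) , (R.trans (R.+-congʳ (power S.root q)) (R.trans (embed-+ _ _) (R.trans (embed S.root-equation) (R.sym x≈)))) ,
      λ t w → λ { m m< → order t w m m< }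
      where
      q : ℕ
      q = suc (suc p)
      -- Positive order makes the numerator divisible by the denominator T^n; V is the quotient, a
      -- power series without constant term.
      V : C
      V i = f (n ℕ.+ i)
      f-below : f PS.below n
      f-below i i< = at-zero f n i (v _ (ℤP.<-trans (shift-< n (≡.subst (+ i ℤ.<_) (≡.sym (ℤP.+-identityˡ (+ n))) (ℤ.+<+ i<))) (ℤ.+<+ (s≤s z≤n))))
      x≈ : (n , f) R.≈ (0 , V)
      x≈ = L.cross (P.trans (P.*-identityˡ f) (PS.factor n f f-below))
      V₀ : V PS.below 1
      V₀ i i< = κ.trans (κ.≡⇒≈ (≡.cong V (≡.sym (ℕP.+-identityʳ i)))) (κ.trans (coeff-cong (R.sym x≈) (+ i)) (v (+ i) (ℤ.+<+ i<)))
      module S = PS.Root p (P.freshman (suc p) (HomProperties.binomials-vanish PS.const q binomials)) V V₀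
      embed : ∀ {f g} → f P.≈ g → (0 , f) R.≈ (0 , g)
      embed e = L.cross (P.*-congˡ e)
      embed-+ : ∀ f g → (0 , f) R.+ (0 , g) R.≈ (0 , f P.+ g)
      embed-+ f g = L.cross (P.*-congˡ (P.+-cong (P.*-identityˡ _) (P.*-identityˡ _)))
      power : ∀ f k → (0 , f) R.^ k R.≈ (0 , f P.^ k)
      power f zero = R.refl
      power f (suc k) = R.*-congˡ {0 , f} (power f k)
      order : ∀ t → Order t (n , f) → Order t (0 , S.root)
      order (+ t) w (+ m) (ℤ.+<+ m<) = κ.trans (κ.≡⇒≈ (≡.cong S.root (ℕP.+-identityʳ m))) (S.root-below t (λ i i< → κ.trans (κ.≡⇒≈ (≡.cong V (≡.sym (ℕP.+-identityʳ i))))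
        (κ.trans (coeff-cong (R.sym x≈) (+ i)) (w (+ i) (ℤ.+<+ i<)))) m m<)
      order t w -[1+ m ] m< = κ.refl

    1/[1-T] : ∃ λ w → Order (+ 0) w × w R.* (R.1# R.- (0 , PS.T)) R.≈ R.1#
    1/[1-T] = (0 , geometric) , (λ { -[1+ m ] _ → κ.refl ; (+ m) (ℤ.+<+ ()) }) , R.trans (R.*-comm (0 , geometric) (R.1# R.- (0 , PS.T))) (L.cross (P.trans e₁ e₂))
      where
      geometric : C
      geometric _ = κ.1#
      e₁ : P.1# P.* ((P.1# P.* P.1# P.+ P.1# P.* (P.- PS.T)) P.* geometric) P.≈ P.1# P.* (geometric P.- PS.T P.* geometric)
      e₁ = P.solve 2 (λ t g → P.con (+ 1) P.:* ((P.con (+ 1) P.:* P.con (+ 1) P.:+ P.con (+ 1) P.:* (P.:- t)) P.:* g) P.:= P.con (+ 1) P.:* (g P.:- t P.:* g)) P.refl PS.T geometric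
      e₂ : P.1# P.* (geometric P.- PS.T P.* geometric) P.≈ P.1# P.* P.1#
      e₂ = P.*-congˡ (pw λ
        { zero → κ.trans (κ.+-congˡ (κ.trans (κ.-‿cong (PS.T*-zero geometric)) κ.-0#≈0#)) (κ.+-identityʳ _)
        ; (suc i) → κ.trans (κ.+-congˡ (κ.-‿cong (PS.T*-suc geometric i))) (κ.-‿inverseʳ _) })

  laurentRing : LaurentRing κ p
  laurentRing = record
    { ring = L.ring ; const = const ; coeff = coeff ; coeff-cong = coeff-cong ; coeff-ext = coeff-ext
    ; coeff-+ = λ { (n , f) (k , g) m → κ.trans (at′-+ (PS.T P.^ k P.* f) (PS.T P.^ n P.* g) (m ℤ.+ + (n ℕ.+ k))) (κ.+-cong (scaled n k f m) (scaled′ k n g m)) }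
    ; coeff-const* = λ { a (n , f) m → const-at a f (m ℤ.+ + n) }
    ; T = 0 , PS.T ; T⁻¹ = 1 , P.1#
    ; T*T⁻¹ = L.cross (P.solve 1 (λ t → P.con (+ 1) P.:* (t P.:* P.con (+ 1)) P.:= t P.:* P.con (+ 1) P.:* P.con (+ 1)) P.refl PS.T)
    ; coeff-T = λ { (n , f) m → κ.trans (reindex (PS.T P.* f) (ℤP.+-assoc (+ 1) m (+ n))) (at′-T f (m ℤ.+ + n)) }
    ; coeff-1 = κ.refl
    ; coeff-1′ = λ { (+ zero) m≢0 → ⊥-elim (m≢0 ≡.refl) ; (+ suc m) _ → κ.refl ; -[1+ m ] _ → κ.refl }
    ; bounded = λ { (n , f) → ℤ.- + n , λ m m< → negative f (m ℤ.+ + n) (≡.subst (m ℤ.+ + n ℤ.<_) (ℤP.+-inverseˡ (+ n)) (ℤP.+-monoˡ-< (+ n) m<)) }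
    ; Order-* = Order-* ; Degree-* = Degree-* ; truncate = truncate ; root = root ; 1/[1-T] = 1/[1-T] }
    where
    const-at : ∀ a f i → at′ (Hom.⟦_⟧ PS.const a P.* f) i κ.≈ a κ.* at′ f i
    const-at a f (+ i) = PS.const-* a f i
    const-at a f -[1+ i ] = κ.sym (κ.zeroʳ a)
    negative : ∀ f i → i ℤ.< + 0 → at′ f i κ.≈ κ.0#
    negative f -[1+ i ] _ = κ.refl
    negative f (+ i) (ℤ.+<+ ())

-- The recursion of the tower, and filtrations by order.

-- The recursion τ(x_{i+1}) = U_{i+1} of the Garcia–Stichtenoth tower, τ(x) = x^q + x, q = p + 2,
-- with D = 1/U kept along so that every formula is polynomial.
module Recursion {c ℓ} (B : CommutativeRing c ℓ) (p : ℕ) where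
  open RingKit B

  q : ℕ
  q = suc (suc p)

  τ : Carrier → Carrier
  τ x = x ^ q + x

  -- This is 1/x when τ(x) = 1/D, because τ(x) = x (x^(q-1) + 1).
  reciprocal : Carrier → Carrier → Carrier
  reciprocal x D = (x ^ suc p + 1#) * D

  -- With 1/D = τ(x) this is x^(q+1) / (x^q + x) = x^q / (x^(q-1) + 1), the right side of the next
  -- equation.
  nextU : Carrier → Carrier → Carrier
  nextU x D = x ^ suc q * D

  -- The inverse of that right side is x^(-1) + x^(-q) = τ(1/x).
  nextD : Carrier → Carrier → Carrier
  nextD x D = τ (reciprocal x D)

  τ-cong : ∀ {x y} → x ≈ y → τ x ≈ τ y
  τ-cong e = +-cong (^-congˡ q e) e

  reciprocal-cong : ∀ {x y D E} → x ≈ y → D ≈ E → reciprocal x D ≈ reciprocal y E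
  reciprocal-cong e e′ = *-cong (+-congʳ (^-congˡ (suc p) e)) e′

  nextU-cong : ∀ {x y D E} → x ≈ y → D ≈ E → nextU x D ≈ nextU y E
  nextU-cong e e′ = *-cong (^-congˡ (suc q) e) e′

  nextD-cong : ∀ {x y D E} → x ≈ y → D ≈ E → nextD x D ≈ nextD y E
  nextD-cong e e′ = τ-cong (reciprocal-cong e e′)

  module _ {x U D : Carrier} (τx : τ x ≈ U) (UD : U * D ≈ 1#) where

    x*reciprocal : x * reciprocal x D ≈ 1#
    x*reciprocal = trans (solve 3 (λ x y D → x :* ((y :+ con (+ 1)) :* D) := (x :* y :+ x) :* D) refl x (x ^ suc p) D) (trans (*-congʳ τx) UD)

    nextU*nextD : nextU x D * nextD x D ≈ 1#
    nextU*nextD = begin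
      x * (x ^ q) * D * (ζ ^ q + ζ)                     ≈⟨ solve 5 (λ x y D z w → x :* y :* D :* (z :+ w) := (x :* (y :* z) :+ y :* (x :* w)) :* D) refl x (x ^ q) D (ζ ^ q) ζ ⟩
      (x * (x ^ q * ζ ^ q) + x ^ q * (x * ζ)) * D       ≈⟨ *-congʳ (+-cong (*-congˡ (trans (sym (^-distrib-* x ζ q)) (trans (^-congˡ q x*reciprocal) (1^ q)))) (*-congˡ x*reciprocal)) ⟩
      (x * 1# + x ^ q * 1#) * D                         ≈⟨ solve 3 (λ x y D → (x :* con (+ 1) :+ y :* con (+ 1)) :* D := (y :+ x) :* D) refl x (x ^ q) D ⟩
      (x ^ q + x) * D                                   ≈⟨ *-congʳ τx ⟩
      U * D                                             ≈⟨ UD ⟩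
      1#                                                ∎
      where ζ = reciprocal x D

    -- Substitutes x^q = U - x. The new right side differs from x by x² D only, which is harmless
    -- where U has a large pole.
    nextU-expand : nextU x D ≈ x - x * x * D
    nextU-expand = begin
      x * x ^ q * D                    ≈⟨ *-congʳ (*-congˡ (x-y≈0⇒x≈y (trans (solve 3 (λ y x u → y :- (u :- x) := y :+ x :- u) refl (x ^ q) x U) (x≈y⇒x-y≈0 τx)))) ⟩
      x * (U - x) * D                  ≈⟨ solve 3 (λ x U D → x :* (U :- x) :* D := x :* (U :* D) :- x :* x :* D) refl x U D ⟩
      x * (U * D) - x * x * D          ≈⟨ +-congʳ (trans (*-congˡ UD) (*-identityʳ x)) ⟩
      x - x * x * D                    ∎

module RecursionHom {c ℓ c′ ℓ′} {B : CommutativeRing c ℓ} {C : CommutativeRing c′ ℓ′} (h : Hom B C) (p : ℕ) where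
  private
    module B = Recursion B p
    module C = Recursion C p
    module K = RingKit C
  open Hom h
  open HomProperties h

  τ-homo : ∀ x → ⟦ B.τ x ⟧ K.≈ C.τ ⟦ x ⟧
  τ-homo x = K.trans (+-homo _ _) (K.+-congʳ (^-homo x B.q))

  reciprocal-homo : ∀ x D → ⟦ B.reciprocal x D ⟧ K.≈ C.reciprocal ⟦ x ⟧ ⟦ D ⟧
  reciprocal-homo x D = K.trans (*-homo _ _) (K.*-congʳ (K.trans (+-homo _ _) (K.+-cong (^-homo x (suc p)) 1-homo)))

  nextU-homo : ∀ x D → ⟦ B.nextU x D ⟧ K.≈ C.nextU ⟦ x ⟧ ⟦ D ⟧
  nextU-homo x D = K.trans (*-homo _ _) (K.*-congʳ (^-homo x (suc B.q)))

  nextD-homo : ∀ x D → ⟦ B.nextD x D ⟧ K.≈ C.nextD ⟦ x ⟧ ⟦ D ⟧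
  nextD-homo x D = K.trans (τ-homo _) (C.τ-cong (reciprocal-homo x D))

-- `G s x` reads: the order of x is at least s. Recording only lower bounds avoids valuations, so
-- the ring may have zero divisors and elements without any order.
record Filtration {c ℓ} (B : CommutativeRing c ℓ) : Set (lsuc ℓ ⊔ c) where
  open RingKit B
  field
    G : ℤ → Carrier → Set ℓ
    resp : ∀ {s x y} → x ≈ y → G s x → G s y
    G-0 : ∀ {s} → G s 0#
    G-1 : G (+ 0) 1#
    G-+ : ∀ {s x y} → G s x → G s y → G s (x + y)
    G-neg : ∀ {s x} → G s x → G s (- x)
    mono : ∀ {s t x} → s ℤ.≤ t → G t x → G s x
    G-* : ∀ {s t x y} → G s x → G t y → G (s ℤ.+ t) (x * y)

  cast : ∀ {s t x} → s ≡ t → G s x → G t x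
  cast ≡.refl g = g

  G-^ : ∀ {s x} → G s x → ∀ n → G (+ n ℤ.* s) (x ^ n)
  G-^ {s} g zero = cast (≡.sym (ℤP.*-zeroˡ s)) G-1
  G-^ {s} g (suc n) = cast (≡.trans (lemma s (+ n)) (≡.cong (ℤ._* s) (≡.sym (ℤP.pos-+ 1 n)))) (G-* g (G-^ g n))
    where
    lemma : ∀ s n → s ℤ.+ n ℤ.* s ≡ (+ 1 ℤ.+ n) ℤ.* s
    lemma = solve-∀

  G-∑ : ∀ {s} n {f : Fin n → Carrier} → (∀ i → G s (f i)) → G s (∑ B n f)
  G-∑ zero g = G-0
  G-∑ (suc n) g = G-+ (g zero) (G-∑ n (g ∘ suc))

  G-∏ : ∀ n {f : Fin n → Carrier} → (∀ i → G (+ 0) (f i)) → G (+ 0) (∏ B n f)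
  G-∏ zero g = G-1
  G-∏ (suc n) g = G-* (g zero) (G-∏ n (g ∘ suc))

  -- n (a + 1) bounds the total pole order of a polynomial of degree < n at an element of pole order a.
  G-horner : ∀ {s w x} n (f : Fin n → Carrier) → G (ℤ.- + w) x → (∀ i → G s (f i)) → G (s ℤ.- + (n ℕ.* w)) (horner n f x)
  G-horner zero f gx gf = G-0
  G-horner {s} {w} (suc n) f gx gf = G-+
    (mono (ℤP.≤-trans (ℤP.+-monoʳ-≤ s (ℤP.neg-mono-≤ (ℤ.+≤+ (z≤n {suc n ℕ.* w})))) (ℤP.≤-reflexive (ℤP.+-identityʳ s))) (gf zero))
    (cast (≡.trans (lemma s (+ w) (+ (n ℕ.* w))) (≡.cong (λ j → s ℤ.- j) (≡.sym (ℤP.pos-+ w (n ℕ.* w))))) (G-* gx (G-horner n (f ∘ suc) gx (gf ∘ suc))))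
    where
    lemma : ∀ s w m → ℤ.- w ℤ.+ (s ℤ.- m) ≡ s ℤ.- (w ℤ.+ m)
    lemma = solve-∀

  module _ (p : ℕ) where
    open Recursion B p

    -- Lower bounds of orders cannot be inverted, so 1/x is estimated through its polynomial
    -- formula: -(q-1) e + q e = e. A bound on the pole of x thus yields a zero of 1/x.
    G-reciprocal : ∀ {x D} e → G (ℤ.- + e) x → G (+ (q ℕ.* e)) D → G (+ e) (reciprocal x D)
    G-reciprocal {x} {D} e gx gD = cast eq (G-* (G-+ (cast eq₁ (G-^ gx (suc p))) (mono neg G-1)) gD)
      where
      eq₁ : + suc p ℤ.* (ℤ.- + e) ≡ ℤ.- + (suc p ℕ.* e)
      eq₁ = ≡.trans (≡.sym (ℤP.neg-distribʳ-* (+ suc p) (+ e))) (≡.cong ℤ.-_ (≡.sym (ℤP.pos-* (suc p) e)))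
      neg : ℤ.- + (suc p ℕ.* e) ℤ.≤ + 0
      neg = ℤP.neg-mono-≤ (ℤ.+≤+ (z≤n {suc p ℕ.* e}))
      lemma : ∀ a e → ℤ.- a ℤ.+ (e ℤ.+ a) ≡ e
      lemma = solve-∀
      eq : ℤ.- + (suc p ℕ.* e) ℤ.+ + (q ℕ.* e) ≡ + e
      eq = ≡.trans (≡.cong (λ j → ℤ.- + (suc p ℕ.* e) ℤ.+ j) (ℤP.pos-+ e (suc p ℕ.* e))) (lemma (+ (suc p ℕ.* e)) (+ e))

    G-τ : ∀ {x} e → G (+ e) x → G (+ e) (τ x)
    G-τ {x} e g = G-+ (mono (≡.subst (+ e ℤ.≤_) (ℤP.pos-* q e) (ℤ.+≤+ (ℕP.m≤m+n e _))) (G-^ g q)) g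

    G-nextD : ∀ {x D} e → G (ℤ.- + e) x → G (+ (q ℕ.* e)) D → G (+ e) (nextD x D)
    G-nextD e gx gD = G-τ e (G-reciprocal e gx gD)

    G-nextU : ∀ {x D} e → G (ℤ.- + e) x → G (+ (q ℕ.* e)) D → G (ℤ.- + e) (nextU x D)
    G-nextU {x} {D} e gx gD = cast eq (G-* (G-^ gx (suc q)) gD)
      where
      lemma : ∀ a e → (+ 1 ℤ.+ a) ℤ.* (ℤ.- e) ℤ.+ a ℤ.* e ≡ ℤ.- e
      lemma = solve-∀
      eq : + suc q ℤ.* (ℤ.- + e) ℤ.+ + (q ℕ.* e) ≡ ℤ.- + e
      eq = ≡.trans (≡.cong₂ (λ i j → i ℤ.* (ℤ.- + e) ℤ.+ j) (ℤP.pos-+ 1 q) (ℤP.pos-* q e)) (lemma (+ q) (+ e))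

-- The extension of a filtration to B[z]/(z^q = α - z) that gives z the order -e.
module ExtensionFiltration {c ℓ} {B : CommutativeRing c ℓ} (F : Filtration B) (p : ℕ) (α : CommutativeRing.Carrier B) (e : ℕ)
  (α-order : Filtration.G F (ℤ.- + (suc (suc p) ℕ.* e)) α) where
  private
    module B = RingKit B
    module F = Filtration F
    module E = Extension B p α (B.- B.1#)
    module K = RingKit E.ring
    q : ℕ
    q = suc (suc p)

  G : ℤ → K.Carrier → Set ℓ
  G s f = ∀ a → F.G (s ℤ.+ + (toℕ a ℕ.* e)) (f a)

  private
    Z-order : ∀ {s f} → G s f → G (s ℤ.- + e) (E.Z f)
    -- The coefficient that wraps around has order at least s + (q-1) e, and α costs q e; together s
    -- - e remains.
    Z-order {s} {f} g zero = F.cast eq (F.G-* α-order (g (fromℕ (suc p))))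
      where
      lemma : ∀ s e r → ℤ.- (e ℤ.+ r) ℤ.+ (s ℤ.+ r) ≡ s ℤ.- e ℤ.+ + 0
      lemma = solve-∀
      eq : ℤ.- + (q ℕ.* e) ℤ.+ (s ℤ.+ + (toℕ (fromℕ (suc p)) ℕ.* e)) ≡ s ℤ.- + e ℤ.+ + 0
      eq rewrite FinP.toℕ-fromℕ p = ≡.trans (≡.cong (λ j → ℤ.- j ℤ.+ (s ℤ.+ + (suc p ℕ.* e))) (ℤP.pos-+ e (suc p ℕ.* e))) (lemma s (+ e) (+ (suc p ℕ.* e)))
    Z-order {s} {f} g (suc zero) = F.cast eq (F.G-+ (F.cast (ℤP.+-identityʳ s) (g zero))
      (F.resp (B.trans (B.-‿cong (B.sym (B.*-identityˡ _))) (B.-‿distribˡ-* B.1# _))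
        (F.G-neg (F.mono (ℤP.≤-trans (ℤP.≤-reflexive (≡.sym (ℤP.+-identityʳ s))) (ℤP.+-monoʳ-≤ s (ℤ.+≤+ z≤n))) (g (fromℕ (suc p)))))))
      where
      lemma : ∀ s e → s ≡ s ℤ.- e ℤ.+ (e ℤ.+ + 0)
      lemma = solve-∀
      eq : s ≡ s ℤ.- + e ℤ.+ + (1 ℕ.* e)
      eq = ≡.trans (lemma s (+ e)) (≡.cong (λ j → s ℤ.- + e ℤ.+ j) (≡.sym (ℤP.pos-+ e 0)))
    Z-order {s} {f} g (suc (suc i)) = F.cast eq (g (inject₁ (suc i)))
      where
      lemma : ∀ s e r → s ℤ.+ r ≡ s ℤ.- e ℤ.+ (e ℤ.+ r)
      lemma = solve-∀
      eq : s ℤ.+ + (toℕ (inject₁ (suc i)) ℕ.* e) ≡ s ℤ.- + e ℤ.+ + (suc (suc (toℕ i)) ℕ.* e)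
      eq rewrite FinP.toℕ-inject₁ i = ≡.trans (lemma s (+ e) (+ (suc (toℕ i) ℕ.* e)))
        (≡.cong (λ j → s ℤ.- + e ℤ.+ j) (≡.sym (ℤP.pos-+ e (suc (toℕ i) ℕ.* e))))

    act-order : ∀ k {s t v w} → (∀ i → F.G (s ℤ.+ + (toℕ i ℕ.* e)) (v i)) → G t w → G (s ℤ.+ t) (E.act k v w)
    act-order zero gv gw a = F.G-0
    act-order (suc k) {s} {t} gv gw a = F.G-+ (F.cast (lemma₁ s t (+ (toℕ a ℕ.* e))) (F.G-* (gv zero) (gw a)))
      (F.cast (lemma₂ s t (+ e) (+ (toℕ a ℕ.* e)))
        (Z-order {(s ℤ.+ + e) ℤ.+ t} (act-order k {s ℤ.+ + e} {t} (λ i → F.cast (≡.trans (≡.cong (λ j → s ℤ.+ j) (ℤP.pos-+ e (toℕ i ℕ.* e))) (≡.sym (ℤP.+-assoc s (+ e) (+ (toℕ i ℕ.* e))))) (gv (suc i))) gw) a))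
      where
      lemma₁ : ∀ s t r → s ℤ.+ + 0 ℤ.+ (t ℤ.+ r) ≡ s ℤ.+ t ℤ.+ r
      lemma₁ = solve-∀
      lemma₂ : ∀ s t e r → s ℤ.+ e ℤ.+ t ℤ.- e ℤ.+ r ≡ s ℤ.+ t ℤ.+ r
      lemma₂ = solve-∀

    G-1 : G (+ 0) K.1#
    G-1 zero = F.G-1
    G-1 (suc i) = F.G-0

  filtration : Filtration E.ring
  filtration = record
    { G = G
    ; resp = λ x≈y g a → F.resp (at x≈y a) (g a)
    ; G-0 = λ a → F.G-0
    ; G-1 = G-1
    ; G-+ = λ g h a → F.G-+ (g a) (h a)
    ; G-neg = λ g a → F.G-neg (g a)
    ; mono = λ s≤t g a → F.mono (ℤP.+-monoˡ-≤ _ s≤t) (g a)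
    ; G-* = λ {s} {t} {x} {y} g h a → F.resp (B.sym (at (E.*-act x y) a)) (act-order q {s} {t} g h a) }

  G-ι : ∀ {s b} → F.G s b → G s (Hom.⟦_⟧ E.ι b)
  G-ι {s} g zero = F.resp (B.sym (E.ι-zero _)) (F.cast (≡.sym (ℤP.+-identityʳ s)) g)
  G-ι g (suc i) = F.resp (B.sym (E.ι-suc _ i)) F.G-0

  G-z : G (ℤ.- + e) E.z
  G-z a = F.cast (≡.cong (ℤ._+ + (toℕ a ℕ.* e)) (ℤP.+-identityˡ (ℤ.- + e))) (Z-order {+ 0} G-1 a)

  G-coefficient : ∀ {s f} → G s f → ∀ a → F.G s (f a)
  G-coefficient {s} g a = F.mono (ℤP.≤-trans (ℤP.≤-reflexive (≡.sym (ℤP.+-identityʳ s))) (ℤP.+-monoʳ-≤ s (ℤ.+≤+ z≤n))) (g a)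

-- The orders at T = 0 and T = ∞ on Laurent series.

module LaurentProperties {c ℓ} {κ : CommutativeRing c ℓ} {p : ℕ} (L : LaurentRing κ p) where
  open LaurentRing L
  private
    module κ = RingKit κ
    module R = RingKit ring
    module C = Hom const

  coeff-0 : ∀ m → coeff R.0# m κ.≈ κ.0#
  coeff-0 m = κ.trans (coeff-cong (R.trans (R.sym (R.zeroˡ R.0#)) (R.*-congʳ (R.sym (HomProperties.0-homo const)))) m)
    (κ.trans (coeff-const* κ.0# R.0# m) (κ.zeroˡ _))

  coeff-neg : ∀ x m → coeff (R.- x) m κ.≈ κ.- coeff x m
  coeff-neg x m = κ.trans (κ.solve 2 (λ a b → b κ.:= a κ.:+ b κ.:- a) κ.refl (coeff x m) _)
    (κ.trans (κ.+-congʳ (κ.trans (κ.sym (coeff-+ x (R.- x) m)) (κ.trans (coeff-cong (R.-‿inverseʳ x) m) (coeff-0 m)))) (κ.+-identityˡ _))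

  coeff-minus : ∀ x y m → coeff (x R.- y) m κ.≈ coeff x m κ.- coeff y m
  coeff-minus x y m = κ.trans (coeff-+ _ _ m) (κ.+-congˡ (coeff-neg y m))

  coeff-const : ∀ a m → m ≢ + 0 → coeff C.⟦ a ⟧ m κ.≈ κ.0#
  coeff-const a m m≢0 = κ.trans (coeff-cong (R.sym (R.*-identityʳ _)) m) (κ.trans (coeff-const* a R.1# m) (κ.trans (κ.*-congˡ (coeff-1′ m m≢0)) (κ.zeroʳ a)))

  coeff-const-0 : ∀ a → coeff C.⟦ a ⟧ (+ 0) κ.≈ a
  coeff-const-0 a = κ.trans (coeff-cong (R.sym (R.*-identityʳ _)) (+ 0)) (κ.trans (coeff-const* a R.1# (+ 0)) (κ.trans (κ.*-congˡ coeff-1) (κ.*-identityʳ a)))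

  coeff-T′ : ∀ x m → coeff (T R.* x) m κ.≈ coeff x (ℤ.pred m)
  coeff-T′ x m = κ.trans (κ.≡⇒≈ (≡.cong (coeff (T R.* x)) (≡.sym (ℤP.suc-pred m)))) (coeff-T x (ℤ.pred m))

  coeff-T₁ : ∀ m → m ≢ + 1 → coeff T m κ.≈ κ.0#
  coeff-T₁ m m≢1 = κ.trans (coeff-cong (R.sym (R.*-identityʳ T)) m) (κ.trans (coeff-T′ R.1# m)
    (coeff-1′ _ λ e → m≢1 (≡.trans (≡.sym (ℤP.suc-pred m)) (≡.cong ℤ.suc e))))

  coeff-T⁻¹ : ∀ m → m ≢ ℤ.- + 1 → coeff T⁻¹ m κ.≈ κ.0#
  coeff-T⁻¹ m m≢-1 = κ.trans (κ.sym (coeff-T T⁻¹ m)) (κ.trans (coeff-cong T*T⁻¹ (ℤ.suc m))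
    (coeff-1′ _ λ e → m≢-1 (≡.trans (≡.sym (ℤP.pred-suc m)) (≡.cong ℤ.pred e))))

  -- Orders are counted in units of 1/Q, so that T has order Q at T = 0. The tower takes Q = q^k,
  -- which keeps the orders integral in spite of ramification.
  module Scaled (Q : ℕ) .{{_ : ℕ.NonZero Q}} where

    -- Orders of series are multiples of Q, so a bound s may be rounded up to one. The rounding
    -- comes from dividing -s by Q with remainder, and it reduces products to `Order-*` and
    -- `Degree-*`.
    ceiling : ∀ s → ∃ λ a → s ℤ.≤ a ℤ.* + Q × (∀ m → m ℤ.< a → m ℤ.* + Q ℤ.< s)
    ceiling s = ℤ.- d , ≡.subst (s ℤ.≤_) (≡.sym e) (ℤP.i≤i+j s (+ r)) , λ m m< →
      ℤP.≤-<-trans (ℤP.*-monoʳ-≤-nonNeg (+ Q) (ℤP.≤-trans (ℤP.≤-reflexive (≡.sym (ℤP.pred-suc m))) (ℤP.pred-mono (ℤP.i<j⇒suc[i]≤j m<))))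
        (≡.subst₂ ℤ._<_ (≡.sym (≡.trans (≡.trans (ℤP.*-distribʳ-+ (+ Q) (ℤ.- + 1) (ℤ.- d)) (≡.cong (λ j → ℤ.- + 1 ℤ.* + Q ℤ.+ j) e)) (lemma₁ s (+ r) (+ Q))))
          (lemma₂ s (+ Q)) (ℤP.+-monoʳ-< (s ℤ.- + Q) (ℤ.+<+ (n%ℕd<d (ℤ.- s) Q))))
      where
      d : ℤ
      d = (ℤ.- s) /ℕ Q
      r : ℕ
      r = (ℤ.- s) %ℕ Q
      lemma : ∀ s r x → ℤ.- s ≡ r ℤ.+ x → ℤ.- x ≡ s ℤ.+ r
      lemma s r x e = ≡.trans (lemma′ s r x) (≡.trans (≡.cong (λ j → s ℤ.+ r ℤ.+ (j ℤ.- (r ℤ.+ x))) e) (lemma″ s r x))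
        where
        lemma′ : ∀ s r x → ℤ.- x ≡ s ℤ.+ r ℤ.+ (ℤ.- s ℤ.- (r ℤ.+ x))
        lemma′ = solve-∀
        lemma″ : ∀ s r x → s ℤ.+ r ℤ.+ (r ℤ.+ x ℤ.- (r ℤ.+ x)) ≡ s ℤ.+ r
        lemma″ = solve-∀
      e : ℤ.- d ℤ.* + Q ≡ s ℤ.+ + r
      e = ≡.trans (≡.sym (ℤP.neg-distribˡ-* d (+ Q))) (lemma s (+ r) (d ℤ.* + Q) (a≡a%ℕn+[a/ℕn]*n (ℤ.- s) Q))
      lemma₁ : ∀ s r Q → ℤ.- + 1 ℤ.* Q ℤ.+ (s ℤ.+ r) ≡ s ℤ.- Q ℤ.+ r
      lemma₁ = solve-∀
      lemma₂ : ∀ s Q → s ℤ.- Q ℤ.+ Q ≡ s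
      lemma₂ = solve-∀

    private
      sum-ceiling : ∀ {s t a b m} → s ℤ.≤ a ℤ.* + Q → t ℤ.≤ b ℤ.* + Q → m ℤ.* + Q ℤ.< s ℤ.+ t → m ℤ.< a ℤ.+ b
      sum-ceiling {s} {t} {a} {b} {m} sa tb m< = ℤP.*-cancelʳ-<-nonNeg (+ Q) (ℤP.<-≤-trans m< (ℤP.≤-trans (ℤP.+-mono-≤ sa tb)
        (ℤP.≤-reflexive (≡.sym (ℤP.*-distribʳ-+ (+ Q) a b)))))

    zeroFiltration : Filtration ring
    zeroFiltration = record
      { G = λ s x → ∀ m → m ℤ.* + Q ℤ.< s → coeff x m κ.≈ κ.0#
      ; resp = λ e g m m< → κ.trans (κ.sym (coeff-cong e m)) (g m m<)
      ; G-0 = λ m _ → coeff-0 m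
      ; G-1 = λ m m< → coeff-1′ m λ { ≡.refl → ℤP.<-irrefl ≡.refl m< }
      ; G-+ = λ g h m m< → κ.trans (coeff-+ _ _ m) (κ.trans (κ.+-cong (g m m<) (h m m<)) (κ.+-identityˡ _))
      ; G-neg = λ g m m< → κ.trans (coeff-neg _ m) (κ.trans (κ.-‿cong (g m m<)) κ.-0#≈0#)
      ; mono = λ s≤t g m m< → g m (ℤP.<-≤-trans m< s≤t)
      ; G-* = λ {s} {t} g h → let (a , sa , fa) = ceiling s ; (b , tb , fb) = ceiling t in λ m m< →
          Order-* {a} {b} (λ i i< → g i (fa i i<)) (λ i i< → h i (fb i i<)) m (sum-ceiling {s} {t} {a} {b} sa tb m<) }

    -- The order at T = ∞ is minus the degree, hence the sign of m. A series with infinitely many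
    -- positive powers of T lies in no `G s`.
    degreeFiltration : Filtration ring
    degreeFiltration = record
      { G = λ s x → ∀ m → (ℤ.- m) ℤ.* + Q ℤ.< s → coeff x m κ.≈ κ.0#
      ; resp = λ e g m m< → κ.trans (κ.sym (coeff-cong e m)) (g m m<)
      ; G-0 = λ m _ → coeff-0 m
      ; G-1 = λ m m< → coeff-1′ m λ { ≡.refl → ℤP.<-irrefl ≡.refl m< }
      ; G-+ = λ g h m m< → κ.trans (coeff-+ _ _ m) (κ.trans (κ.+-cong (g m m<) (h m m<)) (κ.+-identityˡ _))
      ; G-neg = λ g m m< → κ.trans (coeff-neg _ m) (κ.trans (κ.-‿cong (g m m<)) κ.-0#≈0#)
      ; mono = λ s≤t g m m< → g m (ℤP.<-≤-trans m< s≤t)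
      ; G-* = λ {s} {t} g h → let (a , sa , fa) = ceiling s ; (b , tb , fb) = ceiling t in λ m m< →
          Degree-* {ℤ.- a} {ℤ.- b} (λ i i> → g i (fa (ℤ.- i) (flip a i i>))) (λ i i> → h i (fb (ℤ.- i) (flip b i i>))) m
            (≡.subst₂ ℤ._<_ (ℤP.neg-distrib-+ a b) (ℤP.neg-involutive m) (ℤP.neg-mono-< (sum-ceiling {s} {t} {a} {b} sa tb m<))) }
      where
      flip : ∀ a i → ℤ.- a ℤ.< i → ℤ.- i ℤ.< a
      flip a i a< = ≡.subst (ℤ.- i ℤ.<_) (ℤP.neg-involutive a) (ℤP.neg-mono-< a<)

    module V = Filtration zeroFiltration
    module W = Filtration degreeFiltration

    Order⇒V : ∀ {a x} → Order a x → V.G (a ℤ.* + Q) x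
    Order⇒V {a} g m m< = g m (ℤP.*-cancelʳ-<-nonNeg (+ Q) m<)

    V-root : ∀ {s x} → + 0 ℤ.< s → V.G s x → ∃ λ r → r R.^ suc (suc p) R.+ r R.≈ x × V.G s r
    V-root {s} {x} 0<s g = r , eq , V.mono sa (Order⇒V (ord a (λ m m< → g m (fa m m<))))
      where
      a : ℤ
      a = proj₁ (ceiling s)
      sa : s ℤ.≤ a ℤ.* + Q
      sa = proj₁ (proj₂ (ceiling s))
      fa : ∀ m → m ℤ.< a → m ℤ.* + Q ℤ.< s
      fa = proj₂ (proj₂ (ceiling s))
      solution : ∃ λ r → r R.^ suc (suc p) R.+ r R.≈ x × (∀ t → Order t x → Order t r)
      solution = root x λ m m<1 → g m (ℤP.≤-<-trans (ℤP.*-monoʳ-≤-nonNeg (+ Q) {m} {+ 0} (ℤP.≤-trans (ℤP.≤-reflexive (≡.sym (ℤP.pred-suc m))) (ℤP.pred-mono (ℤP.i<j⇒suc[i]≤j m<1)))) 0<s)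
      r : R.Carrier
      r = proj₁ solution
      eq : r R.^ suc (suc p) R.+ r R.≈ x
      eq = proj₁ (proj₂ solution)
      ord : ∀ t → Order t x → Order t r
      ord = proj₂ (proj₂ solution)

    V-const : ∀ a → V.G (+ 0) C.⟦ a ⟧
    V-const a m m< = coeff-const a m λ { ≡.refl → ℤP.<-irrefl ≡.refl m< }

    W-const : ∀ a → W.G (+ 0) C.⟦ a ⟧
    W-const a m m< = coeff-const a m λ { ≡.refl → ℤP.<-irrefl ≡.refl m< }

    V-T : V.G (+ Q) T
    V-T m m< = coeff-T₁ m λ { ≡.refl → ℤP.<-irrefl (ℤP.*-identityˡ (+ Q)) m< }

    V-T⁻¹ : V.G (ℤ.- + Q) T⁻¹
    V-T⁻¹ m m< = coeff-T⁻¹ m λ { ≡.refl → ℤP.<-irrefl (ℤP.-1*i≡-i (+ Q)) m< }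

    W-T : W.G (ℤ.- + Q) T
    W-T m m< = coeff-T₁ m λ { ≡.refl → ℤP.<-irrefl (ℤP.-1*i≡-i (+ Q)) m< }

    W-T⁻¹ : W.G (+ Q) T⁻¹
    W-T⁻¹ m m< = coeff-T⁻¹ m λ { ≡.refl → ℤP.<-irrefl (ℤP.*-identityˡ (+ Q)) m< }

-- What the tower uses of the field with q^2 elements (q = p + 2) and its trace x^q + x.
record TraceField {c ℓ} (κ : CommutativeRing c ℓ) (p : ℕ) : Set (c ⊔ ℓ) where
  open RingKit κ
  open Recursion κ p using (q; τ)
  field
    _≟_ : ∀ x y → Dec (x ≈ y)
    0≉1 : ¬ 0# ≈ 1#
    inverse : ∀ x → ¬ x ≈ 0# → ∃ λ y → x * y ≈ 1#
    binomials : BinomialsVanish q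
    frobenius² : ∀ x → (x ^ q) ^ q ≈ x
    ω : Fin q → Carrier
    ω-zero : ω zero ≈ 0#
    ω-root : ∀ a → τ (ω a) ≈ 0#
    ω-distinct : ∀ a b → a ≢ b → ¬ ω a ≈ ω b
    τ-surjective : ∀ c → c ^ q ≈ c → ∃ λ r → τ r ≈ c

  regular : ∀ x → ¬ x ≈ 0# → ∀ y → x * y ≈ 0# → y ≈ 0#
  regular x x≉0 y e with (x⁻¹ , xx⁻¹) ← inverse x x≉0 =
    trans (sym (*-identityˡ y)) (trans (*-congʳ (trans (sym xx⁻¹) (*-comm x x⁻¹))) (trans (*-assoc _ _ _) (trans (*-congˡ e) (zeroʳ _))))

module LiftProperties {c ℓ} (B : CommutativeRing c ℓ) (p : ℕ) (U : CommutativeRing.Carrier B) where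
  private
    module B = RingKit B
    module E = Extension B p U (B.- B.1#)
    module K = RingKit E.ring
  open Recursion E.ring p using (τ)

  τ-z : τ E.z K.≈ Hom.⟦_⟧ E.ι U
  τ-z = K.trans (K.+-congʳ (K.trans E.z^n (K.+-congˡ (K.*-congʳ (HomProperties.-‿homo E.ι B.1#)))))
    (K.trans (K.+-congʳ (K.+-congˡ (K.*-congʳ (K.-‿cong (Hom.1-homo E.ι)))))
      (K.solve 2 (λ u z → u K.:+ (K.:- K.con (+ 1)) K.:* z K.:+ z K.:= u) K.refl _ _))

  module _ {c′ ℓ′} {S : CommutativeRing c′ ℓ′} (h : Hom B S) (y : CommutativeRing.Carrier S) where
    private
      module S = RingKit S
      module T = Recursion S p

    lift-condition : T.τ y S.≈ Hom.⟦_⟧ h U → y S.^ T.q S.≈ Hom.⟦_⟧ h U S.+ Hom.⟦_⟧ h (B.- B.1#) S.* y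
    lift-condition e = S.trans (S.solve 2 (λ a y → a S.:= a S.:+ y S.:+ (S.:- S.con (+ 1)) S.:* y) S.refl (y S.^ T.q) y)
      (S.+-cong e (S.*-congʳ (S.sym (S.trans (HomProperties.-‿homo h B.1#) (S.-‿cong (Hom.1-homo h))))))

    liftτ : T.τ y S.≈ Hom.⟦_⟧ h U → Hom E.ring S
    liftτ e = E.Lift.lift h y (lift-condition e)

    liftτ-ι : ∀ e b → Hom.⟦_⟧ (liftτ e) (Hom.⟦_⟧ E.ι b) S.≈ Hom.⟦_⟧ h b
    liftτ-ι e = E.Lift.lift-ι h y (lift-condition e)

    liftτ-z : ∀ e → Hom.⟦_⟧ (liftτ e) E.z S.≈ y
    liftτ-z e = E.Lift.lift-z h y (lift-condition e)

-- Changes of polynomial bases, and Gaussian elimination.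

module Matrices {c ℓ} (R : CommutativeRing c ℓ) where
  open RingKit R

  horner-lin : ∀ n m (M : Fin m → Fin n → Carrier) (v : Fin m → Carrier) x →
    horner n (λ j → ∑ R m (λ a → M a j * v a)) x ≈ ∑ R m (λ a → horner n (M a) x * v a)
  horner-lin zero m M v x = sym (∑-0 m (λ a → zeroˡ _))
  horner-lin (suc n) m M v x = begin
    ∑ R m (λ a → M a zero * v a) + x * horner n (λ j → ∑ R m (λ a → M a (suc j) * v a)) x
      ≈⟨ +-congˡ (trans (*-congˡ (horner-lin n m (λ a j → M a (suc j)) v x)) (*-∑ m x _)) ⟩
    ∑ R m (λ a → M a zero * v a) + ∑ R m (λ a → x * (horner n (λ j → M a (suc j)) x * v a))
      ≈⟨ ∑-+ m _ _ ⟨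
    ∑ R m (λ a → M a zero * v a + x * (horner n (λ j → M a (suc j)) x * v a))
      ≈⟨ ∑-cong m (λ a → solve 4 (λ m v x h → m :* v :+ x :* (h :* v) := (m :+ x :* h) :* v) refl (M a zero) (v a) x _) ⟩
    ∑ R m (λ a → (M a zero + x * horner n (λ j → M a (suc j)) x) * v a) ∎

  ∑*-+ : ∀ m (M v w : Fin m → Carrier) → ∑ R m (λ a → M a * (v a + w a)) ≈ ∑ R m (λ a → M a * v a) + ∑ R m (λ a → M a * w a)
  ∑*-+ m M v w = trans (∑-cong m (λ a → distribˡ (M a) (v a) (w a))) (∑-+ m _ _)

  ∑*-* : ∀ m (M : Fin m → Carrier) x (v : Fin m → Carrier) → ∑ R m (λ a → M a * (x * v a)) ≈ x * ∑ R m (λ a → M a * v a)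
  ∑*-* m M x v = trans (∑-cong m (λ a → solve 3 (λ y x v → y :* (x :* v) := x :* (y :* v)) refl (M a) x (v a))) (sym (*-∑ m x _))

  ∑*-0 : ∀ m (M v : Fin m → Carrier) → (∀ a → v a ≈ 0#) → ∑ R m (λ a → M a * v a) ≈ 0#
  ∑*-0 m M v e = ∑-0 m (λ a → trans (*-congˡ (e a)) (zeroʳ (M a)))

  ∑*-cong : ∀ m (M : Fin m → Carrier) {v w : Fin m → Carrier} → (∀ a → v a ≈ w a) → ∑ R m (λ a → M a * v a) ≈ ∑ R m (λ a → M a * w a)
  ∑*-cong m M e = ∑-cong m (λ a → *-congˡ (e a))

  ∑-select : ∀ m (M v : Fin m → Carrier) b → (∀ a → a ≢ b → M a ≈ 0#) → M b ≈ 1# → ∑ R m (λ a → M a * v a) ≈ v b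
  ∑-select m M v b off on = trans (∑-single m (λ a → M a * v a) b (λ a a≢b → trans (*-congʳ (off a a≢b)) (zeroˡ _))) (trans (*-congʳ on) (*-identityˡ _))

  -- pascal c a j is the coefficient of X^j in (X - c)^a
  pascal : Carrier → ℕ → ℕ → Carrier
  pascal c zero zero = 1#
  pascal c zero (suc j) = 0#
  pascal c (suc a) zero = - (c * pascal c a zero)
  pascal c (suc a) (suc j) = pascal c a j - c * pascal c a (suc j)

  pascal-> : ∀ c a j → a ℕ.< j → pascal c a j ≈ 0#
  pascal-> c zero (suc j) _ = refl
  pascal-> c (suc a) (suc j) (s≤s a<j) = trans (+-cong (pascal-> c a j a<j) (-‿cong (trans (*-congˡ (pascal-> c a (suc j) (ℕP.m≤n⇒m≤1+n a<j))) (zeroʳ c))))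
    (trans (+-identityˡ _) -0#≈0#)

  pascal-diagonal : ∀ c a → pascal c a a ≈ 1#
  pascal-diagonal c zero = refl
  pascal-diagonal c (suc a) = trans (+-cong (pascal-diagonal c a) (trans (-‿cong (trans (*-congˡ (pascal-> c a (suc a) (ℕP.n<1+n a))) (zeroʳ c))) -0#≈0#)) (+-identityʳ 1#)

  private
    hornerℕ : ℕ → (ℕ → Carrier) → Carrier → Carrier
    hornerℕ n f = horner n (f ∘ toℕ)

  pascal-power : ∀ c n a x → a ℕ.< n → horner n (λ j → pascal c a (toℕ j)) x ≈ (x - c) ^ a
  pascal-power c (suc n) zero x _ = trans (+-congˡ (trans (*-congˡ (horner-0 n _ x (λ _ → refl))) (zeroʳ x))) (+-identityʳ 1#)
  pascal-power c (suc n) (suc a) x (s≤s a<n) = begin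
    - (c * P 0) + x * horner n (λ j → P (toℕ j) - c * P (suc (toℕ j))) x
      ≈⟨ +-congˡ (*-congˡ (trans (horner-+ n _ _ x) (+-congˡ (trans (horner-cong n (λ j → -‿distribˡ-* c _) refl) (horner-* n (- c) _ x))))) ⟩
    - (c * P 0) + x * (hornerℕ n P x + - c * hornerℕ n (P ∘ suc) x)
      ≈⟨ solve 5 (λ c p x h g → :- (c :* p) :+ x :* (h :+ (:- c) :* g) := x :* h :- c :* (p :+ x :* g)) refl c (P 0) x _ _ ⟩
    x * hornerℕ n P x - c * hornerℕ (suc n) P x
      ≈⟨ +-cong (*-congˡ (pascal-power c n a x a<n)) (-‿cong (*-congˡ (pascal-power c (suc n) a x (ℕP.m≤n⇒m≤1+n a<n)))) ⟩
    x * (x - c) ^ a - c * (x - c) ^ a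
      ≈⟨ solve 3 (λ x c y → x :* y :- c :* y := (x :- c) :* y) refl x c _ ⟩
    (x - c) * (x - c) ^ a ∎
    where P = pascal c a

  ∑-pascal : ∀ c n (j : Fin n) (v : Fin n → Carrier) → (∀ a → toℕ j ℕ.< toℕ a → v a ≈ 0#) →
    ∑ R n (λ a → pascal c (toℕ a) (toℕ j) * v a) ≈ v j
  ∑-pascal c n j v e = trans (∑-single n _ j other) (trans (*-congʳ (pascal-diagonal c (toℕ j))) (*-identityˡ _))
    where
    other : ∀ a → a ≢ j → pascal c (toℕ a) (toℕ j) * v a ≈ 0#
    other a a≢j with toℕ a ℕ.<? toℕ j
    ... | yes a<j = trans (*-congʳ (pascal-> c (toℕ a) (toℕ j) a<j)) (zeroˡ _)
    ... | no a≮j = trans (*-congˡ (e a (ℕP.≤∧≢⇒< (ℕP.≮⇒≥ a≮j) (λ j≡a → a≢j (FinP.toℕ-injective (≡.sym j≡a)))))) (zeroʳ _)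

  -- coefficients of 1 + (X - r)^(q-1) = 1 + Σ_j r^(q-1-j) X^j in characteristic p, n + 1 = q
  indicator : ∀ n → Carrier → Fin (suc n) → Carrier
  indicator n r zero = r ^ n + 1#
  indicator (suc n) r (suc j) = r ^ (n ℕ.∸ toℕ j)

  private
    -- The coefficients of (X^(n+1) - r^(n+1)) / (X - r). At X = r the value is (n+1) r^n, which
    -- vanishes for n + 1 = q.
    homogeneous : ∀ n → Carrier → Fin (suc n) → Carrier
    homogeneous n r j = r ^ (n ℕ.∸ toℕ j)

    homogeneous-telescopes : ∀ n r x → (x - r) * horner (suc n) (homogeneous n r) x ≈ x ^ suc n - r ^ suc n
    homogeneous-telescopes zero r x = solve 2 (λ x r → (x :- r) :* (con (+ 1) :+ x :* con (+ 0)) := x :* con (+ 1) :- r :* con (+ 1)) refl x r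
    homogeneous-telescopes (suc n) r x = begin
      (x - r) * (r ^ suc n + x * H)            ≈⟨ solve 4 (λ x r a h → (x :- r) :* (a :+ x :* h) := (x :- r) :* a :+ x :* ((x :- r) :* h)) refl x r (r ^ suc n) H ⟩
      (x - r) * r ^ suc n + x * ((x - r) * H)  ≈⟨ +-congˡ (*-congˡ (homogeneous-telescopes n r x)) ⟩
      (x - r) * r ^ suc n + x * (x ^ suc n - r ^ suc n) ≈⟨ solve 4 (λ x r a b → (x :- r) :* a :+ x :* (b :- a) := x :* b :- r :* a) refl x r (r ^ suc n) (x ^ suc n) ⟩
      x * x ^ suc n - r * r ^ suc n            ∎
      where H = horner (suc n) (homogeneous n r) x

    homogeneous-diagonal : ∀ n r → horner (suc n) (homogeneous n r) r ≈ (suc n) ·ℕ (r ^ n)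
    homogeneous-diagonal zero r = solve 1 (λ r → con (+ 1) :+ r :* con (+ 0) := con (+ 1) :+ con (+ 0)) refl r
    homogeneous-diagonal (suc n) r = +-congˡ (trans (*-congˡ (homogeneous-diagonal n r)) (×-comm-* (suc n) r (r ^ n)))

    indicator-split : ∀ n r x → horner (suc (suc n)) (indicator (suc n) r) x ≈ 1# + horner (suc (suc n)) (homogeneous (suc n) r) x
    indicator-split n r x = solve 2 (λ a b → a :+ con (+ 1) :+ b := con (+ 1) :+ (a :+ b)) refl _ _

  module _ (n : ℕ) (binomials : BinomialsVanish (suc (suc n))) where

    indicator-diagonal : ∀ r → horner (suc (suc n)) (indicator (suc n) r) r ≈ 1#
    indicator-diagonal r = trans (indicator-split n r r) (trans (+-congˡ (trans (homogeneous-diagonal (suc n) r) q·x≈0)) (+-identityʳ 1#))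
      where
      q·x≈0 : suc (suc n) ·ℕ (r ^ suc n) ≈ 0#
      q·x≈0 = begin
        suc (suc n) ·ℕ (r ^ suc n)           ≈⟨ scale (suc (suc n)) ⟨
        (suc (suc n) ·ℕ 1#) * r ^ suc n      ≈⟨ *-congʳ (trans (≡⇒≈ (≡.cong (_·ℕ 1#) (≡.sym (nC1≡n (suc (suc n)))))) (binomials 1 (s≤s z≤n) (s≤s (s≤s z≤n)))) ⟩
        0# * r ^ suc n                       ≈⟨ zeroˡ _ ⟩
        0#                                   ∎
        where
        scale : ∀ m → (m ·ℕ 1#) * r ^ suc n ≈ m ·ℕ (r ^ suc n)
        scale zero = zeroˡ _
        scale (suc m) = trans (distribʳ _ _ _) (+-cong (*-identityˡ _) (scale m))

    -- The product telescopes to x - r + x^q - r^q, the difference of the values of x^q + x at x and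
    -- r.
    indicator-vanishes : ∀ r x → x ^ suc (suc n) + x ≈ r ^ suc (suc n) + r →
      (x - r) * horner (suc (suc n)) (indicator (suc n) r) x ≈ 0#
    indicator-vanishes r x e = begin
      (x - r) * horner (suc (suc n)) (indicator (suc n) r) x   ≈⟨ *-congˡ (indicator-split n r x) ⟩
      (x - r) * (1# + H)                                       ≈⟨ solve 3 (λ x r h → (x :- r) :* (con (+ 1) :+ h) := x :- r :+ (x :- r) :* h) refl x r H ⟩
      x - r + (x - r) * H                                      ≈⟨ +-congˡ (homogeneous-telescopes (suc n) r x) ⟩
      x - r + (x ^ suc (suc n) - r ^ suc (suc n))              ≈⟨ solve 4 (λ x r a b → x :- r :+ (a :- b) := a :+ x :- (b :+ r)) refl x r _ _ ⟩
      x ^ suc (suc n) + x - (r ^ suc (suc n) + r)              ≈⟨ x≈y⇒x-y≈0 e ⟩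
      0#                                                       ∎
      where H = horner (suc (suc n)) (homogeneous (suc n) r) x

module LinearAlgebra {c ℓ} (κ : CommutativeRing c ℓ)
  (_≟_ : ∀ x y → Dec (CommutativeRing._≈_ κ x y))
  (inverse : ∀ x → ¬ CommutativeRing._≈_ κ x (CommutativeRing.0# κ) → ∃ λ y → CommutativeRing._≈_ κ (CommutativeRing._*_ κ x y) (CommutativeRing.1# κ)) where
  open RingKit κ

  Vector : ℕ → Set c
  Vector n = Fin n → Carrier

  infixr 5 _∷ᵛ_
  _∷ᵛ_ : ∀ {n} → Carrier → Vector n → Vector (suc n)
  (x ∷ᵛ v) zero = x
  (x ∷ᵛ v) (suc i) = v i

  record Functional (n : ℕ) : Set (c ⊔ ℓ) where
    field
      fun : Vector n → Carrier
      fun-cong : ∀ {v w} → (∀ i → v i ≈ w i) → fun v ≈ fun w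
      fun-+ : ∀ v w → fun (λ i → v i + w i) ≈ fun v + fun w
      fun-* : ∀ x v → fun (λ i → x * v i) ≈ x * fun v

    fun-0 : fun (λ _ → 0#) ≈ 0#
    fun-0 = trans (fun-cong {w = λ i → 0# * 0#} (λ i → sym (zeroˡ 0#))) (trans (fun-* 0# (λ _ → 0#)) (zeroˡ _))

    fun-∑ : ∀ m (x : Fin m → Carrier) (v : Fin m → Vector n) → fun (λ i → ∑ κ m (λ j → x j * v j i)) ≈ ∑ κ m (λ j → x j * fun (v j))
    fun-∑ zero x v = fun-0
    fun-∑ (suc m) x v = trans (fun-+ _ _) (+-cong (fun-* _ _) (fun-∑ m (x ∘ suc) (v ∘ suc)))

  open Functional public

  record Linear (m n : ℕ) : Set (c ⊔ ℓ) where
    field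
      map : Vector m → Vector n
      map-cong : ∀ {v w} → (∀ i → v i ≈ w i) → ∀ i → map v i ≈ map w i
      map-+ : ∀ v w i → map (λ j → v j + w j) i ≈ map v i + map w i
      map-* : ∀ x v i → map (λ j → x * v j) i ≈ x * map v i

  open Linear public

  Injective : ∀ {m n} → Linear m n → Set (c ⊔ ℓ)
  Injective {m} {n} K = ∀ v → (∀ i → map K v i ≈ 0#) → ∀ i → v i ≈ 0#

  infixr 9 _∘ˡ_ _∘ᶠ_
  _∘ˡ_ : ∀ {l m n} → Linear m n → Linear l m → Linear l n
  g ∘ˡ f = record { map = map g ∘ map f ; map-cong = map-cong g ∘ map-cong f
    ; map-+ = λ v w i → trans (map-cong g (map-+ f v w) i) (map-+ g _ _ i)
    ; map-* = λ x v i → trans (map-cong g (map-* f x v) i) (map-* g _ _ i) }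

  _∘ᶠ_ : ∀ {m n} → Functional n → Linear m n → Functional m
  g ∘ᶠ f = record { fun = fun g ∘ map f ; fun-cong = fun-cong g ∘ map-cong f
    ; fun-+ = λ v w → trans (fun-cong g (map-+ f v w)) (fun-+ g _ _)
    ; fun-* = λ x v → trans (fun-cong g (map-* f x v)) (fun-* g _ _) }

  private
    tailFunctional : ∀ {n} → Functional (suc n) → Functional n
    tailFunctional f = record { fun = λ v → fun f (0# ∷ᵛ v)
      ; fun-cong = λ e → fun-cong f λ { zero → refl ; (suc i) → e i }
      ; fun-+ = λ v w → trans (fun-cong f λ { zero → sym (+-identityˡ 0#) ; (suc i) → refl }) (fun-+ f _ _)
      ; fun-* = λ x v → trans (fun-cong f λ { zero → sym (zeroʳ x) ; (suc i) → refl }) (fun-* f _ _) }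

    e₀ : ∀ {n} → Vector (suc n)
    e₀ = 1# ∷ᵛ λ _ → 0#

    split-head : ∀ {n} (f : Functional (suc n)) v → fun f v ≈ v zero * fun f e₀ + fun (tailFunctional f) (v ∘ suc)
    split-head f v = trans (fun-cong f λ { zero → sym (trans (+-congʳ (*-identityʳ _)) (+-identityʳ _)) ; (suc i) → sym (trans (+-congʳ (zeroʳ _)) (+-identityˡ _)) })
      (trans (fun-+ f (λ i → v zero * e₀ i) (0# ∷ᵛ (v ∘ suc))) (+-congʳ (fun-* f (v zero) e₀)))

  -- Gaussian elimination for one functional: a vector of value 1, and the kernel parametrised by
  -- one coordinate less.
  record Pivot {n : ℕ} (f : Functional n) : Set (c ⊔ ℓ) where
    field
      {n₀} : ℕ
      n≡ : n ≡ suc n₀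
      w : Vector n
      fw : fun f w ≈ 1#
      K : Linear n₀ n
      injective : Injective K
      kernel : ∀ v → fun f (map K v) ≈ 0#

  pivot? : ∀ {n} (f : Functional n) → (∀ v → fun f v ≈ 0#) ⊎ Pivot f
  pivot? {zero} f = inj₁ λ v → trans (fun-cong f {w = λ _ → 0#} (λ ())) (fun-0 f)
  pivot? {suc n} f with fun f e₀ ≟ 0#
  ... | no fe≉0 = inj₂ record
    { n≡ = ≡.refl ; w = λ i → y * e₀ i
    ; fw = trans (fun-* f y e₀) (trans (*-comm _ _) fe*y)
    ; K = record { map = λ v → - (fun g v * y) ∷ᵛ v
      ; map-cong = λ e → λ { zero → -‿cong (*-congʳ (fun-cong g e)) ; (suc i) → e i }
      ; map-+ = λ v w → λ { zero → trans (-‿cong (*-congʳ (fun-+ g v w))) (solve 3 (λ a b y → :- ((a :+ b) :* y) := :- (a :* y) :+ :- (b :* y)) refl _ _ _) ; (suc i) → refl }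
      ; map-* = λ x v → λ { zero → trans (-‿cong (*-congʳ (fun-* g x v))) (solve 3 (λ x a y → :- (x :* a :* y) := x :* :- (a :* y)) refl _ _ _) ; (suc i) → refl } }
    ; injective = λ v e i → e (suc i)
    ; kernel = λ v → trans (split-head f _) (trans (+-congʳ (solve 3 (λ a y b → (:- (a :* y)) :* b := :- (a :* (b :* y))) refl (fun g v) y (fun f e₀)))
        (trans (+-congʳ (-‿cong (trans (*-congˡ fe*y) (*-identityʳ _)))) (-‿inverseˡ _))) }
    where
    g : Functional n
    g = tailFunctional f
    y : Carrier
    y = proj₁ (inverse _ fe≉0)
    fe*y : fun f e₀ * y ≈ 1#
    fe*y = proj₂ (inverse _ fe≉0)
  ... | yes fe≈0 with pivot? (tailFunctional f)
  ... | inj₁ z = inj₁ λ v → trans (split-head f v) (trans (+-cong (trans (*-congˡ fe≈0) (zeroʳ _)) (z _)) (+-identityˡ 0#))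
  ... | inj₂ record { n₀ = n₀ ; n≡ = ≡.refl ; w = w ; fw = fw ; K = K ; injective = injective ; kernel = kernel } = inj₂ record
    { n≡ = ≡.refl ; w = 0# ∷ᵛ w ; fw = fw
    ; K = record { map = λ v → v zero ∷ᵛ map K (v ∘ suc)
      ; map-cong = λ e → λ { zero → e zero ; (suc i) → map-cong K (e ∘ suc) i }
      ; map-+ = λ v w → λ { zero → refl ; (suc i) → map-+ K _ _ i }
      ; map-* = λ x v → λ { zero → refl ; (suc i) → map-* K x _ i } }
    ; injective = λ v e → λ { zero → e zero ; (suc i) → injective (v ∘ suc) (e ∘ suc) i }
    ; kernel = λ v → trans (split-head f _) (trans (+-cong (trans (*-congˡ fe≈0) (zeroʳ _)) (kernel _)) (+-identityˡ 0#)) }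

  -- Gaussian elimination for a list of functionals. The pivot functionals and the vectors `W` are
  -- dual to each other, the remaining n′ coordinates parametrise common zeros, and n = r + n′ is
  -- the dimension count.
  record Split {n : ℕ} {I : Set} (fs : I → Functional n) (L : List I) : Set (c ⊔ ℓ) where
    field
      r n′ : ℕ
      n≡ : n ≡ r ℕ.+ n′
      r≤ : r ℕ.≤ length L
      pivot : Fin r → I
      W : Fin r → Vector n
      diagonal : ∀ l → fun (fs (pivot l)) (W l) ≈ 1#
      off-diagonal : ∀ l l′ → l ≢ l′ → fun (fs (pivot l)) (W l′) ≈ 0#
      K : Linear n′ n
      injective : Injective K
      kernel : All (λ i → ∀ v → fun (fs i) (map K v) ≈ 0#) L

  split : ∀ {n} {I : Set} (fs : I → Functional n) L → Split fs L
  split {n} fs [] = record { r = 0 ; n′ = n ; n≡ = ≡.refl ; r≤ = z≤n ; pivot = λ () ; W = λ () ; diagonal = λ () ; off-diagonal = λ ()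
    ; K = record { map = λ v → v ; map-cong = λ e → e ; map-+ = λ _ _ _ → refl ; map-* = λ _ _ _ → refl } ; injective = λ v e → e ; kernel = [] }
  split fs (i ∷ L) with pivot? (fs i)
  ... | inj₁ z = record { Split s hiding (r≤; kernel) ; r≤ = ℕP.m≤n⇒m≤1+n (Split.r≤ s) ; kernel = (λ v → z _) ∷ Split.kernel s }
    where
    s : Split fs L
    s = split fs L
  ... | inj₂ record { n₀ = n₀ ; n≡ = ≡.refl ; w = w ; fw = fw ; K = K₀ ; injective = injective₀ ; kernel = kernel₀ } = record
    { r = suc s.r ; n′ = s.n′ ; n≡ = ≡.cong suc s.n≡ ; r≤ = s≤s s.r≤
    ; pivot = pivot ; W = W
    ; diagonal = λ { zero → trans (at-W₀ i) (trans (+-cong fw (trans (-‿cong (∑-0 s.r (λ l → trans (*-congˡ (kernel₀ _)) (zeroʳ _)))) -0#≈0#)) (+-identityʳ 1#)) ; (suc l) → s.diagonal l }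
    ; off-diagonal = off
    ; K = K₀ ∘ˡ s.K ; injective = λ v e → s.injective v (injective₀ _ e)
    ; kernel = (λ v → kernel₀ _) ∷ s.kernel }
    where
    module s = Split (split (λ j → fs j ∘ᶠ K₀) L)
    pivot : Fin (suc s.r) → _
    pivot zero = i
    pivot (suc l) = s.pivot l
    W : Fin (suc s.r) → Vector (suc n₀)
    -- Subtracting the values at the later pivots makes w vanish there; the value of the new
    -- functional is unaffected, as the subtracted vectors lie in its kernel.
    W zero = λ a → w a + - (∑ κ s.r (λ l → fun (fs (s.pivot l)) w * map K₀ (s.W l) a))
    W (suc l) = map K₀ (s.W l)
    fun-neg : ∀ {n} (f : Functional n) v → fun f (λ a → - v a) ≈ - fun f v
    fun-neg f v = trans (fun-cong f (λ a → solve 1 (λ x → :- x := (:- con (+ 1)) :* x) refl (v a))) (trans (fun-* f (- 1#) v) (solve 1 (λ x → (:- con (+ 1)) :* x := :- x) refl _))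
    at-W₀ : ∀ j → fun (fs j) (W zero) ≈ fun (fs j) w - ∑ κ s.r (λ l → fun (fs (s.pivot l)) w * fun (fs j) (map K₀ (s.W l)))
    at-W₀ j = trans (fun-+ (fs j) w _) (+-congˡ (trans (fun-neg (fs j) _) (-‿cong (fun-∑ (fs j) s.r _ _))))
    off : ∀ l l′ → l ≢ l′ → fun (fs (pivot l)) (W l′) ≈ 0#
    off zero zero l≢l = ⊥-elim (l≢l ≡.refl)
    off zero (suc l′) _ = kernel₀ _
    off (suc l) zero _ = trans (at-W₀ (s.pivot l)) (x≈y⇒x-y≈0 (sym (trans (∑-single s.r _ l (λ l′ l′≢l → trans (*-congˡ (s.off-diagonal l l′ (l′≢l ∘ ≡.sym))) (zeroʳ _)))
      (trans (*-congˡ (s.diagonal l)) (*-identityʳ _)))))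
    off (suc l) (suc l′) l≢l′ = s.off-diagonal l l′ (l≢l′ ∘ ≡.cong suc)

-- Partial evaluations and their extension to a new variable.

-- A partial ring homomorphism B ⇀ κ over κ, given by its graph.
record Evaluation {c ℓ} {κ B : CommutativeRing c ℓ} (h : Hom κ B) : Set (lsuc (c ⊔ ℓ)) where
  private
    module κ = RingKit κ
    module B = RingKit B
  field
    Ev : B.Carrier → κ.Carrier → Set (c ⊔ ℓ)
    resp : ∀ {x y v w} → x B.≈ y → v κ.≈ w → Ev x v → Ev y w
    Ev-+ : ∀ {x y v w} → Ev x v → Ev y w → Ev (x B.+ y) (v κ.+ w)
    Ev-* : ∀ {x y v w} → Ev x v → Ev y w → Ev (x B.* y) (v κ.* w)
    Ev-scalar : ∀ a → Ev (Hom.⟦_⟧ h a) a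
    unique : ∀ {x v w} → Ev x v → Ev x w → v κ.≈ w

  Ev-0 : Ev B.0# κ.0#
  Ev-0 = resp (HomProperties.0-homo h) κ.refl (Ev-scalar κ.0#)

  Ev-1 : Ev B.1# κ.1#
  Ev-1 = resp (Hom.1-homo h) κ.refl (Ev-scalar κ.1#)

  Ev--1 : Ev (B.- B.1#) (κ.- κ.1#)
  Ev--1 = resp (B.trans (HomProperties.-‿homo h κ.1#) (B.-‿cong (Hom.1-homo h))) κ.refl (Ev-scalar (κ.- κ.1#))

  Ev-^ : ∀ {x v} → Ev x v → ∀ n → Ev (x B.^ n) (v κ.^ n)
  Ev-^ e zero = Ev-1
  Ev-^ e (suc n) = Ev-* e (Ev-^ e n)

  Ev-∑ : ∀ n {f : Fin n → B.Carrier} {v : Fin n → κ.Carrier} → (∀ i → Ev (f i) (v i)) → Ev (∑ B n f) (∑ κ n v)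
  Ev-∑ zero e = Ev-0
  Ev-∑ (suc n) e = Ev-+ (e zero) (Ev-∑ n (e ∘ suc))

  Ev-∏ : ∀ n {f : Fin n → B.Carrier} {v : Fin n → κ.Carrier} → (∀ i → Ev (f i) (v i)) → Ev (∏ B n f) (∏ κ n v)
  Ev-∏ zero e = Ev-1
  Ev-∏ (suc n) e = Ev-* (e zero) (Ev-∏ n (e ∘ suc))

-- Coefficients are evaluated first, and then z is replaced by a root x in κ of x^q + x = u.
-- Products are compared inside the extension of κ by the same relation, where no partiality occurs.
module ExtensionEvaluation {c ℓ} {κ B : CommutativeRing c ℓ} {h : Hom κ B} (E : Evaluation h) (p : ℕ)
  (U : CommutativeRing.Carrier B) (u : CommutativeRing.Carrier κ) (EvU : Evaluation.Ev E U u) where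
  private
    module κ = RingKit κ
    module B = RingKit B
    module E = Evaluation E
    module X = Extension B p U (B.- B.1#)
    module X̄ = Extension κ p u (κ.- κ.1#)
    module K = RingKit X.ring
    q : ℕ
    q = suc (suc p)
    Coefficientwise : K.Carrier → (Fin q → κ.Carrier) → Set (c ⊔ ℓ)
    Coefficientwise f w = ∀ a → E.Ev (f a) (w a)

    Z-Ev : ∀ f w → Coefficientwise f w → Coefficientwise (X.Z f) (X̄.Z w)
    Z-Ev f w e zero = E.Ev-* EvU (e (fromℕ (suc p)))
    Z-Ev f w e (suc zero) = E.Ev-+ (e zero) (E.Ev-* E.Ev--1 (e (fromℕ (suc p))))
    Z-Ev f w e (suc (suc a)) = e (inject₁ (suc a))

    act-Ev : ∀ k v v̄ f w → (∀ i → E.Ev (v i) (v̄ i)) → Coefficientwise f w → Coefficientwise (X.act k v f) (X̄.act k v̄ w)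
    act-Ev zero v v̄ f w e e′ a = E.Ev-0
    act-Ev (suc k) v v̄ f w e e′ a = E.Ev-+ (E.Ev-* (e zero) (e′ a)) (Z-Ev _ _ (act-Ev k (v ∘ suc) (v̄ ∘ suc) f w (e ∘ suc) e′) a)

    one-Ev : Coefficientwise K.1# (CommutativeRing.1# X̄.ring)
    one-Ev zero = E.Ev-1
    one-Ev (suc a) = E.Ev-0

  module AtRoot (x : κ.Carrier) (τx : Recursion.τ κ p x κ.≈ u) where
    private
      module L = X̄.Lift (idHom κ) x
      relation : x κ.^ q κ.≈ u κ.+ (κ.- κ.1#) κ.* x
      relation = LiftProperties.lift-condition κ p u (idHom κ) x τx
      module h = Hom h
      module ι = Hom X.ι

    Ev′ : K.Carrier → κ.Carrier → Set (c ⊔ ℓ)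
    Ev′ f v = ∃ λ w → Coefficientwise f w × v κ.≈ κ.horner q w x

    Ev-ι : ∀ {b v} → E.Ev b v → Ev′ ι.⟦ b ⟧ v
    Ev-ι {b} {v} e = Hom.⟦_⟧ X̄.ι v , coefficients , κ.sym (L.lift-ι relation v)
      where
      coefficients : Coefficientwise ι.⟦ b ⟧ (Hom.⟦_⟧ X̄.ι v)
      coefficients zero = E.resp (B.sym (X.ι-zero b)) (κ.sym (X̄.ι-zero v)) e
      coefficients (suc a) = E.resp (B.sym (X.ι-suc b a)) (κ.sym (X̄.ι-suc v a)) E.Ev-0

    Ev-z : Ev′ X.z x
    Ev-z = X̄.z , Z-Ev K.1# (CommutativeRing.1# X̄.ring) one-Ev , κ.sym (L.lift-z relation)

    evaluation : Evaluation (X.ι ∘ᴴ h)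
    evaluation = record
      { Ev = Ev′
      ; resp = λ e e′ (w , ew , ev) → w , (λ a → E.resp (at e a) κ.refl (ew a)) , κ.trans (κ.sym e′) ev
      ; Ev-+ = λ (w , ew , ev) (w′ , ew′ , ev′) → (λ a → w a κ.+ w′ a) , (λ a → E.Ev-+ (ew a) (ew′ a)) ,
          κ.trans (κ.+-cong ev ev′) (κ.sym (κ.horner-+ q w w′ x))
      ; Ev-* = λ {f} {g} (w , ew , ev) (w′ , ew′ , ev′) → X̄.act q w w′ ,
          (λ a → E.resp (B.sym (at (X.*-act f g) a)) κ.refl (act-Ev q f w g w′ ew ew′ a)) ,
          κ.trans (κ.*-cong ev ev′) (κ.sym (L.lift-act relation q w w′))
      ; Ev-scalar = λ a → Ev-ι (E.Ev-scalar a)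
      ; unique = λ (w , ew , ev) (w′ , ew′ , ev′) → κ.trans ev (κ.trans (κ.horner-cong q (λ a → E.unique (ew a) (ew′ a)) κ.refl) (κ.sym ev′)) }

-- Polynomials over K of controlled length, and congruences of sums and products.

module Polynomials {c ℓ} (K : CommutativeRing c ℓ) where
  open RingKit K

  infixl 6 _⊕_
  infixl 7 _⊛_ _⊗_

  -- Polynomials are lists here because their lengths have to be bounded through sums and products.
  _⊕_ : List Carrier → List Carrier → List Carrier
  [] ⊕ r = r
  (a ∷ p) ⊕ [] = a ∷ p
  (a ∷ p) ⊕ (b ∷ r) = a + b ∷ p ⊕ r

  _⊛_ : Carrier → List Carrier → List Carrier
  a ⊛ [] = []
  a ⊛ (b ∷ p) = a * b ∷ a ⊛ p

  _⊗_ : List Carrier → List Carrier → List Carrier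
  [] ⊗ r = []
  (a ∷ p) ⊗ r = a ⊛ r ⊕ (0# ∷ p ⊗ r)

  length-⊕ : ∀ {n} p r → length p ℕ.≤ n → length r ℕ.≤ n → length (p ⊕ r) ℕ.≤ n
  length-⊕ [] r p≤ r≤ = r≤
  length-⊕ (a ∷ p) [] p≤ r≤ = p≤
  length-⊕ (a ∷ p) (b ∷ r) (s≤s p≤) (s≤s r≤) = s≤s (length-⊕ p r p≤ r≤)

  length-⊛ : ∀ a p → length (a ⊛ p) ≡ length p
  length-⊛ a [] = ≡.refl
  length-⊛ a (b ∷ p) = ≡.cong suc (length-⊛ a p)

  length-⊗ : ∀ p r → length (p ⊗ r) ℕ.≤ length p ℕ.+ length r
  length-⊗ [] r = z≤n
  length-⊗ (a ∷ p) r = length-⊕ (a ⊛ r) _ (ℕP.≤-trans (ℕP.≤-reflexive (length-⊛ a r)) (ℕP.m≤n+m (length r) _)) (s≤s (length-⊗ p r))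

  ⨂ : ∀ n → (Fin n → List Carrier) → List Carrier
  ⨂ zero P = 1# ∷ []
  ⨂ (suc n) P = P zero ⊗ ⨂ n (P ∘ suc)

  length-⨂ : ∀ n P N → (∀ i → length (P i) ℕ.≤ N) → length (⨂ n P) ℕ.≤ suc (n ℕ.* N)
  length-⨂ zero P N le = ℕP.≤-refl
  length-⨂ (suc n) P N le = ℕP.≤-trans (length-⊗ (P zero) _) (ℕP.≤-trans (ℕP.+-mono-≤ (le zero) (length-⨂ n (P ∘ suc) N (le ∘ suc))) (ℕP.≤-reflexive (ℕP.+-suc N (n ℕ.* N))))

  ⨁ : ∀ n → (Fin n → Carrier) → (Fin n → List Carrier) → List Carrier
  ⨁ zero r P = []
  ⨁ (suc n) r P = r zero ⊛ P zero ⊕ ⨁ n (r ∘ suc) (P ∘ suc)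

  length-⨁ : ∀ n r P N → (∀ i → length (P i) ℕ.≤ N) → length (⨁ n r P) ℕ.≤ N
  length-⨁ zero r P N le = z≤n
  length-⨁ (suc n) r P N le = length-⊕ (r zero ⊛ P zero) _ (ℕP.≤-trans (ℕP.≤-reflexive (length-⊛ (r zero) (P zero))) (le zero)) (length-⨁ n (r ∘ suc) (P ∘ suc) N (le ∘ suc))

  nth : List Carrier → ℕ → Carrier
  nth [] i = 0#
  nth (a ∷ p) zero = a
  nth (a ∷ p) (suc i) = nth p i

  module Eval {c′ ℓ′} {S : CommutativeRing c′ ℓ′} (h : Hom K S) (x : CommutativeRing.Carrier S) where
    private
      module S = RingKit S
      module h = Hom h

    eval : List Carrier → S.Carrier
    eval [] = S.0#
    eval (a ∷ p) = h.⟦ a ⟧ S.+ x S.* eval p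

    eval-⊕ : ∀ p r → eval (p ⊕ r) S.≈ eval p S.+ eval r
    eval-⊕ [] r = S.sym (S.+-identityˡ _)
    eval-⊕ (a ∷ p) [] = S.sym (S.+-identityʳ _)
    eval-⊕ (a ∷ p) (b ∷ r) = S.trans (S.+-cong (h.+-homo a b) (S.*-congˡ (eval-⊕ p r)))
      (S.solve 5 (λ a b x y z → a S.:+ b S.:+ x S.:* (y S.:+ z) S.:= a S.:+ x S.:* y S.:+ (b S.:+ x S.:* z)) S.refl h.⟦ a ⟧ h.⟦ b ⟧ x (eval p) (eval r))

    eval-⊛ : ∀ a p → eval (a ⊛ p) S.≈ h.⟦ a ⟧ S.* eval p
    eval-⊛ a [] = S.sym (S.zeroʳ _)
    eval-⊛ a (b ∷ p) = S.trans (S.+-cong (h.*-homo a b) (S.*-congˡ (eval-⊛ a p)))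
      (S.solve 4 (λ a b x y → a S.:* b S.:+ x S.:* (a S.:* y) S.:= a S.:* (b S.:+ x S.:* y)) S.refl h.⟦ a ⟧ h.⟦ b ⟧ x (eval p))

    eval-⊗ : ∀ p r → eval (p ⊗ r) S.≈ eval p S.* eval r
    eval-⊗ [] r = S.sym (S.zeroˡ _)
    eval-⊗ (a ∷ p) r = S.trans (eval-⊕ (a ⊛ r) _) (S.trans (S.+-cong (eval-⊛ a r) (S.+-cong (HomProperties.0-homo h) (S.*-congˡ (eval-⊗ p r))))
      (S.solve 4 (λ a x y z → a S.:* z S.:+ (S.con (+ 0) S.:+ x S.:* (y S.:* z)) S.:= (a S.:+ x S.:* y) S.:* z) S.refl h.⟦ a ⟧ x (eval p) (eval r)))

    eval-one : eval (1# ∷ []) S.≈ S.1#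
    eval-one = S.trans (S.+-cong h.1-homo (S.zeroʳ x)) (S.+-identityʳ _)

    eval-⨂ : ∀ n P → eval (⨂ n P) S.≈ ∏ S n (λ i → eval (P i))
    eval-⨂ zero P = eval-one
    eval-⨂ (suc n) P = S.trans (eval-⊗ (P zero) _) (S.*-congˡ (eval-⨂ n (P ∘ suc)))

    eval-⨁ : ∀ n r P → eval (⨁ n r P) S.≈ ∑ S n (λ i → h.⟦ r i ⟧ S.* eval (P i))
    eval-⨁ zero r P = S.refl
    eval-⨁ (suc n) r P = S.trans (eval-⊕ (r zero ⊛ P zero) _) (S.+-cong (eval-⊛ (r zero) (P zero)) (eval-⨁ n (r ∘ suc) (P ∘ suc)))

    eval-horner : ∀ n p → length p ℕ.≤ n → eval p S.≈ S.horner n (λ i → h.⟦ nth p (toℕ i) ⟧) x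
    eval-horner n [] _ = S.sym (S.horner-0 n (λ _ → h.⟦ 0# ⟧) x (λ _ → HomProperties.0-homo h))
    eval-horner (suc n) (a ∷ p) (s≤s p≤) = S.+-congˡ (S.*-congˡ (eval-horner n p p≤))

module FiltrationSums {c ℓ} {B : CommutativeRing c ℓ} (Fil : Filtration B) where
  private
    module K = RingKit B
  open Filtration Fil

  ∑-congruent : ∀ {t} n {x y : Fin n → K.Carrier} → (∀ i → G t (x i K.- y i)) → G t (∑ B n x K.- ∑ B n y)
  ∑-congruent zero g = resp (K.sym (K.-‿inverseʳ K.0#)) G-0
  ∑-congruent (suc n) g = resp (K.solve 4 (λ x y a b → x K.:- y K.:+ (a K.:- b) K.:= x K.:+ a K.:- (y K.:+ b)) K.refl _ _ _ _) (G-+ (g zero) (∑-congruent n (g ∘ suc)))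

  ∏-congruent : ∀ {t} n {x y : Fin n → K.Carrier} → (∀ i → G (+ 0) (x i)) → (∀ i → G (+ 0) (y i)) → (∀ i → G t (x i K.- y i)) → G t (∏ B n x K.- ∏ B n y)
  ∏-congruent zero gx gy g = resp (K.sym (K.-‿inverseʳ K.1#)) G-0
  ∏-congruent {t} (suc n) gx gy g = resp (K.solve 4 (λ x y a b → x K.:* (a K.:- b) K.:+ (x K.:- y) K.:* b K.:= x K.:* a K.:- y K.:* b) K.refl _ _ _ _)
    (G-+ (cast (ℤP.+-identityˡ t) (G-* (gx zero) (∏-congruent n (gx ∘ suc) (gy ∘ suc) (g ∘ suc)))) (cast (ℤP.+-identityʳ t) (G-* (g zero) (G-∏ n (gy ∘ suc)))))

funToFin-cong : ∀ {m n} {f g : Fin m → Fin n} → (∀ k → f k ≡ g k) → funToFin f ≡ funToFin g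
funToFin-cong {zero} e = ≡.refl
funToFin-cong {suc m} e = ≡.cong₂ Data.Fin.combine (e zero) (funToFin-cong (e ∘ suc))

-- The tower and its places over T = 0 and T = ∞.

module Tower {c ℓ} {κ : CommutativeRing c ℓ} {p : ℕ} (F : TraceField κ p) (L : LaurentRing κ p) (k : ℕ) where
  open TraceField F
  open LaurentRing L using (T; T⁻¹; T*T⁻¹; const) public
  private
    module κ = RingKit κ
    module C = Hom const
  q : ℕ
  q = suc (suc p)
  Q : ℕ
  Q = q ℕ.^ k
  instance
    Q-nonZero : ℕ.NonZero Q
    Q-nonZero = ℕP.m^n≢0 q k
  R₀ : CommutativeRing c ℓ
  R₀ = LaurentRing.ring L
  module R = RingKit R₀
  open LaurentProperties L public
  open Scaled Q public
  module R₀τ = Recursion R₀ p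
  open Matrices R₀

  e : ℕ → ℤ
  e n = + (q ℕ.^ n)

  0≤e : ∀ n → + 0 ℤ.≤ e n
  0≤e n = ℤ.+≤+ z≤n

  -e≤0 : ∀ n → ℤ.- e n ℤ.≤ + 0
  -e≤0 n = ℤP.neg-mono-≤ (0≤e n)

  0<e : ∀ n → + 0 ℤ.< e n
  0<e n = ℤ.+<+ (ℕP.m^n>0 q n)

  e-mono : ∀ {m n} → m ℕ.≤ n → e m ℤ.≤ e n
  e-mono m≤n = ℤ.+≤+ (ℕP.^-monoʳ-≤ q m≤n)

  freshman-R : ∀ x y → (x R.+ y) R.^ q R.≈ x R.^ q R.+ y R.^ q
  freshman-R = R.freshman (suc p) (HomProperties.binomials-vanish const q binomials)

  record Storey : Set (lsuc (c ⊔ ℓ)) where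
    field
      Λ : CommutativeRing c ℓ
    private module Λ = RingKit Λ
    field
      η : Hom R₀ Λ
      U D : Λ.Carrier
      U*D : U Λ.* D Λ.≈ Λ.1#

  module Step (lev : Storey) where
    open Storey lev
    private module Λ = RingKit Λ
    module E = Extension Λ p U (Λ.- Λ.1#)
    module LP = LiftProperties Λ p U
    module N = Recursion E.ring p

    next : Storey
    next = record { Λ = E.ring ; η = E.ι ∘ᴴ η ; U = N.nextU E.z (Hom.⟦_⟧ E.ι D) ; D = N.nextD E.z (Hom.⟦_⟧ E.ι D)
      ; U*D = N.nextU*nextD LP.τ-z (RingKit.trans E.ring (RingKit.sym E.ring (Hom.*-homo E.ι U D)) (RingKit.trans E.ring (Hom.cong E.ι U*D) (Hom.1-homo E.ι))) }

  storey : ℕ → Storey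
  storey zero = record { Λ = R₀ ; η = idHom R₀ ; U = T ; D = T⁻¹ ; U*D = T*T⁻¹ }
  storey (suc i) = Step.next (storey i)

  module Lev (i : ℕ) where
    open Storey (storey i) public
    module Λ = RingKit Λ
    open Step (storey i) public using (module E; module LP)

  module Specialise (i : ℕ) {B : CommutativeRing c ℓ} (ρ : Hom (Lev.Λ i) B) (r : CommutativeRing.Carrier B)
    (τr : CommutativeRing._≈_ B (Recursion.τ B p r) (Hom.⟦_⟧ ρ (Lev.U i))) where
    private
      module K = RingKit B
      module B = Recursion B p
      module l = Lev i
      module l′ = Lev (suc i)
    hom : Hom l′.Λ B
    hom = l.LP.liftτ ρ r τr
    hom-ι : ∀ b → Hom.⟦_⟧ hom (Hom.⟦_⟧ l.E.ι b) K.≈ Hom.⟦_⟧ ρ b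
    hom-ι = l.LP.liftτ-ι ρ r τr
    hom-z : Hom.⟦_⟧ hom l.E.z K.≈ r
    hom-z = l.LP.liftτ-z ρ r τr
    hom-U : Hom.⟦_⟧ hom l′.U K.≈ B.nextU r (Hom.⟦_⟧ ρ l.D)
    hom-U = K.trans (RecursionHom.nextU-homo hom p l.E.z (Hom.⟦_⟧ l.E.ι l.D)) (B.nextU-cong hom-z (hom-ι l.D))
    hom-D : Hom.⟦_⟧ hom l′.D K.≈ B.nextD r (Hom.⟦_⟧ ρ l.D)
    hom-D = K.trans (RecursionHom.nextD-homo hom p l.E.z (Hom.⟦_⟧ l.E.ι l.D)) (B.nextD-cong hom-z (hom-ι l.D))

  -- The place T = 0 with x_1 = x_2 = … = 0 in the residue field: there x_{i+1} is the series s.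
  record ZeroState (i : ℕ) : Set (c ⊔ ℓ) where
    field
      ρ : Hom (Lev.Λ i) R₀
      ρ-η : ∀ x → Hom.⟦_⟧ ρ (Hom.⟦_⟧ (Lev.η i) x) R.≈ x
      Û-order : V.G (e (k ℕ.+ i)) (Hom.⟦_⟧ ρ (Lev.U i))
      D̂-order : V.G (ℤ.- e (k ℕ.+ i)) (Hom.⟦_⟧ ρ (Lev.D i))

    Û D̂ : R.Carrier
    Û = Hom.⟦_⟧ ρ (Lev.U i)
    D̂ = Hom.⟦_⟧ ρ (Lev.D i)

    Û*D̂ : Û R.* D̂ R.≈ R.1#
    Û*D̂ = R.trans (R.sym (Hom.*-homo ρ _ _)) (R.trans (Hom.cong ρ (Lev.U*D i)) (Hom.1-homo ρ))

    private
      solution : ∃ λ r → r R.^ q R.+ r R.≈ Û × V.G (e (k ℕ.+ i)) r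
      solution = V-root (0<e (k ℕ.+ i)) Û-order
    s : R.Carrier
    s = proj₁ solution
    τs : R₀τ.τ s R.≈ Û
    τs = proj₁ (proj₂ solution)
    s-order : V.G (e (k ℕ.+ i)) s
    s-order = proj₂ (proj₂ solution)

    s∈O : V.G (+ 0) s
    s∈O = V.mono (0≤e (k ℕ.+ i)) s-order

    -- the q values of x_{i+1} when T = 0 and x_1 = … = x_i = 0
    r : Fin q → R.Carrier
    r a = s R.+ C.⟦ ω a ⟧

    r∈O : ∀ a → V.G (+ 0) (r a)
    r∈O a = V.G-+ s∈O (V-const (ω a))

    τr : ∀ a → R₀τ.τ (r a) R.≈ Û
    τr a = R.trans (R.+-congʳ (freshman-R s C.⟦ ω a ⟧)) (R.trans
      (R.solve 4 (λ a b c d → a R.:+ b R.:+ (c R.:+ d) R.:= (a R.:+ c) R.:+ (b R.:+ d)) R.refl _ _ _ _)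
      (R.trans (R.+-cong τs (R.trans (R.sym (RecursionHom.τ-homo const p (ω a))) (R.trans (C.cong (ω-root a)) (HomProperties.0-homo const)))) (R.+-identityʳ _)))

    module At (a : Fin q) = Specialise i ρ (r a) (τr a)

    private
      pe : ℤ → ℤ
      pe x = + suc p ℤ.* x
      0≤pe : ∀ {x} → + 0 ℤ.≤ x → + 0 ℤ.≤ pe x
      0≤pe {x} 0≤x = ℤP.≤-trans (ℤP.≤-reflexive (≡.sym (ℤP.*-zeroʳ (+ suc p)))) (ℤP.*-monoˡ-≤-nonNeg (+ suc p) 0≤x)

    -- 1/s
    ζ : R.Carrier
    ζ = R₀τ.reciprocal s D̂

    ζ-order : V.G (ℤ.- e (k ℕ.+ i)) ζ
    ζ-order = V.cast (ℤP.+-identityˡ _) (V.G-* (V.G-+ (V.mono (0≤pe (0≤e (k ℕ.+ i))) (V.G-^ s-order (suc p))) V.G-1) D̂-order)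

    -- The difference is s^(q-1) D̂, of order at least (q-1) q^(k+i) - q^(k+i) ≥ 0. Up to integral
    -- elements 1/s is therefore the inverse of U.
    ζ-D̂ : V.G (+ 0) (ζ R.- D̂)
    ζ-D̂ = V.resp (R.solve 2 (λ x D → x R.:* D R.:= (x R.:+ R.con (+ 1)) R.:* D R.:- D) R.refl (s R.^ suc p) D̂)
      (V.mono bound (V.G-* (V.G-^ s-order (suc p)) D̂-order))
      where
      lemma : ∀ a b → (+ 1 ℤ.+ a) ℤ.* b ℤ.+ ℤ.- b ≡ a ℤ.* b
      lemma = solve-∀
      bound : + 0 ℤ.≤ pe (e (k ℕ.+ i)) ℤ.+ ℤ.- e (k ℕ.+ i)
      bound = ℤP.≤-trans (ℤP.≤-trans (ℤP.≤-reflexive (≡.sym (ℤP.*-zeroʳ (+ p)))) (ℤP.*-monoˡ-≤-nonNeg (+ p) (0≤e (k ℕ.+ i))))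
        (ℤP.≤-reflexive (≡.trans (≡.sym (lemma (+ p) (e (k ℕ.+ i)))) (≡.cong (λ j → j ℤ.* e (k ℕ.+ i) ℤ.+ ℤ.- e (k ℕ.+ i)) (≡.sym (ℤP.pos-+ 1 p)))))

  private
    k+suc : ∀ i → k ℕ.+ suc i ≡ suc (k ℕ.+ i)
    k+suc i = ℕP.+-suc k i

  zeroState : ∀ i → ZeroState i
  zeroState zero = record { ρ = idHom R₀ ; ρ-η = λ _ → R.refl
    ; Û-order = V.cast (≡.cong e (≡.sym (ℕP.+-identityʳ k))) V-T
    ; D̂-order = V.cast (≡.cong (λ n → ℤ.- e n) (≡.sym (ℕP.+-identityʳ k))) V-T⁻¹ }
  zeroState (suc i) = record { ρ = Z₀.hom ; ρ-η = λ x → R.trans (Z₀.hom-ι _) (Z.ρ-η x)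
    ; Û-order = V.resp (R.sym (R.trans Z₀.hom-U (R₀τ.nextU-cong r≈s R.refl)))
        -- The next U is s^(q+1) D̂, of order (q+1) e - e = q e: along this branch every step
        -- multiplies the order by q.
        (V.cast U-eq (V.G-* (V.G-^ Z.s-order (suc q)) Z.D̂-order))
    ; D̂-order = V.resp (R.sym (R.trans Z₀.hom-D (R₀τ.nextD-cong r≈s R.refl)))
        (V.G-+ (V.cast D-eq (V.G-^ Z.ζ-order q)) (V.mono (ℤP.neg-mono-≤ (e-mono (ℕP.+-monoʳ-≤ k (ℕP.n≤1+n i)))) Z.ζ-order)) }
    where
    module Z = ZeroState (zeroState i)
    module Z₀ = Z.At zero
    r≈s : Z.r zero R.≈ Z.s
    r≈s = R.trans (R.+-congˡ (R.trans (C.cong ω-zero) (HomProperties.0-homo const))) (R.+-identityʳ _)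
    e-suc : + q ℤ.* e (k ℕ.+ i) ≡ e (k ℕ.+ suc i)
    e-suc = ≡.trans (≡.sym (ℤP.pos-* q (q ℕ.^ (k ℕ.+ i)))) (≡.cong e (≡.sym (k+suc i)))
    lemma : ∀ a b → (+ 1 ℤ.+ a) ℤ.* b ℤ.+ ℤ.- b ≡ a ℤ.* b
    lemma = solve-∀
    U-eq : + suc q ℤ.* e (k ℕ.+ i) ℤ.+ ℤ.- e (k ℕ.+ i) ≡ e (k ℕ.+ suc i)
    U-eq = ≡.trans (≡.cong (λ j → j ℤ.* e (k ℕ.+ i) ℤ.+ ℤ.- e (k ℕ.+ i)) (ℤP.pos-+ 1 q)) (≡.trans (lemma (+ q) (e (k ℕ.+ i))) e-suc)
    D-eq : + q ℤ.* (ℤ.- e (k ℕ.+ i)) ≡ ℤ.- e (k ℕ.+ suc i)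
    D-eq = ≡.trans (≡.sym (ℤP.neg-distribʳ-* (+ q) (e (k ℕ.+ i)))) (≡.cong ℤ.-_ e-suc)

  module Zero (i : ℕ) = ZeroState (zeroState i)

  -- At first U agrees with N D̂_m up to integral elements, where N^q = N. For m ≥ 1 this pole is a
  -- value of τ and can be removed from the next variable, so that nothing ramifies. When m = 0 is
  -- reached the pole is that of N/T; from there on the next variable is given order -q^(n-1).
  data Stage (i : ℕ) {B : CommutativeRing c ℓ} (filtration : Filtration B) (ρ : Hom (Lev.Λ i) B) (n : ℕ) : Set (c ⊔ ℓ) where
    unramified : ∀ N m → n ≡ k ℕ.+ m → N κ.^ q κ.≈ N →
      Filtration.G filtration (+ 0) (CommutativeRing._-_ B (Hom.⟦_⟧ ρ (Lev.U i)) (Hom.⟦_⟧ ρ (Hom.⟦_⟧ (Lev.η i) (C.⟦ N ⟧ R.* Zero.D̂ m)))) → Stage i filtration ρ n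
    ramified : n ℕ.≤ k → Stage i filtration ρ n

  -- A place over T = 0 where x_j ≡ 0 for j ≤ j₀ and x_{j₀+1} ≡ ω ≠ 0, followed up to the i-th variable.
  -- While unramified, the next variable is z + shift with z integral.
  record Leaf (i : ℕ) : Set (lsuc (c ⊔ ℓ)) where
    field
      B : CommutativeRing c ℓ
      ρ : Hom (Lev.Λ i) B
      filtration : Filtration B
    module K = RingKit B
    module G = Filtration filtration
    scalar : R.Carrier → K.Carrier
    scalar x = Hom.⟦_⟧ ρ (Hom.⟦_⟧ (Lev.η i) x)
    field
      scalar-order : ∀ {s x} → V.G s x → G.G s (scalar x)
      n : ℕ
      n≤ : n ℕ.≤ k ℕ.+ i
      -- A step lowers n by one and raises i by one, so this invariant keeps n positive while i < k.
      k< : k ℕ.< n ℕ.+ i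
      U-order : G.G (ℤ.- e n) (Hom.⟦_⟧ ρ (Lev.U i))
      D-order : G.G (e n) (Hom.⟦_⟧ ρ (Lev.D i))

      stage : Stage i filtration ρ n

    U*D : Hom.⟦_⟧ ρ (Lev.U i) K.* Hom.⟦_⟧ ρ (Lev.D i) K.≈ K.1#
    U*D = K.trans (K.sym (Hom.*-homo ρ _ _)) (K.trans (Hom.cong ρ (Lev.U*D i)) (Hom.1-homo ρ))

  module Congruence {B : CommutativeRing c ℓ} (Fil : Filtration B) where
    private
      module K = RingKit B
      module G = Filtration Fil
    G-cong-^ : ∀ {t x y} → G.G (+ 0) x → G.G (+ 0) y → G.G t (x K.- y) → ∀ n → G.G t (x K.^ n K.- y K.^ n)
    G-cong-^ gx gy g zero = G.resp (K.sym (K.-‿inverseʳ _)) G.G-0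
    G-cong-^ {t} {x} {y} gx gy g (suc n) = G.resp
      (K.solve 4 (λ x y a b → x K.:* (a K.:- b) K.:+ (x K.:- y) K.:* b K.:= x K.:* a K.:- y K.:* b) K.refl x y (x K.^ n) (y K.^ n))
      (G.G-+ (G.cast (ℤP.+-identityˡ t) (G.G-* gx (G-cong-^ gx gy g n)))
        (G.cast (ℤP.+-identityʳ t) (G.G-* g (G.cast (ℤP.*-zeroʳ (+ n)) (G.G-^ gy n)))))

  -- Here x_{i+1} is the unit r ≡ ω ≠ 0, so the next U, r^(q+1) D̂, has the pole of D̂ with leading
  -- coefficient N = ω^(q+1). As a norm from κ, N is fixed by q-th powers.
  newLeaf : ∀ i → Fin (suc p) → Leaf (suc i)
  newLeaf i a = record
    { B = R₀ ; ρ = Zₐ.hom ; filtration = zeroFiltration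
    ; scalar-order = λ g → V.resp (R.sym (R.trans (Zₐ.hom-ι _) (Z.ρ-η _))) g
    ; n = k ℕ.+ i ; n≤ = ℕP.+-monoʳ-≤ k (ℕP.n≤1+n i) ; k< = ≡.subst (k ℕ.<_) (≡.sym (ℕP.+-suc (k ℕ.+ i) i)) (s≤s (ℕP.≤-trans (ℕP.m≤m+n k i) (ℕP.m≤m+n _ i)))
    ; U-order = V.resp (R.sym Zₐ.hom-U) (V.cast (ℤP.+-identityˡ _) (V.G-* (power (suc q)) Z.D̂-order))
    -- The inverse of the next U is τ(1/r) = τ(r) (1/r)^(q+1), where τ(r) = Û has the required order
    -- and 1/r is integral.
    ; D-order = V.resp (R.trans (R.sym τ-reciprocal) (R.sym Zₐ.hom-D)) (V.cast (ℤP.+-identityʳ (e (k ℕ.+ i)))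
        (V.G-* (V.resp (R.sym (Z.τr (suc a))) Z.Û-order) (V.cast (ℤP.*-zeroʳ (+ suc q)) (V.G-^ ζ∈O (suc q)))))
    ; stage = unramified N i ≡.refl N^q (V.resp (R.sym (R.+-cong Zₐ.hom-U (R.-‿cong (R.trans (Zₐ.hom-ι _) (Z.ρ-η _))))) U-near) }
    where
    module Z = Zero i
    module Zₐ = Z.At (suc a)
    open Congruence zeroFiltration
    r : R.Carrier
    r = Z.r (suc a)
    w : κ.Carrier
    w = ω (suc a)
    N : κ.Carrier
    N = w κ.^ suc q
    N^q : N κ.^ q κ.≈ N
    N^q = κ.trans (κ.^-distrib-* w (w κ.^ q) q) (κ.trans (κ.*-congˡ (frobenius² w)) (κ.*-comm _ _))
    power : ∀ n → V.G (+ 0) (r R.^ n)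
    power n = V.cast (ℤP.*-zeroʳ (+ n)) (V.G-^ (Z.r∈O (suc a)) n)
    ζ : R.Carrier
    ζ = R₀τ.reciprocal r Z.D̂
    r*ζ : r R.* ζ R.≈ R.1#
    r*ζ = R₀τ.x*reciprocal (Z.τr (suc a)) Z.Û*D̂
    w≉0 : ¬ w κ.≈ κ.0#
    w≉0 w≈0 = ω-distinct (suc a) zero (λ ()) (κ.trans w≈0 (κ.sym ω-zero))
    w⁻¹ : κ.Carrier
    w⁻¹ = proj₁ (inverse w w≉0)
    w*w⁻¹ : C.⟦ w ⟧ R.* C.⟦ w⁻¹ ⟧ R.≈ R.1#
    w*w⁻¹ = R.trans (R.sym (C.*-homo _ _)) (R.trans (C.cong (proj₂ (inverse w w≉0))) C.1-homo)
    -- The formula for 1/r contains the pole D̂. But s/r is integral, because s has a zero that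
    -- makes up for D̂, and 1 - s/r = ω/r with ω invertible in κ.
    ζ∈O : V.G (+ 0) ζ
    ζ∈O = V.resp (R.trans (R.*-congʳ ζw) (R.trans (R.*-assoc _ _ _) (R.trans (R.*-congˡ w*w⁻¹) (R.*-identityʳ ζ)))) (V.G-* small (V-const w⁻¹))
      where
      ζw : R.1# R.- ζ R.* Z.s R.≈ ζ R.* C.⟦ w ⟧
      ζw = R.trans (R.+-congʳ (R.sym r*ζ)) (R.solve 3 (λ s w z → (s R.:+ w) R.:* z R.:- z R.:* s R.:= z R.:* w) R.refl Z.s C.⟦ w ⟧ ζ)
      small : V.G (+ 0) (R.1# R.- ζ R.* Z.s)
      small = V.G-+ V.G-1 (V.G-neg (V.cast (ℤP.+-inverseˡ (e (k ℕ.+ i))) (V.G-*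
        (V.cast (ℤP.+-identityˡ (ℤ.- e (k ℕ.+ i))) (V.G-* (V.G-+ (power (suc p)) V.G-1) Z.D̂-order)) Z.s-order)))
    τ-reciprocal : R₀τ.nextD r Z.D̂ R.≈ R₀τ.τ r R.* ζ R.^ suc q
    τ-reciprocal = R.sym (begin
      (r R.^ q R.+ r) R.* (ζ R.* ζ R.^ q)                          ≈⟨ R.solve 4 (λ a r z b → (a R.:+ r) R.:* (z R.:* b) R.:= a R.:* b R.:* z R.:+ r R.:* z R.:* b) R.refl (r R.^ q) r ζ (ζ R.^ q) ⟩
      r R.^ q R.* ζ R.^ q R.* ζ R.+ r R.* ζ R.* ζ R.^ q            ≈⟨ R.+-cong (R.*-congʳ (R.trans (R.sym (R.^-distrib-* r ζ q)) (R.trans (R.^-congˡ q r*ζ) (R.1^ q)))) (R.*-congʳ r*ζ) ⟩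
      R.1# R.* ζ R.+ R.1# R.* ζ R.^ q                              ≈⟨ R.solve 2 (λ a b → R.con (+ 1) R.:* a R.:+ R.con (+ 1) R.:* b R.:= b R.:+ a) R.refl ζ (ζ R.^ q) ⟩
      R₀τ.τ ζ                                                      ∎)
      where open R using (begin_; step-≈-⟩; _∎)
    U-near : V.G (+ 0) (R₀τ.nextU r Z.D̂ R.- C.⟦ N ⟧ R.* Z.D̂)
    U-near = V.resp (R.trans (R.*-congʳ (R.+-congˡ (R.-‿cong (R.sym (HomProperties.^-homo const w (suc q)))))) (R.solve 3 (λ a b d → (a R.:- b) R.:* d R.:= a R.:* d R.:- b R.:* d) R.refl (r R.^ suc q) C.⟦ N ⟧ Z.D̂))
      (V.cast (ℤP.+-inverseʳ (e (k ℕ.+ i))) (V.G-* (G-cong-^ (Z.r∈O (suc a)) (V-const w)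
        (V.resp (R.solve 2 (λ s w → s R.:= s R.:+ w R.:- w) R.refl Z.s C.⟦ w ⟧) Z.s-order) (suc q)) Z.D̂-order))


  r-zero : ∀ m → Zero.r m zero R.≈ Zero.s m
  r-zero m = R.trans (R.+-congˡ (R.trans (C.cong ω-zero) (HomProperties.0-homo const))) (R.+-identityʳ _)

  -- The Artin-Schreier reason for the absence of ramification: this pole is itself a value of τ.
  D̂-suc : ∀ m → Zero.D̂ (suc m) R.≈ R₀τ.τ (Zero.ζ m)
  D̂-suc m = R.trans (ZeroState.At.hom-D (zeroState m) zero) (R₀τ.nextD-cong (r-zero m) R.refl)

  -- Since q^n - q^(n-1) = (q-1) q^(n-1), one more variable of pole order q^(n-1), with exponent at
  -- most q - 1, turns the bound Q - q^n into Q - q^(n-1).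
  pole-sum : ∀ {n n′ a} → n ≡ suc n′ → n ℕ.≤ k → a ℕ.≤ suc p → (Q ℕ.∸ q ℕ.^ n) ℕ.+ a ℕ.* q ℕ.^ n′ ℕ.≤ Q ℕ.∸ q ℕ.^ n′
  pole-sum {_} {n′} {a} ≡.refl n≤k a≤ = ℕP.+-cancelʳ-≤ (q ℕ.^ n′) _ _ (ℕP.≤-trans (ℕP.≤-reflexive (ℕP.+-assoc (Q ℕ.∸ q ℕ.^ suc n′) (a ℕ.* q ℕ.^ n′) _))
    (ℕP.≤-trans (ℕP.+-monoʳ-≤ (Q ℕ.∸ q ℕ.^ suc n′) (ℕP.≤-trans (ℕP.+-monoˡ-≤ _ (ℕP.*-monoˡ-≤ (q ℕ.^ n′) a≤)) (ℕP.≤-reflexive (ℕP.+-comm (suc p ℕ.* q ℕ.^ n′) _))))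
    (ℕP.≤-reflexive (≡.trans (ℕP.m∸n+n≡m (ℕP.^-monoʳ-≤ q n≤k)) (≡.sym (ℕP.m∸n+n≡m (ℕP.^-monoʳ-≤ q (ℕP.≤-trans (ℕP.n≤1+n n′) n≤k))))))))

  pole-shift : ∀ {X Y Z} (s : ℤ) → X ℕ.+ Z ℕ.≤ Y → s ℤ.- + Y ℤ.+ + Z ℤ.≤ s ℤ.- + X
  pole-shift {X} {Y} {Z} s le = ℤP.≤-trans (ℤP.≤-reflexive (lemma s (+ Y) (+ X) (+ Z)))
    (ℤP.≤-trans (ℤP.+-monoʳ-≤ (s ℤ.- + X) (ℤP.i≤j⇒i-j≤0 (≡.subst (ℤ._≤ + Y) (ℤP.pos-+ X Z) (ℤ.+≤+ le)))) (ℤP.≤-reflexive (ℤP.+-identityʳ _)))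
    where
    lemma : ∀ s y x z → s ℤ.- y ℤ.+ z ≡ s ℤ.- x ℤ.+ (x ℤ.+ z ℤ.- y)
    lemma = solve-∀

  -- The next variable at a leaf is z + shift with z of order at least -weight.
  record Shift {i : ℕ} (l : Leaf i) : Set (c ⊔ ℓ) where
    field
      n′ : ℕ
      n≡ : Leaf.n l ≡ suc n′
      shift : R.Carrier
      shift-order : V.G (ℤ.- e n′) shift
      weight : ℕ
      weight≤ : weight ℕ.≤ q ℕ.^ n′
      weight-n : weight ≡ 0 ⊎ (weight ≡ q ℕ.^ n′ × Leaf.n l ℕ.≤ k)
      weight-0 : weight ≡ 0 → k ℕ.≤ n′
      α-order : Leaf.G.G l (ℤ.- + (q ℕ.* weight)) (Leaf.K._-_ l (Hom.⟦_⟧ (Leaf.ρ l) (Lev.U i)) (Leaf.scalar l (R₀τ.τ shift)))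

  -- By additivity of τ, a root of τ(z) = U - τ(shift) yields the root y = z + shift of τ(y) = U.
  -- Adjoining z instead of y gives access to the smaller pole order of the reduced right side.
  module LeafStep {i : ℕ} (l : Leaf i) (sh : Shift l) where
    open Leaf l
    open Shift sh
    private
      α : K.Carrier
      α = Hom.⟦_⟧ ρ (Lev.U i) K.- scalar (R₀τ.τ shift)
    module E = Extension B p α (K.- K.1#)
    module EF = ExtensionFiltration filtration p α weight α-order
    module G′ = Filtration EF.filtration
    module K′ = RingKit E.ring
    module N = Recursion E.ring p
    private
      module ι = Hom E.ι
      embedding : Hom (Lev.Λ i) E.ring
      embedding = E.ι ∘ᴴ ρ
      scalarHom : Hom R₀ B
      scalarHom = ρ ∘ᴴ Lev.η i
      ιscalarHom : Hom R₀ E.ring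
      ιscalarHom = E.ι ∘ᴴ scalarHom

    y : K′.Carrier
    y = E.z K′.+ ι.⟦ scalar shift ⟧

    τy : N.τ y K′.≈ Hom.⟦_⟧ embedding (Lev.U i)
    τy = K′.trans (K′.+-congʳ (K′.freshman (suc p) (HomProperties.binomials-vanish (ιscalarHom ∘ᴴ const) q binomials) E.z ι.⟦ scalar shift ⟧))
      (K′.trans (K′.solve 4 (λ a b c d → a K′.:+ b K′.:+ (c K′.:+ d) K′.:= (a K′.:+ c) K′.:+ (b K′.:+ d)) K′.refl (E.z K′.^ q) (ι.⟦ scalar shift ⟧ K′.^ q) E.z ι.⟦ scalar shift ⟧)
      (K′.trans (K′.+-cong (LiftProperties.τ-z B p α) (K′.sym (RecursionHom.τ-homo ιscalarHom p shift)))
      (K′.trans (K′.sym (ι.+-homo α (scalar (R₀τ.τ shift)))) (ι.cong (K.solve 2 (λ a b → a K.:- b K.:+ b K.:= a) K.refl _ _)))))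

    module Sp = Specialise i embedding y τy

    z-order : G′.G (ℤ.- + weight) E.z
    z-order = EF.G-z

    private
      scalar-ι : ∀ {s x} → V.G s x → G′.G s ι.⟦ scalar x ⟧
      scalar-ι g = EF.G-ι (scalar-order g)

    y-order : G′.G (ℤ.- e n′) y
    y-order = G′.G-+ {ℤ.- e n′} {E.z} {ι.⟦ scalar shift ⟧} (G′.mono {ℤ.- e n′} {ℤ.- + weight} {E.z} (ℤP.neg-mono-≤ (ℤ.+≤+ weight≤)) z-order) (scalar-ι shift-order)

    D-order′ : G′.G (+ (q ℕ.* q ℕ.^ n′)) (Hom.⟦_⟧ embedding (Lev.D i))
    D-order′ = EF.G-ι (G.cast (≡.cong e n≡) D-order)

    NextStage : Set (c ⊔ ℓ)
    NextStage = Stage (suc i) EF.filtration Sp.hom n′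

    next : NextStage → Leaf (suc i)
    next st = record
      { B = E.ring ; ρ = Sp.hom ; filtration = EF.filtration
      ; scalar-order = λ {s} {x} g → G′.resp {s} (K′.sym (Sp.hom-ι (Hom.⟦_⟧ (Lev.η i) x))) (scalar-ι g)
      ; n = n′
      ; n≤ = ℕP.≤-trans (ℕP.n≤1+n n′) (ℕP.≤-trans (≡.subst (ℕ._≤ k ℕ.+ i) n≡ n≤) (ℕP.+-monoʳ-≤ k (ℕP.n≤1+n i)))
      ; k< = ≡.subst (k ℕ.<_) (≡.trans (≡.cong (ℕ._+ i) n≡) (≡.sym (ℕP.+-suc n′ i))) k<
      ; U-order = G′.resp {ℤ.- e n′} (K′.sym Sp.hom-U) (G′.G-nextU p (q ℕ.^ n′) y-order D-order′)
      ; D-order = G′.resp {e n′} (K′.sym Sp.hom-D) (G′.G-nextD p (q ℕ.^ n′) y-order D-order′)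
      ; stage = st }

    -- U′ = y - y²D, so U′ ≡ N D̂ as soon as y ≡ N D̂ modulo integral elements
    U-near : ∀ x → G′.G (+ 0) (y K′.- ι.⟦ scalar x ⟧) →
             G′.G (+ 0) (Hom.⟦_⟧ Sp.hom (Lev.U (suc i)) K′.- Hom.⟦_⟧ Sp.hom (Hom.⟦_⟧ (Lev.η (suc i)) x))
    U-near x g = G′.resp {+ 0} (K′.trans (K′.solve 3 (λ y s d → y K′.:- s K′.:+ (K′.:- (y K′.:* y K′.:* d)) K′.:= y K′.:- y K′.:* y K′.:* d K′.:- s) K′.refl y ι.⟦ scalar x ⟧ D)
        (K′.sym (K′.+-cong (K′.trans Sp.hom-U (N.nextU-expand τy UD)) (K′.-‿cong (Sp.hom-ι (Hom.⟦_⟧ (Lev.η i) x))))))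
      (G′.G-+ {+ 0} {y K′.- ι.⟦ scalar x ⟧} {K′.- (y K′.* y K′.* D)} g (G′.G-neg {+ 0} {y K′.* y K′.* D}
        (G′.mono {+ 0} {ℤ.- e n′ ℤ.+ ℤ.- e n′ ℤ.+ + (q ℕ.* q ℕ.^ n′)} {y K′.* y K′.* D} bound
          (G′.G-* {ℤ.- e n′ ℤ.+ ℤ.- e n′} {+ (q ℕ.* q ℕ.^ n′)} {y K′.* y} {D} (G′.G-* {ℤ.- e n′} {ℤ.- e n′} {y} {y} y-order y-order) D-order′))))
      where
      D : K′.Carrier
      D = Hom.⟦_⟧ embedding (Lev.D i)
      UD : Hom.⟦_⟧ embedding (Lev.U i) K′.* D K′.≈ K′.1#
      UD = K′.trans (K′.sym (Hom.*-homo embedding _ _)) (K′.trans (Hom.cong embedding (Lev.U*D i)) (Hom.1-homo embedding))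
      lemma : ∀ a r → ℤ.- a ℤ.+ ℤ.- a ℤ.+ (a ℤ.+ (a ℤ.+ r)) ≡ r
      lemma = solve-∀
      a r : ℕ
      a = q ℕ.^ n′
      r = p ℕ.* a
      split : + (q ℕ.* a) ≡ + a ℤ.+ (+ a ℤ.+ + r)
      split = ≡.trans (ℤP.pos-+ a (a ℕ.+ r)) (≡.cong (λ j → + a ℤ.+ j) (ℤP.pos-+ a r))
      bound : + 0 ℤ.≤ ℤ.- e n′ ℤ.+ ℤ.- e n′ ℤ.+ + (q ℕ.* a)
      bound = ≡.subst (+ 0 ℤ.≤_) (≡.sym (≡.trans (≡.cong (λ j → ℤ.- e n′ ℤ.+ ℤ.- e n′ ℤ.+ j) split) (lemma (+ a) (+ r)))) (ℤ.+≤+ z≤n)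

    private
      n′≤ : n′ ℕ.≤ k ℕ.+ i
      n′≤ = ℕP.≤-trans (ℕP.n≤1+n n′) (≡.subst (ℕ._≤ k ℕ.+ i) n≡ n≤)

    -- The pole order q^n′ of y is coarsened to q^(k+i), so that the loss is the same at all leaves
    -- of a storey.
    specialise-order : ∀ {s} f → (∀ j → G.G s (Hom.⟦_⟧ ρ (f j))) → G′.G (s ℤ.- + (q ℕ.* q ℕ.^ (k ℕ.+ i))) (Hom.⟦_⟧ Sp.hom f)
    specialise-order {s} f g = G′.G-horner {s} {q ℕ.^ (k ℕ.+ i)} {y} q (λ j → ι.⟦ Hom.⟦_⟧ ρ (f j) ⟧)
      (G′.mono {x = y} (ℤP.neg-mono-≤ (e-mono n′≤)) y-order) (λ j → EF.G-ι (g j))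

    -- the substitution z ↦ x - shift undoes x ↦ z + shift
    coefficient-order : ∀ {s} f → G′.G s (Hom.⟦_⟧ Sp.hom f) → ∀ a → G.G (s ℤ.- + (q ℕ.* q ℕ.^ (k ℕ.+ i))) (Hom.⟦_⟧ ρ (f a))
    coefficient-order {s} f g a = G.resp (at recovers a) (EF″.G-coefficient {s ℤ.- + (q ℕ.* w)} order a)
      where
      w : ℕ
      w = q ℕ.^ (k ℕ.+ i)
      u : K.Carrier
      u = Hom.⟦_⟧ ρ (Lev.U i)
      u-order : G.G (ℤ.- + (q ℕ.* w)) u
      u-order = G.mono (ℤP.neg-mono-≤ (e-mono (ℕP.≤-trans n≤ (ℕP.n≤1+n (k ℕ.+ i))))) U-order
      module E″ = Extension B p u (K.- K.1#)
      module EF″ = ExtensionFiltration filtration p u w u-order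
      module G″ = Filtration EF″.filtration
      module K″ = RingKit E″.ring
      module N″ = Recursion E″.ring p
      h : Hom R₀ E″.ring
      h = E″.ι ∘ᴴ scalarHom
      y″ : K″.Carrier
      y″ = E″.z K″.- Hom.⟦_⟧ h shift
      τy″ : N″.τ y″ K″.≈ Hom.⟦_⟧ E″.ι α
      τy″ = K″.trans (K″.solve 4 (λ a b c d → a K″.:+ b K″.:= (a K″.:+ c) K″.:+ (b K″.:+ d) K″.:- (c K″.:+ d)) K″.refl (y″ K″.^ q) y″ (Hom.⟦_⟧ h shift K″.^ q) (Hom.⟦_⟧ h shift))
        (K″.trans (K″.+-cong (K″.+-cong
            (K″.trans (K″.sym (K″.freshman (suc p) (HomProperties.binomials-vanish (h ∘ᴴ const) q binomials) y″ (Hom.⟦_⟧ h shift)))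
              (K″.^-congˡ q cancel)) cancel) (K″.-‿cong (K″.sym (RecursionHom.τ-homo h p shift))))
        (K″.trans (K″.+-congʳ (LiftProperties.τ-z B p u)) (K″.sym (HomProperties.minus-homo E″.ι _ _))))
        where
        cancel : y″ K″.+ Hom.⟦_⟧ h shift K″.≈ E″.z
        cancel = K″.solve 2 (λ z s → z K″.:- s K″.:+ s K″.:= z) K″.refl E″.z (Hom.⟦_⟧ h shift)
      module LP = LiftProperties B p α
      σ : Hom E.ring E″.ring
      σ = LP.liftτ E″.ι y″ τy″
      σy : Hom.⟦_⟧ σ y K″.≈ E″.z
      σy = K″.trans (Hom.+-homo σ E.z ι.⟦ scalar shift ⟧) (K″.trans (K″.+-cong (LP.liftτ-z E″.ι y″ τy″) (LP.liftτ-ι E″.ι y″ τy″ (scalar shift)))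
        (K″.solve 2 (λ z s → z K″.:- s K″.:+ s K″.:= z) K″.refl E″.z (Hom.⟦_⟧ h shift)))
      recovers : Hom.⟦_⟧ σ (Hom.⟦_⟧ Sp.hom f) K″.≈ (λ a → Hom.⟦_⟧ ρ (f a))
      recovers = K″.trans (HomProperties.horner-homo σ q (λ j → ι.⟦ Hom.⟦_⟧ ρ (f j) ⟧) y)
        (K″.trans (K″.horner-cong q (λ j → LP.liftτ-ι E″.ι y″ τy″ (Hom.⟦_⟧ ρ (f j))) σy) (K″.sym (E″.expand (λ a → Hom.⟦_⟧ ρ (f a)))))
      y″-order : G″.G (ℤ.- + w) y″
      y″-order = G″.G-+ {ℤ.- + w} {E″.z} {K″.- Hom.⟦_⟧ h shift} EF″.G-z (G″.G-neg {ℤ.- + w} {Hom.⟦_⟧ h shift}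
        (EF″.G-ι (scalar-order (V.mono (ℤP.neg-mono-≤ (e-mono n′≤)) shift-order))))
      order : G″.G (s ℤ.- + (q ℕ.* w)) (Hom.⟦_⟧ σ (Hom.⟦_⟧ Sp.hom f))
      order = G″.G-horner {s} {w} {y″} q (λ j → Hom.⟦_⟧ E″.ι (Hom.⟦_⟧ Sp.hom f j)) y″-order (λ j → EF″.G-ι (EF.G-coefficient {s} g j))

    -- Substituting x = z + shift in Σ_a (x - shift)^a v_a gives Σ_a z^a v_a.
    from-pascal : ∀ (v : Fin q → K.Carrier) → K′.horner q (λ j → ι.⟦ ∑ B q (λ a → scalar (pascal shift (toℕ a) (toℕ j)) K.* v a) ⟧) y K′.≈ v
    from-pascal v = begin
      K′.horner q (λ j → ι.⟦ ∑ B q (λ a → scalar (P a j) K.* v a) ⟧) y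
        ≈⟨ K′.horner-cong q (λ j → K′.trans (HomProperties.∑-homo E.ι q (λ a → scalar (P a j) K.* v a)) (K′.∑-cong q (λ a → ι.*-homo (scalar (P a j)) (v a)))) K′.refl ⟩
      K′.horner q (λ j → ∑ E.ring q (λ a → ι.⟦ scalar (P a j) ⟧ K′.* w a)) y
        ≈⟨ Matrices.horner-lin E.ring q q (λ a j → ι.⟦ scalar (P a j) ⟧) w y ⟩
      ∑ E.ring q (λ a → K′.horner q (λ j → ι.⟦ scalar (P a j) ⟧) y K′.* w a)
        ≈⟨ K′.∑-cong q (λ a → K′.trans (K′.*-congʳ {w a} (power a)) (K′.*-comm (E.z K′.^ toℕ a) (w a))) ⟩
      ∑ E.ring q (λ a → w a K′.* E.z K′.^ toℕ a)
        ≈⟨ K′.horner-∑ q w E.z ⟨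
      K′.horner q w E.z
        ≈⟨ E.expand v ⟨
      v ∎
      where
      open K′ using (begin_; step-≈-⟩; step-≈-⟨; _∎)
      P : Fin q → Fin q → R.Carrier
      P a j = pascal shift (toℕ a) (toℕ j)
      w : Fin q → K′.Carrier
      w a = ι.⟦ v a ⟧
      pascal-homo : ∀ a j → Hom.⟦_⟧ ιscalarHom (pascal shift a j) K′.≈ Matrices.pascal E.ring (Hom.⟦_⟧ ιscalarHom shift) a j
      pascal-homo zero zero = Hom.1-homo ιscalarHom
      pascal-homo zero (suc j) = HomProperties.0-homo ιscalarHom
      pascal-homo (suc a) zero = K′.trans (HomProperties.-‿homo ιscalarHom _) (K′.-‿cong (K′.trans (Hom.*-homo ιscalarHom _ _) (K′.*-congˡ (pascal-homo a zero))))
      pascal-homo (suc a) (suc j) = K′.trans (HomProperties.minus-homo ιscalarHom _ _) (K′.+-cong (pascal-homo a j) (K′.-‿cong (K′.trans (Hom.*-homo ιscalarHom _ _) (K′.*-congˡ (pascal-homo a (suc j))))))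
      power : ∀ a → K′.horner q (λ j → ι.⟦ scalar (P a j) ⟧) y K′.≈ E.z K′.^ toℕ a
      power a = K′.trans (K′.horner-cong q (λ j → pascal-homo (toℕ a) (toℕ j)) K′.refl)
        (K′.trans (Matrices.pascal-power E.ring (Hom.⟦_⟧ ιscalarHom shift) q (toℕ a) y (FinP.toℕ<n a))
        (K′.^-congˡ (toℕ a) (K′.solve 2 (λ z s → z K′.:+ s K′.:- s K′.:= z) K′.refl E.z (Hom.⟦_⟧ ιscalarHom shift))))

    -- When the weights q^(k-1), …, q^n have been used, monomials have pole order at most
    -- (q-1)(q^(k-1) + … + q^n) = Q - q^n.
    monomial-order : ∀ {v : Fin q → K.Carrier} → (∀ a → G.G (ℤ.- + (Q ℕ.∸ q ℕ.^ n)) (v a)) → G′.G (ℤ.- + (Q ℕ.∸ q ℕ.^ n′)) v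
    monomial-order g a = G.mono bound (g a)
      where
      nat-bound : ∀ a → a ℕ.≤ suc p → (Q ℕ.∸ q ℕ.^ n) ℕ.+ a ℕ.* weight ℕ.≤ Q ℕ.∸ q ℕ.^ n′
      nat-bound a a≤ with weight-n
      ... | inj₁ w≡0 = ℕP.≤-trans (ℕP.≤-reflexive (≡.cong₂ ℕ._+_ (ℕP.m≤n⇒m∸n≡0 Q≤) (≡.trans (≡.cong (a ℕ.*_) w≡0) (ℕP.*-zeroʳ a)))) z≤n
        where
        Q≤ : Q ℕ.≤ q ℕ.^ n
        Q≤ = ℕP.^-monoʳ-≤ q (ℕP.≤-trans (weight-0 w≡0) (≡.subst (n′ ℕ.≤_) (≡.sym n≡) (ℕP.n≤1+n n′)))
      ... | inj₂ (w≡ , n≤k) = ≡.subst (λ w → (Q ℕ.∸ q ℕ.^ n) ℕ.+ a ℕ.* w ℕ.≤ Q ℕ.∸ q ℕ.^ n′) (≡.sym w≡) (pole-sum n≡ n≤k a≤)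
      bound : ℤ.- + (Q ℕ.∸ q ℕ.^ n′) ℤ.+ + (toℕ a ℕ.* weight) ℤ.≤ ℤ.- + (Q ℕ.∸ q ℕ.^ n)
      bound = ≡.subst₂ ℤ._≤_ (≡.cong (ℤ._+ + (toℕ a ℕ.* weight)) (ℤP.+-identityˡ (ℤ.- + (Q ℕ.∸ q ℕ.^ n′)))) (ℤP.+-identityˡ (ℤ.- + (Q ℕ.∸ q ℕ.^ n)))
        (pole-shift {Q ℕ.∸ q ℕ.^ n} {Q ℕ.∸ q ℕ.^ n′} {toℕ a ℕ.* weight} (+ 0) (nat-bound (toℕ a) (ℕP.≤-pred (FinP.toℕ<n a))))

  Move : ∀ {i} → Leaf i → Set (c ⊔ ℓ)
  Move l = Σ (Shift l) (LeafStep.NextStage l)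

  private
    tailMove : ∀ {i} (l : Leaf i) n′ → Leaf.n l ≡ suc n′ → Leaf.n l ℕ.≤ k → Move l
    tailMove {i} l n′ n≡ n≤k = sh , ramified (ℕP.≤-trans (ℕP.n≤1+n n′) (≡.subst (ℕ._≤ k) n≡ n≤k))
      where
      open Leaf l
      τ0 : scalar (R₀τ.τ R.0#) K.≈ K.0#
      τ0 = K.trans (Hom.cong (ρ ∘ᴴ Lev.η i) (R.trans (R.+-identityʳ _) (R.0^suc (suc p)))) (HomProperties.0-homo (ρ ∘ᴴ Lev.η i))
      sh : Shift l
      sh = record
        { n′ = n′ ; n≡ = n≡ ; shift = R.0# ; shift-order = V.G-0 ; weight = q ℕ.^ n′ ; weight≤ = ℕP.≤-refl
        ; weight-n = inj₂ (≡.refl , n≤k) ; weight-0 = λ w≡0 → ⊥-elim (ℕP.<⇒≢ (ℕP.m^n>0 q n′) (≡.sym w≡0))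
        ; α-order = G.resp (K.sym (K.trans (K.+-congˡ (K.trans (K.-‿cong τ0) K.-0#≈0#)) (K.+-identityʳ _))) (G.cast (≡.cong (λ j → ℤ.- e j) n≡) U-order) }

    -- From N^q = N follows N D̂_{m+1} = N τ(ζ_m) = τ(N ζ_m), so the shift N ζ_m leaves an integral
    -- right side and an integral z. As ζ_m ≡ D̂_m, the new variable is congruent to N D̂_m, and the
    -- situation recurs with m in place of m + 1.
    unramifiedMove : ∀ {i} (l : Leaf i) N m → Leaf.n l ≡ k ℕ.+ suc m → N κ.^ q κ.≈ N →
      Leaf.G.G l (+ 0) (Leaf.K._-_ l (Hom.⟦_⟧ (Leaf.ρ l) (Lev.U i)) (Leaf.scalar l (C.⟦ N ⟧ R.* Zero.D̂ (suc m)))) → Move l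
    unramifiedMove {i} l N m n≡ N^q near = sh , (unramified N m ≡.refl N^q (S.U-near (C.⟦ N ⟧ R.* Zero.D̂ m) (S.G′.resp {+ 0} split
          (S.G′.G-+ {+ 0} {S.E.z} {Hom.⟦_⟧ S.E.ι (scalar (C.⟦ N ⟧ R.* (Zero.ζ m R.- Zero.D̂ m)))} S.z-order
            (S.EF.G-ι (scalar-order (V.G-* (V-const N) (Zero.ζ-D̂ m))))))))
      where
      open Leaf l
      n≡′ : n ≡ suc (k ℕ.+ m)
      n≡′ = ≡.trans n≡ (ℕP.+-suc k m)
      shift : R.Carrier
      shift = C.⟦ N ⟧ R.* Zero.ζ m
      shift-order : V.G (ℤ.- e (k ℕ.+ m)) shift
      shift-order = V.cast (ℤP.+-identityˡ _) (V.G-* (V-const N) (Zero.ζ-order m))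
      τ-shift : R₀τ.τ shift R.≈ C.⟦ N ⟧ R.* Zero.D̂ (suc m)
      τ-shift = R.trans (R.+-congʳ (R.trans (R.^-distrib-* C.⟦ N ⟧ (Zero.ζ m) q) (R.*-congʳ (R.trans (R.sym (HomProperties.^-homo const N q)) (C.cong N^q)))))
        (R.trans (R.sym (R.distribˡ _ _ _)) (R.*-congˡ (R.sym (D̂-suc m))))
      α-order : G.G (ℤ.- + (q ℕ.* 0)) (Hom.⟦_⟧ ρ (Lev.U i) K.- scalar (R₀τ.τ shift))
      α-order = G.cast (≡.cong (λ j → ℤ.- + j) (≡.sym (ℕP.*-zeroʳ q))) (G.resp (K.+-congˡ (K.-‿cong (Hom.cong (ρ ∘ᴴ Lev.η i) (R.sym τ-shift)))) near)
      sh : Shift l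
      sh = record
        { n′ = k ℕ.+ m ; n≡ = n≡′ ; shift = shift ; shift-order = shift-order ; weight = 0 ; weight≤ = z≤n
        ; weight-n = inj₁ ≡.refl ; weight-0 = λ _ → ℕP.m≤m+n k m ; α-order = α-order }
      module S = LeafStep l sh
      h : Hom R₀ S.E.ring
      h = S.E.ι ∘ᴴ ρ ∘ᴴ Lev.η i
      split : S.E.z S.K′.+ Hom.⟦_⟧ h (C.⟦ N ⟧ R.* (Zero.ζ m R.- Zero.D̂ m)) S.K′.≈ S.y S.K′.- Hom.⟦_⟧ h (C.⟦ N ⟧ R.* Zero.D̂ m)
      split = S.K′.trans (S.K′.+-congˡ (S.K′.trans (Hom.cong h (R.solve 3 (λ n z d → n R.:* (z R.:- d) R.:= n R.:* z R.:- n R.:* d) R.refl C.⟦ N ⟧ (Zero.ζ m) (Zero.D̂ m)))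
        (HomProperties.minus-homo h _ _))) (S.K′.sym (S.K′.+-assoc _ _ _))

  move : ∀ {i} → suc i ℕ.≤ k → (l : Leaf i) → Move l
  move {i} i<k l = go (Leaf.n l) ≡.refl (Leaf.stage l)
    where
    go : ∀ n → Leaf.n l ≡ n → Stage i (Leaf.filtration l) (Leaf.ρ l) (Leaf.n l) → Move l
    go zero n≡ _ = ⊥-elim (ℕP.<-asym i<k (≡.subst (λ n → k ℕ.< n ℕ.+ i) n≡ (Leaf.k< l)))
    go (suc n′) n≡ (ramified n≤k) = tailMove l n′ n≡ n≤k
    -- Now n = k and the remaining pole is that of N/T: from here on no shift is made.
    go (suc n′) n≡ (unramified N zero n≡k _ _) = tailMove l n′ n≡ (ℕP.≤-reflexive (≡.trans n≡k (ℕP.+-identityʳ k)))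
    go (suc n′) n≡ (unramified N (suc m) n≡k N^q near) = unramifiedMove l N m n≡k N^q near

  -- The totally ramified place T = ∞.
  record Infinity (i : ℕ) : Set (lsuc (c ⊔ ℓ)) where
    field
      filtration : Filtration (Lev.Λ i)
    module G = Filtration filtration
    field
      n : ℕ
      n+i : n ℕ.+ i ≡ k
      U-order : G.G (ℤ.- e n) (Lev.U i)
      D-order : G.G (e n) (Lev.D i)

  module InfinityStep {i : ℕ} (∞ : Infinity i) (n′ : ℕ) (n≡ : Infinity.n ∞ ≡ suc n′) where
    open Infinity ∞
    module EF = ExtensionFiltration filtration p (Lev.U i) (q ℕ.^ n′) (G.cast (≡.cong (λ j → ℤ.- e j) n≡) U-order)
    module G′ = Filtration EF.filtration

    next : Infinity (suc i)
    next = record { filtration = EF.filtration ; n = n′ ; n+i = ≡.trans (ℕP.+-suc n′ i) (≡.trans (≡.cong (ℕ._+ i) (≡.sym n≡)) n+i)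
      ; U-order = G′.G-nextU p (q ℕ.^ n′) EF.G-z (EF.G-ι (G.cast (≡.cong e n≡) D-order))
      ; D-order = G′.G-nextD p (q ℕ.^ n′) EF.G-z (EF.G-ι (G.cast (≡.cong e n≡) D-order)) }

  ∞-predecessor : ∀ {i} → suc i ℕ.≤ k → (∞ : Infinity i) → ∃ λ n′ → Infinity.n ∞ ≡ suc n′
  ∞-predecessor {i} i<k ∞ with Infinity.n ∞ in eq
  ... | zero = ⊥-elim (ℕP.<-irrefl (≡.trans (≡.cong (ℕ._+ i) (≡.sym eq)) (Infinity.n+i ∞)) i<k)
  ... | suc n′ = n′ , ≡.refl

  infinity : ∀ i → i ℕ.≤ k → Infinity i
  infinity zero _ = record { filtration = degreeFiltration ; n = k ; n+i = ℕP.+-identityʳ k ; U-order = W-T ; D-order = W-T⁻¹ }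
  infinity (suc i) i<k = InfinityStep.next ∞ (proj₁ (∞-predecessor i<k ∞)) (proj₂ (∞-predecessor i<k ∞))
    where
    ∞ : Infinity i
    ∞ = infinity i (ℕP.<⇒≤ i<k)


  -- Orders at all places over T = 0 against orders of coefficients.

  AllCoeffs : ∀ {s} → (R.Carrier → Set s) → ∀ i → Lev.Λ.Carrier i → Set s
  AllCoeffs P zero x = P x
  AllCoeffs P (suc i) f = ∀ a → AllCoeffs P i (f a)

  AllCoeffs-map : ∀ {s s′} {P : R.Carrier → Set s} {P′ : R.Carrier → Set s′} → (∀ {x} → P x → P′ x) → ∀ i {f} → AllCoeffs P i f → AllCoeffs P′ i f
  AllCoeffs-map h zero c = h c
  AllCoeffs-map h (suc i) c a = AllCoeffs-map h i (c a)

  -- Every leaf is carried on to the next storey, and the zero branch gives off q - 1 new leaves,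
  -- one for each nonzero root of τ.
  LeafIndex : ℕ → Set
  LeafIndex zero = ⊥
  LeafIndex (suc i) = LeafIndex i ⊎ Fin (suc p)

  leaf : ∀ i → i ℕ.≤ k → LeafIndex i → Leaf i
  leaf (suc i) i<k (inj₁ l) = LeafStep.next (leaf i (ℕP.<⇒≤ i<k) l) (proj₁ (move i<k (leaf i (ℕP.<⇒≤ i<k) l))) (proj₂ (move i<k (leaf i (ℕP.<⇒≤ i<k) l)))
  leaf (suc i) i<k (inj₂ a) = newLeaf i a

  shiftAt : ∀ i (i<k : i ℕ.< k) l → Shift (leaf i (ℕP.<⇒≤ i<k) l)
  shiftAt i i<k l = proj₁ (move i<k (leaf i (ℕP.<⇒≤ i<k) l))

  -- orders at all places over T = 0
  Order₀ : ℤ → ∀ i → i ℕ.≤ k → Lev.Λ.Carrier i → Set ℓ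
  Order₀ s i i≤k f = (∀ l → Leaf.G.G (leaf i i≤k l) s (Hom.⟦_⟧ (Leaf.ρ (leaf i i≤k l)) f)) × V.G s (Hom.⟦_⟧ (Zero.ρ i) f)

  private
    leaf-* : ∀ {i s t} (l : Leaf i) {f g} → Leaf.G.G l s (Hom.⟦_⟧ (Leaf.ρ l) f) → Leaf.G.G l t (Hom.⟦_⟧ (Leaf.ρ l) g) → Leaf.G.G l (s ℤ.+ t) (Hom.⟦_⟧ (Leaf.ρ l) (Lev.Λ._*_ i f g))
    leaf-* l {f} {g} o o′ = Leaf.G.resp l (Leaf.K.sym l (Hom.*-homo (Leaf.ρ l) f g)) (Leaf.G.G-* l o o′)

    leaf-+ : ∀ {i s} (l : Leaf i) {f g} → Leaf.G.G l s (Hom.⟦_⟧ (Leaf.ρ l) f) → Leaf.G.G l s (Hom.⟦_⟧ (Leaf.ρ l) g) → Leaf.G.G l s (Hom.⟦_⟧ (Leaf.ρ l) (Lev.Λ._+_ i f g))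
    leaf-+ l {f} {g} o o′ = Leaf.G.resp l (Leaf.K.sym l (Hom.+-homo (Leaf.ρ l) f g)) (Leaf.G.G-+ l o o′)

  Order₀-* : ∀ {s t} i i≤k {f g} → Order₀ s i i≤k f → Order₀ t i i≤k g → Order₀ (s ℤ.+ t) i i≤k (Lev.Λ._*_ i f g)
  Order₀-* i i≤k {f} {g} (ol , oz) (ol′ , oz′) = (λ l → leaf-* (leaf i i≤k l) (ol l) (ol′ l)) , V.resp (R.sym (Hom.*-homo (Zero.ρ i) f g)) (V.G-* oz oz′)

  Order₀-+ : ∀ {s} i i≤k {f g} → Order₀ s i i≤k f → Order₀ s i i≤k g → Order₀ s i i≤k (Lev.Λ._+_ i f g)
  Order₀-+ i i≤k {f} {g} (ol , oz) (ol′ , oz′) = (λ l → leaf-+ (leaf i i≤k l) (ol l) (ol′ l)) , V.resp (R.sym (Hom.+-homo (Zero.ρ i) f g)) (V.G-+ oz oz′)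

  Order₀-resp : ∀ {s} i i≤k {f g} → Lev.Λ._≈_ i f g → Order₀ s i i≤k f → Order₀ s i i≤k g
  Order₀-resp i i≤k e (ol , oz) = (λ l → Leaf.G.resp (leaf i i≤k l) (Hom.cong (Leaf.ρ (leaf i i≤k l)) e) (ol l)) , V.resp (Hom.cong (Zero.ρ i) e) oz

  Order₀-η : ∀ {s} i i≤k {x} → V.G s x → Order₀ s i i≤k (Hom.⟦_⟧ (Lev.η i) x)
  Order₀-η i i≤k g = (λ l → Leaf.scalar-order (leaf i i≤k l) g) , V.resp (R.sym (Zero.ρ-η i _)) g

  Order₀-mono : ∀ {s t} i i≤k {f} → s ℤ.≤ t → Order₀ t i i≤k f → Order₀ s i i≤k f
  Order₀-mono i i≤k s≤t (ol , oz) = (λ l → Leaf.G.mono (leaf i i≤k l) s≤t (ol l)) , V.mono s≤t oz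

  distinct : ∀ i a b → a ≢ b → ∃ λ y → C.⟦ y ⟧ R.* (Zero.r i a R.- Zero.r i b) R.≈ R.1#
  distinct i a b a≢b = y , R.trans (R.*-congˡ (R.trans (R.solve 3 (λ s x y → s R.:+ x R.:- (s R.:+ y) R.:= x R.:- y) R.refl (Zero.s i) C.⟦ ω a ⟧ C.⟦ ω b ⟧) (R.sym (HomProperties.minus-homo const _ _))))
    (R.trans (R.sym (C.*-homo _ _)) (R.trans (C.cong (κ.trans (κ.*-comm _ _) (proj₂ (inverse _ ω≉)))) C.1-homo))
    where
    ω≉ : ¬ ω a κ.- ω b κ.≈ κ.0#
    ω≉ e = ω-distinct a b a≢b (κ.x-y≈0⇒x≈y e)
    y : κ.Carrier
    y = proj₁ (inverse _ ω≉)

  -- total loss of order in passing between coefficients and the places over T = 0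
  loss : ℕ → ℕ
  loss zero = 0
  loss (suc i) = loss i ℕ.+ q ℕ.* q ℕ.^ (k ℕ.+ i)

  private
    loss-suc : ∀ s i → s ℤ.- + loss i ℤ.- + (q ℕ.* q ℕ.^ (k ℕ.+ i)) ≡ s ℤ.- + loss (suc i)
    loss-suc s i = ≡.trans (lemma s (+ loss i) _) (≡.cong (λ j → s ℤ.- j) (≡.sym (ℤP.pos-+ (loss i) _)))
      where
      lemma : ∀ s a b → s ℤ.- a ℤ.- b ≡ s ℤ.- (a ℤ.+ b)
      lemma = solve-∀

    loss-suc′ : ∀ s i → s ℤ.- + (q ℕ.* q ℕ.^ (k ℕ.+ i)) ℤ.- + loss i ≡ s ℤ.- + loss (suc i)
    loss-suc′ s i = ≡.trans (lemma s _ (+ loss i)) (≡.cong (λ j → s ℤ.- j) (≡.sym (ℤP.pos-+ (loss i) _)))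
      where
      lemma : ∀ s b a → s ℤ.- b ℤ.- a ≡ s ℤ.- (a ℤ.+ b)
      lemma = solve-∀

  coefficients⇒order : ∀ i i≤k {s f} → AllCoeffs (V.G s) i f → Order₀ (s ℤ.- + loss i) i i≤k f
  coefficients⇒order zero i≤k {s} c = (λ ()) , V.cast (≡.sym (ℤP.+-identityʳ s)) c
  coefficients⇒order (suc i) i<k {s} {f} c = old , at-root zero
    where
    IH : ∀ a → Order₀ (s ℤ.- + loss i) i (ℕP.<⇒≤ i<k) (f a)
    IH a = coefficients⇒order i (ℕP.<⇒≤ i<k) (c a)
    at-root : ∀ b → V.G (s ℤ.- + loss (suc i)) (R.horner q (λ j → Hom.⟦_⟧ (Zero.ρ i) (f j)) (Zero.r i b))
    at-root b = V.cast (loss-suc s i) (V.G-horner q _ (V.mono (-e≤0 (k ℕ.+ i)) (Zero.r∈O i b)) (λ j → proj₂ (IH j)))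
    old : ∀ l → Leaf.G.G (leaf (suc i) i<k l) (s ℤ.- + loss (suc i)) (Hom.⟦_⟧ (Leaf.ρ (leaf (suc i) i<k l)) f)
    old (inj₂ a) = at-root (suc a)
    old (inj₁ l) = LeafStep.G′.cast _ (shiftAt i i<k l) {x = Hom.⟦_⟧ (LeafStep.Sp.hom _ (shiftAt i i<k l)) f} (loss-suc s i)
      (LeafStep.specialise-order _ (shiftAt i i<k l) {s ℤ.- + loss i} f (λ j → proj₁ (IH j) l))

  -- In the zero branch the values at all q roots are known, from the continued branch and from the
  -- q - 1 new leaves. The differences of the roots are nonzero constants, so interpolation recovers
  -- the coefficients without loss. At older leaves `coefficient-order` applies.
  order⇒coefficients : ∀ i i≤k {s f} → Order₀ s i i≤k f → AllCoeffs (V.G (s ℤ.- + loss i)) i f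
  order⇒coefficients zero i≤k {s} (_ , oz) = V.cast (≡.sym (ℤP.+-identityʳ s)) oz
  order⇒coefficients (suc i) i<k {s} {f} (ol , oz) a =
    AllCoeffs-map (V.cast (loss-suc′ s i)) i (order⇒coefficients i (ℕP.<⇒≤ i<k) ((λ l → old l a) , V.mono s-≤ (zero-part a)))
    where
    w : ℕ
    w = q ℕ.^ (k ℕ.+ i)
    s-≤ : s ℤ.- + (q ℕ.* w) ℤ.≤ s
    s-≤ = ℤP.≤-trans (ℤP.+-monoʳ-≤ s (ℤP.neg-mono-≤ (ℤ.+≤+ (z≤n {q ℕ.* w})))) (ℤP.≤-reflexive (ℤP.+-identityʳ s))
    zero-part : ∀ a → V.G s (Hom.⟦_⟧ (Zero.ρ i) (f a))
    zero-part = R.Interpolation.interpolation (V.G s) V.resp V.G-0 (λ g h → V.G-+ g (V.G-neg h)) (Zero.r i)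
      (λ a x g → V.cast (ℤP.+-identityˡ s) (V.G-* (Zero.r∈O i a) g))
      (λ a b a≢b x g → let (y , ye) = distinct i a b a≢b in
        V.resp (R.trans (R.sym (R.*-assoc _ _ _)) (R.trans (R.*-congʳ ye) (R.*-identityˡ x))) (V.cast (ℤP.+-identityˡ s) (V.G-* (V-const y) g)))
      (λ a → Hom.⟦_⟧ (Zero.ρ i) (f a)) values
      where
      values : ∀ a → V.G s (R.horner q (λ a → Hom.⟦_⟧ (Zero.ρ i) (f a)) (Zero.r i a))
      values zero = oz
      values (suc a) = ol (inj₂ a)
    old : ∀ l a → Leaf.G.G (leaf i (ℕP.<⇒≤ i<k) l) (s ℤ.- + (q ℕ.* w)) (Hom.⟦_⟧ (Leaf.ρ (leaf i (ℕP.<⇒≤ i<k) l)) (f a))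
    old l = LeafStep.coefficient-order _ (shiftAt i i<k l) {s} f (ol (inj₁ l))

  private
    binomials-R : R.BinomialsVanish q
    binomials-R = HomProperties.binomials-vanish const q binomials

  -- Coordinates at the places over T = 0 and their independence.

  Coord : ℕ → Set
  Coord zero = ⊤
  Coord (suc i) = Coord i × Fin q

  ownerStep : ∀ {i} → Maybe (LeafIndex i) → Fin q → Maybe (LeafIndex (suc i))
  ownerStep (just l) a = just (inj₁ l)
  ownerStep nothing zero = nothing
  ownerStep nothing (suc a) = just (inj₂ a)

  -- the leaf to which a coordinate belongs, or nothing for the coordinate of the zero branch
  owner : ∀ i → Coord i → Maybe (LeafIndex i)
  owner zero _ = nothing
  owner (suc i) (β , a) = ownerStep (owner i β) a

  origin : ∀ i → Coord i
  origin zero = tt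
  origin (suc i) = origin i , zero

  owner-origin : ∀ i → owner i (origin i) ≡ nothing
  owner-origin zero = ≡.refl
  owner-origin (suc i) rewrite owner-origin i = ≡.refl

  -- the powers of z as polynomials in x at a leaf, the Lagrange polynomials at the roots in the zero branch
  matrix : ∀ i → i ℕ.< k → Maybe (LeafIndex i) → Fin q → Fin q → R.Carrier
  matrix i i<k (just l) a j = pascal (Shift.shift (shiftAt i i<k l)) (toℕ a) (toℕ j)
  matrix i i<k nothing a j = indicator (suc p) (Zero.r i a) j

  -- the element of Λ with given coordinates at the places over T = 0
  Θ : ∀ i → i ℕ.≤ k → (Coord i → R.Carrier) → Lev.Λ.Carrier i
  row : ∀ i → i ℕ.< k → (Coord (suc i) → R.Carrier) → Fin q → Coord i → R.Carrier
  row i i<k v j β = ∑ R₀ q (λ a → matrix i i<k (owner i β) a j R.* v (β , a))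
  Θ zero _ v = v tt
  Θ (suc i) i<k v j = Θ i (ℕP.<⇒≤ i<k) (row i i<k v j)

  Θ-cong : ∀ i i≤k {v w} → (∀ β → v β R.≈ w β) → Lev.Λ._≈_ i (Θ i i≤k v) (Θ i i≤k w)
  Θ-cong zero _ e = e tt
  Θ-cong (suc i) i<k e = pw λ j → Θ-cong i (ℕP.<⇒≤ i<k) (λ β → ∑*-cong q (λ a → matrix i i<k (owner i β) a j) (λ a → e (β , a)))

  Θ-+ : ∀ i i≤k v w → Lev.Λ._≈_ i (Θ i i≤k (λ β → v β R.+ w β)) (Lev.Λ._+_ i (Θ i i≤k v) (Θ i i≤k w))
  Θ-+ zero _ v w = R.refl
  Θ-+ (suc i) i<k v w = pw λ j → Lev.Λ.trans i
    (Θ-cong i (ℕP.<⇒≤ i<k) (λ β → ∑*-+ q (λ a → matrix i i<k (owner i β) a j) (λ a → v (β , a)) (λ a → w (β , a))))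
    (Θ-+ i (ℕP.<⇒≤ i<k) (row i i<k v j) (row i i<k w j))

  Θ-* : ∀ i i≤k x v → Lev.Λ._≈_ i (Θ i i≤k (λ β → x R.* v β)) (Lev.Λ._*_ i (Hom.⟦_⟧ (Lev.η i) x) (Θ i i≤k v))
  Θ-* zero _ x v = R.refl
  Θ-* (suc i) i<k x v = pw λ j → Lev.Λ.trans i
    (Θ-cong i (ℕP.<⇒≤ i<k) (λ β → ∑*-* q (λ a → matrix i i<k (owner i β) a j) x (λ a → v (β , a))))
    (Lev.Λ.trans i (Θ-* i (ℕP.<⇒≤ i<k) x (row i i<k v j))
      (Lev.Λ.sym i (Lev.E.ι* i (Hom.⟦_⟧ (Lev.η i) x) (Θ (suc i) i<k v) j)))

  Θ-0 : ∀ i i≤k {v} → (∀ β → v β R.≈ R.0#) → Lev.Λ._≈_ i (Θ i i≤k v) (Lev.Λ.0# i)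
  Θ-0 zero _ e = e tt
  Θ-0 (suc i) i<k {v} e = pw λ j → Θ-0 i (ℕP.<⇒≤ i<k) (λ β → ∑*-0 q (λ a → matrix i i<k (owner i β) a j) (λ a → v (β , a)) (λ a → e (β , a)))

  Θ-∑ : ∀ i i≤k m (x : Fin m → R.Carrier) (v : Fin m → Coord i → R.Carrier) →
    Lev.Λ._≈_ i (Θ i i≤k (λ β → ∑ R₀ m (λ a → x a R.* v a β))) (∑ (Lev.Λ i) m (λ a → Lev.Λ._*_ i (Hom.⟦_⟧ (Lev.η i) (x a)) (Θ i i≤k (v a))))
  Θ-∑ i i≤k zero x v = Θ-0 i i≤k (λ _ → R.refl)
  Θ-∑ i i≤k (suc m) x v = Lev.Λ.trans i (Θ-+ i i≤k _ _) (Lev.Λ.+-cong i (Θ-* i i≤k (x zero) (v zero)) (Θ-∑ i i≤k m (x ∘ suc) (v ∘ suc)))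

  private
    indicator-off : ∀ i a b → a ≢ b → R.horner q (indicator (suc p) (Zero.r i a)) (Zero.r i b) R.≈ R.0#
    indicator-off i a b a≢b = R.trans (R.sym (R.trans (R.*-congʳ (proj₂ d)) (R.*-identityˡ _)))
      (R.trans (R.*-assoc _ _ _) (R.trans (R.*-congˡ (indicator-vanishes p binomials-R (Zero.r i a) (Zero.r i b) (R.trans (Zero.τr i b) (R.sym (Zero.τr i a))))) (R.zeroʳ _)))
      where
      d : ∃ λ y → C.⟦ y ⟧ R.* (Zero.r i b R.- Zero.r i a) R.≈ R.1#
      d = distinct i b a (a≢b ∘ ≡.sym)

    row-value : ∀ i i<k v β → owner i β ≡ nothing → ∀ b → R.horner q (λ j → row i i<k v j β) (Zero.r i b) R.≈ v (β , b)
    row-value i i<k v β o b rewrite o = R.trans (horner-lin q q (λ a j → indicator (suc p) (Zero.r i a) j) (λ a → v (β , a)) (Zero.r i b))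
      (∑-select q (λ a → R.horner q (indicator (suc p) (Zero.r i a)) (Zero.r i b)) (λ a → v (β , a)) b
        (λ a a≢b → indicator-off i a b a≢b) (indicator-diagonal p binomials-R (Zero.r i b)))

  zero-Θ : ∀ i i≤k v → Hom.⟦_⟧ (Zero.ρ i) (Θ i i≤k v) R.≈ v (origin i)
  zero-Θ zero _ v = R.refl
  zero-Θ (suc i) i<k v = R.trans (R.horner-cong q (λ j → zero-Θ i (ℕP.<⇒≤ i<k) (row i i<k v j)) R.refl) (row-value i i<k v (origin i) (owner-origin i) zero)

  private
    newLeaf-Θ : ∀ i (i<k : i ℕ.< k) v a → Hom.⟦_⟧ (Leaf.ρ (leaf (suc i) i<k (inj₂ a))) (Θ (suc i) i<k v) R.≈ v (origin i , suc a)
    newLeaf-Θ i i<k v a = R.trans (R.horner-cong q (λ j → zero-Θ i (ℕP.<⇒≤ i<k) (row i i<k v j)) R.refl) (row-value i i<k v (origin i) (owner-origin i) (suc a))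

  slice : ∀ {i} → (Coord (suc i) → R.Carrier) → Fin q → Coord i → R.Carrier
  slice v a β = v (β , a)

  -- A Chinese remainder decomposition, proved storey by storey together with `leaf-Θ`: a leaf sees
  -- only the coordinates it owns, and they are the coefficients of its component in the powers of
  -- the successive z.
  leaf-local : ∀ i i≤k l {v w} → (∀ β → owner i β ≡ just l → v β R.≈ w β) →
    Leaf.K._≈_ (leaf i i≤k l) (Hom.⟦_⟧ (Leaf.ρ (leaf i i≤k l)) (Θ i i≤k v)) (Hom.⟦_⟧ (Leaf.ρ (leaf i i≤k l)) (Θ i i≤k w))
  leaf-Θ : ∀ i (i<k : i ℕ.< k) l v →
    Leaf.K._≈_ (leaf (suc i) i<k (inj₁ l)) (Hom.⟦_⟧ (Leaf.ρ (leaf (suc i) i<k (inj₁ l))) (Θ (suc i) i<k v))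
      (λ a → Hom.⟦_⟧ (Leaf.ρ (leaf i (ℕP.<⇒≤ i<k) l)) (Θ i (ℕP.<⇒≤ i<k) (slice v a)))

  leaf-local (suc i) i<k (inj₂ a) {v} {w} e = R.trans (newLeaf-Θ i i<k v a) (R.trans (e (origin i , suc a) o) (R.sym (newLeaf-Θ i i<k w a)))
    where
    o : owner (suc i) (origin i , suc a) ≡ just (inj₂ a)
    o rewrite owner-origin i = ≡.refl
  leaf-local (suc i) i<k (inj₁ l) {v} {w} e = Leaf.K.trans l′ (leaf-Θ i i<k l v)
    (Leaf.K.trans l′ (pw λ a → leaf-local i (ℕP.<⇒≤ i<k) l (λ β o → e (β , a) (≡.cong (λ m → ownerStep m a) o))) (Leaf.K.sym l′ (leaf-Θ i i<k l w)))
    where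
    l′ : Leaf (suc i)
    l′ = leaf (suc i) i<k (inj₁ l)

  leaf-Θ i i<k l v = LeafStep.K′.trans l′ sh (LeafStep.K′.horner-cong l′ sh q (λ j → Hom.cong (LeafStep.E.ι l′ sh) (leaf-row j)) (LeafStep.K′.refl l′ sh))
    (LeafStep.from-pascal l′ sh (λ a → ρ.⟦ Θ i i≤k (slice v a) ⟧))
    where
    i≤k : i ℕ.≤ k
    i≤k = ℕP.<⇒≤ i<k
    l′ : Leaf i
    l′ = leaf i i≤k l
    sh : Shift l′
    sh = shiftAt i i<k l
    module ρ = Hom (Leaf.ρ l′)
    P : Fin q → Fin q → R.Carrier
    P a j = pascal (Shift.shift sh) (toℕ a) (toℕ j)
    leaf-row : ∀ j → Leaf.K._≈_ l′ ρ.⟦ Θ i i≤k (row i i<k v j) ⟧ (∑ (Leaf.B l′) q (λ a → Leaf.K._*_ l′ (Leaf.scalar l′ (P a j)) ρ.⟦ Θ i i≤k (slice v a) ⟧))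
    leaf-row j = Leaf.K.trans l′ (leaf-local i i≤k l (λ β o → R.≡⇒≈ (≡.cong (λ m → ∑ R₀ q (λ a → matrix i i<k m a j R.* v (β , a))) o)))
      (Leaf.K.trans l′ (ρ.cong (Θ-∑ i i≤k q (λ a → P a j) (slice v)))
      (Leaf.K.trans l′ (HomProperties.∑-homo (Leaf.ρ l′) q (λ a → Lev.Λ._*_ i (Hom.⟦_⟧ (Lev.η i) (P a j)) (Θ i i≤k (slice v a))))
        (Leaf.K.∑-cong l′ q (λ a → ρ.*-homo (Hom.⟦_⟧ (Lev.η i) (P a j)) (Θ i i≤k (slice v a))))))

  -- Integral coordinates do not give integral elements, since the powers of z have poles; but their
  -- total order is below Q. One factor T, of order Q, removes them in `TΘ-order`, at the price of
  -- one degree in T.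
  Θ-leaf-order : ∀ i i≤k {v} → (∀ β → V.G (+ 0) (v β)) → ∀ l →
    Leaf.G.G (leaf i i≤k l) (ℤ.- + (Q ℕ.∸ q ℕ.^ Leaf.n (leaf i i≤k l))) (Hom.⟦_⟧ (Leaf.ρ (leaf i i≤k l)) (Θ i i≤k v))
  Θ-leaf-order (suc i) i<k {v} g (inj₂ a) = V.cast (≡.cong (λ j → ℤ.- + j) (≡.sym (ℕP.m≤n⇒m∸n≡0 (ℕP.^-monoʳ-≤ q (ℕP.m≤m+n k i)))))
    (V.resp (R.sym (newLeaf-Θ i i<k v a)) (g (origin i , suc a)))
  Θ-leaf-order (suc i) i<k {v} g (inj₁ l) = LeafStep.G′.resp _ sh {ℤ.- + (Q ℕ.∸ q ℕ.^ Shift.n′ sh)} (LeafStep.K′.sym _ sh (leaf-Θ i i<k l v))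
    (LeafStep.monomial-order _ sh λ a → Θ-leaf-order i (ℕP.<⇒≤ i<k) (λ β → g (β , a)) l)
    where
    sh : Shift (leaf i (ℕP.<⇒≤ i<k) l)
    sh = shiftAt i i<k l

  TΘ-order : ∀ i i≤k {v} → (∀ β → V.G (+ 0) (v β)) → Order₀ (+ 0) i i≤k (Lev.Λ._*_ i (Hom.⟦_⟧ (Lev.η i) T) (Θ i i≤k v))
  TΘ-order i i≤k {v} g = (λ l → Leaf.G.mono (leaf i i≤k l) (≤-bound (ℕP.m∸n≤m Q (q ℕ.^ Leaf.n (leaf i i≤k l)))) (leaf-* (leaf i i≤k l) (Leaf.scalar-order (leaf i i≤k l) V-T) (Θ-leaf-order i i≤k g l))) ,
    V.resp (R.sym (R.trans (Hom.*-homo (Zero.ρ i) _ _) (R.*-cong (Zero.ρ-η i T) (zero-Θ i i≤k v))))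
      (V.mono (ℤ.+≤+ z≤n) (V.cast (ℤP.+-identityʳ (+ Q)) (V.G-* V-T (g (origin i)))))
    where
    ≤-bound : ∀ {x y} → x ℕ.≤ y → + 0 ℤ.≤ + y ℤ.+ ℤ.- + x
    ≤-bound x≤y = ℤP.i≤j⇒0≤j-i (ℤ.+≤+ x≤y)

  -- Small means divisible by T^A. The powers of a shift have poles and would spoil smallness;
  -- therefore leaf coordinates are exact polynomials of degree < A, for which small means zero. The
  -- zero branch involves only integral factors, so there plain smallness survives the induction.
  module Independence (A : ℕ) where
    private
      t : ℤ
      t = + A ℤ.* + Q

    -- polynomials in T of degree < A
    Reduced : R.Carrier → Set ℓ
    Reduced x = V.G (+ 0) x × (∀ m → + A ℤ.≤ m → LaurentRing.coeff L x m κ.≈ κ.0#)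

    reduced-small : ∀ {x} → Reduced x → V.G t x → x R.≈ R.0#
    reduced-small {x} (_ , high) g = LaurentRing.coeff-ext L λ m → κ.trans (zero-coeff m (m ℤ.<? + A)) (κ.sym (coeff-0 m))
      where
      zero-coeff : ∀ m → Dec (m ℤ.< + A) → LaurentRing.coeff L x m κ.≈ κ.0#
      zero-coeff m (yes m<A) = g m (ℤP.*-monoʳ-<-pos (+ Q) {{positive Q}} m<A)
        where
        positive : ∀ n .{{_ : ℕ.NonZero n}} → ℤ.Positive (+ n)
        positive (suc n) = _
      zero-coeff m (no m≮A) = high m (ℤP.≮⇒≥ m≮A)

    Good Small : ∀ {i} → Maybe (LeafIndex i) → R.Carrier → Set ℓ
    Good (just _) = Reduced
    Good nothing = V.G (+ 0)
    Small (just _) x = x R.≈ R.0#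
    Small nothing = V.G t

    private
      Good-resp : ∀ {i} (o : Maybe (LeafIndex i)) {x y} → x R.≈ y → Good o x → Good o y
      Good-resp (just _) e (g , h) = V.resp e g , λ m m≥ → κ.trans (κ.sym (LaurentRing.coeff-cong L e m)) (h m m≥)
      Good-resp nothing e g = V.resp e g

      downward : ∀ n (P : Fin n → Set ℓ) → (∀ j → (∀ a → toℕ j ℕ.< toℕ a → P a) → P j) → ∀ j → P j
      downward (suc n) P step = all
        where
        above : ∀ j → P (suc j)
        above = downward n (P ∘ suc) λ j h → step (suc j) λ { (suc a) (s≤s j<a) → h a j<a }
        all : ∀ j → P j
        all zero = step zero λ { (suc a) _ → above a }
        all (suc j) = above j

    -- For leaf coordinates the matrix is unitriangular, so the coefficients of x_{i+1} are treated
    -- from the highest power downwards. Once the coordinates (β, a) with a > j are zero, row j is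
    -- the coordinate (β, j) itself, and thus still a polynomial.
    independence : ∀ i i≤k v → (∀ β → Good (owner i β) (v β)) → AllCoeffs (V.G t) i (Θ i i≤k v) → ∀ β → Small (owner i β) (v β)
    independence zero _ v good c _ = c
    independence (suc i) i<k v good c (β , a) = conclude (owner i β) ≡.refl a (good (β , a))
      where
      Vanishing : Fin q → Set ℓ
      Vanishing j = (∀ β → Small (owner i β) (row i i<k v j β)) × (∀ β l → owner i β ≡ just l → v (β , j) R.≈ R.0#)
      leaf-entry : ∀ j → (∀ a → toℕ j ℕ.< toℕ a → Vanishing a) → ∀ β l → owner i β ≡ just l → row i i<k v j β R.≈ v (β , j)
      leaf-entry j above β l o = R.trans (R.≡⇒≈ (≡.cong (λ m → ∑ R₀ q (λ a → matrix i i<k m a j R.* v (β , a))) o))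
        (∑-pascal _ q j (λ a → v (β , a)) (λ a j<a → proj₂ (above a j<a) β l o))
      row-good : ∀ j → (∀ a → toℕ j ℕ.< toℕ a → Vanishing a) → ∀ β o → owner i β ≡ o → Good o (row i i<k v j β)
      row-good j above β (just l) o≡ = Good-resp {i} (just l) (R.sym (leaf-entry j above β l o≡)) (≡.subst (λ m → Good (ownerStep m j) (v (β , j))) o≡ (good (β , j)))
      row-good j above β nothing o≡ = V.resp (R.≡⇒≈ (≡.sym (≡.cong (λ m → ∑ R₀ q (λ a → matrix i i<k m a j R.* v (β , a))) o≡)))
        (V.G-∑ q (λ a → V.G-* (indicator∈O a j) (entry a (≡.subst (λ m → Good (ownerStep m a) (v (β , a))) o≡ (good (β , a))))))
        where
        entry : ∀ a → Good {suc i} (ownerStep nothing a) (v (β , a)) → V.G (+ 0) (v (β , a))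
        entry zero g = g
        entry (suc a) (g , _) = g
        indicator∈O : ∀ a j → V.G (+ 0) (indicator (suc p) (Zero.r i a) j)
        indicator∈O a zero = V.G-+ (V.cast (ℤP.*-zeroʳ (+ suc p)) (V.G-^ (Zero.r∈O i a) (suc p))) V.G-1
        indicator∈O a (suc j) = V.cast (ℤP.*-zeroʳ (+ (p ℕ.∸ toℕ j))) (V.G-^ (Zero.r∈O i a) (p ℕ.∸ toℕ j))
      vanish : ∀ j → Vanishing j
      vanish = downward q Vanishing λ j above →
        let small = independence i (ℕP.<⇒≤ i<k) (row i i<k v j) (λ β → row-good j above β (owner i β) ≡.refl) (c j)
        in small , λ β l o → R.trans (R.sym (leaf-entry j above β l o)) (≡.subst (λ m → Small m (row i i<k v j β)) o (small β))
      conclude : ∀ o → owner i β ≡ o → ∀ a → Good (ownerStep o a) (v (β , a)) → Small (ownerStep o a) (v (β , a))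
      conclude (just l) o a _ = proj₂ (vanish a) β l o
      conclude nothing o a good-a = finish a good-a
        where
        v-small : ∀ a → V.G t (v (β , a))
        v-small a = V.resp (row-value i i<k v β o a) (V.cast (≡.trans (≡.cong (λ j → t ℤ.- + j) (ℕP.*-zeroʳ q)) (ℤP.+-identityʳ t))
          (V.G-horner {t} {0} q (λ j → row i i<k v j β) (Zero.r∈O i a) (λ j → ≡.subst (λ m → Small m (row i i<k v j β)) o (proj₁ (vanish j) β))))
        finish : ∀ a → Good (ownerStep {i} nothing a) (v (β , a)) → Small (ownerStep {i} nothing a) (v (β , a))
        finish zero _ = v-small zero
        finish (suc a) g = reduced-small g (v-small (suc a))

  -- Evaluation at T = 1 and the rational points above it.

  open LaurentRing L using (coeff; coeff-cong; coeff-ext; coeff-+; coeff-const*; coeff-T; coeff-1; coeff-1′; Order; Degree; Degree-*; 1/[1-T]) public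

  constant : ∀ i → Hom κ (Lev.Λ i)
  constant zero = const
  constant (suc i) = Lev.E.ι i ∘ᴴ constant i

  constant-η : ∀ i a → Lev.Λ._≈_ i (Hom.⟦_⟧ (constant i) a) (Hom.⟦_⟧ (Lev.η i) C.⟦ a ⟧)
  constant-η zero a = R.refl
  constant-η (suc i) a = Hom.cong (Lev.E.ι i) (constant-η i a)

  Bounded : R.Carrier → Set ℓ
  Bounded x = ∃ λ b → Degree b x

  Degree-resp : ∀ {b x y} → x R.≈ y → Degree b x → Degree b y
  Degree-resp e d m b<m = κ.trans (κ.sym (coeff-cong e m)) (d m b<m)

  Degree-mono : ∀ {b b′ x} → b ℤ.≤ b′ → Degree b x → Degree b′ x
  Degree-mono le d m b<m = d m (ℤP.≤-<-trans le b<m)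

  Degree-+ : ∀ {b x y} → Degree b x → Degree b y → Degree b (x R.+ y)
  Degree-+ d d′ m b<m = κ.trans (coeff-+ _ _ m) (κ.trans (κ.+-cong (d m b<m) (d′ m b<m)) (κ.+-identityˡ κ.0#))

  Degree-const : ∀ a → Degree (+ 0) C.⟦ a ⟧
  Degree-const a m 0<m = coeff-const a m λ m≡0 → ℤP.<-irrefl (≡.sym m≡0) 0<m

  Degree-T : Degree (+ 1) T
  Degree-T m 1<m = coeff-T₁ m λ m≡1 → ℤP.<-irrefl (≡.sym m≡1) 1<m

  Bounded-+ : ∀ {x y} → Bounded x → Bounded y → Bounded (x R.+ y)
  Bounded-+ (b , d) (b′ , d′) = b ℤ.⊔ b′ , Degree-+ (Degree-mono (ℤP.i≤i⊔j b b′) d) (Degree-mono (ℤP.i≤j⊔i b b′) d′)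

  Bounded-* : ∀ {x y} → Bounded x → Bounded y → Bounded (x R.* y)
  Bounded-* (b , d) (b′ , d′) = b ℤ.+ b′ , Degree-* d d′

  Bounded-const : ∀ a → Bounded C.⟦ a ⟧
  Bounded-const a = + 0 , Degree-const a

  Bounded-neg : ∀ {x} → Bounded x → Bounded (R.- x)
  Bounded-neg (b , d) = b , λ m b<m → κ.trans (coeff-neg _ m) (κ.trans (κ.-‿cong (d m b<m)) κ.-0#≈0#)

  Bounded-1-T : Bounded (R.1# R.- T)
  Bounded-1-T = Bounded-+ (+ 0 , Degree-resp C.1-homo (Degree-const κ.1#)) (Bounded-neg (+ 1 , Degree-T))

  w : R.Carrier
  w = proj₁ 1/[1-T]

  w-inverse : w R.* (R.1# R.- T) R.≈ R.1#
  w-inverse = proj₂ (proj₂ 1/[1-T])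

  w-cancel : ∀ x → (R.1# R.- T) R.* (w R.* x) R.≈ x
  w-cancel x = R.trans (R.solve 3 (λ t w x → t R.:* (w R.:* x) R.:= w R.:* t R.:* x) R.refl (R.1# R.- T) w x) (R.trans (R.*-congʳ w-inverse) (R.*-identityˡ x))

  private
    <-suc : ∀ i → i ℤ.< ℤ.suc i
    <-suc i = ℤP.suc[i]≤j⇒i<j ℤP.≤-refl

    -- Multiplication by 1/(1-T) forms the partial sums of the coefficients. For a Laurent
    -- polynomial x they become constant, equal to x(1), from the degree on.
    w-coeff : ∀ x m → coeff (w R.* x) (ℤ.suc m) κ.≈ coeff (w R.* x) m κ.+ coeff x (ℤ.suc m)
    w-coeff x m = κ.trans (coeff-cong (R.trans (R.solve 2 (λ t y → y R.:= t R.:* y R.:+ (R.con (+ 1) R.:- t) R.:* y) R.refl T (w R.* x)) (R.+-congˡ (w-cancel x))) (ℤ.suc m))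
      (κ.trans (coeff-+ _ _ _) (κ.+-congʳ (coeff-T (w R.* x) m)))

    stable : ∀ {b x} → Degree b x → ∀ n → coeff (w R.* x) (b ℤ.+ + n) κ.≈ coeff (w R.* x) b
    stable {b} d zero = κ.≡⇒≈ (≡.cong (coeff _) (ℤP.+-identityʳ b))
    stable {b} {x} d (suc n) = κ.trans (κ.≡⇒≈ (≡.cong (coeff (w R.* x)) (lemma b n)))
      (κ.trans (w-coeff x (b ℤ.+ + n)) (κ.trans (κ.+-cong (stable d n) (d _ (ℤP.≤-<-trans (ℤP.i≤i+j b (+ n)) (<-suc (b ℤ.+ + n))))) (κ.+-identityʳ _)))
      where
      lemma : ∀ b n → b ℤ.+ + suc n ≡ ℤ.suc (b ℤ.+ + n)
      lemma b n = ≡.trans (≡.cong (λ j → b ℤ.+ j) (ℤP.pos-+ 1 n)) (swap b (+ n))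
        where
        swap : ∀ b n → b ℤ.+ (+ 1 ℤ.+ n) ≡ + 1 ℤ.+ (b ℤ.+ n)
        swap = solve-∀

    offset : ∀ {b m} → b ℤ.≤ m → ∃ λ n → m ≡ b ℤ.+ + n
    offset {b} {m} b≤m = ℤ.∣ m ℤ.- b ∣ , ≡.trans (lemma b m) (≡.cong (λ j → b ℤ.+ j) (≡.sym (ℤP.0≤i⇒+∣i∣≡i (ℤP.i≤j⇒0≤j-i b≤m))))
      where
      lemma : ∀ b m → m ≡ b ℤ.+ (m ℤ.- b)
      lemma = solve-∀

    stable≥ : ∀ {b x} → Degree b x → ∀ {m} → b ℤ.≤ m → coeff (w R.* x) m κ.≈ coeff (w R.* x) b
    stable≥ d b≤m with (n , ≡.refl) ← offset b≤m = stable d n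

    w-coefficient : ∀ {m} → + 0 ℤ.≤ m → coeff w m κ.≈ κ.1#
    w-coefficient {m} 0≤m = κ.trans (coeff-cong (R.sym (R.*-identityʳ w)) m) (κ.trans (stable≥ one-degree 0≤m) (κ.trans (coeff-cong (R.*-identityʳ w) (+ 0))
      (κ.trans (coeff-cong (R.sym (R.*-identityʳ w)) (+ 0)) (κ.trans (w-coeff R.1# (ℤ.- + 1)) (κ.trans (κ.+-cong (κ.trans (coeff-cong (R.*-identityʳ w) (ℤ.- + 1)) (proj₁ (proj₂ 1/[1-T]) (ℤ.- + 1) ℤ.-<+)) coeff-1) (κ.+-identityˡ κ.1#))))))
      where
      one-degree : Degree (+ 0) R.1#
      one-degree = Degree-resp C.1-homo (Degree-const κ.1#)

  -- evaluation at T = 1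
  Ev₀ : R.Carrier → κ.Carrier → Set (c ⊔ ℓ)
  Ev₀ x v = ∃ λ y → Bounded y × x R.≈ C.⟦ v ⟧ R.+ (R.1# R.- T) R.* y

  -- The value is the final partial sum. After its subtraction the partial sums end in zeros, so the
  -- quotient by 1 - T is a Laurent polynomial.
  total₀ : ∀ {b x} → Degree b x → ∃ (Ev₀ x)
  total₀ {b} {x} d = v , w R.* (x R.- C.⟦ v ⟧) , (b′ , degree) ,
    R.trans (R.solve 2 (λ x v → x R.:= v R.:+ (x R.:- v)) R.refl x C.⟦ v ⟧) (R.+-congˡ (R.sym (w-cancel _)))
    where
    b′ : ℤ
    b′ = b ℤ.⊔ + 0
    v : κ.Carrier
    v = coeff (w R.* x) b′
    degree : Degree b′ (w R.* (x R.- C.⟦ v ⟧))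
    degree m b′<m = κ.trans (coeff-cong (R.solve 3 (λ w x v → w R.:* (x R.:- v) R.:= w R.:* x R.:- v R.:* w) R.refl w x C.⟦ v ⟧) m)
      (κ.trans (coeff-minus _ _ m) (κ.x≈y⇒x-y≈0 (κ.trans (stable≥ (Degree-mono (ℤP.i≤i⊔j b (+ 0)) d) (ℤP.<⇒≤ b′<m))
        (κ.sym (κ.trans (coeff-const* v w m) (κ.trans (κ.*-congˡ (w-coefficient (ℤP.≤-trans (ℤP.i≤j⊔i b (+ 0)) (ℤP.<⇒≤ b′<m)))) (κ.*-identityʳ v)))))))

  -- The partial sums are constant from b on, and the constant is x(1) = 0; so already the
  -- coefficient at b vanishes and the degree drops.
  divide : ∀ {b x} → Degree b x → Ev₀ x κ.0# → Degree (ℤ.pred b) (w R.* x)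
  divide {b} {x} d (y , (b″ , d″) , e) m <m = κ.trans (stable≥ d b≤m) (κ.trans (κ.sym (stable≥ d (ℤP.i≤i⊔j b (ℤ.suc b″)))) 
    (κ.trans (coeff-cong wx≈y (b ℤ.⊔ ℤ.suc b″)) (d″ _ (ℤP.<-≤-trans (<-suc b″) (ℤP.i≤j⊔i b (ℤ.suc b″))))))
    where
    b≤m : b ℤ.≤ m
    b≤m = ≡.subst (ℤ._≤ m) (ℤP.suc-pred b) (ℤP.i<j⇒suc[i]≤j <m)
    wx≈y : w R.* x R.≈ y
    wx≈y = R.trans (R.*-congˡ (R.trans e (R.trans (R.+-congʳ (HomProperties.0-homo const)) (R.+-identityˡ _))))
      (R.trans (R.sym (R.*-assoc _ _ _)) (R.trans (R.*-congʳ w-inverse) (R.*-identityˡ y)))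

  evaluation₀ : Evaluation const
  evaluation₀ = record
    { Ev = Ev₀
    ; resp = λ e e′ (y , by , ey) → y , by , R.trans (R.sym e) (R.trans ey (R.+-congʳ (C.cong e′)))
    ; Ev-+ = λ {x} {x′} {v} {v′} (y , by , ey) (y′ , by′ , ey′) → y R.+ y′ , Bounded-+ by by′ , R.trans (R.+-cong ey ey′)
        (R.trans (R.solve 5 (λ v y v′ y′ t → v R.:+ t R.:* y R.:+ (v′ R.:+ t R.:* y′) R.:= v R.:+ v′ R.:+ t R.:* (y R.:+ y′)) R.refl C.⟦ v ⟧ y C.⟦ v′ ⟧ y′ (R.1# R.- T))
          (R.+-congʳ (R.sym (C.+-homo v v′))))
    ; Ev-* = λ {x} {x′} {v} {v′} (y , by , ey) (y′ , by′ , ey′) → C.⟦ v ⟧ R.* y′ R.+ (C.⟦ v′ ⟧ R.* y R.+ (R.1# R.- T) R.* (y R.* y′)) ,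
        Bounded-+ (Bounded-* (Bounded-const v) by′) (Bounded-+ (Bounded-* (Bounded-const v′) by) (Bounded-* Bounded-1-T (Bounded-* by by′))) ,
        R.trans (R.*-cong ey ey′) (R.trans
          (R.solve 5 (λ v y v′ y′ t → (v R.:+ t R.:* y) R.:* (v′ R.:+ t R.:* y′) R.:= v R.:* v′ R.:+ t R.:* (v R.:* y′ R.:+ (v′ R.:* y R.:+ t R.:* (y R.:* y′)))) R.refl C.⟦ v ⟧ y C.⟦ v′ ⟧ y′ (R.1# R.- T))
          (R.+-congʳ (R.sym (C.*-homo v v′))))
    ; Ev-scalar = λ a → R.0# , (+ 0 , λ m _ → coeff-0 m) , R.solve 2 (λ a t → a R.:= a R.:+ t R.:* R.con (+ 0)) R.refl C.⟦ a ⟧ (R.1# R.- T)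
    ; unique = unique }
    where
    -- Two values would make (v - v′)/(1-T) a Laurent polynomial, although all its coefficients at m
    -- ≥ 0 equal v - v′.
    unique : ∀ {x v v′} → Ev₀ x v → Ev₀ x v′ → v κ.≈ v′
    unique {x} {v} {v′} (y , by , ey) (y′ , by′ , ey′) = κ.x-y≈0⇒x≈y (κ.trans (κ.sym (κ.trans (κ.*-congˡ (w-coefficient (ℤP.i≤j⊔i (ℤ.suc b) (+ 0)))) (κ.*-identityʳ _)))
      (κ.trans (κ.sym (coeff-const* (v κ.- v′) w m)) (κ.trans (coeff-cong wv m) (d m (ℤP.<-≤-trans (<-suc b) (ℤP.i≤i⊔j (ℤ.suc b) (+ 0)))))))
      where
      bounded : Bounded (y′ R.- y)
      bounded = Bounded-+ by′ (Bounded-neg by)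
      b m : ℤ
      b = proj₁ bounded
      m = ℤ.suc b ℤ.⊔ + 0
      d : Degree b (y′ R.- y)
      d = proj₂ bounded
      difference : C.⟦ v κ.- v′ ⟧ R.≈ (R.1# R.- T) R.* (y′ R.- y)
      difference = R.trans (HomProperties.minus-homo const v v′) (R.trans
        (R.solve 5 (λ v y v′ y′ t → v R.:- v′ R.:= (v R.:+ t R.:* y) R.:- (v′ R.:+ t R.:* y′) R.:+ t R.:* (y′ R.:- y)) R.refl C.⟦ v ⟧ y C.⟦ v′ ⟧ y′ (R.1# R.- T))
        (R.trans (R.+-congʳ (R.x≈y⇒x-y≈0 (R.trans (R.sym ey) ey′))) (R.+-identityˡ _)))
      wv : C.⟦ v κ.- v′ ⟧ R.* w R.≈ y′ R.- y
      wv = R.trans (R.*-congʳ difference) (R.trans (R.solve 3 (λ t y w → t R.:* y R.:* w R.:= w R.:* t R.:* y) R.refl (R.1# R.- T) (y′ R.- y) w)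
        (R.trans (R.*-congʳ w-inverse) (R.*-identityˡ _)))

  -- The invariant that u is invertible and u^q = u makes the points split completely: x^q + x = u
  -- has q roots in κ, and the next u, x^(q+1)/u, is again fixed by q-th powers because x^(q+1) is a
  -- norm.
  record Point (i : ℕ) : Set (lsuc (c ⊔ ℓ)) where
    field
      evaluation : Evaluation (constant i)
    open Evaluation evaluation public
    field
      u d : κ.Carrier
      Ev-U : Ev (Lev.U i) u
      Ev-D : Ev (Lev.D i) d
      u^q : u κ.^ q κ.≈ u
      u*d : u κ.* d κ.≈ κ.1#

    d^q : d κ.^ q κ.≈ d
    d^q = κ.trans (κ.sym (κ.*-identityˡ _)) (κ.trans (κ.*-congʳ (κ.sym u*d)) (κ.trans
      (κ.solve 3 (λ u d e → u κ.:* d κ.:* e κ.:= d κ.:* (u κ.:* e)) κ.refl u d (d κ.^ q))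
      (κ.trans (κ.*-congˡ (κ.trans (κ.*-congʳ (κ.sym u^q)) (κ.trans (κ.sym (κ.^-distrib-* u d q)) (κ.trans (κ.^-congˡ q u*d) (κ.1^ q))))) (κ.*-identityʳ d))))

    private
      x₀ : ∃ λ x → Recursion.τ κ p x κ.≈ u
      x₀ = τ-surjective u u^q

    x : Fin q → κ.Carrier
    x a = proj₁ x₀ κ.+ ω a

    τx : ∀ a → Recursion.τ κ p (x a) κ.≈ u
    τx a = κ.trans (κ.+-congʳ (κ.freshman (suc p) binomials (proj₁ x₀) (ω a)))
      (κ.trans (κ.solve 4 (λ a b c d → a κ.:+ b κ.:+ (c κ.:+ d) κ.:= (a κ.:+ c) κ.:+ (b κ.:+ d)) κ.refl _ _ _ _)
      (κ.trans (κ.+-cong (proj₂ x₀) (ω-root a)) (κ.+-identityʳ u)))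

    module X = ExtensionEvaluation evaluation p (Lev.U i) u Ev-U
    module Over (a : Fin q) = X.AtRoot (x a) (τx a)

    next : Fin q → Point (suc i)
    next a = record
      { evaluation = Over.evaluation a
      ; u = N.nextU (x a) d ; d = N.nextD (x a) d
      ; Ev-U = E.Ev-* (E.Ev-^ (Over.Ev-z a) (suc q)) (Over.Ev-ι a Ev-D)
      ; Ev-D = E.Ev-+ (E.Ev-^ reciprocal-Ev q) reciprocal-Ev
      ; u^q = κ.trans (κ.^-distrib-* (x a κ.^ suc q) d q) (κ.*-cong (κ.trans (κ.^-distrib-* (x a) (x a κ.^ q) q) (κ.trans (κ.*-congˡ (frobenius² (x a))) (κ.*-comm _ _))) d^q)
      ; u*d = N.nextU*nextD (τx a) u*d }
      where
      module N = Recursion κ p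
      module N′ = Recursion (Lev.Λ (suc i)) p
      module E = Evaluation (Over.evaluation a)
      reciprocal-Ev : E.Ev (N′.reciprocal (Lev.E.z i) (Hom.⟦_⟧ (Lev.E.ι i) (Lev.D i))) (N.reciprocal (x a) d)
      reciprocal-Ev = E.Ev-* (E.Ev-+ (E.Ev-^ (Over.Ev-z a) (suc p)) E.Ev-1) (Over.Ev-ι a Ev-D)

  point : ∀ i → Coord i → Point i
  point zero _ = record
    { evaluation = evaluation₀
    ; u = κ.1# ; d = κ.1#
    ; Ev-U = R.- R.1# , Bounded-neg (+ 0 , Degree-resp C.1-homo (Degree-const κ.1#)) , R.trans (R.solve 1 (λ t → t R.:= R.con (+ 1) R.:+ (R.con (+ 1) R.:- t) R.:* (R.:- R.con (+ 1))) R.refl T) (R.+-congʳ (R.sym C.1-homo))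
    ; Ev-D = T⁻¹ , (ℤ.- + 1 , λ m <m → coeff-T⁻¹ m λ m≡ → ℤP.<-irrefl (≡.sym m≡) <m) ,
        R.trans (R.solve 2 (λ t t′ → t′ R.:= t R.:* t′ R.:+ (R.con (+ 1) R.:- t) R.:* t′) R.refl T T⁻¹) (R.+-congʳ (R.trans T*T⁻¹ (R.sym C.1-homo)))
    ; u^q = κ.1^ q ; u*d = κ.*-identityˡ κ.1# }
  point (suc i) (β , a) = Point.next (point i β) a

  total : ∀ i β {f} → AllCoeffs (∃ ∘ Ev₀) i f → ∃ (Point.Ev (point i β) f)
  total zero β t = t
  total (suc i) (β , a) t = _ , (λ j → proj₁ (total i β (t j))) , (λ j → proj₂ (total i β (t j))) , κ.refl

  -- Above a point of the lower storey lie q points with distinct x, and f becomes a polynomial of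
  -- degree < q in x there. Its q zeros force all its coefficients to vanish at the lower point, and
  -- so on down to T = 1.
  zero-values : ∀ i {f} → AllCoeffs (∃ ∘ Ev₀) i f → (∀ β → Point.Ev (point i β) f κ.0#) → AllCoeffs (λ x → Ev₀ x κ.0#) i f
  zero-values zero t z = z tt
  zero-values (suc i) {f} t z j = zero-values i (t j) λ β → Point.resp (point i β) (Lev.Λ.refl i) (coefficient β j) (proj₂ (total i β (t j)))
    where
    module _ (β : Coord i) where
      open Point (point i β)
      value : Fin q → κ.Carrier
      value j = proj₁ (total i β (t j))
      root : ∀ a → κ.horner q value (x a) κ.≈ κ.0#
      root a = Point.unique (next a) (value , (λ j → proj₂ (total i β (t j))) , κ.refl) (z (β , a))
      coefficient : ∀ j → value j κ.≈ κ.0#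
      coefficient = κ.vanishing x (λ a b a≢b y e → regular (ω a κ.- ω b) (λ e → ω-distinct a b a≢b (κ.x-y≈0⇒x≈y e)) y
        (κ.trans (κ.*-congʳ (κ.solve 3 (λ x a b → a κ.:- b κ.:= x κ.:+ a κ.:- (x κ.:+ b)) κ.refl _ (ω a) (ω b))) e)) value root


  -- Orders and residues at T = ∞.

  module ∞ (i : ℕ) (i≤k : i ℕ.≤ k) = Infinity (infinity i i≤k)

  ∞⇒degree : ∀ i i≤k {s f} → ∞.G.G i i≤k s f → AllCoeffs (W.G s) i f
  ∞⇒degree zero i≤k g = g
  ∞⇒degree (suc i) i<k {s} g a = ∞⇒degree i (ℕP.<⇒≤ i<k) (∞.G.mono i (ℕP.<⇒≤ i<k) (ℤP.i≤i+j s (+ (toℕ a ℕ.* q ℕ.^ ∞.n (suc i) i<k))) (g a))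

  private
    ∞n≤k : ∀ i i≤k → ∞.n i i≤k ℕ.≤ k
    ∞n≤k i i≤k = ≡.subst (∞.n i i≤k ℕ.≤_) (∞.n+i i i≤k) (ℕP.m≤m+n _ i)

    n-suc : ∀ i (i<k : i ℕ.< k) → ∞.n i (ℕP.<⇒≤ i<k) ≡ suc (∞.n (suc i) i<k)
    n-suc i i<k = proj₂ (∞-predecessor i<k (infinity i (ℕP.<⇒≤ i<k)))

  -- By `pole-sum`, a monomial in the variables has pole order at most (q-1)(q^(k-1) + ... + q^n) =
  -- Q - q^n at T = ∞.
  degree⇒∞ : ∀ i i≤k {s f} → AllCoeffs (W.G s) i f → ∞.G.G i i≤k (s ℤ.- + (Q ℕ.∸ q ℕ.^ ∞.n i i≤k)) f
  degree⇒∞ zero i≤k {s} c = W.mono (ℤP.≤-reflexive (≡.trans (≡.cong (λ n → s ℤ.- + n) (ℕP.n∸n≡0 Q)) (ℤP.+-identityʳ s))) c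
  degree⇒∞ (suc i) i<k {s} c a = ∞.G.mono i i≤k (pole-shift {Q ℕ.∸ q ℕ.^ ∞.n i i≤k} {Q ℕ.∸ q ℕ.^ ∞.n (suc i) i<k} {toℕ a ℕ.* q ℕ.^ ∞.n (suc i) i<k} s
      (pole-sum (n-suc i i<k) (∞n≤k i i≤k) (ℕP.≤-pred (FinP.toℕ<n a)))) (degree⇒∞ i i≤k (c a))
    where
    i≤k : i ℕ.≤ k
    i≤k = ℕP.<⇒≤ i<k

  private
    coeff-T⁻¹^ : ∀ d → coeff (T⁻¹ R.^ d) (ℤ.- + d) κ.≈ κ.1#
    coeff-T⁻¹^′ : ∀ d m → m ≢ ℤ.- + d → coeff (T⁻¹ R.^ d) m κ.≈ κ.0#

    T⁻¹-shift : ∀ x m → coeff (T⁻¹ R.* x) m κ.≈ coeff x (ℤ.suc m)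
    T⁻¹-shift x m = κ.trans (κ.sym (coeff-T (T⁻¹ R.* x) m)) (coeff-cong (R.trans (R.sym (R.*-assoc _ _ _)) (R.trans (R.*-congʳ T*T⁻¹) (R.*-identityˡ x))) (ℤ.suc m))

    suc-neg : ∀ d → ℤ.suc (ℤ.- + suc d) ≡ ℤ.- + d
    suc-neg d = ≡.trans (≡.cong (λ j → ℤ.suc (ℤ.- j)) (ℤP.pos-+ 1 d)) (lemma (+ d))
      where
      lemma : ∀ d → + 1 ℤ.+ (ℤ.- (+ 1 ℤ.+ d)) ≡ ℤ.- d
      lemma = solve-∀

    coeff-T⁻¹^ zero = coeff-1
    coeff-T⁻¹^ (suc d) = κ.trans (T⁻¹-shift (T⁻¹ R.^ d) (ℤ.- + suc d)) (κ.trans (κ.≡⇒≈ (≡.cong (coeff (T⁻¹ R.^ d)) (suc-neg d))) (coeff-T⁻¹^ d))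
    coeff-T⁻¹^′ zero m m≢ = coeff-1′ m m≢
    coeff-T⁻¹^′ (suc d) m m≢ = κ.trans (T⁻¹-shift (T⁻¹ R.^ d) m) (coeff-T⁻¹^′ d (ℤ.suc m) λ e →
      m≢ (≡.trans (≡.sym (ℤP.pred-suc m)) (≡.trans (≡.cong ℤ.pred (≡.trans e (≡.sym (suc-neg d)))) (ℤP.pred-suc (ℤ.- + suc d)))))

  -- The orders at T = ∞ of the elements of the i-th storey are the multiples of q^n.
  no-jump : ∀ i i≤k s → ¬ q ℕ.^ ∞.n i i≤k ∣ s → ∀ {f} → ∞.G.G i i≤k (+ s) f → ∞.G.G i i≤k (+ suc s) f
  no-jump zero i≤k s ∤s g m m< = g m (ℤP.≤∧≢⇒< (≡.subst ((ℤ.- m) ℤ.* + Q ℤ.≤_) (ℤP.pred-suc (+ s)) (ℤP.i<j⇒i≤pred[j] m<))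
    λ e → ∤s (∣.divides ℤ.∣ ℤ.- m ∣ (≡.trans (≡.cong ℤ.∣_∣ (≡.sym e)) (ℤP.abs-* (ℤ.- m) (+ Q)))))
  no-jump (suc i) i<k s ∤s g a = no-jump i (ℕP.<⇒≤ i<k) (s ℕ.+ toℕ a ℕ.* e′) (λ ∣s+ → ∤s (∣.∣m+n∣m⇒∣n
      (≡.subst (e′ ∣_) (ℕP.+-comm s _) (∣.∣-trans (≡.subst (λ n → e′ ∣ q ℕ.^ n) (≡.sym (n-suc i i<k)) (∣.n∣m*n q)) ∣s+)) (∣.n∣m*n (toℕ a)))) (g a)
    where
    e′ : ℕ
    e′ = q ℕ.^ ∞.n (suc i) i<k

  -- The elements of order ≥ s modulo those of order ≥ s + 1 have dimension at most one over κ,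
  -- spanned by the class of h. This expresses that T = ∞ is totally ramified with residue field κ.
  Jump : ∀ i → i ℕ.≤ k → ℕ → Set (c ⊔ ℓ)
  Jump i i≤k s = ∃ λ h → ∀ {f} → ∞.G.G i i≤k (+ s) f → ∃ λ a →
    ∞.G.G i i≤k (+ suc s) (Lev.Λ._-_ i f (Lev.Λ._*_ i (Hom.⟦_⟧ (constant i) a) h))

  private
    trivial-jump : ∀ i i≤k s → ¬ q ℕ.^ ∞.n i i≤k ∣ s → Jump i i≤k s
    trivial-jump i i≤k s ∤s = Λ.0# , λ {f} g → κ.0# , ∞.G.resp i i≤k (Λ.solve 2 (λ f a → f Λ.:= f Λ.:- a Λ.:* Λ.con (+ 0)) Λ.refl f (Hom.⟦_⟧ (constant i) κ.0#)) (no-jump i i≤k s ∤s g)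
      where module Λ = Lev.Λ i

    residue-≤ : ∀ e s a b .{{_ : ℕ.NonZero e}} → b ℕ.< q → a ℕ.≤ b → q ℕ.* e ∣ s ℕ.+ a ℕ.* e → q ℕ.* e ∣ s ℕ.+ b ℕ.* e → b ℕ.≤ a
    residue-≤ e s a b b<q a≤b ∣a ∣b with b ℕ.∸ a in eq
    ... | zero = ℕP.m∸n≡0⇒m≤n eq
    ... | suc x = ⊥-elim (∣.>⇒∤ {{≡.subst ℕ.NonZero (≡.sym eq) _}} (ℕP.≤-<-trans (ℕP.m∸n≤m b a) b<q) (∣.*-cancelʳ-∣ e (∣.∣m+n∣m⇒∣n (≡.subst (q ℕ.* e ∣_) sum ∣b) ∣a)))
      where
      sum : s ℕ.+ b ℕ.* e ≡ s ℕ.+ a ℕ.* e ℕ.+ (b ℕ.∸ a) ℕ.* e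
      sum = ≡.trans (≡.cong (λ x → s ℕ.+ x ℕ.* e) (≡.sym (ℕP.m+[n∸m]≡n a≤b))) (≡.trans (≡.cong (s ℕ.+_) (ℕP.*-distribʳ-+ e a (b ℕ.∸ a))) (≡.sym (ℕP.+-assoc s _ _)))

    unique-residue : ∀ e s a b .{{_ : ℕ.NonZero e}} → a ℕ.< q → b ℕ.< q → q ℕ.* e ∣ s ℕ.+ a ℕ.* e → q ℕ.* e ∣ s ℕ.+ b ℕ.* e → a ≡ b
    unique-residue e s a b a<q b<q ∣a ∣b with ℕP.≤-total a b
    ... | inj₁ a≤b = ℕP.≤-antisym a≤b (residue-≤ e s a b b<q a≤b ∣a ∣b)
    ... | inj₂ b≤a = ≡.sym (ℕP.≤-antisym b≤a (residue-≤ e s b a a<q b≤a ∣b ∣a))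

  -- The terms f_a z^a have orders in different classes modulo the q^n of the storey below. At most
  -- one exponent a₀ fits the given s; for the others `no-jump` already gives order s + 1.
  jump : ∀ i i≤k s → Jump i i≤k s
  jump zero i≤k s with Q ∣? s
  ... | no ∤s = trivial-jump zero i≤k s ∤s
  ... | yes (∣.divides d s≡dQ) = T⁻¹ R.^ d , λ {f} g → coeff f (ℤ.- + d) , λ m m< →
    κ.trans (coeff-minus f _ m) (κ.x≈y⇒x-y≈0 (κ.sym (κ.trans (coeff-const* (coeff f (ℤ.- + d)) (T⁻¹ R.^ d) m) (compare f g m m< (m ℤ.≟ ℤ.- + d)))))
    where
    compare : ∀ f → W.G (+ s) f → ∀ m → (ℤ.- m) ℤ.* + Q ℤ.< + suc s → Dec (m ≡ ℤ.- + d) → coeff f (ℤ.- + d) κ.* coeff (T⁻¹ R.^ d) m κ.≈ coeff f m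
    compare f g _ m< (yes ≡.refl) = κ.trans (κ.*-congˡ (coeff-T⁻¹^ d)) (κ.*-identityʳ _)
    compare f g m m< (no m≢) = κ.trans (κ.*-congˡ (coeff-T⁻¹^′ d m m≢)) (κ.trans (κ.zeroʳ _) (κ.sym (g m (ℤP.≤∧≢⇒< (≡.subst ((ℤ.- m) ℤ.* + Q ℤ.≤_) (ℤP.pred-suc (+ s)) (ℤP.i<j⇒i≤pred[j] m<)) λ e →
      m≢ (≡.trans (≡.sym (ℤP.neg-involutive m)) (≡.cong ℤ.-_ (ℤP.*-cancelʳ-≡ (ℤ.- m) (+ d) (+ Q) (≡.trans e (≡.trans (≡.cong +_ s≡dQ) (ℤP.pos-* d Q))))))))))
  jump (suc i) i<k s with FinP.any? (λ (a : Fin q) → q ℕ.^ ∞.n i (ℕP.<⇒≤ i<k) ∣? s ℕ.+ toℕ a ℕ.* q ℕ.^ ∞.n (suc i) i<k)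
  ... | no ∤ = Λ′.0# , λ {f} g → κ.0# , ∞.G.resp (suc i) i<k {+ suc s} (Λ′.solve 2 (λ f a → f Λ′.:= f Λ′.:- a Λ′.:* Λ′.con (+ 0)) Λ′.refl f (Hom.⟦_⟧ (constant (suc i)) κ.0#))
      (λ a → no-jump i (ℕP.<⇒≤ i<k) (s ℕ.+ toℕ a ℕ.* q ℕ.^ ∞.n (suc i) i<k) (λ ∣a → ∤ (a , ∣a)) {f a} (g a))
    where module Λ′ = Lev.Λ (suc i)
  ... | yes (a₀ , ∣a₀) = h , λ {f} g → proj₁ (proj₂ IH (g a₀)) , λ a → ∞.G.resp i i≤k (Λ.+-congˡ (Λ.-‿cong (Λ.sym (Lev.E.ι* i _ h a)))) (entry f g a (a FinP.≟ a₀))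
    where
    module Λ = Lev.Λ i
    i≤k : i ℕ.≤ k
    i≤k = ℕP.<⇒≤ i<k
    e′ : ℕ
    e′ = q ℕ.^ ∞.n (suc i) i<k
    instance
      e′-nonZero : ℕ.NonZero e′
      e′-nonZero = ℕP.m^n≢0 q (∞.n (suc i) i<k)
    IH : Jump i i≤k (s ℕ.+ toℕ a₀ ℕ.* e′)
    IH = jump i i≤k (s ℕ.+ toℕ a₀ ℕ.* e′)
    pick : ∀ {a : Fin q} → Dec (a ≡ a₀) → Λ.Carrier
    pick (yes _) = proj₁ IH
    pick (no _) = Λ.0#
    h : Fin q → Λ.Carrier
    h a = pick (a FinP.≟ a₀)
    divides-q : ∀ {x} → q ℕ.^ ∞.n i i≤k ∣ x → q ℕ.* e′ ∣ x
    divides-q = ≡.subst (λ n → q ℕ.^ n ∣ _) (n-suc i i<k)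
    entry : ∀ (f : Fin q → Λ.Carrier) (g : ∞.G.G (suc i) i<k (+ s) f) a (d : Dec (a ≡ a₀)) →
      ∞.G.G i i≤k (+ suc s ℤ.+ + (toℕ a ℕ.* e′)) (f a Λ.- Hom.⟦_⟧ (constant i) (proj₁ (proj₂ IH (g a₀))) Λ.* pick d)
    entry f g _ (yes ≡.refl) = proj₂ (proj₂ IH (g a₀))
    entry f g a (no a≢a₀) = ∞.G.resp i i≤k (Λ.solve 2 (λ f a → f Λ.:= f Λ.:- a Λ.:* Λ.con (+ 0)) Λ.refl (f a) (Hom.⟦_⟧ (constant i) (proj₁ (proj₂ IH (g a₀)))))
      (no-jump i i≤k (s ℕ.+ toℕ a ℕ.* e′) (λ ∣a → a≢a₀ (FinP.toℕ-injective (unique-residue e′ s (toℕ a) (toℕ a₀) (FinP.toℕ<n a) (FinP.toℕ<n a₀) (divides-q ∣a) (divides-q ∣a₀)))) (g a))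

  constant-∞ : ∀ i i≤k a → ∞.G.G i i≤k (+ 0) (Hom.⟦_⟧ (constant i) a)
  constant-∞ zero i≤k a = W-const a
  constant-∞ (suc i) i<k a = InfinityStep.EF.G-ι (infinity i (ℕP.<⇒≤ i<k)) _ (n-suc i i<k) (constant-∞ i (ℕP.<⇒≤ i<k) a)

  constant-small : ∀ i i≤k a → ∞.G.G i i≤k (+ 1) (Hom.⟦_⟧ (constant i) a) → a κ.≈ κ.0#
  constant-small zero i≤k a g = κ.trans (κ.sym (coeff-const-0 a)) (g (+ 0) (ℤ.+<+ (s≤s z≤n)))
  constant-small (suc i) i<k a g = constant-small i (ℕP.<⇒≤ i<k) a (∞.G.resp i (ℕP.<⇒≤ i<k) (Lev.E.ι-zero i _) (g zero))

  -- The leading coefficients of f and of 1 with respect to the same h are compared. That of 1 is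
  -- nonzero by `constant-small`, so their quotient is the residue.
  residue : ∀ i i≤k {f} → ∞.G.G i i≤k (+ 0) f → ∃ λ a → ∞.G.G i i≤k (+ 1) (Lev.Λ._-_ i f (Hom.⟦_⟧ (constant i) a))
  residue i i≤k {f} g = x , G.resp eq (G.G-+ (proj₂ f-jump) (G.G-neg (G.cast (ℤP.+-identityˡ (+ 1)) (G.G-* (constant-∞ i i≤k x) (proj₂ one-jump)))))
    where
    module Λ = Lev.Λ i
    module G = ∞.G i i≤k
    module c = Hom (constant i)
    J : Jump i i≤k 0
    J = jump i i≤k 0
    h : Λ.Carrier
    h = proj₁ J
    one-jump : ∃ λ a → G.G (+ 1) (Λ.1# Λ.- c.⟦ a ⟧ Λ.* h)
    one-jump = proj₂ J G.G-1
    f-jump : ∃ λ a → G.G (+ 1) (f Λ.- c.⟦ a ⟧ Λ.* h)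
    f-jump = proj₂ J g
    a₁≉0 : ¬ proj₁ one-jump κ.≈ κ.0#
    a₁≉0 e = 0≉1 (κ.sym (constant-small i i≤k κ.1# (G.resp (Λ.trans (Λ.+-congˡ (Λ.trans (Λ.-‿cong (Λ.trans (Λ.*-congʳ (Λ.trans (c.cong e) (HomProperties.0-homo (constant i)))) (Λ.zeroˡ h))) Λ.-0#≈0#))
      (Λ.trans (Λ.+-identityʳ Λ.1#) (Λ.sym c.1-homo))) (proj₂ one-jump))))
    a₁⁻¹ : ∃ λ y → proj₁ one-jump κ.* y κ.≈ κ.1#
    a₁⁻¹ = inverse _ a₁≉0
    x : κ.Carrier
    x = proj₁ f-jump κ.* proj₁ a₁⁻¹
    xa₁ : c.⟦ x ⟧ Λ.* c.⟦ proj₁ one-jump ⟧ Λ.≈ c.⟦ proj₁ f-jump ⟧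
    xa₁ = Λ.trans (Λ.sym (c.*-homo _ _)) (c.cong (κ.trans (κ.*-assoc _ _ _) (κ.trans (κ.*-congˡ (κ.trans (κ.*-comm _ _) (proj₂ a₁⁻¹))) (κ.*-identityʳ _))))
    eq : (f Λ.- c.⟦ proj₁ f-jump ⟧ Λ.* h) Λ.- c.⟦ x ⟧ Λ.* (Λ.1# Λ.- c.⟦ proj₁ one-jump ⟧ Λ.* h) Λ.≈ f Λ.- c.⟦ x ⟧
    eq = Λ.trans (Λ.+-congʳ (Λ.+-congˡ (Λ.-‿cong (Λ.*-congʳ (Λ.sym xa₁)))))
      (Λ.solve 4 (λ f x a h → f Λ.:- x Λ.:* a Λ.:* h Λ.:- x Λ.:* (Λ.con (+ 1) Λ.:- a Λ.:* h) Λ.:= f Λ.:- x) Λ.refl f c.⟦ x ⟧ c.⟦ proj₁ one-jump ⟧ h)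

  -- Functions without poles over T = 0.

  private
    -- A nonzero coefficient at T^m would need both mQ ≥ -N and -mQ ≥ N + 1. This plays the part of
    -- a product formula for T = 0 and T = ∞.
    small-zero : ∀ i N {f} → AllCoeffs (V.G (ℤ.- + N)) i f → AllCoeffs (W.G (+ suc N)) i f → Lev.Λ._≈_ i f (Lev.Λ.0# i)
    small-zero zero N {f} v w = coeff-ext λ m → κ.trans (zero-coeff m (m ℤ.* + Q ℤ.<? ℤ.- + N)) (κ.sym (coeff-0 m))
      where
      zero-coeff : ∀ m → Dec (m ℤ.* + Q ℤ.< ℤ.- + N) → coeff f m κ.≈ κ.0#
      zero-coeff m (yes m<) = v m m<
      zero-coeff m (no m≮) = w m (ℤP.≤-<-trans (≡.subst₂ ℤ._≤_ (ℤP.neg-distribˡ-* m (+ Q)) (ℤP.neg-involutive (+ N)) (ℤP.neg-mono-≤ (ℤP.≮⇒≥ m≮))) (ℤ.+<+ (ℕP.n<1+n N)))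
    small-zero (suc i) N v w = pw λ a → small-zero i N (v a) (w a)

    ^-zero : ∀ v n → v κ.^ n κ.≈ κ.0# → v κ.≈ κ.0#
    ^-zero v zero e = ⊥-elim (0≉1 (κ.sym e))
    ^-zero v (suc n) e with v ≟ κ.0#
    ... | yes v≈0 = v≈0
    ... | no v≉0 = ^-zero v n (regular v v≉0 _ e)

    Order₀-^ : ∀ i i≤k {f} → Order₀ (+ 0) i i≤k f → ∀ n → Order₀ (+ 0) i i≤k (Lev.Λ._^_ i f n)
    Order₀-^ i i≤k o zero = (λ l → Leaf.G.resp (leaf i i≤k l) (Leaf.K.sym (leaf i i≤k l) (Hom.1-homo (Leaf.ρ (leaf i i≤k l)))) (Leaf.G.G-1 (leaf i i≤k l))) ,
      V.resp (R.sym (Hom.1-homo (Zero.ρ i))) V.G-1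
    Order₀-^ i i≤k o (suc n) = Order₀-* i i≤k o (Order₀-^ i i≤k o n)

  -- a function without poles that vanishes at T = ∞ is nilpotent
  values-vanish : ∀ i i≤k {f} → Order₀ (+ 0) i i≤k f → ∞.G.G i i≤k (+ 1) f → ∀ β {v} → Point.Ev (point i β) f v → v κ.≈ κ.0#
  values-vanish i i≤k {f} o g β {v} e = ^-zero v N (P.unique (P.Ev-^ e N) (P.resp (Lev.Λ.sym i power-zero) κ.refl P.Ev-0))
    where
    module P = Point (point i β)
    N : ℕ
    -- Powers of f keep order 0 over T = 0 while the order at T = ∞ grows, so the power `loss i` + 1
    -- outruns the loss and is zero.
    N = suc (loss i)
    power-zero : Lev.Λ._≈_ i (Lev.Λ._^_ i f N) (Lev.Λ.0# i)
    power-zero = small-zero i (loss i) (AllCoeffs-map (V.cast (ℤP.+-identityˡ (ℤ.- + loss i))) i (order⇒coefficients i i≤k (Order₀-^ i i≤k o N)))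
      (∞⇒degree i i≤k (∞.G.cast i i≤k (ℤP.*-identityʳ (+ N)) (∞.G.G-^ i i≤k g N)))

  k≤k : k ℕ.≤ k
  k≤k = ℕP.≤-refl

  module Λₖ = Lev.Λ k

  scale : R.Carrier → Λₖ.Carrier → Λₖ.Carrier
  scale x f = Hom.⟦_⟧ (Lev.η k) x Λₖ.* f

  n-top : ∞.n k k≤k ≡ 0
  n-top = ℕP.+-cancelʳ-≡ k _ 0 (∞.n+i k k≤k)

  -- functions without poles over T = 0 with coefficients of degree at most b
  Space : ℤ → Λₖ.Carrier → Set ℓ
  Space b f = Order₀ (+ 0) k k≤k f × AllCoeffs (Degree b) k f

  AllCoeffs-resp : ∀ {s} {P : R.Carrier → Set s} → (∀ {x y} → x R.≈ y → P x → P y) → ∀ i {f g} → Lev.Λ._≈_ i f g → AllCoeffs P i f → AllCoeffs P i g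
  AllCoeffs-resp r zero e c = r e c
  AllCoeffs-resp r (suc i) e c a = AllCoeffs-resp r i (at e a) (c a)

  AllCoeffs-scale : ∀ {s s′ s″} {P : R.Carrier → Set s} {P′ : R.Carrier → Set s′} {P″ : R.Carrier → Set s″} y → (∀ {x y} → x R.≈ y → P″ x → P″ y) →
    (∀ {x} → P x → P′ x → P″ (y R.* x)) → ∀ i {f} → AllCoeffs P i f → AllCoeffs P′ i f → AllCoeffs P″ i (Lev.Λ._*_ i (Hom.⟦_⟧ (Lev.η i) y) f)
  AllCoeffs-scale y r h zero c c′ = h c c′
  AllCoeffs-scale y r h (suc i) {f} c c′ a = AllCoeffs-resp r i (Lev.Λ.sym i (Lev.E.ι* i _ f a)) (AllCoeffs-scale y r h i (c a) (c′ a))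

  AllCoeffs-total : ∀ i {b f} → AllCoeffs (Degree b) i f → AllCoeffs (∃ ∘ Ev₀) i f
  AllCoeffs-total i = AllCoeffs-map total₀ i

  Space-divide : ∀ {b f} → Space b f → (∀ β → Point.Ev (point k β) f κ.0#) → Space (ℤ.pred b) (scale w f)
  Space-divide (o , d) z = Order₀-* k k≤k (Order₀-η k k≤k (V.cast (ℤP.*-zeroˡ (+ Q)) (Order⇒V {+ 0} (proj₁ (proj₂ 1/[1-T]))))) o ,
    AllCoeffs-scale w Degree-resp divide k d (zero-values k (AllCoeffs-total k d) z)

  scale-w-injective : ∀ {f} → scale w f Λₖ.≈ Λₖ.0# → f Λₖ.≈ Λₖ.0#
  scale-w-injective {f} e = Λₖ.trans (Λₖ.sym (Λₖ.*-identityˡ f)) (Λₖ.trans (Λₖ.*-congʳ (Λₖ.trans (Λₖ.sym (Hom.1-homo η)) (Λₖ.trans (Hom.cong η (R.trans (R.sym w-inverse) (R.*-comm _ _))) (Hom.*-homo η _ _))))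
    (Λₖ.trans (Λₖ.*-assoc _ _ _) (Λₖ.trans (Λₖ.*-congˡ e) (Λₖ.zeroʳ _))))
    where
    η : Hom R₀ (Lev.Λ k)
    η = Lev.η k

  Degree⇒W : ∀ {b x} → Degree b x → W.G ((ℤ.- b) ℤ.* + Q) x
  Degree⇒W {b} d m m< = d m (ℤP.≰⇒> λ m≤b → ℤP.<⇒≱ m< (ℤP.*-monoʳ-≤-nonNeg (+ Q) (ℤP.neg-mono-≤ m≤b)))

  Space-∞ : ∀ {b f} → Space b f → ∞.G.G k k≤k ((ℤ.- b) ℤ.* + Q ℤ.- + (Q ℕ.∸ 1)) f
  Space-∞ {b} (o , d) = ∞.G.cast k k≤k (≡.cong (λ n → (ℤ.- b) ℤ.* + Q ℤ.- + (Q ℕ.∸ q ℕ.^ n)) n-top) (degree⇒∞ k k≤k (AllCoeffs-map Degree⇒W k d))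

  -- Negative degree means a zero at T = ∞, hence zeros at all points over T = 1, hence divisibility
  -- by 1 - T, which lowers the degree further. After `loss k` rounds the degree is low enough for
  -- `small-zero`.
  Space-negative : ∀ {f} → Space (ℤ.- + 1) f → f Λₖ.≈ Λₖ.0#
  Space-negative = descend (loss k) 0 (ℕP.+-identityʳ (loss k))
    where
    1≤Q : 1 ℕ.≤ Q
    1≤Q = ℕP.m^n>0 q k
    positive-order : ∀ N → + 1 ℤ.≤ + suc N ℤ.* + Q ℤ.- + (Q ℕ.∸ 1)
    positive-order N = ℤP.≤-trans (ℤP.≤-reflexive (≡.sym (≡.trans (≡.cong (λ j → j ℤ.- + (Q ℕ.∸ 1)) (≡.trans (≡.cong +_ (≡.sym (ℕP.m+[n∸m]≡n 1≤Q))) (ℤP.pos-+ 1 (Q ℕ.∸ 1)))) (lemma (+ 1) (+ (Q ℕ.∸ 1))))))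
      (ℤP.+-monoˡ-≤ (ℤ.- + (Q ℕ.∸ 1)) (≡.subst (+ Q ℤ.≤_) (ℤP.pos-* (suc N) Q) (ℤ.+≤+ (ℕP.m≤m+n Q (N ℕ.* Q)))))
      where
      lemma : ∀ a b → a ℤ.+ b ℤ.- b ≡ a
      lemma = solve-∀
    descend : ∀ j N → j ℕ.+ N ≡ loss k → ∀ {f} → Space -[1+ N ] f → f Λₖ.≈ Λₖ.0#
    descend zero _ ≡.refl (o , d) = small-zero k (loss k) (AllCoeffs-map (V.cast (ℤP.+-identityˡ (ℤ.- + loss k))) k (order⇒coefficients k k≤k o))
      (AllCoeffs-map (λ d → W.mono (≡.subst (+ suc (loss k) ℤ.≤_) (ℤP.pos-* (suc (loss k)) Q) (ℤ.+≤+ (ℕP.m≤m*n (suc (loss k)) Q))) (Degree⇒W d)) k d)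
    descend (suc j) N e {f} sp = scale-w-injective (descend j (suc N) (≡.trans (ℕP.+-suc j N) e) (Space-divide sp λ β →
      let (v , ev) = total k β (AllCoeffs-total k (proj₂ sp)) in Point.resp (point k β) Λₖ.refl (values-vanish k k≤k (proj₁ sp)
        (∞.G.mono k k≤k (positive-order N) (Space-∞ sp)) β ev) ev))

  -- Families of functions and functions dual to points.

  open LinearAlgebra κ _≟_ inverse public
  private
    module cₖ = Hom (constant k)

  index : ∀ i → Coord i → Fin (q ℕ.^ i)
  index zero _ = zero
  index (suc i) (β , a) = combine a (index i β)

  unindex : ∀ i → Fin (q ℕ.^ i) → Coord i
  unindex zero _ = tt
  unindex (suc i) x = unindex i (proj₂ (remQuot {q} (q ℕ.^ i) x)) , proj₁ (remQuot {q} (q ℕ.^ i) x)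

  unindex-index : ∀ i β → unindex i (index i β) ≡ β
  unindex-index zero tt = ≡.refl
  unindex-index (suc i) (β , a) = ≡.trans (≡.cong (λ (b , y) → unindex i y , b) (FinP.remQuot-combine {q} {q ℕ.^ i} a (index i β))) (≡.cong (_, a) (unindex-index i β))

  index-unindex : ∀ i x → index i (unindex i x) ≡ x
  index-unindex zero zero = ≡.refl
  index-unindex (suc i) x = ≡.trans (≡.cong (combine (proj₁ (remQuot {q} (q ℕ.^ i) x))) (index-unindex i _)) (FinP.combine-remQuot {q} (q ℕ.^ i) x)

  -- A space of functions is given as an injective linear image of κ^n, so that its dimension is
  -- simply the number n.
  record Family (n : ℕ) (b : ℤ) : Set (c ⊔ ℓ) where
    field
      Φ : Vector n → Λₖ.Carrier
      Φ-cong : ∀ {v w} → (∀ i → v i κ.≈ w i) → Φ v Λₖ.≈ Φ w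
      Φ-+ : ∀ v w → Φ (λ i → v i κ.+ w i) Λₖ.≈ Φ v Λₖ.+ Φ w
      Φ-* : ∀ x v → Φ (λ i → x κ.* v i) Λₖ.≈ cₖ.⟦ x ⟧ Λₖ.* Φ v
      injective : ∀ v → Φ v Λₖ.≈ Λₖ.0# → ∀ i → v i κ.≈ κ.0#
      member : ∀ v → Space b (Φ v)

    private
      value : ∀ β v → ∃ (Point.Ev (point k β) (Φ v))
      value β v = total k β (AllCoeffs-total k (proj₂ (member v)))

    evaluateAt : Coord k → Functional n
    evaluateAt β = record
      { fun = λ v → proj₁ (value β v)
      ; fun-cong = λ {v} {w} e → P.unique (P.resp (Φ-cong e) κ.refl (proj₂ (value β v))) (proj₂ (value β w))
      ; fun-+ = λ v w → P.unique (proj₂ (value β _)) (P.resp (Λₖ.sym (Φ-+ v w)) κ.refl (P.Ev-+ (proj₂ (value β v)) (proj₂ (value β w))))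
      ; fun-* = λ x v → P.unique (proj₂ (value β _)) (P.resp (Λₖ.sym (Φ-* x v)) κ.refl (P.Ev-* (P.Ev-scalar x) (proj₂ (value β v)))) }
      where module P = Point (point k β)

    evaluate : ∀ β v → Point.Ev (point k β) (Φ v) (fun (evaluateAt β) v)
    evaluate β v = proj₂ (value β v)

  record DualFunctions (r : ℕ) (b : ℤ) : Set (c ⊔ ℓ) where
    field
      P : Fin r → Coord k
      f : Fin r → Λₖ.Carrier
      member : ∀ l → Space b (f l)
      diagonal : ∀ l → Point.Ev (point k (P l)) (f l) κ.1#
      off-diagonal : ∀ l l′ → l ≢ l′ → Point.Ev (point k (P l)) (f l′) κ.0#

  Space-mono : ∀ {b b′ f} → b ℤ.≤ b′ → Space b f → Space b′ f
  Space-mono le (o , d) = o , AllCoeffs-map (Degree-mono le) k d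

  raise : ∀ {r b b′} → b ℤ.≤ b′ → DualFunctions r b → DualFunctions r b′
  raise le D = record { D hiding (member) ; member = λ l → Space-mono le (D.member l) }
    where module D = DualFunctions D

  -- r is the rank of evaluation at the Q points. The pivots give points and dual functions; the
  -- functions in the kernel vanish at all points and are divided by 1 - T.
  separate : ∀ {n b} → Family n b → ∃ λ r → ∃ λ n′ → n ≡ r ℕ.+ n′ × DualFunctions r b × Family n′ (ℤ.pred b)
  separate {n} {b} fam = S.r , S.n′ , S.n≡ ,
    record { P = λ l → unindex k (S.pivot l) ; f = λ l → Φ (S.W l) ; member = λ l → member (S.W l)
      ; diagonal = λ l → Point.resp (point k (unindex k (S.pivot l))) Λₖ.refl (S.diagonal l) (evaluate _ (S.W l))
      ; off-diagonal = λ l l′ l≢l′ → Point.resp (point k (unindex k (S.pivot l))) Λₖ.refl (S.off-diagonal l l′ l≢l′) (evaluate _ (S.W l′)) } ,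
    record
      { Φ = λ v → scale w (Φ (map S.K v))
      ; Φ-cong = λ e → Λₖ.*-congˡ (Φ-cong (map-cong S.K e))
      ; Φ-+ = λ v w′ → Λₖ.trans (Λₖ.*-congˡ (Λₖ.trans (Φ-cong (map-+ S.K v w′)) (Φ-+ _ _))) (Λₖ.distribˡ _ _ _)
      ; Φ-* = λ x v → Λₖ.trans (Λₖ.*-congˡ (Λₖ.trans (Φ-cong (map-* S.K x v)) (Φ-* x _))) (Λₖ.solve 3 (λ w x y → w Λₖ.:* (x Λₖ.:* y) Λₖ.:= x Λₖ.:* (w Λₖ.:* y)) Λₖ.refl _ _ _)
      ; injective = λ v e → S.injective v (injective _ (scale-w-injective e))
      ; member = λ v → Space-divide (member (map S.K v)) λ β → Point.resp (point k β) Λₖ.refl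
          (κ.trans (κ.≡⇒≈ (≡.cong (λ β → fun (evaluateAt β) (map S.K v)) (≡.sym (unindex-index k β)))) (tabulate⁻ S.kernel (index k β) v)) (evaluate β (map S.K v)) }
    where
    open Family fam
    module S = Split (split (evaluateAt ∘ unindex k) (tabulate (λ x → x)))

  negative-family : ∀ {n} → Family n (ℤ.- + 1) → n ≡ 0
  negative-family {zero} fam = ≡.refl
  negative-family {suc n} fam = ⊥-elim (0≉1 (κ.sym (Family.injective fam (λ _ → κ.1#) (Space-negative (Family.member fam _)) zero)))

  -- A family of at least 2Q independent functions of degree at most 2.

  private
    poly : ∀ n → (Fin n → κ.Carrier) → R.Carrier
    poly n a = R.horner n (λ j → C.⟦ a j ⟧) T

    poly-step : ∀ n a m → coeff (poly (suc n) a) m κ.≈ coeff C.⟦ a zero ⟧ m κ.+ coeff (poly n (a ∘ suc)) (ℤ.pred m)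
    poly-step n a m = κ.trans (coeff-+ _ _ m) (κ.+-congˡ (coeff-T′ _ m))

    poly-order : ∀ n a → Order (+ 0) (poly n a)
    poly-order zero a m m<0 = coeff-0 m
    poly-order (suc n) a m m<0 = κ.trans (poly-step n a m) (κ.trans (κ.+-cong (coeff-const _ m λ m≡0 → ℤP.<-irrefl m≡0 m<0)
      (poly-order n (a ∘ suc) (ℤ.pred m) (ℤP.≤-<-trans (ℤP.i≤j⇒pred[i]≤j ℤP.≤-refl) m<0))) (κ.+-identityˡ _))

    poly-high : ∀ n a m → + n ℤ.≤ m → coeff (poly n a) m κ.≈ κ.0#
    poly-high zero a m _ = coeff-0 m
    poly-high (suc n) a m n<m = κ.trans (poly-step n a m) (κ.trans (κ.+-cong (coeff-const _ m λ m≡0 → ℤP.<⇒≱ (ℤ.+<+ (s≤s z≤n)) (≡.subst (+ suc n ℤ.≤_) m≡0 n<m))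
      (poly-high n (a ∘ suc) (ℤ.pred m) (ℤP.pred-mono n<m))) (κ.+-identityˡ _))

    poly-coefficient : ∀ n a j → coeff (poly n a) (+ toℕ j) κ.≈ a j
    poly-coefficient (suc n) a zero = κ.trans (poly-step n a (+ 0)) (κ.trans (κ.+-cong (coeff-const-0 (a zero)) (poly-order n (a ∘ suc) (ℤ.- + 1) ℤ.-<+)) (κ.+-identityʳ _))
    poly-coefficient (suc n) a (suc j) = κ.trans (poly-step n a (+ suc (toℕ j))) (κ.trans (κ.+-congʳ (coeff-const _ (+ suc (toℕ j)) λ ())) (κ.trans (κ.+-identityˡ _) (poly-coefficient n (a ∘ suc) j)))

    poly∈O : ∀ n a → V.G (+ 0) (poly n a)
    poly∈O n a = V.cast (ℤP.*-zeroˡ (+ Q)) (Order⇒V {+ 0} (poly-order n a))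

    poly-cong : ∀ n a b → (∀ j → a j κ.≈ b j) → poly n a R.≈ poly n b
    poly-cong n a b e = R.horner-cong n (λ j → C.cong (e j)) R.refl

    poly-+ : ∀ n a b → poly n (λ j → a j κ.+ b j) R.≈ poly n a R.+ poly n b
    poly-+ n a b = R.trans (R.horner-cong n (λ j → C.+-homo (a j) (b j)) R.refl) (R.horner-+ n (λ j → C.⟦ a j ⟧) (λ j → C.⟦ b j ⟧) T)

    poly-* : ∀ n x a → poly n (λ j → x κ.* a j) R.≈ C.⟦ x ⟧ R.* poly n a
    poly-* n x a = R.trans (R.horner-cong n (λ j → C.*-homo x (a j)) R.refl) (R.horner-* n C.⟦ x ⟧ (λ j → C.⟦ a j ⟧) T)

  component : ∀ i → Lev.Λ.Carrier i → Coord i → R.Carrier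
  component zero f _ = f
  component (suc i) f (β , a) = component i (f a) β

  component-cong : ∀ i {f g} → Lev.Λ._≈_ i f g → ∀ β → component i f β R.≈ component i g β
  component-cong zero e _ = e
  component-cong (suc i) e (β , a) = component-cong i (at e a) β

  component-+ : ∀ i f g β → component i (Lev.Λ._+_ i f g) β R.≈ component i f β R.+ component i g β
  component-+ zero f g _ = R.refl
  component-+ (suc i) f g (β , a) = component-+ i (f a) (g a) β

  component-* : ∀ i x f β → component i (Lev.Λ._*_ i (Hom.⟦_⟧ (Lev.η i) x) f) β R.≈ x R.* component i f β
  component-* zero x f _ = R.refl
  component-* (suc i) x f (β , a) = R.trans (component-cong i (Lev.E.ι* i _ f a) β) (component-* i x (f a) β)

  component⇒AllCoeffs : ∀ {s} {P : R.Carrier → Set s} i {f} → (∀ β → P (component i f β)) → AllCoeffs P i f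
  component⇒AllCoeffs zero h = h tt
  component⇒AllCoeffs (suc i) h a = component⇒AllCoeffs i (λ β → h (β , a))

  trunc : R.Carrier → R.Carrier
  trunc x = proj₁ (LaurentRing.truncate L (+ 2) x)

  private
    trunc-low : ∀ x m → m ℤ.< + 2 → coeff (trunc x) m κ.≈ coeff x m
    trunc-low x = proj₁ (proj₂ (LaurentRing.truncate L (+ 2) x))

    trunc-high : ∀ x m → + 2 ℤ.≤ m → coeff (trunc x) m κ.≈ κ.0#
    trunc-high x = proj₂ (proj₂ (LaurentRing.truncate L (+ 2) x))

    by-trunc : ∀ x y → (∀ m → m ℤ.< + 2 → coeff x m κ.≈ coeff y m) → (∀ m → + 2 ℤ.≤ m → coeff x m κ.≈ κ.0#) → trunc y R.≈ x
    by-trunc x y low high = coeff-ext λ m → split-at m (m ℤ.<? + 2)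
      where
      split-at : ∀ m → Dec (m ℤ.< + 2) → coeff (trunc y) m κ.≈ coeff x m
      split-at m (yes m<2) = κ.trans (trunc-low y m m<2) (κ.sym (low m m<2))
      split-at m (no m≮2) = κ.trans (trunc-high y m (ℤP.≮⇒≥ m≮2)) (κ.sym (high m (ℤP.≮⇒≥ m≮2)))

    trunc-cong : ∀ {x y} → x R.≈ y → trunc x R.≈ trunc y
    trunc-cong {x} {y} e = by-trunc (trunc y) x (λ m m<2 → κ.trans (trunc-low y m m<2) (κ.sym (coeff-cong e m))) (trunc-high y)

    trunc-+ : ∀ x y → trunc (x R.+ y) R.≈ trunc x R.+ trunc y
    trunc-+ x y = by-trunc _ _ (λ m m<2 → κ.trans (coeff-+ _ _ m) (κ.trans (κ.+-cong (trunc-low x m m<2) (trunc-low y m m<2)) (κ.sym (coeff-+ x y m))))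
      (λ m 2≤m → κ.trans (coeff-+ _ _ m) (κ.trans (κ.+-cong (trunc-high x m 2≤m) (trunc-high y m 2≤m)) (κ.+-identityˡ _)))

    trunc-* : ∀ a x → trunc (C.⟦ a ⟧ R.* x) R.≈ C.⟦ a ⟧ R.* trunc x
    trunc-* a x = by-trunc _ _ (λ m m<2 → κ.trans (coeff-const* a _ m) (κ.trans (κ.*-congˡ (trunc-low x m m<2)) (κ.sym (coeff-const* a x m))))
      (λ m 2≤m → κ.trans (coeff-const* a _ m) (κ.trans (κ.*-congˡ (trunc-high x m 2≤m)) (κ.zeroʳ a)))

  truncΛ : ∀ i → Lev.Λ.Carrier i → Lev.Λ.Carrier i
  truncΛ zero f = trunc f
  truncΛ (suc i) f a = truncΛ i (f a)

  private
    truncΛ-cong : ∀ i {f g} → Lev.Λ._≈_ i f g → Lev.Λ._≈_ i (truncΛ i f) (truncΛ i g)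
    truncΛ-cong zero e = trunc-cong e
    truncΛ-cong (suc i) e = pw λ a → truncΛ-cong i (at e a)

    truncΛ-+ : ∀ i f g → Lev.Λ._≈_ i (truncΛ i (Lev.Λ._+_ i f g)) (Lev.Λ._+_ i (truncΛ i f) (truncΛ i g))
    truncΛ-+ zero f g = trunc-+ f g
    truncΛ-+ (suc i) f g = pw λ a → truncΛ-+ i (f a) (g a)

    truncΛ-* : ∀ i x f → Lev.Λ._≈_ i (truncΛ i (Lev.Λ._*_ i (Hom.⟦_⟧ (constant i) x) f)) (Lev.Λ._*_ i (Hom.⟦_⟧ (constant i) x) (truncΛ i f))
    truncΛ-* zero x f = trunc-* x f
    truncΛ-* (suc i) x f = pw λ a → Lev.Λ.trans i (truncΛ-cong i (Lev.E.ι* i _ f a)) (Lev.Λ.trans i (truncΛ-* i x (f a)) (Lev.Λ.sym i (Lev.E.ι* i _ (truncΛ (suc i) f) a)))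

    truncΛ-degree : ∀ i f → AllCoeffs (Degree (+ 1)) i (truncΛ i f)
    truncΛ-degree zero f m 1<m = trunc-high f m (ℤP.i<j⇒suc[i]≤j 1<m)
    truncΛ-degree (suc i) f a = truncΛ-degree i (f a)

  -- Errors divisible by T^A stay harmless after the loss in `coefficients⇒order`, and with A
  -- coefficients for each of the Q coordinates, the Q · `loss k` conditions `Gap` leave dimension
  -- at least 2Q.
  A : ℕ
  A = 2 ℕ.+ loss k

  -- The coefficients of T^2 up to T^(A-1) vanish, so that cutting off everything from T^2 on
  -- changes x by a multiple of T^A only.
  Gap : R.Carrier → Set ℓ
  Gap x = ∀ (j : Fin (loss k)) → coeff x (+ (2 ℕ.+ toℕ j)) κ.≈ κ.0#

  private
    truncΛ-difference : ∀ i {f} → AllCoeffs Gap i f → AllCoeffs (V.G (+ A ℤ.* + Q)) i (Lev.Λ._-_ i (truncΛ i f) f)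
    truncΛ-difference zero {f} gap m m< = κ.trans (coeff-minus _ _ m) (κ.x≈y⇒x-y≈0 (compare m (m ℤ.<? + 2) (ℤP.*-cancelʳ-<-nonNeg (+ Q) m<)))
      where
      compare : ∀ m → Dec (m ℤ.< + 2) → m ℤ.< + A → coeff (trunc f) m κ.≈ coeff f m
      compare m (yes m<2) _ = trunc-low f m m<2
      compare m (no m≮2) m<A = κ.trans (trunc-high f m (ℤP.≮⇒≥ m≮2)) (κ.sym (in-gap m (ℤP.≮⇒≥ m≮2) m<A))
        where
        in-gap : ∀ m → + 2 ℤ.≤ m → m ℤ.< + A → coeff f m κ.≈ κ.0#
        in-gap (+ suc (suc n)) _ (ℤ.+<+ (s≤s (s≤s n<))) = κ.trans (κ.≡⇒≈ (≡.cong (λ n → coeff f (+ (2 ℕ.+ n))) (≡.sym (FinP.toℕ-fromℕ< n<)))) (gap (Data.Fin.fromℕ< n<))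
        in-gap (+ zero) (ℤ.+≤+ ()) _
        in-gap (+ suc zero) (ℤ.+≤+ (s≤s ())) _
    truncΛ-difference (suc i) gap a = truncΛ-difference i (gap a)

    entry : Vector (Q ℕ.* A) → Coord k → R.Carrier
    entry v β = poly A (λ j → v (combine (index k β) j))

    element : Vector (Q ℕ.* A) → Λₖ.Carrier
    element v = Θ k k≤k (entry v)

    at-index : Vector (Q ℕ.* A) → Coord k → Fin A → κ.Carrier
    at-index v β j = v (combine (index k β) j)

    element-cong : ∀ {v w} → (∀ i → v i κ.≈ w i) → element v Λₖ.≈ element w
    element-cong {v} {w} e = Θ-cong k k≤k {entry v} {entry w} λ β → poly-cong A (at-index v β) (at-index w β) (λ j → e (combine (index k β) j))

    element-+ : ∀ v w → element (λ i → v i κ.+ w i) Λₖ.≈ element v Λₖ.+ element w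
    element-+ v w = Λₖ.trans (Θ-cong k k≤k {entry (λ i → v i κ.+ w i)} {λ β → entry v β R.+ entry w β} λ β → poly-+ A (at-index v β) (at-index w β))
      (Θ-+ k k≤k (entry v) (entry w))

    element-* : ∀ x v → element (λ i → x κ.* v i) Λₖ.≈ cₖ.⟦ x ⟧ Λₖ.* element v
    element-* x v = Λₖ.trans (Θ-cong k k≤k {entry (λ i → x κ.* v i)} {λ β → C.⟦ x ⟧ R.* entry v β} λ β → poly-* A x (at-index v β))
      (Λₖ.trans (Θ-* k k≤k C.⟦ x ⟧ (entry v)) (Λₖ.*-congʳ (Λₖ.sym (constant-η k x))))

    coefficient : Fin (Q ℕ.* loss k) → Functional (Q ℕ.* A)
    coefficient x = record
      { fun = λ v → coeff (component k (element v) β) m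
      ; fun-cong = λ e → coeff-cong (component-cong k (element-cong e) β) m
      ; fun-+ = λ v w → κ.trans (coeff-cong (R.trans (component-cong k (element-+ v w) β) (component-+ k _ _ β)) m) (coeff-+ _ _ m)
      ; fun-* = λ a v → κ.trans (coeff-cong (R.trans (component-cong k (Λₖ.trans (element-* a v) (Λₖ.*-congʳ (constant-η k a))) β) (component-* k C.⟦ a ⟧ _ β)) m) (coeff-const* a _ m) }
      where
      β : Coord k
      β = unindex k (proj₁ (remQuot {Q} (loss k) x))
      m : ℤ
      m = + (2 ℕ.+ toℕ (proj₂ (remQuot {Q} (loss k) x)))

    module S = Split (split coefficient (tabulate (λ x → x)))

    gap : ∀ v → AllCoeffs Gap k (element (map S.K v))
    gap v = component⇒AllCoeffs k λ β j → κ.trans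
      (κ.≡⇒≈ (≡.sym (≡.trans (≡.cong (λ (y , j) → coeff (component k (element (map S.K v)) (unindex k y)) (+ (2 ℕ.+ toℕ j))) (FinP.remQuot-combine {Q} {loss k} (index k β) j))
        (≡.cong (λ β → coeff (component k (element (map S.K v)) β) (+ (2 ℕ.+ toℕ j))) (unindex-index k β)))))
      (tabulate⁻ S.kernel (combine (index k β) j) v)

    module I = Independence A

    reduced : ∀ v β → I.Reduced (entry v β)
    reduced v β = poly∈O A (λ j → v (combine (index k β) j)) , poly-high A (λ j → v (combine (index k β) j))

    good : ∀ o {x} → I.Reduced x → I.Good {k} o x
    good (Maybe.just _) r = r
    good Maybe.nothing (g , _) = g

    small : ∀ o {x} → I.Reduced x → I.Small {k} o x → x R.≈ R.0#
    small (Maybe.just _) r e = e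
    small Maybe.nothing r g = I.reduced-small r g

    element-injective : ∀ v → AllCoeffs (V.G (+ A ℤ.* + Q)) k (element v) → ∀ i → v i κ.≈ κ.0#
    element-injective v g i = κ.trans (κ.≡⇒≈ (≡.cong v (≡.sym (≡.trans (≡.cong (λ y → combine y j) (index-unindex k y)) (FinP.combine-remQuot {Q} A i)))))
      (κ.trans (κ.sym (poly-coefficient A (λ j → v (combine (index k β) j)) j))
        (κ.trans (coeff-cong (small (owner k β) (reduced v β) (I.independence k k≤k (entry v) (λ β → good (owner k β) (reduced v β)) g β)) (+ toℕ j)) (coeff-0 _)))
      where
      y : Fin Q
      y = proj₁ (remQuot {Q} A i)
      j : Fin A
      j = proj₂ (remQuot {Q} A i)
      β : Coord k
      β = unindex k y

    loss≤ : + 0 ℤ.≤ + A ℤ.* + Q ℤ.- + loss k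
    loss≤ = ℤP.i≤j⇒0≤j-i (≡.subst (+ loss k ℤ.≤_) (ℤP.pos-* A Q) (ℤ.+≤+ (ℕP.≤-trans (ℕP.m≤n+m (loss k) 2) (ℕP.m≤m*n A Q))))

    scale-T-injective : ∀ {f} → scale T f Λₖ.≈ Λₖ.0# → f Λₖ.≈ Λₖ.0#
    scale-T-injective {f} e = Λₖ.trans (Λₖ.sym (Λₖ.*-identityˡ f)) (Λₖ.trans (Λₖ.*-congʳ (Λₖ.trans (Λₖ.sym (Hom.1-homo (Lev.η k))) (Λₖ.trans (Hom.cong (Lev.η k) (R.trans (R.sym T*T⁻¹) (R.*-comm _ _))) (Hom.*-homo (Lev.η k) _ _))))
      (Λₖ.trans (Λₖ.*-assoc _ _ _) (Λₖ.trans (Λₖ.*-congˡ e) (Λₖ.zeroʳ _))))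

    -- T times the element has no pole over T = 0, but its coefficients are series. By the gap,
    -- truncating them changes the element by coefficients divisible by T^A, which have order at
    -- least A Q - `loss k` ≥ 0 at all places over T = 0. The degree is 1 from the truncation and 1
    -- from the factor T.
    initial-member : ∀ v → Space (+ 2) (scale T (truncΛ k (element (map S.K v))))
    initial-member v = Order₀-resp k k≤k
        (Λₖ.solve 3 (λ t f g → t Λₖ.:* f Λₖ.:+ t Λₖ.:* (g Λₖ.:- f) Λₖ.:= t Λₖ.:* g) Λₖ.refl (Hom.⟦_⟧ (Lev.η k) T) f (truncΛ k f))
        (Order₀-+ k k≤k (TΘ-order k k≤k {entry (map S.K v)} (λ β → proj₁ (reduced (map S.K v) β))) (Order₀-* {+ 0} {+ 0} k k≤k (Order₀-η k k≤k (V.mono (ℤ.+≤+ z≤n) V-T))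
          (Order₀-mono k k≤k loss≤ (coefficients⇒order k k≤k (truncΛ-difference k (gap v)))))) ,
      AllCoeffs-scale T Degree-resp (λ d _ → Degree-* Degree-T d) k (truncΛ-degree k f) (truncΛ-degree k f)
      where
      f : Λₖ.Carrier
      f = element (map S.K v)

    initial : Family S.n′ (+ 2)
    initial = record
      { Φ = λ v → scale T (truncΛ k (element (map S.K v)))
      ; Φ-cong = λ e → Λₖ.*-congˡ (truncΛ-cong k (element-cong (map-cong S.K e)))
      ; Φ-+ = λ v w → Λₖ.trans (Λₖ.*-congˡ (Λₖ.trans (truncΛ-cong k (Λₖ.trans (element-cong (map-+ S.K v w)) (element-+ (map S.K v) (map S.K w)))) (truncΛ-+ k (element (map S.K v)) (element (map S.K w))))) (Λₖ.distribˡ _ _ _)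
      ; Φ-* = λ x v → Λₖ.trans (Λₖ.*-congˡ (Λₖ.trans (truncΛ-cong k (Λₖ.trans (element-cong (map-* S.K x v)) (element-* x (map S.K v)))) (truncΛ-* k x (element (map S.K v)))))
          (Λₖ.solve 3 (λ w x y → w Λₖ.:* (x Λₖ.:* y) Λₖ.:= x Λₖ.:* (w Λₖ.:* y)) Λₖ.refl _ _ _)
      -- If the truncation is zero, the element itself has coefficients divisible by T^A, and the
      -- independence of the coordinates makes them zero.
      ; injective = λ v e → S.injective v (element-injective (map S.K v) (AllCoeffs-resp V.resp k (Λₖ.trans (Λₖ.-‿cong (Λₖ.+-congʳ (scale-T-injective e))) (Λₖ.solve 1 (λ f → Λₖ.:- (Λₖ.con (+ 0) Λₖ.:- f) Λₖ.:= f) Λₖ.refl _))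
          (negate k (truncΛ-difference k (gap v)))))
      ; member = initial-member }
      where
      negate : ∀ i {f t} → AllCoeffs (V.G t) i f → AllCoeffs (V.G t) i (Lev.Λ.-_ i f)
      negate zero g = V.G-neg g
      negate (suc i) g a = negate i (g a)

    -- There are Q (2 + `loss k`) unknowns and the rank of the conditions is at most Q · `loss k`.
    2Q≤ : 2 ℕ.* Q ℕ.≤ S.n′
    2Q≤ = ℕP.+-cancelˡ-≤ S.r _ _ (ℕP.≤-trans (ℕP.+-monoˡ-≤ (2 ℕ.* Q) (ℕP.≤-trans S.r≤ (ℕP.≤-reflexive (length-tabulate {n = Q ℕ.* loss k} (λ x → x)))))
      (ℕP.≤-trans (ℕP.≤-reflexive (≡.trans (ℕP.+-comm (Q ℕ.* loss k) _) (≡.trans (≡.cong (ℕ._+ Q ℕ.* loss k) (ℕP.*-comm 2 Q)) (≡.sym (ℕP.*-distribˡ-+ Q 2 (loss k)))))) (ℕP.≤-reflexive S.n≡)))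

    third : ∀ N a b c → N ℕ.≤ a ℕ.+ (b ℕ.+ c) → N ℕ.≤ 3 ℕ.* a ⊎ N ℕ.≤ 3 ℕ.* b ⊎ N ℕ.≤ 3 ℕ.* c
    third N a b c N≤ with N ℕ.≤? 3 ℕ.* a | N ℕ.≤? 3 ℕ.* b
    ... | yes h | _ = inj₁ h
    ... | no _ | yes h = inj₂ (inj₁ h)
    ... | no ¬a | no ¬b = inj₂ (inj₂ (ℕP.+-cancelˡ-≤ (N ℕ.+ N) N _ (ℕP.≤-trans (ℕP.≤-reflexive (three N)) (ℕP.≤-trans (ℕP.*-monoʳ-≤ 3 N≤)
      (ℕP.≤-trans (ℕP.≤-reflexive (distribute a b c)) (ℕP.+-monoˡ-≤ (3 ℕ.* c) (ℕP.+-mono-≤ (ℕP.<⇒≤ (ℕP.≰⇒> ¬a)) (ℕP.<⇒≤ (ℕP.≰⇒> ¬b)))))))))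
      where
      three : ∀ N → N ℕ.+ N ℕ.+ N ≡ 3 ℕ.* N
      three = ℕSolver.solve-∀
      distribute : ∀ a b c → 3 ℕ.* (a ℕ.+ (b ℕ.+ c)) ≡ 3 ℕ.* a ℕ.+ 3 ℕ.* b ℕ.+ 3 ℕ.* c
      distribute = ℕSolver.solve-∀

  dual-functions : ∃ λ s → 2 ℕ.* Q ℕ.≤ 3 ℕ.* s × DualFunctions s (+ 2)
  dual-functions =
    let (a , n₁ , e₁ , D₁ , fam₁) = separate initial
        (b , n₂ , e₂ , D₂ , fam₂) = separate fam₁
        (c , n₃ , e₃ , D₃ , fam₃) = separate fam₂
    in choose a b c D₁ D₂ D₃ (third (2 ℕ.* Q) a b c (≡.subst (2 ℕ.* Q ℕ.≤_) (total-dimension a b c e₁ e₂ e₃ (negative-family fam₃)) 2Q≤))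
    where
    total-dimension : ∀ a b c {n n₁ n₂ n₃} → n ≡ a ℕ.+ n₁ → n₁ ≡ b ℕ.+ n₂ → n₂ ≡ c ℕ.+ n₃ → n₃ ≡ 0 → n ≡ a ℕ.+ (b ℕ.+ c)
    total-dimension a b c ≡.refl ≡.refl ≡.refl ≡.refl = ≡.cong (λ x → a ℕ.+ (b ℕ.+ x)) (ℕP.+-identityʳ c)
    choose : ∀ a b c → DualFunctions a (+ 2) → DualFunctions b (+ 1) → DualFunctions c (+ 0) →
      2 ℕ.* Q ℕ.≤ 3 ℕ.* a ⊎ 2 ℕ.* Q ℕ.≤ 3 ℕ.* b ⊎ 2 ℕ.* Q ℕ.≤ 3 ℕ.* c → ∃ λ s → 2 ℕ.* Q ℕ.≤ 3 ℕ.* s × DualFunctions s (+ 2)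
    choose a b c D₁ D₂ D₃ (inj₁ h) = a , h , D₁
    choose a b c D₁ D₂ D₃ (inj₂ (inj₁ h)) = b , h , raise (ℤ.+≤+ (s≤s z≤n)) D₂
    choose a b c D₁ D₂ D₃ (inj₂ (inj₂ h)) = c , h , raise (ℤ.+≤+ z≤n) D₃

  -- Expansions at T = ∞ with coefficients in K, and independence of products.

  -- The completion at the place T = ∞ has the residue field κ = K(α) and the uniformiser t. There ξ = α + t
  -- generates the integers over K: its polynomials in γ = ξ² - ξ - b approximate every integral element.
  module Expansion {K : CommutativeRing c ℓ} (incl : Hom K κ) (b : CommutativeRing.Carrier K) (α : κ.Carrier)
    (α² : α κ.* α κ.≈ Hom.⟦_⟧ incl b κ.+ α) (ω₀≉0 : ¬ α κ.+ α κ.- κ.1# κ.≈ κ.0#)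
    (re im : κ.Carrier → CommutativeRing.Carrier K) (split : ∀ y → y κ.≈ Hom.⟦_⟧ incl (re y) κ.+ Hom.⟦_⟧ incl (im y) κ.* α) where
    private
      module 𝕂 = RingKit K
    open Polynomials K public

    ω₀ : κ.Carrier
    ω₀ = α κ.+ α κ.- κ.1#

    private
      module c = Hom (constant k)
    module G = Filtration (Infinity.filtration (infinity k k≤k))

    lift : Hom K (Lev.Λ k)
    lift = constant k ∘ᴴ incl

    U t ξ : Λₖ.Carrier
    U = Lev.U k
    t = Lev.D k
    ξ = c.⟦ α ⟧ Λₖ.+ t

    open Eval lift ξ public

    t-order : G.G (+ 1) t
    t-order = G.cast (≡.cong e n-top) (∞.D-order k k≤k)

    U-order : G.G (ℤ.- + 1) U
    U-order = G.cast (≡.cong (λ n → ℤ.- e n) n-top) (∞.U-order k k≤k)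

    lift-order : ∀ a → G.G (+ 0) (Hom.⟦_⟧ lift a)
    lift-order a = constant-∞ k k≤k (Hom.⟦_⟧ incl a)

    t^-order : ∀ j → G.G (+ j) (t Λₖ.^ j)
    t^-order j = G.cast (ℤP.*-identityʳ (+ j)) (G.G-^ t-order j)

    U^-order : ∀ j → G.G (ℤ.- + j) (U Λₖ.^ j)
    U^-order j = G.cast (≡.trans (≡.sym (ℤP.neg-distribʳ-* (+ j) (+ 1))) (≡.cong ℤ.-_ (ℤP.*-identityʳ (+ j)))) (G.G-^ U-order j)

    U^*t^ : ∀ j → U Λₖ.^ j Λₖ.* t Λₖ.^ j Λₖ.≈ Λₖ.1#
    U^*t^ j = Λₖ.trans (Λₖ.sym (Λₖ.^-distrib-* U t j)) (Λₖ.trans (Λₖ.^-congˡ j (Lev.U*D k)) (Λₖ.1^ j))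

    private
      γ : List 𝕂.Carrier
      γ = 𝕂.- b ∷ 𝕂.- 𝕂.1# ∷ 𝕂.1# ∷ []

      cα² : c.⟦ α ⟧ Λₖ.* c.⟦ α ⟧ Λₖ.≈ Hom.⟦_⟧ lift b Λₖ.+ c.⟦ α ⟧
      cα² = Λₖ.trans (Λₖ.sym (c.*-homo α α)) (Λₖ.trans (c.cong α²) (c.+-homo _ α))

      cω₀ : c.⟦ ω₀ ⟧ Λₖ.≈ c.⟦ α ⟧ Λₖ.+ c.⟦ α ⟧ Λₖ.- Λₖ.1#
      cω₀ = Λₖ.trans (HomProperties.minus-homo (constant k) _ _) (Λₖ.+-cong (c.+-homo α α) (Λₖ.-‿cong c.1-homo))

      -- At ξ = α + t the relation α² = b + α cancels the constant term and leaves (2α - 1 + t) t.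
      -- Since 2α - 1 ≠ 0, a polynomial over K thus takes a uniformiser as its value.
      eval-γ : eval γ Λₖ.≈ (c.⟦ ω₀ ⟧ Λₖ.+ t) Λₖ.* t
      eval-γ = begin
        eval γ
          ≈⟨ Λₖ.+-cong (HomProperties.-‿homo lift b) (Λₖ.*-congˡ (Λₖ.+-cong (Λₖ.trans (HomProperties.-‿homo lift 𝕂.1#) (Λₖ.-‿cong (Hom.1-homo lift))) (Λₖ.*-congˡ eval-one))) ⟩
        Λₖ.- B Λₖ.+ (a Λₖ.+ t) Λₖ.* (Λₖ.- Λₖ.1# Λₖ.+ (a Λₖ.+ t) Λₖ.* Λₖ.1#)
          ≈⟨ Λₖ.solve 3 (λ a b t → Λₖ.:- b Λₖ.:+ (a Λₖ.:+ t) Λₖ.:* (Λₖ.:- Λₖ.con (+ 1) Λₖ.:+ (a Λₖ.:+ t) Λₖ.:* Λₖ.con (+ 1)) Λₖ.:= (a Λₖ.:* a Λₖ.:- (b Λₖ.:+ a)) Λₖ.:+ (a Λₖ.:+ a Λₖ.:- Λₖ.con (+ 1) Λₖ.:+ t) Λₖ.:* t) Λₖ.refl a B t ⟩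
        (a Λₖ.* a Λₖ.- (B Λₖ.+ a)) Λₖ.+ (a Λₖ.+ a Λₖ.- Λₖ.1# Λₖ.+ t) Λₖ.* t
          ≈⟨ Λₖ.+-cong (Λₖ.x≈y⇒x-y≈0 cα²) (Λₖ.*-congʳ (Λₖ.+-congʳ (Λₖ.sym cω₀))) ⟩
        Λₖ.0# Λₖ.+ (c.⟦ ω₀ ⟧ Λₖ.+ t) Λₖ.* t
          ≈⟨ Λₖ.+-identityˡ _ ⟩
        (c.⟦ ω₀ ⟧ Λₖ.+ t) Λₖ.* t ∎
        where
        open Λₖ using (begin_; step-≈-⟩; _∎)
        a B : Λₖ.Carrier
        a = c.⟦ α ⟧
        B = Hom.⟦_⟧ lift b

      γ^U^ : ∀ j → eval γ Λₖ.^ j Λₖ.* U Λₖ.^ j Λₖ.≈ (c.⟦ ω₀ ⟧ Λₖ.+ t) Λₖ.^ j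
      γ^U^ j = Λₖ.trans (Λₖ.sym (Λₖ.^-distrib-* (eval γ) U j)) (Λₖ.^-congˡ j (Λₖ.trans (Λₖ.*-congʳ eval-γ) (Λₖ.trans (Λₖ.*-assoc _ t U)
        (Λₖ.trans (Λₖ.*-congˡ (Λₖ.trans (Λₖ.*-comm t U) (Lev.U*D k))) (Λₖ.*-identityʳ _)))))

      ω₀⁻¹ : ∃ λ y → ω₀ κ.* y κ.≈ κ.1#
      ω₀⁻¹ = inverse ω₀ ω₀≉0

      -- The linear polynomial re y + im y X takes a value congruent to y at ξ, so polynomials over
      -- K reach every residue in κ.
      line : κ.Carrier → List 𝕂.Carrier
      line y = re y ∷ im y ∷ []

      eval-line : ∀ y → eval (line y) Λₖ.≈ c.⟦ y ⟧ Λₖ.+ Hom.⟦_⟧ lift (im y) Λₖ.* t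
      eval-line y = Λₖ.trans (Λₖ.solve 4 (λ a a′ z t → a Λₖ.:+ (z Λₖ.:+ t) Λₖ.:* (a′ Λₖ.:+ (z Λₖ.:+ t) Λₖ.:* Λₖ.con (+ 0)) Λₖ.:= a Λₖ.:+ a′ Λₖ.:* z Λₖ.:+ a′ Λₖ.:* t) Λₖ.refl
          (Hom.⟦_⟧ lift (re y)) (Hom.⟦_⟧ lift (im y)) c.⟦ α ⟧ t)
        (Λₖ.+-congʳ (Λₖ.sym (Λₖ.trans (c.cong (split y)) (Λₖ.trans (c.+-homo _ _) (Λₖ.+-congˡ (c.*-homo _ α))))))

      -- One digit of the expansion in powers of γ: z is the residue of r / t^j, and its division by
      -- ω₀^j accounts for γ^j having leading term (ω₀ t)^j.
      digit : ∀ j {r} → G.G (+ j) r → ∃ λ y → G.G (+ suc j) (r Λₖ.- eval (line y) Λₖ.* eval γ Λₖ.^ j)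
      digit j {r} g = y , G.resp (Λₖ.trans (Λₖ.*-congʳ difference) (Λₖ.trans (Λₖ.*-assoc _ _ _) (Λₖ.trans (Λₖ.*-congˡ (U^*t^ j)) (Λₖ.*-identityʳ _))))
          (G.G-* {+ 1} {+ j} total-order (t^-order j))
        where
        open Congruence (Infinity.filtration (infinity k k≤k))
        leading : ∃ λ z → G.G (+ 1) (r Λₖ.* U Λₖ.^ j Λₖ.- c.⟦ z ⟧)
        leading = residue k k≤k (G.cast (ℤP.+-inverseʳ (+ j)) (G.G-* g (U^-order j)))
        z y : κ.Carrier
        z = proj₁ leading
        y = z κ.* proj₁ ω₀⁻¹ κ.^ j
        ε ly : Λₖ.Carrier
        ε = c.⟦ ω₀ ⟧ Λₖ.+ t
        ly = eval (line y)
        yω : c.⟦ y ⟧ Λₖ.* c.⟦ ω₀ ⟧ Λₖ.^ j Λₖ.≈ c.⟦ z ⟧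
        yω = Λₖ.trans (Λₖ.*-congˡ (Λₖ.sym (HomProperties.^-homo (constant k) ω₀ j))) (Λₖ.trans (Λₖ.sym (c.*-homo y (ω₀ κ.^ j))) (c.cong
          (κ.trans (κ.*-assoc z _ _) (κ.trans (κ.*-congˡ (κ.trans (κ.sym (κ.^-distrib-* (proj₁ ω₀⁻¹) ω₀ j)) (κ.trans (κ.^-congˡ j (κ.trans (κ.*-comm _ ω₀) (proj₂ ω₀⁻¹))) (κ.1^ j)))) (κ.*-identityʳ z)))))
        A-near : G.G (+ 1) (ly Λₖ.- c.⟦ y ⟧)
        A-near = G.resp (Λₖ.trans (Λₖ.solve 2 (λ a b → b Λₖ.:= a Λₖ.:+ b Λₖ.:- a) Λₖ.refl c.⟦ y ⟧ _) (Λₖ.+-congʳ (Λₖ.sym (eval-line y))))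
          (G.G-* {+ 0} {+ 1} (lift-order (im y)) t-order)
        A-order : G.G (+ 0) ly
        A-order = G.resp (Λₖ.sym (eval-line y)) (G.G-+ (constant-∞ k k≤k y) (G.mono (ℤ.+≤+ z≤n) (G.G-* {+ 0} {+ 1} (lift-order (im y)) t-order)))
        ε-near : G.G (+ 1) (ε Λₖ.^ j Λₖ.- c.⟦ ω₀ ⟧ Λₖ.^ j)
        ε-near = G-cong-^ (G.G-+ (constant-∞ k k≤k ω₀) (G.mono (ℤ.+≤+ z≤n) t-order)) (constant-∞ k k≤k ω₀)
          (G.resp (Λₖ.solve 2 (λ a t → t Λₖ.:= a Λₖ.:+ t Λₖ.:- a) Λₖ.refl c.⟦ ω₀ ⟧ t) t-order) j
        ω^-order : G.G (+ 0) (c.⟦ ω₀ ⟧ Λₖ.^ j)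
        ω^-order = G.cast (ℤP.*-zeroʳ (+ j)) (G.G-^ (constant-∞ k k≤k ω₀) j)
        total-order : G.G (+ 1) ((r Λₖ.* U Λₖ.^ j Λₖ.- c.⟦ z ⟧) Λₖ.- (ly Λₖ.* (ε Λₖ.^ j Λₖ.- c.⟦ ω₀ ⟧ Λₖ.^ j) Λₖ.+ (ly Λₖ.- c.⟦ y ⟧) Λₖ.* c.⟦ ω₀ ⟧ Λₖ.^ j))
        total-order = G.G-+ (proj₂ leading) (G.G-neg (G.G-+ (G.G-* {+ 0} {+ 1} A-order ε-near) (G.G-* {+ 1} {+ 0} A-near ω^-order)))
        difference : (r Λₖ.* U Λₖ.^ j Λₖ.- c.⟦ z ⟧) Λₖ.- (ly Λₖ.* (ε Λₖ.^ j Λₖ.- c.⟦ ω₀ ⟧ Λₖ.^ j) Λₖ.+ (ly Λₖ.- c.⟦ y ⟧) Λₖ.* c.⟦ ω₀ ⟧ Λₖ.^ j)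
          Λₖ.≈ (r Λₖ.- ly Λₖ.* eval γ Λₖ.^ j) Λₖ.* U Λₖ.^ j
        difference = begin
          (r Λₖ.* u Λₖ.- c.⟦ z ⟧) Λₖ.- (ly Λₖ.* (ε Λₖ.^ j Λₖ.- w′) Λₖ.+ (ly Λₖ.- c.⟦ y ⟧) Λₖ.* w′)
            ≈⟨ Λₖ.+-congʳ (Λₖ.+-congˡ (Λₖ.-‿cong (Λₖ.sym yω))) ⟩
          (r Λₖ.* u Λₖ.- c.⟦ y ⟧ Λₖ.* w′) Λₖ.- (ly Λₖ.* (ε Λₖ.^ j Λₖ.- w′) Λₖ.+ (ly Λₖ.- c.⟦ y ⟧) Λₖ.* w′)
            ≈⟨ Λₖ.solve 5 (λ ru y w ly e → (ru Λₖ.:- y Λₖ.:* w) Λₖ.:- (ly Λₖ.:* (e Λₖ.:- w) Λₖ.:+ (ly Λₖ.:- y) Λₖ.:* w) Λₖ.:= ru Λₖ.:- ly Λₖ.:* e) Λₖ.refl (r Λₖ.* u) c.⟦ y ⟧ w′ ly (ε Λₖ.^ j) ⟩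
          r Λₖ.* u Λₖ.- ly Λₖ.* ε Λₖ.^ j
            ≈⟨ Λₖ.+-congˡ (Λₖ.-‿cong (Λₖ.*-congˡ (Λₖ.sym (γ^U^ j)))) ⟩
          r Λₖ.* u Λₖ.- ly Λₖ.* (eval γ Λₖ.^ j Λₖ.* u)
            ≈⟨ Λₖ.solve 4 (λ r u ly g → r Λₖ.:* u Λₖ.:- ly Λₖ.:* (g Λₖ.:* u) Λₖ.:= (r Λₖ.:- ly Λₖ.:* g) Λₖ.:* u) Λₖ.refl r u ly (eval γ Λₖ.^ j) ⟩
          (r Λₖ.- ly Λₖ.* eval γ Λₖ.^ j) Λₖ.* u ∎
          where
          open Λₖ using (begin_; step-≈-⟩; _∎)
          u w′ : Λₖ.Carrier
          u = U Λₖ.^ j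
          w′ = c.⟦ ω₀ ⟧ Λₖ.^ j

      γ^ : ℕ → List 𝕂.Carrier
      γ^ zero = 𝕂.1# ∷ []
      γ^ (suc j) = γ ⊗ γ^ j

      eval-γ^ : ∀ j → eval (γ^ j) Λₖ.≈ eval γ Λₖ.^ j
      eval-γ^ zero = eval-one
      eval-γ^ (suc j) = Λₖ.trans (eval-⊗ γ (γ^ j)) (Λₖ.*-congˡ (eval-γ^ j))

      length-γ^ : ∀ j → length (γ^ j) ℕ.≤ suc (j ℕ.* 3)
      length-γ^ zero = ℕP.≤-refl
      length-γ^ (suc j) = ℕP.≤-trans (length-⊗ γ (γ^ j)) (ℕP.≤-trans (ℕP.+-monoʳ-≤ 3 (length-γ^ j)) (ℕP.≤-reflexive (ℕP.+-suc 3 (j ℕ.* 3))))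

    -- Each digit is allowed length 3, because γ has length 3 and `length-⊗` bounds the length of a
    -- product by the sum of the lengths.
    expand : ∀ j {g} → G.G (+ 0) g → ∃ λ P → length P ℕ.≤ j ℕ.* 3 × G.G (+ j) (g Λₖ.- eval P)
    expand zero {g} o = [] , z≤n , G.resp (Λₖ.solve 1 (λ g → g Λₖ.:= g Λₖ.:- Λₖ.con (+ 0)) Λₖ.refl g) o
    expand (suc j) {g} o = P ⊕ (line y ⊗ γ^ j) ,
        length-⊕ P _ (ℕP.≤-trans (proj₁ (proj₂ IH)) (ℕP.m≤n+m (j ℕ.* 3) 3)) (ℕP.≤-trans (length-⊗ (line y) (γ^ j)) (ℕP.≤-trans (ℕP.+-monoʳ-≤ 2 (length-γ^ j)) (ℕP.≤-reflexive (ℕP.+-suc 2 (j ℕ.* 3))))) ,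
        G.resp (Λₖ.trans (Λₖ.solve 3 (λ g p d → g Λₖ.:- p Λₖ.:- d Λₖ.:= g Λₖ.:- (p Λₖ.:+ d)) Λₖ.refl g (eval P) _)
          (Λₖ.+-congˡ (Λₖ.-‿cong (Λₖ.sym (Λₖ.trans (eval-⊕ P _) (Λₖ.+-congˡ (Λₖ.trans (eval-⊗ (line y) (γ^ j)) (Λₖ.*-congˡ (eval-γ^ j))))))))) (proj₂ next-digit)
      where
      IH : ∃ λ P → length P ℕ.≤ j ℕ.* 3 × G.G (+ j) (g Λₖ.- eval P)
      IH = expand j o
      P : List 𝕂.Carrier
      P = proj₁ IH
      next-digit : ∃ λ y → G.G (+ suc j) ((g Λₖ.- eval P) Λₖ.- eval (line y) Λₖ.* eval γ Λₖ.^ j)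
      next-digit = digit j (proj₂ (proj₂ IH))
      y : κ.Carrier
      y = proj₁ next-digit

    module Assembly {c′ ℓ′} {𝔽 : CommutativeRing c′ ℓ′} (ι : Hom K 𝔽)
      (incl-injective : ∀ x → Hom.⟦_⟧ incl x κ.≈ κ.0# → CommutativeRing._≈_ K x (CommutativeRing.0# K))
      (m : ℕ) (1≤m : 1 ℕ.≤ m) (N : ℕ) (long : 10 ℕ.* (m ℕ.* m) ℕ.* Q ℕ.≤ suc N) (θ : CommutativeRing.Carrier 𝔽)
      (independent-powers : ∀ (a : Fin (suc N) → CommutativeRing.Carrier K) → CommutativeRing._≈_ 𝔽 (RingKit.horner 𝔽 (suc N) (λ i → Hom.⟦_⟧ ι (a i)) θ) (CommutativeRing.0# 𝔽) →
        ∀ i → CommutativeRing._≈_ K (a i) (CommutativeRing.0# K)) where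
      private
        module K = RingKit K
        module F = RingKit 𝔽
        module EvalF = Eval ι θ
        module Sums = FiltrationSums (Infinity.filtration (infinity k k≤k))
        s : ℕ
        s = proj₁ dual-functions
        module D = DualFunctions (proj₂ (proj₂ dual-functions))

        pole precision : ℕ
        -- A pole bound for the dual functions at T = ∞: 2Q for coefficients of degree 2 in T, and Q
        -- - 1 for the monomials.
        pole = 2 ℕ.* Q ℕ.+ (Q ℕ.∸ 1)
        -- A product of m functions has pole order up to m · pole, and its expansion must still be
        -- controlled to positive order.
        precision = m ℕ.* suc pole

        pole-bound : (ℤ.- + 2) ℤ.* + Q ℤ.- + (Q ℕ.∸ 1) ≡ ℤ.- + pole
        pole-bound = ≡.trans (lemma (+ Q) (+ (Q ℕ.∸ 1))) (≡.cong ℤ.-_ (≡.sym (≡.trans (ℤP.pos-+ (2 ℕ.* Q) (Q ℕ.∸ 1)) (≡.cong (λ x → x ℤ.+ + (Q ℕ.∸ 1)) (ℤP.pos-* 2 Q)))))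
          where
          lemma : ∀ a b → (ℤ.- + 2) ℤ.* a ℤ.- b ≡ ℤ.- (+ 2 ℤ.* a ℤ.+ b)
          lemma = solve-∀

        tᵖ uᵖ : Λₖ.Carrier
        tᵖ = t Λₖ.^ pole
        uᵖ = U Λₖ.^ pole

        g : Fin s → Λₖ.Carrier
        g l = tᵖ Λₖ.* D.f l

        g-order : ∀ l → G.G (+ 0) (g l)
        g-order l = G.cast (ℤP.+-inverseʳ (+ pole)) (G.G-* (t^-order pole) (G.cast pole-bound (Space-∞ (D.member l))))

        expansion : ∀ l → ∃ λ P → length P ℕ.≤ precision ℕ.* 3 × G.G (+ precision) (g l Λₖ.- eval P)
        expansion l = expand precision (g-order l)

        P : Fin s → List K.Carrier
        P l = proj₁ (expansion l)

        h : Fin s → Λₖ.Carrier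
        h l = eval (P l)

        h-order : ∀ l → G.G (+ 0) (h l)
        h-order l = G.resp (Λₖ.solve 2 (λ g h → g Λₖ.:- (g Λₖ.:- h) Λₖ.:= h) Λₖ.refl (g l) (h l)) (G.G-+ (g-order l) (G.G-neg (G.mono (ℤ.+≤+ z≤n) (proj₂ (proj₂ (expansion l))))))

        a : Fin s → F.Carrier
        a l = EvalF.eval (P l)

        M : ℕ
        M = s ℕ.^ m

        -- The precision is 3mQ, so each polynomial has length at most 9mQ and a product of m of
        -- them at most 1 + 9m²Q ≤ 10m²Q. This is the origin of the constant 10.
        long-enough : suc (m ℕ.* (precision ℕ.* 3)) ℕ.≤ suc N
        long-enough = ℕP.≤-trans (ℕP.≤-trans (ℕP.+-monoˡ-≤ (m ℕ.* (precision ℕ.* 3)) 1≤) (ℕP.≤-reflexive (≡.trans (≡.cong (λ x → m ℕ.* m ℕ.* Q ℕ.+ m ℕ.* (m ℕ.* x ℕ.* 3)) suc-pole) (lemma m Q)))) long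
          where
          lemma : ∀ m Q → m ℕ.* m ℕ.* Q ℕ.+ m ℕ.* (m ℕ.* (3 ℕ.* Q) ℕ.* 3) ≡ 10 ℕ.* (m ℕ.* m) ℕ.* Q
          lemma = ℕSolver.solve-∀
          1≤Q : 1 ℕ.≤ Q
          1≤Q = ℕP.m^n>0 q k
          1≤ : 1 ℕ.≤ m ℕ.* m ℕ.* Q
          1≤ = ℕP.*-mono-≤ (ℕP.*-mono-≤ 1≤m 1≤m) 1≤Q
          suc-pole : suc pole ≡ 3 ℕ.* Q
          suc-pole = ≡.trans (≡.sym (ℕP.+-suc (2 ℕ.* Q) (Q ℕ.∸ 1))) (≡.trans (≡.cong (2 ℕ.* Q ℕ.+_) (ℕP.m+[n∸m]≡n 1≤Q)) (three Q))
            where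
            three : ∀ Q → 2 ℕ.* Q ℕ.+ Q ≡ 3 ℕ.* Q
            three = ℕSolver.solve-∀

        dual : ∀ {e l : Fin s} → Dec (e ≡ l) → κ.Carrier
        dual (yes _) = κ.1#
        dual (no _) = κ.0#

        dual-Ev : ∀ e l (d : Dec (e ≡ l)) → Point.Ev (point k (D.P e)) (D.f l) (dual d)
        dual-Ev e _ (yes ≡.refl) = D.diagonal e
        dual-Ev e l (no e≢l) = D.off-diagonal e l e≢l

        Order₀-0 : Order₀ (+ 0) k k≤k Λₖ.0#
        Order₀-0 = Order₀-resp k k≤k (HomProperties.0-homo (Lev.η k)) (Order₀-η k k≤k V.G-0)

        Order₀-1 : Order₀ (+ 0) k k≤k Λₖ.1#
        Order₀-1 = Order₀-resp k k≤k (Hom.1-homo (Lev.η k)) (Order₀-η k k≤k V.G-1)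

        Order₀-lift : ∀ x → Order₀ (+ 0) k k≤k (Hom.⟦_⟧ lift x)
        Order₀-lift x = Order₀-resp k k≤k (Λₖ.sym (constant-η k _)) (Order₀-η k k≤k (V-const _))

        Order₀-∑ : ∀ n {f : Fin n → Λₖ.Carrier} → (∀ i → Order₀ (+ 0) k k≤k (f i)) → Order₀ (+ 0) k k≤k (∑ (Lev.Λ k) n f)
        Order₀-∑ zero o = Order₀-0
        Order₀-∑ (suc n) o = Order₀-+ k k≤k (o zero) (Order₀-∑ n (o ∘ suc))

        Order₀-∏ : ∀ n {f : Fin n → Λₖ.Carrier} → (∀ i → Order₀ (+ 0) k k≤k (f i)) → Order₀ (+ 0) k k≤k (∏ (Lev.Λ k) n f)
        Order₀-∏ zero o = Order₀-1
        Order₀-∏ (suc n) o = Order₀-* {+ 0} {+ 0} k k≤k (o zero) (Order₀-∏ n (o ∘ suc))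

        -- Since the powers of θ are independent, a relation between products of the values P_l(θ)
        -- is an identity of polynomials. It therefore holds at ξ too, and approximately for the
        -- functions that the P_l expand.
        module Relation (r : Fin M → K.Carrier) (relation : ∑ 𝔽 M (λ x → Hom.⟦_⟧ ι (r x) F.* ∏ 𝔽 m (λ j → a (finToFun {s} {m} x j))) F.≈ F.0#) where

          combination : (Fin s → Λₖ.Carrier) → Λₖ.Carrier
          combination f = ∑ (Lev.Λ k) M (λ x → Hom.⟦_⟧ lift (r x) Λₖ.* ∏ (Lev.Λ k) m (λ j → f (finToFun {s} {m} x j)))

          polynomial : List K.Carrier
          polynomial = ⨁ M r (λ x → ⨂ m (λ j → P (finToFun {s} {m} x j)))

          polynomial-length : length polynomial ℕ.≤ suc N
          polynomial-length = ℕP.≤-trans (length-⨁ M r _ (suc (m ℕ.* (precision ℕ.* 3))) (λ x → length-⨂ m _ (precision ℕ.* 3) (λ j → proj₁ (proj₂ (expansion (finToFun {s} {m} x j)))))) long-enough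

          coefficients-vanish : ∀ (i : Fin (suc N)) → nth polynomial (toℕ i) K.≈ K.0#
          coefficients-vanish = independent-powers (λ i → nth polynomial (toℕ i)) (F.trans (F.sym (EvalF.eval-horner (suc N) polynomial polynomial-length))
            (F.trans (EvalF.eval-⨁ M r _) (F.trans (F.∑-cong M (λ x → F.*-congˡ (EvalF.eval-⨂ m _))) relation)))

          combination-h : combination h Λₖ.≈ Λₖ.0#
          combination-h = Λₖ.trans (Λₖ.sym (Λₖ.trans (eval-⨁ M r _) (Λₖ.∑-cong M (λ x → Λₖ.*-congˡ (eval-⨂ m _)))))
            (Λₖ.trans (eval-horner (suc N) polynomial polynomial-length) (Λₖ.horner-0 (suc N) (λ i → Hom.⟦_⟧ lift (nth polynomial (toℕ i))) ξ
              (λ i → Λₖ.trans (Hom.cong lift (coefficients-vanish i)) (HomProperties.0-homo lift))))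

          combination-g : G.G (+ precision) (combination g)
          combination-g = G.resp (Λₖ.trans (Λₖ.+-congˡ (Λₖ.-‿cong combination-h)) (Λₖ.trans (Λₖ.+-congˡ Λₖ.-0#≈0#) (Λₖ.+-identityʳ _)))
            (Sums.∑-congruent M (λ x → G.resp (Λₖ.solve 3 (λ r a b → r Λₖ.:* (a Λₖ.:- b) Λₖ.:= r Λₖ.:* a Λₖ.:- r Λₖ.:* b) Λₖ.refl _ _ _)
              (G.cast (ℤP.+-identityˡ (+ precision)) (G.G-* (lift-order (r x)) (Sums.∏-congruent m (λ j → g-order _) (λ j → h-order _) (λ j → proj₂ (proj₂ (expansion (finToFun {s} {m} x j)))))))))

          combination-scale : combination g Λₖ.≈ tᵖ Λₖ.^ m Λₖ.* combination D.f
          combination-scale = Λₖ.trans (Λₖ.∑-cong M (λ x → Λₖ.trans (Λₖ.*-congˡ (Λₖ.∏-* m tᵖ (λ j → D.f (finToFun {s} {m} x j))))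
              (Λₖ.solve 3 (λ r t f → r Λₖ.:* (t Λₖ.:* f) Λₖ.:= t Λₖ.:* (r Λₖ.:* f)) Λₖ.refl _ (tᵖ Λₖ.^ m) _))) (Λₖ.sym (Λₖ.*-∑ M (tᵖ Λₖ.^ m) _))

          -- Removing the factor t^(m · pole) uses up m · pole of the precision m (pole + 1); order
          -- m ≥ 1 is left.
          combination-∞ : G.G (+ 1) (combination D.f)
          combination-∞ = G.resp (Λₖ.trans (Λₖ.*-congˡ combination-scale) (Λₖ.trans (Λₖ.sym (Λₖ.*-assoc _ _ _))
              (Λₖ.trans (Λₖ.*-congʳ (Λₖ.trans (Λₖ.sym (Λₖ.^-distrib-* uᵖ tᵖ m)) (Λₖ.trans (Λₖ.^-congˡ m (U^*t^ pole)) (Λₖ.1^ m)))) (Λₖ.*-identityˡ _))))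
            (G.mono (ℤP.≤-trans (ℤ.+≤+ 1≤m) (ℤP.≤-reflexive (≡.sym order))) (G.G-* (G.G-^ (U^-order pole) m) combination-g))
            where
            lemma : ∀ m p → m ℤ.* (ℤ.- p) ℤ.+ m ℤ.* (+ 1 ℤ.+ p) ≡ m
            lemma = solve-∀
            order : + m ℤ.* (ℤ.- + pole) ℤ.+ + precision ≡ + m
            order = ≡.trans (≡.cong (λ x → + m ℤ.* (ℤ.- + pole) ℤ.+ x) (≡.trans (ℤP.pos-* m (suc pole)) (≡.cong (λ x → + m ℤ.* x) (ℤP.pos-+ 1 pole)))) (lemma (+ m) (+ pole))

          combination-0 : Order₀ (+ 0) k k≤k (combination D.f)
          combination-0 = Order₀-∑ M (λ x → Order₀-* {+ 0} {+ 0} k k≤k (Order₀-lift (r x)) (Order₀-∏ m (λ j → proj₁ (D.member (finToFun {s} {m} x j)))))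

          module _ (e : Fin s) where
            private
              module E = Point (point k (D.P e))
              diagonal : Fin M
              diagonal = funToFin {m} (λ _ → e)

              factor : Fin M → Fin m → κ.Carrier
              factor x j = dual (e FinP.≟ finToFun {s} {m} x j)

              scalar : Fin M → κ.Carrier
              scalar x = Hom.⟦_⟧ incl (r x)

              term : Fin M → κ.Carrier
              term x = scalar x κ.* ∏ κ m (factor x)

              combination-Ev : E.Ev (combination D.f) (∑ κ M term)
              combination-Ev = E.Ev-∑ M (λ x → E.Ev-* (E.Ev-scalar (scalar x)) (E.Ev-∏ m (λ j → dual-Ev e (finToFun {s} {m} x j) (e FinP.≟ finToFun {s} {m} x j))))

              dual-yes : ∀ {l} (d : Dec (e ≡ l)) → e ≡ l → dual d κ.≈ κ.1#
              dual-yes (yes _) _ = κ.refl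
              dual-yes (no e≢l) e≡l = ⊥-elim (e≢l e≡l)

              dual-no : ∀ {l} (d : Dec (e ≡ l)) → e ≢ l → dual d κ.≈ κ.0#
              dual-no (yes e≡l) e≢l = ⊥-elim (e≢l e≡l)
              dual-no (no _) _ = κ.refl

              module OffDiagonal (x : Fin M) (x≢ : x ≢ diagonal) where
                by-search : Dec (∃ λ j → ¬ e ≡ finToFun {s} {m} x j) → term x κ.≈ κ.0#
                by-search (yes (j , e≢)) = κ.trans (κ.*-congˡ {scalar x} (κ.∏-zero m (factor x) j (dual-no (e FinP.≟ finToFun {s} {m} x j) e≢))) (κ.zeroʳ (scalar x))
                by-search (no none) = ⊥-elim (x≢ (≡.trans (≡.sym (FinP.funToFin-finToFin {m} {s} x)) (funToFin-cong {m} {s} {finToFun {s} {m} x} {λ _ → e} (λ j → same j (e FinP.≟ finToFun {s} {m} x j)))))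
                  where
                  same : ∀ j → Dec (e ≡ finToFun {s} {m} x j) → finToFun {s} {m} x j ≡ e
                  same j (yes e≡) = ≡.sym e≡
                  same j (no e≢) = ⊥-elim (none (j , e≢))

              off-diagonal : ∀ x → x ≢ diagonal → term x κ.≈ κ.0#
              off-diagonal x x≢ = OffDiagonal.by-search x x≢ (FinP.any? (λ j → ¬? (e FinP.≟ finToFun {s} {m} x j)))

              on-diagonal : term diagonal κ.≈ scalar diagonal
              on-diagonal = κ.trans (κ.*-congˡ {scalar diagonal} (κ.∏-1 m (factor diagonal) (λ j → dual-yes (e FinP.≟ finToFun {s} {m} diagonal j) (≡.sym (FinP.finToFun-funToFin {m} {s} (λ _ → e) j)))))
                (κ.*-identityʳ (scalar diagonal))

            diagonal-vanishes : r (funToFin {m} (λ _ → e)) K.≈ K.0#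
            diagonal-vanishes = incl-injective (r diagonal) (κ.trans (κ.sym on-diagonal) (κ.trans (κ.sym (κ.∑-single M term diagonal off-diagonal))
              (values-vanish k k≤k combination-0 combination-∞ (D.P e) combination-Ev)))

      independent-products : ∃ λ s → 2 ℕ.* Q ℕ.≤ 3 ℕ.* s × Σ (Fin s → F.Carrier) λ a →
        ∀ (r : Fin (s ℕ.^ m) → K.Carrier) → ∑ 𝔽 (s ℕ.^ m) (λ x → Hom.⟦_⟧ ι (r x) F.* ∏ 𝔽 m (λ j → a (finToFun {s} {m} x j))) F.≈ F.0# →
        ∀ e → r (funToFin {m} (λ _ → e)) K.≈ K.0#
      independent-products = s , proj₁ (proj₂ dual-functions) , a , Relation.diagonal-vanishes

-- A Fredholm alternative, and the subrank from independent products.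

module Fredholm {c ℓ} (K : CommutativeRing c ℓ)
  (_≟_ : ∀ x y → Dec (CommutativeRing._≈_ K x y))
  (inverse : ∀ x → ¬ CommutativeRing._≈_ K x (CommutativeRing.0# K) → ∃ λ y → CommutativeRing._≈_ K (CommutativeRing._*_ K x y) (CommutativeRing.1# K)) where
  open RingKit K
  open Matrices K using (∑-select; ∑*-*)

  -- Either some functional φ takes the prescribed values t on the vectors b x, or these vectors
  -- satisfy a linear relation r that the values t violate.
  Solution Obstruction : ∀ n N → (Fin N → Fin n → Carrier) → (Fin N → Carrier) → Set (c ⊔ ℓ)
  Solution n N b t = Σ (Fin n → Carrier) λ φ → ∀ x → ∑ K n (λ j → φ j * b x j) ≈ t x
  Obstruction n N b t = Σ (Fin N → Carrier) λ r → (∀ j → ∑ K N (λ x → r x * b x j) ≈ 0#) × ∑ K N (λ x → r x * t x) ≈ 1#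

  private
    combine-rows : ∀ N (r r′ : Fin N → Carrier) y (b : Fin N → Carrier) →
      ∑ K N (λ x → (r′ x - y * r x) * b x) ≈ ∑ K N (λ x → r′ x * b x) - y * ∑ K N (λ x → r x * b x)
    combine-rows N r r′ y b = trans (∑-cong N (λ x → solve 4 (λ r r′ y b → (r′ :- y :* r) :* b := r′ :* b :+ (:- y) :* (r :* b)) refl (r x) (r′ x) y (b x)))
      (trans (∑-+ N _ _) (+-congˡ (trans (sym (*-∑ N (- y) _)) (sym (-‿distribˡ-* y _)))))

  private
    alternative-zero : ∀ N b t → Dec (∃ λ x → ¬ t x ≈ 0#) → Solution 0 N b t ⊎ Obstruction 0 N b t
    alternative-zero N b t (yes (x₀ , t≉0)) = inj₂ (pick , (λ ()) , trans (∑-single N _ x₀ other) (trans (*-congʳ on) (trans (*-comm _ _) (proj₂ (inverse (t x₀) t≉0)))))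
      where
      choose : ∀ {x} → Dec (x ≡ x₀) → Carrier
      choose (yes _) = proj₁ (inverse (t x₀) t≉0)
      choose (no _) = 0#
      pick : Fin N → Carrier
      pick x = choose (x FinP.≟ x₀)
      on : pick x₀ ≈ proj₁ (inverse (t x₀) t≉0)
      on with x₀ FinP.≟ x₀
      ... | yes _ = refl
      ... | no x≢x = ⊥-elim (x≢x ≡.refl)
      other : ∀ x → x ≢ x₀ → pick x * t x ≈ 0#
      other x x≢x₀ with x FinP.≟ x₀
      ... | yes x≡x₀ = ⊥-elim (x≢x₀ x≡x₀)
      ... | no _ = zeroˡ _
    alternative-zero N b t (no none) = inj₁ ((λ ()) , λ x → sym (zero-t x (t x ≟ 0#)))
      where
      zero-t : ∀ x → Dec (t x ≈ 0#) → t x ≈ 0#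
      zero-t x (yes e) = e
      zero-t x (no ne) = ⊥-elim (none (x , ne))

    tails : ∀ {n N} → (Fin N → Fin (suc n) → Carrier) → Fin N → Fin n → Carrier
    tails b x j = b x (suc j)

    module _ {n N : ℕ} (b : Fin N → Fin (suc n) → Carrier) (t : Fin N → Carrier) where

      -- eliminating the first unknown with an obstruction for the others, of pivot μ
      module Eliminate (r : Fin N → Carrier) (e : ∀ j → ∑ K N (λ x → r x * b x (suc j)) ≈ 0#) (e₁ : ∑ K N (λ x → r x * t x) ≈ 1#)
        (μ⁻¹ : Carrier) (μμ⁻¹ : ∑ K N (λ x → r x * b x zero) * μ⁻¹ ≈ 1#) where

        reduced : Fin N → Carrier
        reduced x = t x - μ⁻¹ * b x zero

        solution : Solution n N (tails b) reduced → Solution (suc n) N b t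
        solution (φ , e′) = (λ { zero → μ⁻¹ ; (suc j) → φ j }) , λ x → trans (+-congˡ (e′ x)) (solve 2 (λ a t → a :+ (t :- a) := t) refl (μ⁻¹ * b x zero) (t x))

        obstruction : Obstruction n N (tails b) reduced → Obstruction (suc n) N b t
        obstruction (r′ , e′ , e₁′) = (λ x → r′ x - ν * μ⁻¹ * r x) , relation , normalised
          where
          ν : Carrier
          ν = ∑ K N (λ x → r′ x * b x zero)
          relation : ∀ j → ∑ K N (λ x → (r′ x - ν * μ⁻¹ * r x) * b x j) ≈ 0#
          relation zero = trans (combine-rows N r r′ (ν * μ⁻¹) (λ x → b x zero)) (x≈y⇒x-y≈0 (sym (trans (*-assoc ν μ⁻¹ _) (trans (*-congˡ (trans (*-comm μ⁻¹ _) μμ⁻¹)) (*-identityʳ ν)))))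
          relation (suc j) = trans (combine-rows N r r′ (ν * μ⁻¹) (λ x → b x (suc j))) (trans (+-cong (e′ j) (-‿cong (trans (*-congˡ (e j)) (zeroʳ _)))) (trans (+-congˡ -0#≈0#) (+-identityʳ 0#)))
          expansion : ∑ K N (λ x → r′ x * reduced x) ≈ ∑ K N (λ x → r′ x * t x) - ν * μ⁻¹ * 1#
          expansion = trans (∑-cong N (λ x → solve 4 (λ r t m b → r :* (t :- m :* b) := r :* t :+ (:- m) :* (r :* b)) refl (r′ x) (t x) μ⁻¹ (b x zero)))
            (trans (∑-+ N _ _) (+-congˡ (trans (sym (*-∑ N (- μ⁻¹) _)) (solve 2 (λ m n → (:- m) :* n := :- (n :* m :* con (+ 1))) refl μ⁻¹ ν))))
          normalised : ∑ K N (λ x → (r′ x - ν * μ⁻¹ * r x) * t x) ≈ 1#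
          normalised = trans (combine-rows N r r′ (ν * μ⁻¹) t) (trans (+-congˡ (-‿cong (*-congˡ e₁))) (trans (sym expansion) e₁′))

      eliminate : (∀ t′ → Solution n N (tails b) t′ ⊎ Obstruction n N (tails b) t′) → Solution (suc n) N b t ⊎ Obstruction (suc n) N b t
      eliminate again = first (again t)
        where
        first : Solution n N (tails b) t ⊎ Obstruction n N (tails b) t → Solution (suc n) N b t ⊎ Obstruction (suc n) N b t
        first (inj₁ (φ , e)) = inj₁ ((λ { zero → 0# ; (suc j) → φ j }) , λ x → trans (+-cong (zeroˡ _) (e x)) (+-identityˡ _))
        -- An obstruction for the other unknowns either kills the first column as well, and then
        -- remains one, or it forces the first unknown to be the inverse of the pivot.
        first (inj₂ (r , e , e₁)) = pivot (∑ K N (λ x → r x * b x zero) ≟ 0#)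
          where
          pivot : Dec (∑ K N (λ x → r x * b x zero) ≈ 0#) → Solution (suc n) N b t ⊎ Obstruction (suc n) N b t
          pivot (yes μ≈0) = inj₂ (r , (λ { zero → μ≈0 ; (suc j) → e j }) , e₁)
          pivot (no μ≉0) = Data.Sum.map (Eliminate.solution r e e₁ (proj₁ μ⁻¹) (proj₂ μ⁻¹)) (Eliminate.obstruction r e e₁ (proj₁ μ⁻¹) (proj₂ μ⁻¹))
            (again (Eliminate.reduced r e e₁ (proj₁ μ⁻¹) (proj₂ μ⁻¹)))
            where
            μ⁻¹ : ∃ λ y → ∑ K N (λ x → r x * b x zero) * y ≈ 1#
            μ⁻¹ = inverse (∑ K N (λ x → r x * b x zero)) μ≉0

  alternative : ∀ n N b t → Solution n N b t ⊎ Obstruction n N b t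
  alternative zero N b t = alternative-zero N b t (FinP.any? (λ x → ¬? (t x ≟ 0#)))
  alternative (suc n) N b t = eliminate b t (alternative n N (tails b))

ringHom : ∀ {c ℓ c′ ℓ′} {R : CommutativeRing c ℓ} {S : CommutativeRing c′ ℓ′} {f} → IsRingHom R S f → Hom R S
ringHom {f = f} h = record { ⟦_⟧ = f ; cong = ⟦⟧-cong ; +-homo = +-homo ; *-homo = *-homo ; 1-homo = 1#-homo }
  where open RingMorphisms.IsRingHomomorphism h

module FieldBasis {c ℓ c′ ℓ′} {K : CommutativeRing c ℓ} {F : CommutativeRing c′ ℓ′} (ι : Hom K F) {n : ℕ} (B : Basis K F (Hom.⟦_⟧ ι) n) where
  open Basis B
  private
    module K = RingKit K
    module F = RingKit F
    module ι = Hom ι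

  coord-∑ : ∀ m (a : Fin m → K.Carrier) (y : Fin m → F.Carrier) j →
    coord (∑ F m (λ i → ι.⟦ a i ⟧ F.* y i)) j K.≈ ∑ K m (λ i → a i K.* coord (y i) j)
  coord-∑ m a y j = K.trans (coord-cong (begin
      ∑ F m (λ i → ι.⟦ a i ⟧ F.* y i)                                                   ≈⟨ F.∑-cong m (λ i → F.*-congˡ (expand (y i))) ⟩
      ∑ F m (λ i → ι.⟦ a i ⟧ F.* ∑ F n (λ j → ι.⟦ coord (y i) j ⟧ F.* ω j))              ≈⟨ F.∑-cong m (λ i → F.*-∑ n _ _) ⟩
      ∑ F m (λ i → ∑ F n (λ j → ι.⟦ a i ⟧ F.* (ι.⟦ coord (y i) j ⟧ F.* ω j)))            ≈⟨ F.∑-swap m n _ ⟩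
      ∑ F n (λ j → ∑ F m (λ i → ι.⟦ a i ⟧ F.* (ι.⟦ coord (y i) j ⟧ F.* ω j)))            ≈⟨ F.∑-cong n (λ j → F.∑-cong m (λ i → F.solve 3 (λ a b w → a F.:* (b F.:* w) F.:= w F.:* (a F.:* b)) F.refl _ _ _)) ⟩
      ∑ F n (λ j → ∑ F m (λ i → ω j F.* (ι.⟦ a i ⟧ F.* ι.⟦ coord (y i) j ⟧)))            ≈⟨ F.∑-cong n (λ j → F.*-∑ m (ω j) _) ⟨
      ∑ F n (λ j → ω j F.* ∑ F m (λ i → ι.⟦ a i ⟧ F.* ι.⟦ coord (y i) j ⟧))              ≈⟨ F.∑-cong n (λ j → F.trans (F.*-congˡ (F.sym (F.trans (HomProperties.∑-homo ι m _) (F.∑-cong m (λ i → ι.*-homo _ _))))) (F.*-comm _ _)) ⟩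
      ∑ F n (λ j → ι.⟦ ∑ K m (λ i → a i K.* coord (y i) j) ⟧ F.* ω j)                    ∎) j)
    (coord-unique (λ j → ∑ K m (λ i → a i K.* coord (y i) j)) j)
    where open F using (begin_; step-≈-⟩; step-≈-⟨; _∎)

  coord-zero : ∀ x → (∀ j → coord x j K.≈ K.0#) → x F.≈ F.0#
  coord-zero x e = F.trans (expand x) (F.∑-0 n (λ j → F.trans (F.*-congʳ (F.trans (ι.cong (e j)) (HomProperties.0-homo ι))) (F.zeroˡ _)))

  ∑Idx-cong : ∀ d {G H : (Fin d → Fin n) → K.Carrier} → (∀ js → G js K.≈ H js) → ∑Idx K d n G K.≈ ∑Idx K d n H
  ∑Idx-cong zero e = e _
  ∑Idx-cong (suc d) e = K.∑-cong n (λ j → ∑Idx-cong d (λ js → e _))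

  ∑Idx-* : ∀ d x (G : (Fin d → Fin n) → K.Carrier) → ∑Idx K d n (λ js → x K.* G js) K.≈ x K.* ∑Idx K d n G
  ∑Idx-* zero x G = K.refl
  ∑Idx-* (suc d) x G = K.trans (K.∑-cong n (λ j → ∑Idx-* d x (λ js → G (j FVec.∷ js)))) (K.sym (K.*-∑ n x (λ j → ∑Idx K d n (λ js → G (j FVec.∷ js)))))

  element : (Fin n → K.Carrier) → F.Carrier
  element c = ∑ F n (λ j → ι.⟦ c j ⟧ F.* ω j)

  summand : ∀ m (c : Fin (suc m) → Fin n → K.Carrier) → F.Carrier → (Fin (suc m) → Fin n) → K.Carrier
  summand m c x js = ∏ K (suc m) (λ k → c k (js k)) K.* coord (x F.* ∏ F m (λ k → ω (js (inject₁ k)))) (js (fromℕ m))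

  -- Contracting the first m legs of the structure tensor multiplies the elements with coordinates
  -- c, and the last leg pairs with the coordinates of the product. The factor x accumulates the
  -- factors already contracted.
  multilinear : ∀ m (c : Fin (suc m) → Fin n → K.Carrier) x →
    ∑Idx K (suc m) n (summand m c x) K.≈ ∑ K n (λ l → c (fromℕ m) l K.* coord (x F.* ∏ F m (λ k → element (c (inject₁ k)))) l)
  multilinear zero c x = K.∑-cong n (λ j → K.*-congʳ (K.*-identityʳ _))
  multilinear (suc m) c x = begin
    ∑ K n (λ j → ∑Idx K (suc m) n (λ js → c zero j K.* ∏ K (suc m) (λ k → c (suc k) (js k)) K.* coord (x F.* (ω j F.* ∏ F m (λ k → ω (js (inject₁ k))))) (js (fromℕ m))))
      ≈⟨ K.∑-cong n (λ j → K.trans (∑Idx-cong (suc m) {H = λ js → c zero j K.* summand m (c ∘ suc) (x F.* ω j) js} (λ js → K.trans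
          (K.*-assoc (c zero j) (∏ K (suc m) (λ k → c (suc k) (js k))) (coord (x F.* (ω j F.* ∏ F m (λ k → ω (js (inject₁ k))))) (js (fromℕ m))))
          (K.*-congˡ {c zero j} (K.*-congˡ {∏ K (suc m) (λ k → c (suc k) (js k))} (coord-cong (F.sym (F.*-assoc x (ω j) (∏ F m (λ k → ω (js (inject₁ k)))))) (js (fromℕ m)))))))
          (∑Idx-* (suc m) (c zero j) (summand m (c ∘ suc) (x F.* ω j)))) ⟩
    ∑ K n (λ j → c zero j K.* ∑Idx K (suc m) n (summand m (c ∘ suc) (x F.* ω j)))
      ≈⟨ K.∑-cong n (λ j → K.*-congˡ (multilinear m (c ∘ suc) (x F.* ω j))) ⟩
    ∑ K n (λ j → c zero j K.* ∑ K n (λ l → c (fromℕ (suc m)) l K.* coord (x F.* ω j F.* X) l))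
      ≈⟨ K.∑-cong n (λ j → K.*-∑ n (c zero j) _) ⟩
    ∑ K n (λ j → ∑ K n (λ l → c zero j K.* (c (fromℕ (suc m)) l K.* coord (x F.* ω j F.* X) l)))
      ≈⟨ K.∑-swap n n _ ⟩
    ∑ K n (λ l → ∑ K n (λ j → c zero j K.* (c (fromℕ (suc m)) l K.* coord (x F.* ω j F.* X) l)))
      ≈⟨ K.∑-cong n (λ l → Mat.∑*-* n (c zero) (c (fromℕ (suc m)) l) (λ j → coord (x F.* ω j F.* X) l)) ⟩
    ∑ K n (λ l → c (fromℕ (suc m)) l K.* ∑ K n (λ j → c zero j K.* coord (x F.* ω j F.* X) l))
      ≈⟨ K.∑-cong n (λ l → K.*-congˡ (K.trans (K.sym (coord-∑ n (c zero) (λ j → x F.* ω j F.* X) l)) (coord-cong product l))) ⟩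
    ∑ K n (λ l → c (fromℕ (suc m)) l K.* coord (x F.* (element (c zero) F.* X)) l) ∎
    where
    open K using (begin_; step-≈-⟩; _∎)
    module Mat = Matrices K
    X : F.Carrier
    X = ∏ F m (λ k → element (c (inject₁ (suc k))))
    product : ∑ F n (λ j → ι.⟦ c zero j ⟧ F.* (x F.* ω j F.* X)) F.≈ x F.* (element (c zero) F.* X)
    product = F.trans (F.∑-cong n (λ j → F.solve 4 (λ a x w y → a F.:* (x F.:* w F.:* y) F.:= x F.:* y F.:* (a F.:* w)) F.refl _ x (ω j) X))
      (F.trans (F.sym (F.*-∑ n (x F.* X) _)) (F.solve 3 (λ x y e → x F.:* y F.:* e F.:= x F.:* (e F.:* y)) F.refl x X _))

  -- The first m legs send e to the coordinates of a_e; the last sends e to a functional that is 1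
  -- on the product with constant index e and 0 on the products with all other indices.
  module Subrank (_≟_ : ∀ x y → Dec (x K.≈ y)) (inverse : ∀ x → ¬ x K.≈ K.0# → ∃ λ y → x K.* y K.≈ K.1#) (0≉1 : ¬ K.0# K.≈ K.1#)
    (m s : ℕ) (a : Fin s → F.Carrier)
    (independent : ∀ (r : Fin (s ℕ.^ m) → K.Carrier) → ∑ F (s ℕ.^ m) (λ x → ι.⟦ r x ⟧ F.* ∏ F m (λ k → a (finToFun x k))) F.≈ F.0# →
      ∀ e → r (funToFin {m} (λ _ → e)) K.≈ K.0#) where
    open Fredholm K _≟_ inverse
    private
      N : ℕ
      N = s ℕ.^ m
      diagonal : Fin s → Fin N
      diagonal e = funToFin {m} (λ _ → e)
      products : Fin N → F.Carrier
      products x = ∏ F m (λ k → a (finToFun x k))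

      δ-yes : ∀ {t} (x : Fin t) → δ K x x K.≈ K.1#
      δ-yes x with x FinP.≟ x
      ... | yes _ = K.refl
      ... | no x≢x = ⊥-elim (x≢x ≡.refl)

      δ-no : ∀ {t} (x y : Fin t) → x ≢ y → δ K x y K.≈ K.0#
      δ-no x y x≢y with x FinP.≟ y
      ... | yes x≡y = ⊥-elim (x≢y x≡y)
      ... | no _ = K.refl

      -- An obstruction would be a relation between the products with coefficient 1 at the diagonal
      -- index, contrary to `independent`.
      functional : ∀ e → Σ (Fin n → K.Carrier) λ φ → ∀ x → ∑ K n (λ j → φ j K.* coord (products x) j) K.≈ δ K x (diagonal e)
      functional e with alternative n N (λ x → coord (products x)) (λ x → δ K x (diagonal e))
      ... | inj₁ solution = solution
      ... | inj₂ (r , relation , normalised) = ⊥-elim (0≉1 (K.trans (K.sym (independent r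
          (coord-zero _ (λ j → K.trans (coord-∑ N r products j) (relation j))) e))
          (K.trans (K.sym (K.trans (K.∑-single N _ (diagonal e) (λ x x≢ → K.trans (K.*-congˡ (δ-no x (diagonal e) x≢)) (K.zeroʳ _))) (K.trans (K.*-congˡ (δ-yes (diagonal e))) (K.*-identityʳ _)))) normalised)))

      legs : ∀ m → Fin (suc m) → Fin s → Fin n → K.Carrier
      legs zero _ e = proj₁ (functional e)
      legs (suc m) zero e = coord (a e)
      legs (suc m) (suc k) = legs m k

      legs-last : ∀ m e → legs m (fromℕ m) e ≡ proj₁ (functional e)
      legs-last zero e = ≡.refl
      legs-last (suc m) e = legs-last m e

      legs-inject : ∀ m k e → legs m (inject₁ k) e ≡ coord (a e)
      legs-inject (suc m) zero e = ≡.refl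
      legs-inject (suc m) (suc k) e = legs-inject m k e

      last-view : ∀ {m p} {P : Fin (suc m) → Set p} → (∀ k → P (inject₁ k)) → P (fromℕ m) → ∀ k → P k
      last-view {zero} h l zero = l
      last-view {suc m} h l zero = h zero
      last-view {suc m} {P = P} h l (suc k) = last-view {P = P ∘ suc} (h ∘ suc) l k

      IdT-value : ∀ (i : Fin (suc m) → Fin s) → IdT K (suc m) s i K.≈ δ K (funToFin (i ∘ inject₁)) (diagonal (i (fromℕ m)))
      IdT-value i with FinP.any? (λ k → ¬? (i (inject₁ k) FinP.≟ i (fromℕ m)))
      ... | yes (k , i≢) = K.trans (K.∑-0 s zero-product) (K.sym (δ-no _ _ λ e → i≢ (≡.trans (≡.sym (FinP.finToFun-funToFin (i ∘ inject₁) k))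
          (≡.trans (≡.cong (λ x → finToFun x k) e) (FinP.finToFun-funToFin (λ _ → i (fromℕ m)) k)))))
        where
        zero-product : ∀ e → ∏ K (suc m) (λ k → δ K (i k) e) K.≈ K.0#
        zero-product e with i (fromℕ m) FinP.≟ e
        ... | yes ≡.refl = K.∏-zero (suc m) (λ k → δ K (i k) e) (inject₁ k) (δ-no _ _ i≢)
        ... | no l≢e = K.∏-zero (suc m) (λ k → δ K (i k) e) (fromℕ m) (δ-no _ _ l≢e)
      ... | no none = K.trans (K.∑-single s (λ e → ∏ K (suc m) (λ k → δ K (i k) e)) l (λ e e≢l → K.∏-zero (suc m) (λ k → δ K (i k) e) (fromℕ m) (δ-no l e (e≢l ∘ ≡.sym))))
          (K.trans (K.∏-1 (suc m) (λ k → δ K (i k) l) (λ k → K.trans (K.≡⇒≈ (≡.cong (λ x → δ K x l) (all k))) (δ-yes l)))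
            (K.sym (K.trans (K.≡⇒≈ (≡.cong (λ x → δ K x (diagonal l)) (funToFin-cong same))) (δ-yes (diagonal l)))))
        where
        l : Fin s
        l = i (fromℕ m)
        same : ∀ k → i (inject₁ k) ≡ l
        same k with i (inject₁ k) FinP.≟ l
        ... | yes e = e
        ... | no ne = ⊥-elim (none (k , ne))
        all : ∀ k → i k ≡ l
        all = last-view {P = λ k → i k ≡ l} same ≡.refl

    subrank : SubrankAtLeast K (structureTensor K F B (suc m)) s
    subrank = legs m , λ i → K.sym (K.trans
      (∑Idx-cong (suc m) {H = summand m (λ k → legs m k (i k)) F.1#} (λ js → K.*-congˡ {∏ K (suc m) (λ k → legs m k (i k) (js k))}
        (coord-cong (F.sym (F.*-identityˡ (∏ F m (λ k → ω (js (inject₁ k)))))) (js (fromℕ m)))))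
      (K.trans (multilinear m (λ k → legs m k (i k)) F.1#)
      (K.trans (K.∑-cong n (λ l → K.*-cong (K.≡⇒≈ (≡.cong (λ f → f l) (legs-last m (i (fromℕ m)))))
        (coord-cong (F.trans (F.*-identityˡ _) (F.∏-cong m (λ k → F.trans (F.∑-cong n (λ j → F.*-congʳ (ι.cong (K.≡⇒≈ (≡.cong (λ f → f j) (legs-inject m k (i (inject₁ k)))))))) 
          (F.trans (F.sym (expand (a (i (inject₁ k))))) (F.≡⇒≈ (≡.cong a (≡.sym (FinP.finToFun-funToFin (i ∘ inject₁) k)))))))) l)))
      (K.trans (proj₂ (functional (i (fromℕ m))) (funToFin (i ∘ inject₁))) (K.sym (IdT-value i))))))

-- The finite field K and its quadratic extension κ.

module FiniteField {c ℓ} (K : CommutativeRing c ℓ) (field′ : IsField K) (p : ℕ) (card : HasCardinality K (suc (suc p))) where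
  open RingKit K
  open IsField field′ public
  private
    module card = Inverse card

  q : ℕ
  q = suc (suc p)

  _≟_ : ∀ x y → Dec (x ≈ y)
  x ≟ y = map′ (λ e → trans (sym (card.inverseˡ ≡.refl)) (trans (card.to-cong e) (card.inverseˡ ≡.refl))) card.from-cong (card.from x FinP.≟ card.from y)

  regular : ∀ x → ¬ x ≈ 0# → ∀ y → x * y ≈ 0# → y ≈ 0#
  regular x x≉0 y e with (x⁻¹ , xx⁻¹) ← inverse x x≉0 =
    trans (sym (*-identityˡ y)) (trans (*-congʳ (trans (sym xx⁻¹) (*-comm x x⁻¹))) (trans (*-assoc _ _ _) (trans (*-congˡ e) (zeroʳ _))))

  private
    -- Moves the zero element to the index `zero`, so that the units are exactly the `enum (suc a)`.
    swap : Perm.Permutation q q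
    swap = Perm.transpose zero (card.from 0#)

  enum : Fin q → Carrier
  enum a = card.to (swap Perm.⟨$⟩ʳ a)

  index : Carrier → Fin q
  index x = swap Perm.⟨$⟩ˡ card.from x

  enum-index : ∀ x → enum (index x) ≈ x
  enum-index x = trans (card.to-cong (Perm.inverseʳ swap)) (card.inverseˡ ≡.refl)

  index-enum : ∀ a → index (enum a) ≡ a
  index-enum a = ≡.trans (≡.cong (swap Perm.⟨$⟩ˡ_) (card.inverseʳ refl)) (Perm.inverseˡ swap)

  index-cong : ∀ {x y} → x ≈ y → index x ≡ index y
  index-cong e = ≡.cong (swap Perm.⟨$⟩ˡ_) (card.from-cong e)

  enum-zero : enum zero ≈ 0#
  enum-zero = card.inverseˡ ≡.refl

  enum-distinct : ∀ a b → a ≢ b → ¬ enum a ≈ enum b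
  enum-distinct a b a≢b e = a≢b (≡.trans (≡.sym (index-enum a)) (≡.trans (index-cong e) (index-enum b)))

  private
    enum-cancel : ∀ a b → a ≢ b → ∀ x → (enum a - enum b) * x ≈ 0# → x ≈ 0#
    enum-cancel a b a≢b = regular _ (λ e → enum-distinct a b a≢b (x-y≈0⇒x≈y e))

    unit : Fin (suc p) → Carrier
    unit a = enum (suc a)

    unit≉0 : ∀ a → ¬ unit a ≈ 0#
    unit≉0 a e = enum-distinct (suc a) zero (λ ()) (trans e (sym enum-zero))

    unit-index : ∀ x → ¬ x ≈ 0# → ∃ λ a → unit a ≈ x
    unit-index x x≉0 with index x in eq
    ... | zero = ⊥-elim (x≉0 (trans (sym (enum-index x)) (trans (≡⇒≈ (≡.cong enum eq)) enum-zero)))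
    ... | suc a = a , trans (≡⇒≈ (≡.cong enum (≡.sym eq))) (enum-index x)

    unit-injective : ∀ {a b} → unit a ≈ unit b → a ≡ b
    unit-injective {a} {b} e with suc a FinP.≟ suc b
    ... | yes ≡.refl = ≡.refl
    ... | no a≢b = ⊥-elim (enum-distinct (suc a) (suc b) a≢b e)

    product≉0 : ∀ x y → ¬ x ≈ 0# → ¬ y ≈ 0# → ¬ x * y ≈ 0#
    product≉0 x y x≉0 y≉0 e = y≉0 (regular x x≉0 y e)

    ∏≉0 : ∀ n (f : Fin n → Carrier) → (∀ i → ¬ f i ≈ 0#) → ¬ ∏ K n f ≈ 0#
    ∏≉0 zero f h e = 0≉1 (sym e)
    ∏≉0 (suc n) f h = product≉0 _ _ (h zero) (∏≉0 n (f ∘ suc) (h ∘ suc))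

    module Product = Algebra.Properties.CommutativeMonoid.Sum (CommutativeRing.*-commutativeMonoid K)

    ∏-sum : ∀ n (f : Fin n → Carrier) → ∏ K n f ≈ Product.sum f
    ∏-sum zero f = refl
    ∏-sum (suc n) f = *-congˡ (∏-sum n (f ∘ suc))

    ∏-permute : ∀ n (f : Fin n → Carrier) (π : Perm.Permutation n n) → ∏ K n f ≈ ∏ K n (λ i → f (π Perm.⟨$⟩ʳ i))
    ∏-permute n f π = trans (∏-sum n f) (trans (Product.sum-permute f π) (sym (∏-sum n _)))

  -- multiplication by x permutes the units
  unit-power : ∀ x → ¬ x ≈ 0# → x ^ suc p ≈ 1#
  unit-power x x≉0 = x-y≈0⇒x≈y (regular P (∏≉0 (suc p) unit unit≉0) _ (trans (solve 2 (λ P y → P :* (y :- con (+ 1)) := y :* P :- P) refl P (x ^ suc p)) (x≈y⇒x-y≈0 (sym P≈xP))))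
    where
    P : Carrier
    P = ∏ K (suc p) unit
    x⁻¹ : Carrier
    x⁻¹ = proj₁ (inverse x x≉0)
    x⁻¹≉0 : ¬ x⁻¹ ≈ 0#
    x⁻¹≉0 e = 0≉1 (trans (sym (zeroʳ x)) (trans (*-congˡ (sym e)) (proj₂ (inverse x x≉0))))
    times : ∀ y → ¬ y ≈ 0# → Fin (suc p) → Fin (suc p)
    times y y≉0 a = proj₁ (unit-index (y * unit a) (product≉0 y (unit a) y≉0 (unit≉0 a)))
    times-unit : ∀ y y≉0 a → unit (times y y≉0 a) ≈ y * unit a
    times-unit y y≉0 a = proj₂ (unit-index (y * unit a) (product≉0 y (unit a) y≉0 (unit≉0 a)))
    cancel : ∀ y z y≉0 z≉0 → y * z ≈ 1# → ∀ a → times y y≉0 (times z z≉0 a) ≡ a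
    cancel y z y≉0 z≉0 yz a = unit-injective (trans (times-unit y y≉0 _) (trans (*-congˡ (times-unit z z≉0 a)) (trans (sym (*-assoc _ _ _)) (trans (*-congʳ yz) (*-identityˡ _)))))
    P≈xP : P ≈ x ^ suc p * P
    P≈xP = trans (∏-permute (suc p) unit (Perm.permutation (times x x≉0) (times x⁻¹ x⁻¹≉0)
        (cancel x x⁻¹ x≉0 x⁻¹≉0 (proj₂ (inverse x x≉0))) (cancel x⁻¹ x x⁻¹≉0 x≉0 (trans (*-comm _ _) (proj₂ (inverse x x≉0))))))
      (trans (∏-cong (suc p) (times-unit x x≉0)) (∏-* (suc p) x unit))

  frobenius : ∀ x → x ^ q ≈ x
  frobenius x with x ≟ 0#
  ... | yes x≈0 = trans (^-congˡ q x≈0) (trans (0^suc (suc p)) (sym x≈0))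
  ... | no x≉0 = trans (*-congˡ (unit-power x x≉0)) (*-identityʳ x)

  private
    coefficients : Fin q → Carrier
    coefficients zero = 0#
    coefficients (suc i) = (q C suc (toℕ i)) ·ℕ 1#

    module Sum = Algebra.Properties.CommutativeMonoid.Sum (CommutativeRing.+-commutativeMonoid K)

    ∑-sum : ∀ n (f : Fin n → Carrier) → ∑ K n f ≈ Sum.sum f
    ∑-sum zero f = refl
    ∑-sum (suc n) f = +-congˡ (∑-sum n (f ∘ suc))

    -- (x + 1)^q - x^q - 1 = 0
    root : ∀ x → horner q coefficients x ≈ 0#
    root x = begin
      horner q coefficients x                                       ≈⟨ horner-∑ q coefficients x ⟩
      0# * 1# + ∑ K (suc p) (λ i → coefficients (suc i) * x ^ suc (toℕ i)) ≈⟨ trans (+-congʳ (zeroˡ 1#)) (+-identityˡ _) ⟩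
      ∑ K (suc p) (λ i → coefficients (suc i) * x ^ suc (toℕ i))    ≈⟨ ∑-cong (suc p) (λ i → term i) ⟨
      ∑ K (suc p) (λ i → t (suc (inject₁ i)))                       ≈⟨ ∑-sum (suc p) (λ i → t (suc (inject₁ i))) ⟩
      S                                                             ≈⟨ solve 3 (λ a s b → s := a :+ (s :+ b) :- b :- a) refl 1# S (x ^ q) ⟩
      1# + (S + x ^ q) - x ^ q - 1#                                 ≈⟨ +-congʳ (+-congʳ (+-cong first (+-congˡ last))) ⟨
      t zero + (S + t (suc (fromℕ (suc p)))) - x ^ q - 1#           ≈⟨ +-congʳ (+-congʳ (+-congˡ (Sum.sum-init-last (t ∘ suc)))) ⟨
      t zero + Sum.sum (t ∘ suc) - x ^ q - 1#                       ≈⟨ +-congʳ (+-congʳ (Bin.theorem q x 1#)) ⟨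
      (x + 1#) ^ q - x ^ q - 1#                                     ≈⟨ +-congʳ (+-cong (frobenius (x + 1#)) (-‿cong (frobenius x))) ⟩
      x + 1# - x - 1#                                               ≈⟨ solve 1 (λ x → x :+ con (+ 1) :- x :- con (+ 1) := con (+ 0)) refl x ⟩
      0#                                                            ∎
      where
      module Bin = Algebra.Properties.CommutativeSemiring.Binomial (CommutativeRing.commutativeSemiring K)
      t : Fin (suc q) → Carrier
      t = Bin.binomialTerm x 1# q
      S : Carrier
      S = Sum.sum (λ i → t (suc (inject₁ i)))
      first : t zero ≈ 1#
      first = trans (+-identityʳ _) (trans (*-identityˡ _) (1^ q))
      last : t (suc (fromℕ (suc p))) ≈ x ^ q
      last rewrite FinP.toℕ-fromℕ p | nCn≡1 q | ℕP.n∸n≡0 p = trans (+-identityʳ _) (*-identityʳ _)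
      ·-cong : ∀ n {a b} → a ≈ b → n ·ℕ a ≈ n ·ℕ b
      ·-cong zero e = refl
      ·-cong (suc n) e = +-cong e (·-cong n e)
      scaled : ∀ n z → n ·ℕ z ≈ (n ·ℕ 1#) * z
      scaled n z = trans (·-cong n (sym (*-identityˡ z))) (sym (×-assoc-* n 1# z))
      term : ∀ i → t (suc (inject₁ i)) ≈ coefficients (suc i) * x ^ suc (toℕ i)
      term i = trans (scaled (q C suc (toℕ (inject₁ i))) (Bin.binomial x 1# q (suc (inject₁ i))))
        (trans (≡⇒≈ (≡.cong (λ n → (q C suc n) ·ℕ 1# * (x ^ suc n * 1# ^ (q ℕ.∸ suc n))) (FinP.toℕ-inject₁ i)))
          (*-congˡ (trans (*-congˡ (1^ (q ℕ.∸ suc (toℕ i)))) (*-identityʳ _))))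

  -- The polynomial (X+1)^q - X^q - 1 has degree < q and vanishes at all q elements of K, so its
  -- coefficients, the binomials, are zero in K.
  binomials : BinomialsVanish q
  binomials (suc i) _ i<q with suc j ← Data.Fin.fromℕ< i<q in eq = trans (≡⇒≈ (≡.cong (λ i → (q C i) ·ℕ 1#) (≡.trans (≡.sym (FinP.toℕ-fromℕ< i<q)) (≡.cong toℕ eq))))
    (vanishing enum enum-cancel coefficients (λ a → root (enum a)) (suc j))

  -- x² - x takes the value 0 twice
  irreducible : ∃ λ b → ∀ x → ¬ x * x - x ≈ b
  irreducible with FinP.all? (λ b → FinP.any? (λ a → (enum a * enum a - enum a) ≟ enum b))
  ... | no ¬all = let (b , none) = FinP.¬∀⟶∃¬ q _ (λ b → FinP.any? (λ a → (enum a * enum a - enum a) ≟ enum b)) ¬all in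
    enum b , λ x e → none (index x , trans (+-cong (*-cong (enum-index x) (enum-index x)) (-‿cong (enum-index x))) e)
  -- If x² - x were surjective, a choice of preimages would be injective and so, by finiteness,
  -- would hit both 0 and 1. These are preimages of the same element, for which only one was chosen.
  ... | yes all = ⊥-elim (missed (FinP.any? (λ b → section b FinP.≟ index 0#)))
    where
    section : Fin q → Fin q
    section b = proj₁ (all b)
    section-injective : ∀ {a b} → section a ≡ section b → a ≡ b
    section-injective {a} {b} e = ≡.trans (≡.sym (index-enum a)) (≡.trans (index-cong (trans (sym (proj₂ (all a)))
      (trans (≡⇒≈ (≡.cong (λ c → enum c * enum c - enum c) e)) (proj₂ (all b))))) (index-enum b))
    misses : ∀ c → ¬ (∃ λ b → section b ≡ c) → ⊥
    misses c none = ℕP.1+n≰n (FinP.injective⇒≤ {f = λ b → punchOut {i = c} {j = section b} (λ e → none (b , ≡.sym e))}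
      λ {x} {y} e → section-injective (FinP.punchOut-injective {i = c} (λ e → none (x , ≡.sym e)) (λ e → none (y , ≡.sym e)) e))
    value : ∀ {b x} → section b ≡ index x → enum b ≈ x * x - x
    value {b} {x} e = trans (sym (proj₂ (all b))) (trans (≡⇒≈ (≡.cong (λ c → enum c * enum c - enum c) e)) (+-cong (*-cong (enum-index x) (enum-index x)) (-‿cong (enum-index x))))
    missed : Dec (∃ λ b → section b ≡ index 0#) → ⊥
    missed (no none) = misses (index 0#) none
    missed (yes (b , e)) = misses (index 1#) λ (b′ , e′) → 0≉1 (trans (sym (enum-index 0#)) (trans (≡⇒≈ (≡.cong enum (≡.trans (≡.sym e)
      (≡.trans (≡.cong section (≡.trans (≡.sym (index-enum b)) (≡.trans (index-cong (trans (value e) (trans (solve 0 (con (+ 0) :* con (+ 0) :- con (+ 0) := con (+ 1) :* con (+ 1) :- con (+ 1)) refl) (sym (value e′))))) (index-enum b′)))) e′))))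
      (enum-index 1#)))

  b : Carrier
  b = proj₁ irreducible

-- The polynomial X² - X - b is used because it serves every characteristic, including 2.
module QuadraticExtension {c ℓ} (K : CommutativeRing c ℓ) (field′ : IsField K) (p : ℕ) (card : HasCardinality K (suc (suc p))) where
  module K = FiniteField K field′ p card
  open K using (q; b)
  private
    module 𝕂 = RingKit K
  module E = Extension K 0 b 𝕂.1#
  κ : CommutativeRing c ℓ
  κ = E.ring
  open RingKit κ
  module ι = Hom E.ι

  α : Carrier
  α = E.z

  α² : α * α ≈ ι.⟦ b ⟧ + α
  α² = trans (*-congˡ (sym (*-identityʳ α))) (trans E.z^n (+-congˡ (trans (*-congʳ ι.1-homo) (*-identityˡ α))))

  split : ∀ x → x ≈ ι.⟦ x zero ⟧ + ι.⟦ x (suc zero) ⟧ * α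
  split x = trans (E.expand x) (solve 3 (λ a b z → a :+ z :* (b :+ z :* con (+ 0)) := a :+ b :* z) refl ι.⟦ x zero ⟧ ι.⟦ x (suc zero) ⟧ α)

  first : ∀ u v → (ι.⟦ u ⟧ + ι.⟦ v ⟧ * α) zero 𝕂.≈ u
  first u v = 𝕂.trans (𝕂.+-cong (E.ι-zero u) (𝕂.trans (E.ι* v α zero) (𝕂.trans (𝕂.*-congˡ (𝕂.trans (𝕂.*-congˡ 𝕂.refl) (𝕂.zeroʳ b))) (𝕂.zeroʳ v)))) (𝕂.+-identityʳ u)

  second : ∀ u v → (ι.⟦ u ⟧ + ι.⟦ v ⟧ * α) (suc zero) 𝕂.≈ v
  second u v = 𝕂.trans (𝕂.+-cong (E.ι-suc u zero) (𝕂.trans (E.ι* v α (suc zero)) (𝕂.trans (𝕂.*-congˡ (𝕂.solve 0 (𝕂.con (+ 1) 𝕂.:+ 𝕂.con (+ 1) 𝕂.:* 𝕂.con (+ 0) 𝕂.:= 𝕂.con (+ 1)) 𝕂.refl)) (𝕂.*-identityʳ v)))) (𝕂.+-identityˡ v)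

  _≟_ : ∀ x y → Dec (x ≈ y)
  x ≟ y = map′ pw at (FinP.all? (λ i → x i K.≟ y i))

  0≉1 : ¬ 0# ≈ 1#
  0≉1 e = K.0≉1 (at e zero)

  private
    norm : Carrier → 𝕂.Carrier
    norm x = x zero 𝕂.* x zero 𝕂.+ x zero 𝕂.* x (suc zero) 𝕂.- b 𝕂.* (x (suc zero) 𝕂.* x (suc zero))

    conjugate : Carrier → Carrier
    conjugate x = ι.⟦ x zero ⟧ + ι.⟦ x (suc zero) ⟧ - ι.⟦ x (suc zero) ⟧ * α

    x*conjugate : ∀ x → x * conjugate x ≈ ι.⟦ norm x ⟧
    x*conjugate x = begin
      x * conjugate x ≈⟨ *-congʳ (split x) ⟩
      (u + v * α) * (u + v - v * α) ≈⟨ solve 3 (λ u v a → (u :+ v :* a) :* (u :+ v :- v :* a) := u :* u :+ u :* v :+ v :* v :* (a :- a :* a)) refl u v α ⟩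
      u * u + u * v + v * v * (α - α * α) ≈⟨ +-congˡ (*-congˡ (+-congˡ (-‿cong α²))) ⟩
      u * u + u * v + v * v * (α - (ι.⟦ b ⟧ + α)) ≈⟨ solve 4 (λ u v a b → u :* u :+ u :* v :+ v :* v :* (a :- (b :+ a)) := u :* u :+ u :* v :- b :* (v :* v)) refl u v α ι.⟦ b ⟧ ⟩
      u * u + u * v - ι.⟦ b ⟧ * (v * v) ≈⟨ +-cong (trans (ι.+-homo _ _) (+-cong (ι.*-homo _ _) (ι.*-homo _ _))) (trans (HomProperties.-‿homo E.ι _) (-‿cong (trans (ι.*-homo _ _) (*-congˡ (ι.*-homo _ _))))) ⟨
      ι.⟦ x zero 𝕂.* x zero 𝕂.+ x zero 𝕂.* x (suc zero) ⟧ + ι.⟦ 𝕂.- (b 𝕂.* (x (suc zero) 𝕂.* x (suc zero))) ⟧ ≈⟨ ι.+-homo _ _ ⟨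
      ι.⟦ norm x ⟧ ∎
      where
      u v : Carrier
      u = ι.⟦ x zero ⟧
      v = ι.⟦ x (suc zero) ⟧

    -- If u² + uv - bv² = 0 with v ≠ 0, then -u/v is a root of X² - X - b in K.
    norm≉0 : ∀ x → ¬ x ≈ 0# → ¬ norm x 𝕂.≈ 𝕂.0#
    norm≉0 x x≉0 N≈0 = by-cases (v K.≟ 𝕂.0#)
      where
      u v : 𝕂.Carrier
      u = x zero
      v = x (suc zero)
      uu : v 𝕂.≈ 𝕂.0# → u 𝕂.* u 𝕂.≈ 𝕂.0#
      uu v≈0 = 𝕂.trans (𝕂.sym (𝕂.trans (𝕂.+-cong (𝕂.+-congˡ (𝕂.*-congˡ v≈0)) (𝕂.-‿cong (𝕂.*-congˡ (𝕂.*-congˡ v≈0))))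
        (𝕂.solve 3 (λ u v b → u 𝕂.:* u 𝕂.:+ u 𝕂.:* 𝕂.con (+ 0) 𝕂.:- b 𝕂.:* (v 𝕂.:* 𝕂.con (+ 0)) 𝕂.:= u 𝕂.:* u) 𝕂.refl u v b))) N≈0
      u≈0 : v 𝕂.≈ 𝕂.0# → Dec (u 𝕂.≈ 𝕂.0#) → u 𝕂.≈ 𝕂.0#
      u≈0 v≈0 (yes e) = e
      u≈0 v≈0 (no u≉0) = K.regular u u≉0 u (uu v≈0)
      by-cases : Dec (v 𝕂.≈ 𝕂.0#) → ⊥
      by-cases (yes v≈0) = x≉0 (pw λ { zero → u≈0 v≈0 (u K.≟ 𝕂.0#) ; (suc zero) → v≈0 })
      by-cases (no v≉0) = proj₂ K.irreducible (𝕂.- (u 𝕂.* w)) (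
        𝕂.trans (𝕂.solve 2 (λ u w → (𝕂.:- (u 𝕂.:* w)) 𝕂.:* (𝕂.:- (u 𝕂.:* w)) 𝕂.:- (𝕂.:- (u 𝕂.:* w)) 𝕂.:= w 𝕂.:* w 𝕂.:* (u 𝕂.:* u) 𝕂.:+ u 𝕂.:* w) 𝕂.refl u w) (
        𝕂.trans (𝕂.+-congˡ (𝕂.trans (𝕂.sym (𝕂.*-identityʳ (u 𝕂.* w))) (𝕂.*-congˡ (𝕂.sym vw)))) (
        𝕂.trans (𝕂.solve 3 (λ u v w → w 𝕂.:* w 𝕂.:* (u 𝕂.:* u) 𝕂.:+ u 𝕂.:* w 𝕂.:* (v 𝕂.:* w) 𝕂.:= w 𝕂.:* w 𝕂.:* (u 𝕂.:* u 𝕂.:+ u 𝕂.:* v)) 𝕂.refl u v w) (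
        𝕂.trans (𝕂.*-congˡ (𝕂.x-y≈0⇒x≈y N≈0)) (
        𝕂.trans (𝕂.solve 3 (λ v w b → w 𝕂.:* w 𝕂.:* (b 𝕂.:* (v 𝕂.:* v)) 𝕂.:= b 𝕂.:* (v 𝕂.:* w 𝕂.:* (v 𝕂.:* w))) 𝕂.refl v w b) (
        𝕂.trans (𝕂.*-congˡ (𝕂.trans (𝕂.*-cong vw vw) (𝕂.*-identityˡ 𝕂.1#))) (𝕂.*-identityʳ b)))))))
        where
        w : 𝕂.Carrier
        w = proj₁ (K.inverse v v≉0)
        vw : v 𝕂.* w 𝕂.≈ 𝕂.1#
        vw = proj₂ (K.inverse v v≉0)

  inverse : ∀ x → ¬ x ≈ 0# → ∃ λ y → x * y ≈ 1#
  inverse x x≉0 = conjugate x * ι.⟦ proj₁ n⁻¹ ⟧ , trans (sym (*-assoc x (conjugate x) ι.⟦ proj₁ n⁻¹ ⟧)) (trans (*-congʳ (x*conjugate x))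
      (trans (sym (ι.*-homo (norm x) (proj₁ n⁻¹))) (trans (ι.cong (proj₂ n⁻¹)) ι.1-homo)))
    where
    n⁻¹ : ∃ λ y → norm x 𝕂.* y 𝕂.≈ 𝕂.1#
    n⁻¹ = K.inverse (norm x) (norm≉0 x x≉0)

  regular : ∀ x → ¬ x ≈ 0# → ∀ y → x * y ≈ 0# → y ≈ 0#
  regular x x≉0 y e = trans (sym (*-identityˡ y)) (trans (*-congʳ (trans (sym (proj₂ (inverse x x≉0))) (*-comm x _))) (trans (*-assoc _ x y) (trans (*-congˡ e) (zeroʳ _))))

  binomials : BinomialsVanish q
  binomials = HomProperties.binomials-vanish E.ι q K.binomials

  private
    fresh : ∀ x y → (x + y) ^ q ≈ x ^ q + y ^ q
    fresh = freshman (suc p) binomials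

    fixed : ∀ u → ι.⟦ u ⟧ ^ q ≈ ι.⟦ u ⟧
    fixed u = trans (sym (HomProperties.^-homo E.ι u q)) (ι.cong (K.frobenius u))

    power : ∀ x → x ^ q ≈ ι.⟦ x zero ⟧ + ι.⟦ x (suc zero) ⟧ * α ^ q
    power x = trans (^-congˡ q (split x)) (trans (fresh _ _) (+-cong (fixed _) (trans (^-distrib-* _ _ q) (*-congʳ (fixed _)))))

    -- As b is fixed by q-th powers, α^q is again a root of Y² - Y - b = (Y - α)(Y - (1 - α)).
    α^q-root : (α ^ q - α) * (α ^ q - (1# - α)) ≈ 0#
    α^q-root = begin
      (α ^ q - α) * (α ^ q - (1# - α))            ≈⟨ solve 2 (λ y a → (y :- a) :* (y :- (con (+ 1) :- a)) := y :* y :- y :- (a :* a :- a)) refl (α ^ q) α ⟩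
      α ^ q * α ^ q - α ^ q - (α * α - α)         ≈⟨ +-cong (+-congʳ (trans (sym (^-distrib-* α α q)) (trans (^-congˡ q α²) (trans (fresh _ _) (+-congʳ (fixed b)))))) (-‿cong (+-congʳ α²)) ⟩
      ι.⟦ b ⟧ + α ^ q - α ^ q - (ι.⟦ b ⟧ + α - α) ≈⟨ solve 3 (λ b y a → b :+ y :- y :- (b :+ a :- a) := con (+ 0)) refl ι.⟦ b ⟧ (α ^ q) α ⟩
      0#                                          ∎

    -- otherwise all elements would be roots of X^q - X
    α^q≉α : ¬ α ^ q ≈ α
    α^q≉α e = 0≉1 (trans (solve 0 (con (+ 0) := :- con (+ 0)) refl) (trans (-‿cong (sym (vanishing point cancel polynomial root (suc zero)))) (-‿involutive 1#)))
      where
      monomial : ∀ n → Fin (suc n) → Carrier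
      monomial zero _ = 1#
      monomial (suc n) zero = 0#
      monomial (suc n) (suc i) = monomial n i
      horner-monomial : ∀ n x → horner (suc n) (monomial n) x ≈ x ^ n
      horner-monomial zero x = solve 1 (λ x → con (+ 1) :+ x :* con (+ 0) := con (+ 1)) refl x
      horner-monomial (suc n) x = trans (+-identityˡ _) (*-congˡ (horner-monomial n x))
      polynomial : Fin (suc q) → Carrier
      polynomial zero = 0#
      polynomial (suc zero) = - 1#
      polynomial (suc (suc i)) = monomial p i
      point : Fin (suc q) → Carrier
      point zero = α
      point (suc a) = ι.⟦ K.enum a ⟧
      difference : ∀ a b → a ≢ b → ¬ point a - point b ≈ 0#
      difference zero zero a≢b _ = a≢b ≡.refl
      difference zero (suc b) _ e = K.0≉1 (𝕂.sym (𝕂.trans (𝕂.sym (second (𝕂.- K.enum b) 𝕂.1#)) (at (trans (trans (+-cong (HomProperties.-‿homo E.ι _) (trans (*-congʳ ι.1-homo) (*-identityˡ α))) (+-comm _ _)) e) (suc zero))))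
      difference (suc a) zero _ e = K.0≉1 (𝕂.sym (𝕂.trans (𝕂.sym (second (𝕂.- K.enum a) 𝕂.1#)) (at (trans (trans (+-cong (HomProperties.-‿homo E.ι _) (trans (*-congʳ ι.1-homo) (*-identityˡ α))) (solve 2 (λ a z → :- a :+ z := :- (a :- z)) refl _ _)) (trans (-‿cong e) -0#≈0#)) (suc zero))))
      difference (suc a) (suc b) a≢b e = K.enum-distinct a b (a≢b ∘ ≡.cong suc) (𝕂.x-y≈0⇒x≈y (𝕂.trans (𝕂.sym (E.ι-zero _)) (at (trans (HomProperties.minus-homo E.ι _ _) e) zero)))
      cancel : ∀ a b → a ≢ b → ∀ x → (point a - point b) * x ≈ 0# → x ≈ 0#
      cancel a b a≢b = regular _ (difference a b a≢b)
      point^q : ∀ a → point a ^ q ≈ point a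
      point^q zero = e
      point^q (suc a) = fixed _
      root : ∀ a → horner (suc q) polynomial (point a) ≈ 0#
      root a = trans (+-congˡ (*-congˡ (+-congˡ (*-congˡ (horner-monomial p (point a)))))) (trans
        (solve 2 (λ x y → con (+ 0) :+ x :* (:- con (+ 1) :+ x :* y) := x :* (x :* y) :- x) refl (point a) (point a ^ p)) (x≈y⇒x-y≈0 (point^q a)))

  α^q : α ^ q ≈ 1# - α
  α^q = x-y≈0⇒x≈y (regular _ (α^q≉α ∘ x-y≈0⇒x≈y) _ α^q-root)

  private
    conjugate^q : (1# - α) ^ q ≈ α
    conjugate^q = begin
      (1# - α) ^ q                     ≈⟨ solve 2 (λ x y → x := x :+ y :- y) refl _ (α ^ q) ⟩
      (1# - α) ^ q + α ^ q - α ^ q     ≈⟨ +-cong (sym (fresh _ _)) (-‿cong α^q) ⟩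
      (1# - α + α) ^ q - (1# - α)      ≈⟨ +-congʳ (trans (^-congˡ q (solve 1 (λ a → con (+ 1) :- a :+ a := con (+ 1)) refl α)) (1^ q)) ⟩
      1# - (1# - α)                    ≈⟨ solve 1 (λ a → con (+ 1) :- (con (+ 1) :- a) := a) refl α ⟩
      α                                ∎

  -- the unit part of ξ² - ξ - b for ξ near α
  ω₀ : Carrier
  ω₀ = α + α - 1#

  ω₀≉0 : ¬ ω₀ ≈ 0#
  ω₀≉0 e = α^q≉α (trans α^q (x-y≈0⇒x≈y (trans (solve 1 (λ a → con (+ 1) :- a :- a := :- (a :+ a :- con (+ 1))) refl α) (trans (-‿cong e) -0#≈0#))))

  private
    -- The q-th power exchanges α and 1 - α, so it negates their difference 2α - 1.
    ω₀-root : ω₀ ^ q + ω₀ ≈ 0#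
    ω₀-root = begin
      ω₀ ^ q + ω₀                       ≈⟨ +-congʳ (^-congˡ q (solve 1 (λ a → a :+ a :- con (+ 1) := a :+ (:- (con (+ 1) :- a))) refl α)) ⟩
      (α + - (1# - α)) ^ q + ω₀          ≈⟨ +-congʳ (fresh _ _) ⟩
      α ^ q + (- (1# - α)) ^ q + ω₀      ≈⟨ +-congʳ (+-cong α^q (trans minus^q (-‿cong conjugate^q))) ⟩
      1# - α + - α + ω₀                  ≈⟨ solve 1 (λ a → con (+ 1) :- a :+ (:- a) :+ (a :+ a :- con (+ 1)) := con (+ 0)) refl α ⟩
      0#                                ∎
      where
      minus^q : (- (1# - α)) ^ q ≈ - (1# - α) ^ q
      minus^q = trans (solve 2 (λ x y → x := x :+ y :- y) refl _ ((1# - α) ^ q)) (trans (+-congʳ (trans (sym (fresh _ _)) (trans (^-congˡ q (-‿inverseˡ _)) (0^suc (suc p))))) (+-identityˡ _))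

  traceField : TraceField κ p
  traceField = record
    { _≟_ = _≟_ ; 0≉1 = 0≉1 ; inverse = inverse ; binomials = binomials
    ; frobenius² = λ x → trans (^-congˡ q (trans (power x) (+-congˡ (*-congˡ α^q)))) (trans (fresh _ _)
        (trans (+-cong (fixed _) (trans (^-distrib-* _ _ q) (*-cong (fixed _) conjugate^q))) (sym (split x))))
    -- The K-multiples of ω₀ are q distinct zeros of τ, because ω₀^q = -ω₀.
    ; ω = λ a → ι.⟦ K.enum a ⟧ * ω₀
    ; ω-zero = trans (*-congʳ (trans (ι.cong K.enum-zero) (HomProperties.0-homo E.ι))) (zeroˡ _)
    ; ω-root = λ a → trans (+-congʳ (trans (^-distrib-* _ ω₀ q) (*-congʳ (fixed _)))) (trans (sym (distribˡ _ _ _)) (trans (*-congˡ ω₀-root) (zeroʳ _)))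
    ; ω-distinct = λ a b a≢b e → K.enum-distinct a b a≢b (𝕂.x-y≈0⇒x≈y (𝕂.trans (𝕂.sym (E.ι-zero _)) (at (trans (HomProperties.minus-homo E.ι _ _)
        (regular ω₀ ω₀≉0 _ (trans (solve 3 (λ w x y → w :* (x :- y) := x :* w :- y :* w) refl ω₀ _ _) (x≈y⇒x-y≈0 e)))) zero)))
    -- For c fixed by q-th powers, τ(c α) = c (1 - α) + c α = c.
    ; τ-surjective = λ c c^q → c * α , trans (+-congʳ (trans (^-distrib-* c α q) (*-cong c^q α^q))) (solve 2 (λ c a → c :* (con (+ 1) :- a) :+ c :* a := c) refl c α) }

-- The pigeonhole principle and an element θ with independent powers.

InjectionInto : ∀ {ℓ} {N : ℕ} (P : Fin N → Set ℓ) → ℕ → Set ℓ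
InjectionInto {N = N} P a = Σ (Fin a → Fin N) λ g → (∀ i j → g i ≡ g j → i ≡ j) × (∀ i → P (g i))

private
  insert : ∀ {ℓ N a} {P : Fin (suc N) → Set ℓ} → P zero → InjectionInto (P ∘ suc) a → InjectionInto P (suc a)
  insert {N = N} {a} {P} p (g , injective , member) = g′ , injective′ , member′
    where
    g′ : Fin (suc a) → Fin (suc N)
    g′ zero = zero
    g′ (suc i) = suc (g i)
    injective′ : ∀ i j → g′ i ≡ g′ j → i ≡ j
    injective′ zero zero _ = ≡.refl
    injective′ (suc i) (suc j) e = ≡.cong suc (injective i j (FinP.suc-injective e))
    member′ : ∀ i → P (g′ i)
    member′ zero = p
    member′ (suc i) = member i

  skip : ∀ {ℓ N a} {P : Fin (suc N) → Set ℓ} → InjectionInto (P ∘ suc) a → InjectionInto P a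
  skip (g , injective , member) = suc ∘ g , (λ i j e → injective i j (FinP.suc-injective e)) , member

partition : ∀ {ℓ N} {P : Fin N → Set ℓ} → (∀ i → Dec (P i)) → ∃ λ a → ∃ λ b → a ℕ.+ b ≡ N × InjectionInto P a × InjectionInto (¬_ ∘ P) b
partition {N = zero} P? = 0 , 0 , ≡.refl , ((λ ()) , (λ ()) , λ ()) , ((λ ()) , (λ ()) , λ ())
partition {N = suc N} {P} P? with P? zero | partition {P = P ∘ suc} (P? ∘ suc)
... | yes p | a , b , e , g , h = suc a , b , ≡.cong suc e , insert {P = P} p g , skip {P = ¬_ ∘ P} h
... | no ¬p | a , b , e , g , h = a , suc b , ≡.trans (ℕP.+-suc a b) (≡.cong suc e) , skip {P = P} g , insert {P = ¬_ ∘ P} ¬p h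

-- Induction on the number of values: either more than m elements go to `zero`, or the complement of
-- that fibre is still too large for the remaining values.
large-fibre : ∀ M m {N} (f : Fin N → Fin M) → M ℕ.* m ℕ.< N → ∃ λ x → InjectionInto (λ i → f i ≡ x) (suc m)
large-fibre zero m {suc N} f _ with () ← f zero
large-fibre (suc M) m {N} f lt = split (partition (λ i → f i FinP.≟ zero))
  where
  split : (∃ λ a → ∃ λ b → a ℕ.+ b ≡ N × InjectionInto (λ i → f i ≡ zero) a × InjectionInto (λ i → ¬ f i ≡ zero) b) → ∃ λ x → InjectionInto (λ i → f i ≡ x) (suc m)
  split (a , b , e , (g , g-injective , g-zero) , (h , h-injective , h-nonzero)) = by-size (m ℕ.<? a)
    where
    lower : ∀ (x : Fin (suc M)) → ¬ x ≡ zero → ∃ λ y → x ≡ suc y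
    lower zero x≢0 = ⊥-elim (x≢0 ≡.refl)
    lower (suc y) _ = y , ≡.refl
    by-size : Dec (m ℕ.< a) → ∃ λ x → InjectionInto (λ i → f i ≡ x) (suc m)
    by-size (yes m<a) = zero , (λ i → g (Data.Fin.inject≤ i m<a)) , (λ i j e → FinP.inject≤-injective m<a m<a i j (g-injective _ _ e)) , λ i → g-zero _
    by-size (no m≮a) with large-fibre M m (λ i → proj₁ (lower (f (h i)) (h-nonzero i)))
        (ℕP.+-cancelˡ-< m _ _ (ℕP.<-≤-trans lt (ℕP.≤-trans (ℕP.≤-reflexive (≡.sym e)) (ℕP.+-monoˡ-≤ b (ℕP.≮⇒≥ m≮a)))))
    ... | x , g′ , injective′ , member′ = suc x , h ∘ g′ , (λ i j e → injective′ i j (h-injective _ _ e)) ,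
      λ i → ≡.trans (proj₂ (lower (f (h (g′ i))) (h-nonzero (g′ i)))) (≡.cong suc (member′ i))

module FewRoots {c ℓ c′ ℓ′} (K : CommutativeRing c ℓ) (K-field : IsField K) (p : ℕ) (card : HasCardinality K (suc (suc p)))
  {F : CommutativeRing c′ ℓ′} (F-field : IsField F) (ι : Hom K F) {n : ℕ} (B : Basis K F (Hom.⟦_⟧ ι) n) where
  private
    module 𝕂 = FiniteField K K-field p card
    module K = RingKit K
    module F = RingKit F
    module ι = Hom ι
  open 𝕂 using (q)
  open Basis B
  open FieldBasis ι B

  private
    regular : ∀ x → ¬ x F.≈ F.0# → ∀ y → x F.* y F.≈ F.0# → y F.≈ F.0#
    regular x x≉0 y e = F.trans (F.sym (F.*-identityˡ y)) (F.trans (F.*-congʳ (F.trans (F.sym (proj₂ (IsField.inverse F-field x x≉0))) (F.*-comm x _)))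
      (F.trans (F.*-assoc _ x y) (F.trans (F.*-congˡ e) (F.zeroʳ _))))

    coord-0 : ∀ j → coord F.0# j K.≈ K.0#
    coord-0 j = coord-∑ 0 (λ ()) (λ ()) j

    zero? : ∀ x → Dec (x F.≈ F.0#)
    zero? x = map′ (coord-zero x) (λ e j → K.trans (coord-cong e j) (coord-0 j)) (FinP.all? (λ j → coord x j 𝕂.≟ K.0#))

    vector : ∀ N → Fin (q ℕ.^ N) → Fin N → K.Carrier
    vector N y j = 𝕂.enum (finToFun {q} {N} y j)

    point : Fin (q ℕ.^ n) → F.Carrier
    point y = element (vector n y)

    vector-injective : ∀ N (y y′ : Fin (q ℕ.^ N)) → (∀ j → vector N y j K.≈ vector N y′ j) → y ≡ y′
    vector-injective N y y′ e = ≡.trans (≡.sym (FinP.funToFin-finToFin {N} {q} y)) (≡.trans (funToFin-cong {N} {q} {finToFun {q} {N} y} {finToFun {q} {N} y′} (λ j → ≡.trans (≡.sym (𝕂.index-enum (finToFun {q} {N} y j)))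
      (≡.trans (𝕂.index-cong (e j)) (𝕂.index-enum (finToFun {q} {N} y′ j))))) (FinP.funToFin-finToFin {N} {q} y′))

    point-injective : ∀ y y′ → point y F.≈ point y′ → y ≡ y′
    point-injective y y′ e = vector-injective n y y′ λ j → K.trans (K.sym (coord-unique (vector n y) j)) (K.trans (coord-cong e j) (coord-unique (vector n y′) j))

    value : ∀ N → (Fin N → K.Carrier) → F.Carrier → F.Carrier
    value N c x = F.horner N (λ i → ι.⟦ c i ⟧) x

  ι-injective : ∀ x → ι.⟦ x ⟧ F.≈ F.0# → x K.≈ K.0#
  ι-injective x e with x 𝕂.≟ K.0#
  ... | yes x≈0 = x≈0
  ... | no x≉0 = ⊥-elim (IsField.0≉1 F-field (F.trans (F.sym (F.zeroˡ ι.⟦ proj₁ (𝕂.inverse x x≉0) ⟧)) (F.trans (F.*-congʳ (F.sym e))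
    (F.trans (F.sym (ι.*-homo _ _)) (F.trans (ι.cong (proj₂ (𝕂.inverse x x≉0))) ι.1-homo)))))


  -- There are q^n elements, of which at most q^(N+1) N are roots of nonzero polynomials of degree ≤ N.
  independent-powers : ∀ N → q ℕ.^ suc N ℕ.* N ℕ.< q ℕ.^ n →
    ∃ λ θ → ∀ (c : Fin (suc N) → K.Carrier) → F.horner (suc N) (λ i → ι.⟦ c i ⟧) θ F.≈ F.0# → ∀ i → c i K.≈ K.0#
  independent-powers N lt = find (FinP.all? bad?)
    where
    Bad : Fin (q ℕ.^ n) → Fin (q ℕ.^ suc N) → Set (ℓ ⊔ ℓ′)
    Bad y x = (∃ λ i → ¬ vector (suc N) x i K.≈ K.0#) × value (suc N) (vector (suc N) x) (point y) F.≈ F.0#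
    bad? : ∀ y → Dec (∃ (Bad y))
    bad? y = FinP.any? (λ x → FinP.any? (λ i → ¬? (vector (suc N) x i 𝕂.≟ K.0#)) ×-dec zero? (value (suc N) (vector (suc N) x) (point y)))
    find : Dec (∀ y → ∃ (Bad y)) → ∃ λ θ → ∀ (c : Fin (suc N) → K.Carrier) → F.horner (suc N) (λ i → ι.⟦ c i ⟧) θ F.≈ F.0# → ∀ i → c i K.≈ K.0#
    find (no some-good) = point (proj₁ good) , λ c e i → K.trans (K.sym (vector-c c i)) (zero-entry c e i (vector (suc N) (x c) i 𝕂.≟ K.0#))
      where
      good : ∃ λ y → ¬ ∃ (Bad y)
      good = FinP.¬∀⟶∃¬ (q ℕ.^ n) (λ y → ∃ (Bad y)) bad? some-good
      x : (Fin (suc N) → K.Carrier) → Fin (q ℕ.^ suc N)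
      x c = funToFin {suc N} {q} (𝕂.index ∘ c)
      vector-c : ∀ c i → vector (suc N) (x c) i K.≈ c i
      vector-c c i = K.trans (K.≡⇒≈ (≡.cong 𝕂.enum (FinP.finToFun-funToFin (𝕂.index ∘ c) i))) (𝕂.enum-index (c i))
      zero-entry : ∀ c → value (suc N) c (point (proj₁ good)) F.≈ F.0# → ∀ i → Dec (vector (suc N) (x c) i K.≈ K.0#) → vector (suc N) (x c) i K.≈ K.0#
      zero-entry c e i (yes z) = z
      zero-entry c e i (no nz) = ⊥-elim (proj₂ good (x c , (i , nz) , F.trans (F.horner-cong (suc N) (λ i → ι.cong (vector-c c i)) F.refl) e))
    find (yes all-bad) = ⊥-elim (contradiction-from (large-fibre (q ℕ.^ suc N) N (λ y → proj₁ (all-bad y)) lt))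
      where
      contradiction-from : (∃ λ x → InjectionInto (λ y → proj₁ (all-bad y) ≡ x) (suc N)) → ⊥
      contradiction-from (x , g , injective , member) = proj₂ nonzero (ι-injective _ (F.vanishing (point ∘ g)
          (λ a b a≢b → regular _ (λ e → a≢b (injective a b (point-injective (g a) (g b) (F.x-y≈0⇒x≈y e)))))
          (λ i → ι.⟦ vector (suc N) x i ⟧) root (proj₁ nonzero)))
        where
        nonzero : ∃ λ i → ¬ vector (suc N) x i K.≈ K.0#
        nonzero = ≡.subst (λ x → ∃ λ i → ¬ vector (suc N) x i K.≈ K.0#) (member zero) (proj₁ (proj₂ (all-bad (g zero))))
        root : ∀ a → value (suc N) (vector (suc N) x) (point (g a)) F.≈ F.0#
        root a = ≡.subst (λ x → value (suc N) (vector (suc N) x) (point (g a)) F.≈ F.0#) (member a) (proj₂ (proj₂ (all-bad (g a))))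

-- The two ranges of n and the numerical bound.

module _ {c ℓ c′ ℓ′} (K : CommutativeRing c ℓ) (K-field : IsField K) (p : ℕ) (card : HasCardinality K (suc (suc p)))
  {F : CommutativeRing c′ ℓ′} (F-field : IsField F) (ι : Hom K F) {n : ℕ} (B : Basis K F (Hom.⟦_⟧ ι) n) (m : ℕ) where
  private
    module 𝕂 = FiniteField K K-field p card
    module K = RingKit K
    module F = RingKit F
    q : ℕ
    q = suc (suc p)

  -- Taken with the single element a = 1, whose only product is 1. It covers the small n, for which
  -- s = 1 is enough.
  subrank-one : SubrankAtLeast K (structureTensor K F B (suc m)) 1
  subrank-one = FieldBasis.Subrank.subrank ι B 𝕂._≟_ 𝕂.inverse 𝕂.0≉1 m 1 (λ _ → F.1#) independent
    where
    only : ∀ e (x : Fin (1 ℕ.^ m)) → x ≡ funToFin {m} (λ _ → e)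
    only e x = ≡.trans (≡.sym (FinP.funToFin-finToFin {m} {1} x)) (funToFin-cong {m} {1} {finToFun {1} {m} x} {λ _ → e} (λ k → unique (finToFun {1} {m} x k) e))
      where
      unique : (a b : Fin 1) → a ≡ b
      unique zero zero = ≡.refl
    independent : ∀ (r : Fin (1 ℕ.^ m) → K.Carrier) → ∑ F (1 ℕ.^ m) (λ x → Hom.⟦_⟧ ι (r x) F.* ∏ F m (λ _ → F.1#)) F.≈ F.0# → ∀ e → r (funToFin {m} (λ _ → e)) K.≈ K.0#
    independent r eq e = FewRoots.ι-injective K K-field p card F-field ι B _ (F.trans (F.sym (F.trans
      (F.∑-single (1 ℕ.^ m) _ (funToFin {m} (λ _ → e)) (λ x x≢ → ⊥-elim (x≢ (only e x))))
      (F.trans (F.*-congˡ (F.∏-1 m (λ _ → F.1#) (λ _ → F.refl))) (F.*-identityʳ _)))) eq)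

  module Construction (1≤m : 1 ℕ.≤ m) (k N : ℕ) (long : 10 ℕ.* (m ℕ.* m) ℕ.* q ℕ.^ k ℕ.≤ suc N)
    (θ : F.Carrier) (independent-powers : ∀ (a : Fin (suc N) → K.Carrier) → F.horner (suc N) (λ i → Hom.⟦_⟧ ι (a i)) θ F.≈ F.0# → ∀ i → a i K.≈ K.0#) where
    private
      module QE = QuadraticExtension K K-field p card

    large-subrank : ∃ λ s → 2 ℕ.* q ℕ.^ k ℕ.≤ 3 ℕ.* s × SubrankAtLeast K (structureTensor K F B (suc m)) s
    large-subrank = let (s , 2Q≤3s , a , independent) = products in
      s , 2Q≤3s , FieldBasis.Subrank.subrank ι B 𝕂._≟_ 𝕂.inverse 𝕂.0≉1 m s a independent
      where
      products : ∃ λ s → 2 ℕ.* q ℕ.^ k ℕ.≤ 3 ℕ.* s × Σ (Fin s → F.Carrier) λ a →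
        ∀ (r : Fin (s ℕ.^ m) → K.Carrier) → ∑ F (s ℕ.^ m) (λ x → Hom.⟦_⟧ ι (r x) F.* ∏ F m (λ j → a (finToFun {s} {m} x j))) F.≈ F.0# →
        ∀ e → r (funToFin {m} (λ _ → e)) K.≈ K.0#
      products = Tower.Expansion.Assembly.independent-products QE.traceField (laurentRing QE.κ p QE.binomials) k
        QE.E.ι QE.K.b QE.α QE.α² QE.ω₀≉0 (λ y → y zero) (λ y → y (suc zero)) QE.split
        ι (λ x e → K.trans (K.sym (QE.E.ι-zero x)) (at e zero)) m 1≤m N long θ independent-powers

private
  <-power : ∀ q j → 2 ℕ.≤ q → j ℕ.< q ℕ.^ j
  <-power q zero _ = s≤s z≤n
  <-power q (suc j) 2≤q = ℕP.≤-trans (ℕP.≤-trans (ℕP.+-monoˡ-≤ (suc j) (s≤s z≤n)) (ℕP.≤-reflexive (≡.cong (suc j ℕ.+_) (≡.sym (ℕP.+-identityʳ (suc j)))))) (ℕP.*-mono-≤ 2≤q (<-power q j 2≤q))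

  largest-power : ∀ q A n → 1 ℕ.≤ A → 2 ℕ.≤ q → A ℕ.≤ n → ∃ λ k → A ℕ.* q ℕ.^ k ℕ.≤ n × n ℕ.< A ℕ.* q ℕ.^ suc k
  largest-power q A n 1≤A 2≤q A≤n = search n (ℕP.<-≤-trans (<-power q n 2≤q) (ℕP.≤-trans (ℕP.≤-reflexive (≡.sym (ℕP.*-identityˡ (q ℕ.^ n)))) (ℕP.*-monoˡ-≤ (q ℕ.^ n) 1≤A)))
    where
    search : ∀ j → n ℕ.< A ℕ.* q ℕ.^ j → ∃ λ k → A ℕ.* q ℕ.^ k ℕ.≤ n × n ℕ.< A ℕ.* q ℕ.^ suc k
    search zero n< = ⊥-elim (ℕP.<⇒≱ n< (ℕP.≤-trans (ℕP.≤-reflexive (ℕP.*-identityʳ A)) A≤n))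
    search (suc j) n< with A ℕ.* q ℕ.^ j ℕ.≤? n
    ... | yes le = j , le , n<
    ... | no ¬le = search j (ℕP.≰⇒> ¬le)

  -- Here N + 1 = ⌈n/2⌉ is the number of powers of θ. N ≤ a keeps the count of bad θ below q^n, and
  -- a ≤ N + 1 means that only a factor 2 is lost.
  half : ∀ n → 1 ℕ.≤ n → ∃ λ a → ∃ λ N → n ≡ a ℕ.+ suc N × N ℕ.≤ a × a ℕ.≤ suc N
  half (suc zero) _ = 0 , 0 , ≡.refl , z≤n , z≤n
  half (suc (suc zero)) _ = 1 , 0 , ≡.refl , z≤n , s≤s z≤n
  half (suc (suc (suc n))) _ with half (suc n) (s≤s z≤n)
  ... | a , N , e , N≤a , a≤N = suc a , suc N , ≡.cong suc (≡.trans (≡.cong suc e) (≡.sym (ℕP.+-suc a (suc N)))) , s≤s N≤a , s≤s a≤N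

  double-bound : ∀ {n a N X} → n ≡ a ℕ.+ suc N → a ℕ.≤ suc N → suc N ℕ.≤ X → n ℕ.≤ 2 ℕ.* X
  double-bound {X = X} ≡.refl a≤ N≤ = ℕP.≤-trans (ℕP.+-mono-≤ (ℕP.≤-trans a≤ N≤) N≤) (ℕP.≤-reflexive (≡.cong (X ℕ.+_) (≡.sym (ℕP.+-identityʳ X))))

open import Data.Nat using (_≤_; _*_)

theorem3p7 : ∀ {c ℓ c′ ℓ′ : Level} (d n q : ℕ) → 2 ≤ d → 1 ≤ n → IsPrimePower q →
    (K : CommutativeRing c ℓ) → IsField K → HasCardinality K q →
    (F : CommutativeRing c′ ℓ′) → IsField F →
    (ι : CommutativeRing.Carrier K → CommutativeRing.Carrier F) → IsRingHom K F ι →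
    (B : Basis K F ι n) →
    ∃ λ (s : ℕ) → SubrankAtLeast K (structureTensor K F B d) s × n ≤ 48 * (d * d) * q * s
theorem3p7 d n zero _ _ _ K _ card _ _ _ _ _ with () ← Inverse.from card (CommutativeRing.0# K)
theorem3p7 d n (suc zero) _ _ _ K K-field card _ _ _ _ _ = ⊥-elim (IsField.0≉1 K-field (K.trans (K.sym (Inverse.inverseˡ card ≡.refl))
    (K.trans (Inverse.to-cong card (unique (Inverse.from card K.0#) (Inverse.from card K.1#))) (Inverse.inverseˡ card ≡.refl))))
  where
  module K = CommutativeRing K
  unique : (a b : Fin 1) → a ≡ b
  unique zero zero = ≡.refl
theorem3p7 (suc m) n (suc (suc p)) (s≤s 1≤m) 1≤n _ K K-field card F F-field ι₀ ι-hom B = by-size (half n 1≤n)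
  where
  q d A : ℕ
  q = suc (suc p)
  d = suc m
  A = 10 ℕ.* (m ℕ.* m)
  ι : Hom K F
  ι = ringHom ι-hom
  2≤q : 2 ℕ.≤ q
  2≤q = s≤s (s≤s z≤n)
  Goal : Set _
  Goal = ∃ λ (s : ℕ) → SubrankAtLeast K (structureTensor K F B d) s × n ℕ.≤ 48 ℕ.* (d ℕ.* d) ℕ.* q ℕ.* s
  mm≤dd : m ℕ.* m ℕ.≤ d ℕ.* d
  mm≤dd = ℕP.*-mono-≤ (ℕP.n≤1+n m) (ℕP.n≤1+n m)
  by-size : (∃ λ a → ∃ λ N → n ≡ a ℕ.+ suc N × N ℕ.≤ a × a ℕ.≤ suc N) → Goal
  by-size (a , N , n≡ , N≤a , a≤N) = go (A ℕ.≤? suc N)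
    where
    -- From N < q^N ≤ q^a follows q^(N+1) N < q^(N+1+a) = q^n.
    few : q ℕ.^ suc N ℕ.* N ℕ.< q ℕ.^ n
    few = ℕP.<-≤-trans (ℕP.*-monoʳ-< (q ℕ.^ suc N) {{ℕP.m^n≢0 q (suc N)}} (ℕP.<-≤-trans (<-power q N 2≤q) (ℕP.^-monoʳ-≤ q N≤a)))
      (ℕP.≤-reflexive (≡.trans (≡.sym (ℕP.^-distribˡ-+-* q (suc N) a)) (≡.cong (q ℕ.^_) (≡.trans (ℕP.+-comm (suc N) a) (≡.sym n≡)))))
    θ = FewRoots.independent-powers K K-field p card F-field ι B N few
    go : Dec (A ℕ.≤ suc N) → Goal
    -- In this range n ≤ 2A = 20 (d-1)², which is within the bound for s = 1.
    go (no A≰N) = 1 , subrank-one K K-field p card F-field ι B m , ℕP.≤-trans (double-bound n≡ a≤N (ℕP.<⇒≤ (ℕP.≰⇒> A≰N)))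
      (ℕP.≤-trans (ℕP.≤-reflexive (≡.sym (ℕP.*-assoc 2 10 (m ℕ.* m)))) (ℕP.≤-trans (ℕP.*-mono-≤ {20} {48} (ℕP.m≤m+n 20 28) mm≤dd)
        (ℕP.≤-trans (ℕP.m≤m*n (48 ℕ.* (d ℕ.* d)) q) (ℕP.≤-reflexive (≡.sym (ℕP.*-identityʳ (48 ℕ.* (d ℕ.* d) ℕ.* q)))))))
    -- Q = q^k is the largest power for which the polynomials still fit into N + 1 powers of θ. That
    -- the next power is too large bounds n from above and brings in the factor q.
    go (yes A≤N) = construct (largest-power q A (suc N) (ℕP.*-mono-≤ {1} {10} (s≤s z≤n) (ℕP.*-mono-≤ 1≤m 1≤m)) 2≤q A≤N)
      where
      construct : (∃ λ k → A ℕ.* q ℕ.^ k ℕ.≤ suc N × suc N ℕ.< A ℕ.* q ℕ.^ suc k) → Goal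
      construct (k , lower , upper) = conclude (Construction.large-subrank K K-field p card F-field ι B m 1≤m k N lower (proj₁ θ) (proj₂ θ))
        where
        conclude : (∃ λ s → 2 ℕ.* q ℕ.^ k ℕ.≤ 3 ℕ.* s × SubrankAtLeast K (structureTensor K F B d) s) → Goal
        -- With m = d - 1: n ≤ 2A q Q = 10 m² q · 2Q ≤ 10 m² q · 3s = 30 m² q s ≤ 48 d² q s.
        conclude (s , 2Q≤3s , subrank) = s , subrank , ℕP.≤-trans (double-bound n≡ a≤N (ℕP.<⇒≤ upper))
          (ℕP.≤-trans (ℕP.≤-reflexive (regroup (m ℕ.* m) q (q ℕ.^ k))) (ℕP.≤-trans (ℕP.*-monoʳ-≤ (10 ℕ.* (m ℕ.* m) ℕ.* q) 2Q≤3s)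
            (ℕP.≤-trans (ℕP.≤-reflexive (regroup′ (m ℕ.* m) q s)) (ℕP.*-monoˡ-≤ s (ℕP.*-monoˡ-≤ q (ℕP.*-mono-≤ {30} {48} (ℕP.m≤m+n 30 18) mm≤dd))))))
          where
          regroup : ∀ M q Q → 2 ℕ.* (10 ℕ.* M ℕ.* (q ℕ.* Q)) ≡ 10 ℕ.* M ℕ.* q ℕ.* (2 ℕ.* Q)
          regroup = ℕSolver.solve-∀
          regroup′ : ∀ M q s → 10 ℕ.* M ℕ.* q ℕ.* (3 ℕ.* s) ≡ 30 ℕ.* M ℕ.* q ℕ.* s
          regroup′ = ℕSolver.solve-∀
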